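{- The greedy elements $x[a_1,a_2]$ for $(a_1, a_2) \in \mathbb{Z}^2$ form a $\mathbb{K}[p_{1,1},\dots,p_{1,\ell_1},p_{2,1},\dots,p_{2,\ell_2}]$-basis for $\mathcal{A}(P_1,P_2)$.
   Context: Let $\mathbb{K}$ be a field of characteristic zero, $P_1=1+\sum_{j=1}^{\ell_1}p_{1,j}z^j$, $P_2=1+\sum_{j=1}^{\ell_2}p_{2,j}z^j$ with $p_{i,j}$ indeterminates, $\overline P_i(z)=\frac1{p_{i,\ell_i}}z^{\ell_i}P_i(z^{ -1})$, and cluster pre-variables $x_k$ ($k\in\mathbb{Z}$) defined by $x_{k+1}x_{k-1}=P_1(x_k),P_2(x_k),\overline P_1(x_k),\overline P_2(x_k)$ according as $k\equiv1,2,3,0\pmod4$; each lies in $\underline{\mathbb{K}}=\mathbb{K}[p_{i,j},p_{1,\ell_1}^{ -1},p_{2,\ell_2}^{ -1}][x_1^{\pm1},x_2^{\pm1}]$. Let $X_k=p_{1,\ell_1}^{a_k}p_{2,\ell_2}^{b_k}x_k$ ($a_k,b_k\in\mathbb{Z}$) be normalized so that its unique lowest total degree term has coefficient $1$; $\mathcal A(P_1,P_2)$ is the $\mathbb{K}[p_{i,j}]$-subalgebra of $\underline{\mathbb{K}}$ generated by all $X_k$. For $(a_1,a_2)\in\mathbb{Z}^2$, $x[a_1,a_2]=x_1^{ -a_1}x_2^{ -a_2}\sum_\omega\mathrm{wt}(\omega)x_1^{\omega(E_2)}x_2^{\omega(E_1)}$, summed over all compatible gradings on $E([a_1]_+,[a_2]_+)$,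 with $[a]_+=\max(a,0)$. Here, on the maximal Dyck path $\mathcal P(m,n)$ (north/east unit-step path from $(0,0)$ to $(m,n)$ closest to the diagonal without crossing strictly above it) with horizontal edges $u_1,\dots,u_m$ forming $E_1$ and vertical edges $v_1,\dots,v_n$ forming $E_2$, a grading $\omega:E_1\cup E_2\to\mathbb{Z}_{\ge0}$ is compatible if for every $u\in E_1$, $v\in E_2$ there is an edge $e$ on the subpath $\overrightarrow{uv}$ (going east, cyclically, from the left endpoint of $u$ to the top endpoint of $v$) with ($e\ne v$ and the number of vertical edges of $\overrightarrow{ue}$ equals the sum of $\omega$ over its horizontal edges) or ($e\ne u$ and the number of horizontal edges of $\overrightarrow{ev}$ equals the sum of $\omega$ over its vertical edges); and $\mathrm{wt}(\omega)=\prod_ip_{2,\omega(u_i)}\prod_jp_{1,\omega(v_j)}$ with $p_{i,0}=1$. -}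

module Defs where

open import Level using (_⊔_)
open import Algebra.Bundles using (CommutativeRing)
open import Data.Nat as ℕ using (ℕ; zero; suc; _≡ᵇ_; _≤ᵇ_; _<ᵇ_)
open import Data.Integer as ℤ using (ℤ; +_; -[1+_]; _%ℕ_)
open import Data.Vec as Vec using (Vec; []; _∷_)
import Data.Vec.Properties as VecP
open import Data.List as List using (List; []; _∷_; _++_; map; foldr; concatMap; upTo; applyUpTo; length; take; drop)
open import Data.Bool.ListAction using (any; all)
open import Data.List.Relation.Unary.All using (All)
open import Data.List.Relation.Unary.Unique.Propositional using (Unique)
open import Data.Product using (Σ; _×_; _,_; proj₁; proj₂)
import Data.Product.Properties as ProdP
open import Data.Bool using (Bool; true; false; if_then_else_; _∧_; _∨_; not)
open import Relation.Nullary using (¬_; ⌊_⌋)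
open import Relation.Binary.PropositionalEquality using (_≡_; _≢_)

module _ {c ℓ} (K : CommutativeRing c ℓ) where
  open CommutativeRing K

  ofℕ : ℕ → Carrier
  ofℕ zero    = 0#
  ofℕ (suc n) = 1# + ofℕ n

  record IsCharZeroField : Set (c ⊔ ℓ) where
    field
      0≉1      : ¬ (0# ≈ 1#)
      inverse  : ∀ x → ¬ (x ≈ 0#) → Σ Carrier (λ y → x * y ≈ 1#)
      charZero : ∀ n → ¬ (ofℕ (suc n) ≈ 0#)

[_]₊ : ℤ → ℕ
[ + n ]₊    = n
[ -[1+ n ] ]₊ = 0

-- Exponent vectors.  A monomial in the variables
--   p_{1,1},…,p_{1,ℓ₁}, p_{2,1},…,p_{2,ℓ₂}, x₁, x₂
-- with integer exponents (position j of the first vector, counted from 1,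
-- is the exponent of p_{1,j}, etc.; the last two components are the
-- exponents of x₁ and x₂).

Mon : ℕ → ℕ → Set
Mon ℓ₁ ℓ₂ = Vec ℤ ℓ₁ × Vec ℤ ℓ₂ × ℤ × ℤ

_≟M_ : ∀ {ℓ₁ ℓ₂} (m n : Mon ℓ₁ ℓ₂) → _
_≟M_ = ProdP.≡-dec (VecP.≡-dec ℤ._≟_)
         (ProdP.≡-dec (VecP.≡-dec ℤ._≟_) (ProdP.≡-dec ℤ._≟_ ℤ._≟_))

zeros : (n : ℕ) → Vec ℤ n
zeros n = Vec.replicate n (+ 0)

-- vector of length ℓ with e at position j (1-based), 0 elsewhere
-- (all zeros if j = 0 or j > ℓ)
expAt : (ℓ j : ℕ) → ℤ → Vec ℤ ℓ
expAt zero    j             e = []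
expAt (suc ℓ) zero          e = zeros (suc ℓ)
expAt (suc ℓ) (suc zero)    e = e ∷ zeros ℓ
expAt (suc ℓ) (suc (suc j)) e = + 0 ∷ expAt ℓ (suc j) e

-- The ambient ring: Laurent polynomials over K in all variables
-- p_{i,j}, x₁, x₂, represented as finite formal sums of terms, with
-- equality ≋ given by equality of all coefficients.  The ring
-- K[p_{i,j}, p_{1,ℓ₁}⁻¹, p_{2,ℓ₂}⁻¹][x₁^{±1}, x₂^{±1}] of the paper is a
-- subring of it.

module _ {c ℓ} (K : CommutativeRing c ℓ) (ℓ₁ ℓ₂ : ℕ) where
  open CommutativeRing K

  LP : Set c
  LP = List (Carrier × Mon ℓ₁ ℓ₂)

  coeff : LP → Mon ℓ₁ ℓ₂ → Carrier
  coeff f m = foldr (λ t acc → if ⌊ proj₂ t ≟M m ⌋ then proj₁ t + acc else acc) 0# f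

  _≋_ : LP → LP → Set ℓ
  f ≋ g = ∀ m → coeff f m ≈ coeff g m

  mon₀ : Mon ℓ₁ ℓ₂
  mon₀ = zeros ℓ₁ , zeros ℓ₂ , + 0 , + 0

  mulMon : Mon ℓ₁ ℓ₂ → Mon ℓ₁ ℓ₂ → Mon ℓ₁ ℓ₂
  mulMon (a , b , d , e) (a' , b' , d' , e') =
    Vec.zipWith ℤ._+_ a a' , Vec.zipWith ℤ._+_ b b' , d ℤ.+ d' , e ℤ.+ e'

  𝟘 : LP
  𝟘 = []

  const : Carrier → LP
  const k = (k , mon₀) ∷ []

  𝟙 : LP
  𝟙 = const 1#

  _⊕_ : LP → LP → LP
  f ⊕ g = f ++ g

  _⊗_ : LP → LP → LP
  f ⊗ g = concatMap (λ s → map (λ t → (proj₁ s * proj₁ t , mulMon (proj₂ s) (proj₂ t))) g) f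

  _^_ : LP → ℕ → LP
  f ^ zero  = 𝟙
  f ^ suc n = f ⊗ (f ^ n)

  Σ₁ : ℕ → (ℕ → LP) → LP
  Σ₁ n F = foldr _⊕_ 𝟘 (applyUpTo (λ i → F (suc i)) n)

  monoP : ℤ → ℤ → ℤ → ℤ → LP
  monoP a b d e = (1# , (expAt ℓ₁ ℓ₁ a , expAt ℓ₂ ℓ₂ b , d , e)) ∷ []

  x₁ x₂ : LP
  x₁ = monoP (+ 0) (+ 0) (+ 1) (+ 0)
  x₂ = monoP (+ 0) (+ 0) (+ 0) (+ 1)

  p₁ : ℕ → LP
  p₁ zero = 𝟙
  p₁ (suc j) = if suc j ≤ᵇ ℓ₁ then (1# , (expAt ℓ₁ (suc j) (+ 1) , zeros ℓ₂ , + 0 , + 0)) ∷ [] else 𝟘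

  p₂ : ℕ → LP
  p₂ zero = 𝟙
  p₂ (suc j) = if suc j ≤ᵇ ℓ₂ then (1# , (zeros ℓ₁ , expAt ℓ₂ (suc j) (+ 1) , + 0 , + 0)) ∷ [] else 𝟘

  P₁ P₂ : LP → LP
  P₁ z = 𝟙 ⊕ Σ₁ ℓ₁ (λ j → p₁ j ⊗ (z ^ j))
  P₂ z = 𝟙 ⊕ Σ₁ ℓ₂ (λ j → p₂ j ⊗ (z ^ j))

  -- P̄_i(z) = p_{i,ℓ_i}⁻¹ z^{ℓ_i} P_i(z⁻¹)
  --        = p_{i,ℓ_i}⁻¹ (z^{ℓ_i} + Σ_{j=1}^{ℓ_i} p_{i,j} z^{ℓ_i - j})
  P̄₁ P̄₂ : LP → LP
  P̄₁ z = monoP -[1+ 0 ] (+ 0) (+ 0) (+ 0) ⊗ ((z ^ ℓ₁) ⊕ Σ₁ ℓ₁ (λ j → p₁ j ⊗ (z ^ (ℓ₁ ℕ.∸ j))))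
  P̄₂ z = monoP (+ 0) -[1+ 0 ] (+ 0) (+ 0) ⊗ ((z ^ ℓ₂) ⊕ Σ₁ ℓ₂ (λ j → p₂ j ⊗ (z ^ (ℓ₂ ℕ.∸ j))))

  exch : ℤ → LP → LP
  exch k with k %ℕ 4
  ... | 1 = P₁
  ... | 2 = P₂
  ... | 3 = P̄₁
  ... | _ = P̄₂

  record IsPreClusterSeq (x : ℤ → LP) : Set ℓ where
    field
      init₁ : x (+ 1) ≋ x₁
      init₂ : x (+ 2) ≋ x₂
      exchange : ∀ k → (x (k ℤ.+ + 1) ⊗ x (k ℤ.- + 1)) ≋ exch k (x k)

  -- "the unique lowest total degree term (in x₁,x₂) has coefficient 1":
  -- there is (e₁,e₂) such that the coefficient of x₁^{e₁}x₂^{e₂}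
  -- (an element of K[p^{±1}]) is exactly 1, and every other monomial
  -- whose total x-degree is ≤ e₁+e₂ has coefficient 0.
  LowestTermNormalized : LP → Set ℓ
  LowestTermNormalized f =
    Σ (ℤ × ℤ) λ e →
      (coeff f (zeros ℓ₁ , zeros ℓ₂ , proj₁ e , proj₂ e) ≈ 1#)
      × (∀ (m : Mon ℓ₁ ℓ₂) → m ≢ (zeros ℓ₁ , zeros ℓ₂ , proj₁ e , proj₂ e) →
           proj₁ (proj₂ (proj₂ m)) ℤ.+ proj₂ (proj₂ (proj₂ m)) ℤ.≤ proj₁ e ℤ.+ proj₂ e →
           coeff f m ≈ 0#)

  normalize : (x : ℤ → LP) (a b : ℤ → ℤ) → ℤ → LP
  normalize x a b k = monoP (a k) (b k) (+ 0) (+ 0) ⊗ x k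

  data InA (X : ℤ → LP) : LP → Set (c ⊔ ℓ) where
    gen   : ∀ k → InA X (X k)
    const∈ : ∀ k → InA X (const k)
    p₁∈   : ∀ j → InA X (p₁ j)
    p₂∈   : ∀ j → InA X (p₂ j)
    add∈  : ∀ {f g} → InA X f → InA X g → InA X (f ⊕ g)
    mul∈  : ∀ {f g} → InA X f → InA X g → InA X (f ⊗ g)
    resp∈ : ∀ {f g} → f ≋ g → InA X f → InA X g

  IsCoeffPoly : LP → Set ℓ
  IsCoeffPoly f = ∀ (m : Mon ℓ₁ ℓ₂) →
    ¬ (All (ℤ._≤_ (+ 0)) (Vec.toList (proj₁ m)) × All (ℤ._≤_ (+ 0)) (Vec.toList (proj₁ (proj₂ m)))
       × proj₁ (proj₂ (proj₂ m)) ≡ + 0 × proj₂ (proj₂ (proj₂ m)) ≡ + 0) →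
    coeff f m ≈ 0#

  linComb : (ℤ × ℤ → LP) → List (LP × (ℤ × ℤ)) → LP
  linComb g cs = foldr (λ t acc → (proj₁ t ⊗ g (proj₂ t)) ⊕ acc) 𝟘 cs

  record IsCoeffBasis (A : LP → Set (c ⊔ ℓ)) (g : ℤ × ℤ → LP) : Set (c ⊔ ℓ) where
    field
      member   : ∀ a → A (g a)
      spanning : ∀ f → A f → Σ (List (LP × (ℤ × ℤ))) λ cs →
                   All (λ t → IsCoeffPoly (proj₁ t)) cs × (f ≋ linComb g cs)
      independent : ∀ (cs : List (LP × (ℤ × ℤ))) →
                   All (λ t → IsCoeffPoly (proj₁ t)) cs →
                   Unique (map proj₂ cs) →
                   linComb g cs ≋ 𝟘 →
                   All (λ t → proj₁ t ≋ 𝟘) cs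

  data Step : Set where
    E N : Step

  -- maximal Dyck path 𝒫(m,n): the highest N/E path from (0,0) to (m,n)
  -- staying weakly below the diagonal (points (i,j) with j·m ≤ i·n),
  -- obtained by stepping north whenever that stays weakly below it.
  dyck : ℕ → ℕ → List Step
  dyck m n = go (m ℕ.+ n) 0 0
    where
    go : ℕ → ℕ → ℕ → List Step
    go zero    i j = []
    go (suc f) i j =
      if (j <ᵇ n) ∧ ((suc j ℕ.* m) ≤ᵇ (i ℕ.* n))
      then N ∷ go f i (suc j)
      else E ∷ go f (suc i) j

  at : ∀ {A : Set} → A → List A → ℕ → A
  at d []       _       = d
  at d (a ∷ as) zero    = a
  at d (a ∷ as) (suc k) = at d as k

  isE isN : Step → Bool
  isE E = true
  isE N = false
  isN s = not (isE s)

  -- gradings ω with ω(u) ∈ {0..ℓ₂} on horizontal and ω(v) ∈ {0..ℓ₁} on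
  -- vertical edges (larger values have weight 0 since p_{i,j} = 0 for
  -- j > ℓ_i), listed as the value on each edge in path order
  gradings : List Step → List (List ℕ)
  gradings []       = [] ∷ []
  gradings (s ∷ ss) =
    concatMap (λ v → map (v ∷_) (gradings ss)) (upTo (suc (bound s)))
    where
    bound : Step → ℕ
    bound E = ℓ₂
    bound N = ℓ₁

  cyc : (L i j : ℕ) → List ℕ
  cyc L i j = if i ≤ᵇ j then applyUpTo (i ℕ.+_) (suc (j ℕ.∸ i))
              else applyUpTo (i ℕ.+_) (L ℕ.∸ i) ++ upTo (suc j)

  -- ω (given as its list of values in path order) is a compatible
  -- grading on the path P: for every horizontal u and vertical v there is
  -- an edge e on the cyclic subpath uv with
  --   (e ≠ v and #vertical edges of ue = Σ_{horizontal edges of ue} ω) or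
  --   (e ≠ u and #horizontal edges of ev = Σ_{vertical edges of ev} ω),
  -- all subpaths including their first and last edges.
  compatible : List Step → List ℕ → Bool
  compatible P ω =
    all (λ i → all (λ j → not (isE (stepAt i)) ∨ not (isN (stepAt j)) ∨ ok i j) (upTo L)) (upTo L)
    where
    L = length P
    stepAt : ℕ → Step
    stepAt = at E P
    ωAt : ℕ → ℕ
    ωAt = at 0 ω
    sumL : List ℕ → ℕ
    sumL = foldr ℕ._+_ 0
    #N #E ωE ωN : List ℕ → ℕ
    #N es = sumL (map (λ k → if isN (stepAt k) then 1 else 0) es)
    #E es = sumL (map (λ k → if isE (stepAt k) then 1 else 0) es)
    ωE es = sumL (map (λ k → if isE (stepAt k) then ωAt k else 0) es)
    ωN es = sumL (map (λ k → if isN (stepAt k) then ωAt k else 0) es)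
    ok : ℕ → ℕ → Bool
    ok i j = any (λ t → let ue = take (suc t) uv ; ev = drop t uv in
                   (not (t ≡ᵇ (length uv ℕ.∸ 1)) ∧ (#N ue ≡ᵇ ωE ue))
                 ∨ (not (t ≡ᵇ 0) ∧ (#E ev ≡ᵇ ωN ev)))
               (upTo (length uv))
      where
      uv = cyc L i j

  term : List Step → List ℕ → ℤ → ℤ → LP
  term P ω a₁ a₂ = foldr _⊗_ 𝟙 (List.zipWith wt P ω) ⊗ monoP (+ 0) (+ 0) (+ ωV ℤ.- a₁) (+ ωH ℤ.- a₂)
    where
    wt : Step → ℕ → LP
    wt E v = p₂ v
    wt N v = p₁ v
    ωH ωV : ℕ
    ωH = foldr ℕ._+_ 0 (List.zipWith (λ s v → if isE s then v else 0) P ω)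
    ωV = foldr ℕ._+_ 0 (List.zipWith (λ s v → if isN s then v else 0) P ω)

  greedy : ℤ × ℤ → LP
  greedy (a₁ , a₂) =
    foldr _⊕_ 𝟘 (map (λ ω → if compatible P ω then term P ω a₁ a₂ else 𝟘) (gradings P))
    where
    P = dyck [ a₁ ]₊ [ a₂ ]₊

{-# OPTIONS --safe #-}
-- Let Q₁ = P₁(x₁) and Q₂ = P₂(x₂), so that x₃ = x₁⁻¹Q₂ and x₀ = x₂⁻¹Q₁.  The algebra and the span of
-- the greedy elements are both identified with the upper bound: the Laurent polynomials with
-- coefficients in K[p_{i,j}] that are Laurent in (x₂, x₃) and in (x₀, x₁), i.e. in which the coefficient
-- of x₁^{-n} is divisible by Q₂ⁿ and that of x₂^{-n} by Q₁ⁿ.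
--
-- Greedy elements lie in the upper bound: fix a grading on the vertical edges and read the path as a
-- queue, vertical edges admitting ω customers and horizontal edges serving one.  At least a₁ − |ω| of the
-- horizontal edges meet an empty queue; compatibility does not depend on their values, so summing over
-- these contributes Q₂^{a₁ − |ω|}.  Eliminating first negative powers of x₁, then of x₂, shows that the
-- upper bound is spanned by any family with the same lowest terms as the standard monomials in
-- x₀, x₁, x₂, x₃; the greedy elements are such a family.
--
-- Cluster variables lie in the upper bound: over the Laurent ring in the p_{i,j} each x_{k+2} is a
-- polynomial in x_{k−2}, …, x_{k+1}.  The normalised variables have no negative powers of p_{i,ℓᵢ} because
-- division by an element with lowest coefficient 1 preserves integrality; that the normalised exchange
-- relations are integral amounts to sign-coherence of the denominator vectors, which follows from
-- their being real roots of a rank 2 root system.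
module Submission where

open import Defs hiding (_≋_; _⊕_; _⊗_; _^_)
open import Level using (Level; _⊔_)
open import Algebra.Bundles using (CommutativeRing)
import Algebra.Properties.CommutativeSemigroup as CommutativeSemigroupProperties
import Algebra.Properties.Ring as RingProperties
import Algebra.Solver.Ring.NaturalCoefficients.Default as SemiringSolver
open import Data.Bool using (Bool; true; false; if_then_else_; _∧_; _∨_; not)
import Data.Bool.ListAction as Bools
import Data.Bool.Properties as BoolP
open import Data.Empty using (⊥; ⊥-elim)
open import Data.Integer as ℤ using (ℤ; +_; -[1+_]; _%ℕ_)
import Data.Integer.Properties as ℤP
open import Data.Integer.Tactic.RingSolver using (solve-∀)
open import Data.List as List using (List; []; _∷_; _++_; map; foldr; concatMap; filter; applyUpTo; upTo; length; take; drop)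
import Data.List.Properties as ListP
open import Data.List.Relation.Unary.All as All using (All; []; _∷_)
import Data.List.Relation.Unary.All.Properties as AllP
open import Data.List.Relation.Unary.AllPairs using ([]; _∷_)
open import Data.List.Relation.Unary.Unique.Propositional using (Unique)
open import Data.Nat as ℕ using (ℕ; zero; suc; z≤n; s≤s; _≡ᵇ_; _≤ᵇ_; _<ᵇ_)
import Data.Nat.Properties as ℕP
open import Data.Nat.Tactic.RingSolver using () renaming (solve-∀ to solveℕ-∀)
open import Data.Product using (Σ; _×_; _,_; proj₁; proj₂)
open import Data.Sum using (_⊎_; inj₁; inj₂)
open import Data.Unit using (⊤; tt)
open import Data.Vec as Vec using (Vec; []; _∷_)
import Data.Vec.Properties as VecP
open import Function using (_∘_)
open import Relation.Binary.Definitions using (tri<; tri≈; tri>)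
open import Relation.Binary.PropositionalEquality as ≡ using (_≡_; _≢_; refl; cong; cong₂; sym; trans)
import Relation.Binary.Reasoning.Setoid as SetoidReasoning
open import Relation.Nullary using (¬_; Dec; yes; no; ⌊_⌋)
open import Relation.Nullary.Decidable using (¬?; _×-dec_)
open import Relation.Unary using (Decidable)

-- Elements are finite formal sums up to equality of coefficients, so there is neither a normal form
-- nor a division algorithm. One device replaces both: a linear operator sending each monomial t to
-- t plus terms of larger total degree is unitriangular. It yields exact division by elements with
-- lowest coefficient 1, the transfer of integrality from an element to its coordinates, and the
-- independence of the greedy elements. Divisibility by powers of Q₁ and Q₂ is likewise expressed
-- through coordinates in an explicit family. The normalising exponents are known only through the
-- lowest terms they produce. Uniqueness of lowest terms turns each exchange relation into a linear
-- recurrence for them, but which monomial of the exchange polynomial is lowest depends on the sign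
-- of the degree of the middle variable, and degree 0 would decide nothing. Hence sign-coherence is
-- proved in the same induction as the recurrences. In finite type both signs recur, so the
-- induction makes no distinction by ℓ₁ℓ₂.

module Monomials (ℓ₁ ℓ₂ : ℕ) where

  infixl 7 _·_

  _·_ : Mon ℓ₁ ℓ₂ → Mon ℓ₁ ℓ₂ → Mon ℓ₁ ℓ₂
  (a , b , d , e) · (a' , b' , d' , e') =
    Vec.zipWith ℤ._+_ a a' , Vec.zipWith ℤ._+_ b b' , d ℤ.+ d' , e ℤ.+ e'

  one : Mon ℓ₁ ℓ₂
  one = zeros ℓ₁ , zeros ℓ₂ , + 0 , + 0

  inv : Mon ℓ₁ ℓ₂ → Mon ℓ₁ ℓ₂
  inv (a , b , d , e) = Vec.map ℤ.-_ a , Vec.map ℤ.-_ b , ℤ.- d , ℤ.- e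

  pairs≡ : ∀ {a a' : Vec ℤ ℓ₁} {b b' : Vec ℤ ℓ₂} {d d' e e' : ℤ} →
           a ≡ a' → b ≡ b' → d ≡ d' → e ≡ e' →
           _≡_ {A = Mon ℓ₁ ℓ₂} (a , b , d , e) (a' , b' , d' , e')
  pairs≡ refl refl refl refl = refl

  ·-comm : ∀ m n → m · n ≡ n · m
  ·-comm (a , b , d , e) (a' , b' , d' , e') = pairs≡
    (VecP.zipWith-comm ℤP.+-comm a a') (VecP.zipWith-comm ℤP.+-comm b b')
    (ℤP.+-comm d d') (ℤP.+-comm e e')

  ·-assoc : ∀ m n o → (m · n) · o ≡ m · (n · o)
  ·-assoc (a , b , d , e) (a' , b' , d' , e') (a″ , b″ , d″ , e″) = pairs≡
    (VecP.zipWith-assoc ℤP.+-assoc a a' a″) (VecP.zipWith-assoc ℤP.+-assoc b b' b″)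
    (ℤP.+-assoc d d' d″) (ℤP.+-assoc e e' e″)

  ·-identityˡ : ∀ m → one · m ≡ m
  ·-identityˡ (a , b , d , e) = pairs≡
    (VecP.zipWith-identityˡ ℤP.+-identityˡ a) (VecP.zipWith-identityˡ ℤP.+-identityˡ b)
    (ℤP.+-identityˡ d) (ℤP.+-identityˡ e)

  ·-identityʳ : ∀ m → m · one ≡ m
  ·-identityʳ m = ≡.trans (·-comm m one) (·-identityˡ m)

  ·-inverseˡ : ∀ m → inv m · m ≡ one
  ·-inverseˡ (a , b , d , e) = pairs≡
    (VecP.zipWith-inverseˡ ℤP.+-inverseˡ a) (VecP.zipWith-inverseˡ ℤP.+-inverseˡ b)
    (ℤP.+-inverseˡ d) (ℤP.+-inverseˡ e)

  ·-inverseʳ : ∀ m → m · inv m ≡ one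
  ·-inverseʳ m = ≡.trans (·-comm m (inv m)) (·-inverseˡ m)

  ·-interchange : ∀ m n o q → (m · n) · (o · q) ≡ (m · o) · (n · q)
  ·-interchange m n o q = begin
    (m · n) · (o · q) ≡⟨ ·-assoc m n (o · q) ⟩
    m · (n · (o · q)) ≡⟨ cong (m ·_) (·-assoc n o q) ⟨
    m · ((n · o) · q) ≡⟨ cong (λ z → m · (z · q)) (·-comm n o) ⟩
    m · ((o · n) · q) ≡⟨ cong (m ·_) (·-assoc o n q) ⟩
    m · (o · (n · q)) ≡⟨ ·-assoc m o (n · q) ⟨
    (m · o) · (n · q) ∎
    where open ≡.≡-Reasoning

  exp₁ exp₂ deg : Mon ℓ₁ ℓ₂ → ℤ
  exp₁ m = proj₁ (proj₂ (proj₂ m))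
  exp₂ m = proj₂ (proj₂ (proj₂ m))
  deg m = exp₁ m ℤ.+ exp₂ m

  deg-· : ∀ m n → deg (m · n) ≡ deg m ℤ.+ deg n
  deg-· (_ , _ , d , e) (_ , _ , d' , e') = lemma d d' e e'
    where
    lemma : ∀ d d' e e' → (d ℤ.+ d') ℤ.+ (e ℤ.+ e') ≡ (d ℤ.+ e) ℤ.+ (d' ℤ.+ e')
    lemma = solve-∀

  Integral : Mon ℓ₁ ℓ₂ → Set
  Integral m = All (ℤ._≤_ (+ 0)) (Vec.toList (proj₁ m)) × All (ℤ._≤_ (+ 0)) (Vec.toList (proj₁ (proj₂ m)))

-- The ring of Laurent polynomials as formal sums, and linear operators on it.

module LaurentRing {c ℓ} (K : CommutativeRing c ℓ) (ℓ₁ ℓ₂ : ℕ) where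

  open CommutativeRing K using (Carrier; _≈_; _+_; _*_; -_; 0#; 1#)
  private module K = CommutativeRing K
  open Monomials ℓ₁ ℓ₂ public
  private module ≈-R = SetoidReasoning K.setoid

  infix  4 _≋_
  infixl 6 _⊕_
  infixl 7 _⊗_
  infixr 8 _^_

  𝕃 : Set c
  𝕃 = Defs.LP K ℓ₁ ℓ₂

  𝕄 : Set
  𝕄 = Mon ℓ₁ ℓ₂

  cf : 𝕃 → 𝕄 → Carrier
  cf = Defs.coeff K ℓ₁ ℓ₂

  -- A record, so that f and g can be inferred from f ≋ g.
  record _≋_ (f g : 𝕃) : Set ℓ where
    constructor mk≋
    field ≋-at : ∀ m → cf f m ≈ cf g m
  open _≋_ public

  _⊕_ : 𝕃 → 𝕃 → 𝕃
  _⊕_ = Defs._⊕_ K ℓ₁ ℓ₂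

  𝟎 𝟏 : 𝕃
  𝟎 = Defs.𝟘 K ℓ₁ ℓ₂
  𝟏 = Defs.𝟙 K ℓ₁ ℓ₂

  opaque
    -- Opaque, so that factors can be inferred from a product; `⊗-unfold` and `^-unfold` lead back
    -- to the original definitions.
    _⊗_ : 𝕃 → 𝕃 → 𝕃
    _⊗_ = Defs._⊗_ K ℓ₁ ℓ₂

    _^_ : 𝕃 → ℕ → 𝕃
    _^_ = Defs._^_ K ℓ₁ ℓ₂

    ⊗-unfold : ∀ f g → f ⊗ g ≡ Defs._⊗_ K ℓ₁ ℓ₂ f g
    ⊗-unfold f g = refl

    ^-unfold : ∀ f n → f ^ n ≡ Defs._^_ K ℓ₁ ℓ₂ f n
    ^-unfold f n = refl

    ^-zero : ∀ f → f ^ 0 ≡ 𝟏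
    ^-zero f = refl

    ^-suc : ∀ f n → f ^ suc n ≡ f ⊗ f ^ n
    ^-suc f n = refl

  mono : 𝕄 → 𝕃
  mono m = (1# , m) ∷ []

  neg : 𝕃 → 𝕃
  neg = map (λ t → (- proj₁ t , proj₂ t))

  -- Pairing with an arbitrary function on monomials. Testing equalities against all φ turns the
  -- ring laws into manipulations of finite sums in K, without ever merging equal monomials in the
  -- lists.
  eval : (𝕄 → Carrier) → 𝕃 → Carrier
  eval φ = foldr (λ t acc → proj₁ t * φ (proj₂ t) + acc) 0#

  eval-++ : ∀ φ f g → eval φ (f ++ g) ≈ eval φ f + eval φ g
  eval-++ φ []      g = K.sym (K.+-identityˡ _)
  eval-++ φ (t ∷ f) g = K.trans (K.+-congˡ (eval-++ φ f g)) (K.sym (K.+-assoc _ _ _))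

  eval-cong : ∀ {φ ψ} f → All (λ t → φ (proj₂ t) ≈ ψ (proj₂ t)) f → eval φ f ≈ eval ψ f
  eval-cong []      []       = K.refl
  eval-cong (t ∷ f) (e ∷ es) = K.+-cong (K.*-congˡ e) (eval-cong f es)

  eval-cong′ : ∀ {φ ψ} f → (∀ m → φ m ≈ ψ m) → eval φ f ≈ eval ψ f
  eval-cong′ f e = eval-cong f (All.universal (λ t → e (proj₂ t)) f)

  +-interchange : ∀ a b d e → (a + b) + (d + e) ≈ (a + d) + (b + e)
  +-interchange a b d e = begin
    (a + b) + (d + e) ≈⟨ K.+-assoc a b _ ⟩
    a + (b + (d + e)) ≈⟨ K.+-congˡ (K.+-assoc b d e) ⟨
    a + ((b + d) + e) ≈⟨ K.+-congˡ (K.+-congʳ (K.+-comm b d)) ⟩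
    a + ((d + b) + e) ≈⟨ K.+-congˡ (K.+-assoc d b e) ⟩
    a + (d + (b + e)) ≈⟨ K.+-assoc a d _ ⟨
    (a + d) + (b + e) ∎
    where open ≈-R

  eval-+ : ∀ φ ψ f → eval (λ m → φ m + ψ m) f ≈ eval φ f + eval ψ f
  eval-+ φ ψ []      = K.sym (K.+-identityˡ 0#)
  eval-+ φ ψ (t ∷ f) = K.trans (K.+-cong (K.distribˡ _ _ _) (eval-+ φ ψ f)) (+-interchange _ _ _ _)

  eval-* : ∀ k φ f → eval (λ m → k * φ m) f ≈ k * eval φ f
  eval-* k φ []      = K.sym (K.zeroʳ k)
  eval-* k φ ((a , m) ∷ f) = begin
    a * (k * φ m) + eval (λ m → k * φ m) f ≈⟨ K.+-cong (K.*-assoc a k _) (K.sym (eval-* k φ f)) ⟨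
    (a * k) * φ m + k * eval φ f           ≈⟨ K.+-congʳ (K.*-congʳ (K.*-comm a k)) ⟩
    (k * a) * φ m + k * eval φ f           ≈⟨ K.+-congʳ (K.*-assoc k a _) ⟩
    k * (a * φ m) + k * eval φ f           ≈⟨ K.distribˡ k _ _ ⟨
    k * (a * φ m + eval φ f)               ∎
    where open ≈-R

  eval-0 : ∀ f → eval (λ _ → 0#) f ≈ 0#
  eval-0 []      = K.refl
  eval-0 (t ∷ f) = K.trans (K.+-cong (K.zeroʳ _) (eval-0 f)) (K.+-identityˡ 0#)

  eval-swap : ∀ (φ : 𝕄 → 𝕄 → Carrier) f g →
    eval (λ s → eval (φ s) g) f ≈ eval (λ t → eval (λ s → φ s t) f) g
  eval-swap φ []            g = K.sym (eval-0 g)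
  eval-swap φ ((a , m) ∷ f) g = begin
    a * eval (φ m) g + eval (λ s → eval (φ s) g) f
      ≈⟨ K.+-cong (K.sym (eval-* a (φ m) g)) (eval-swap φ f g) ⟩
    eval (λ t → a * φ m t) g + eval (λ t → eval (λ s → φ s t) f) g
      ≈⟨ eval-+ _ _ g ⟨
    eval (λ t → a * φ m t + eval (λ s → φ s t) f) g ∎
    where open ≈-R

  eval-scale : ∀ φ k (h : 𝕄 → 𝕄) g →
    eval φ (map (λ t → (k * proj₁ t , h (proj₂ t))) g) ≈ k * eval (φ ∘ h) g
  eval-scale φ k h []            = K.sym (K.zeroʳ k)
  eval-scale φ k h ((a , m) ∷ g) =
    K.trans (K.+-cong (K.*-assoc k a _) (eval-scale φ k h g)) (K.sym (K.distribˡ k _ _))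

  eval-neg : ∀ φ f → eval φ (neg f) ≈ - eval φ f
  eval-neg φ []            = K.sym -0#≈0#
    where open RingProperties K.ring using (-0#≈0#)
  eval-neg φ ((a , m) ∷ f) =
    K.trans (K.+-cong (K.sym (-‿distribˡ-* a (φ m))) (eval-neg φ f)) (-‿+-comm _ _)
    where open RingProperties K.ring using (-‿distribˡ-*; -‿+-comm)

  opaque
    -- The K-linear operator with `mono m ↦ w m`. Spans, changes of family and multiplication by a
    -- fixed element all take this form.
    T : (𝕄 → 𝕃) → 𝕃 → 𝕃
    T w = concatMap (λ t → map (λ u → (proj₁ t * proj₁ u , proj₂ u)) (w (proj₂ t)))

    eval-T : ∀ φ w f → eval φ (T w f) ≈ eval (λ m → eval φ (w m)) f
    eval-T φ w []            = K.refl
    eval-T φ w ((a , m) ∷ f) =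
      K.trans (eval-++ φ (map _ (w m)) (T w f))
              (K.+-cong (eval-scale φ a (λ n → n) (w m)) (eval-T φ w f))

  opaque
    unfolding _⊗_
    eval-⊗ : ∀ φ f g → eval φ (f ⊗ g) ≈ eval (λ s → eval (λ t → φ (s · t)) g) f
    eval-⊗ φ []            g = K.refl
    eval-⊗ φ ((a , m) ∷ f) g =
      K.trans (eval-++ φ (map _ g) (f ⊗ g))
              (K.+-cong (eval-scale φ a (m ·_) g) (eval-⊗ φ f g))

  δ : 𝕄 → 𝕄 → Carrier
  δ m n = if ⌊ n ≟M m ⌋ then 1# else 0#

  cf-eval : ∀ f m → cf f m ≈ eval (δ m) f
  cf-eval []            m = K.refl
  cf-eval ((a , n) ∷ f) m with n ≟M m
  ... | yes _ = K.+-cong (K.sym (K.*-identityʳ a)) (cf-eval f m)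
  ... | no  _ = K.trans (K.sym (K.+-identityˡ _)) (K.+-cong (K.sym (K.zeroʳ a)) (cf-eval f m))

  ext : ∀ {f g} → (∀ φ → eval φ f ≈ eval φ g) → f ≋ g
  ext {f} {g} e .≋-at m = K.trans (cf-eval f m) (K.trans (e (δ m)) (K.sym (cf-eval g m)))

  δ-same : ∀ m → δ m m ≈ 1#
  δ-same m with m ≟M m
  ... | yes _ = K.refl
  ... | no ne = ⊥-elim (ne refl)

  δ-diff : ∀ {m n} → n ≢ m → δ m n ≈ 0#
  δ-diff {m} {n} ne with n ≟M m
  ... | yes e = ⊥-elim (ne e)
  ... | no _  = K.refl

  private
    remove : 𝕄 → 𝕃 → 𝕃
    remove m = filter (λ t → ¬? (proj₂ t ≟M m))

    eval-remove : ∀ φ m f → eval φ f ≈ cf f m * φ m + eval φ (remove m f)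
    eval-remove φ m [] = K.sym (K.trans (K.+-identityʳ _) (K.zeroˡ _))
    eval-remove φ m ((a , n) ∷ f) with n ≟M m
    ... | yes refl = begin
      a * φ n + eval φ f                             ≈⟨ K.+-congˡ (eval-remove φ n f) ⟩
      a * φ n + (cf f n * φ n + eval φ (remove n f)) ≈⟨ K.+-assoc _ _ _ ⟨
      (a * φ n + cf f n * φ n) + eval φ (remove n f) ≈⟨ K.+-congʳ (K.distribʳ _ _ _) ⟨
      (a + cf f n) * φ n + eval φ (remove n f)       ∎
      where open ≈-R
    ... | no _ = begin
      a * φ n + eval φ f                             ≈⟨ K.+-congˡ (eval-remove φ m f) ⟩
      a * φ n + (cf f m * φ m + eval φ (remove m f)) ≈⟨ K.+-assoc _ _ _ ⟨
      (a * φ n + cf f m * φ m) + eval φ (remove m f) ≈⟨ K.+-congʳ (K.+-comm _ _) ⟩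
      (cf f m * φ m + a * φ n) + eval φ (remove m f) ≈⟨ K.+-assoc _ _ _ ⟩
      cf f m * φ m + (a * φ n + eval φ (remove m f)) ∎
      where open ≈-R

    cf-remove : ∀ m n f → (∀ o → cf f o ≈ 0#) → cf (remove m f) n ≈ 0#
    cf-remove m n f z with m ≟M n
    ... | yes refl = go f
      where
      go : ∀ g → cf (remove m g) m ≈ 0#
      go [] = K.refl
      go ((a , o) ∷ g) with o ≟M m
      ... | yes _ = go g
      ... | no ne with o ≟M m
      ...   | yes e = ⊥-elim (ne e)
      ...   | no _  = go g
    ... | no m≢n = begin
      cf (remove m f) n                            ≈⟨ cf-eval (remove m f) n ⟩
      eval (δ n) (remove m f)                      ≈⟨ K.+-identityˡ _ ⟨
      0# + eval (δ n) (remove m f)                 ≈⟨ K.+-congʳ (K.zeroˡ _) ⟨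
      0# * δ n m + eval (δ n) (remove m f)         ≈⟨ K.+-congʳ (K.*-congʳ (z m)) ⟨
      cf f m * δ n m + eval (δ n) (remove m f)     ≈⟨ eval-remove (δ n) m f ⟨
      eval (δ n) f                                 ≈⟨ cf-eval f n ⟨
      cf f n                                       ≈⟨ z n ⟩
      0#                                           ∎
      where open ≈-R

    -- All terms sharing the monomial of the first term are removed at once, their total coefficient
    -- being zero. `n` bounds the length because this recursion is not structural.
    eval-zero : ∀ φ n f → length f ℕ.≤ n → (∀ m → cf f m ≈ 0#) → eval φ f ≈ 0#
    eval-zero φ n       []            _        z = K.refl
    eval-zero φ (suc n) ((a , m) ∷ f) (s≤s le) z = begin
      eval φ ((a , m) ∷ f)                                       ≈⟨ eval-remove φ m ((a , m) ∷ f) ⟩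
      cf ((a , m) ∷ f) m * φ m + eval φ (remove m ((a , m) ∷ f)) ≈⟨ K.+-congʳ (K.*-congʳ (z m)) ⟩
      0# * φ m + eval φ (remove m ((a , m) ∷ f))                 ≈⟨ K.+-congʳ (K.zeroˡ _) ⟩
      0# + eval φ (remove m ((a , m) ∷ f))                       ≈⟨ K.+-identityˡ _ ⟩
      eval φ (remove m ((a , m) ∷ f))
        ≈⟨ eval-zero φ n (remove m ((a , m) ∷ f)) shorter (λ o → cf-remove m o ((a , m) ∷ f) z) ⟩
      0#                                                         ∎
      where
      open ≈-R
      shorter : length (remove m ((a , m) ∷ f)) ℕ.≤ n
      shorter with m ≟M m
      ... | yes _ = ℕP.≤-trans (ListP.length-filter (λ t → ¬? (proj₂ t ≟M m)) f) le
      ... | no ne = ⊥-elim (ne refl)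

  cf-++ : ∀ f g m → cf (f ++ g) m ≈ cf f m + cf g m
  cf-++ f g m = K.trans (cf-eval (f ++ g) m) (K.trans (eval-++ (δ m) f g)
    (K.+-cong (K.sym (cf-eval f m)) (K.sym (cf-eval g m))))

  cf-neg : ∀ f m → cf (neg f) m ≈ - cf f m
  cf-neg f m = K.trans (cf-eval (neg f) m) (K.trans (eval-neg (δ m) f) (K.-‿cong (K.sym (cf-eval f m))))

  -- The converse of `ext`: a list may repeat monomials, yet its pairing with φ depends only on its
  -- coefficients, because `f ++ neg g` has none.
  eval-≋ : ∀ φ {f g} → f ≋ g → eval φ f ≈ eval φ g
  eval-≋ φ {f} {g} e = begin
    eval φ f                             ≈⟨ K.+-identityʳ _ ⟨
    eval φ f + 0#                        ≈⟨ K.+-congˡ (K.-‿inverseˡ _) ⟨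
    eval φ f + (- eval φ g + eval φ g)   ≈⟨ K.+-assoc _ _ _ ⟨
    (eval φ f + - eval φ g) + eval φ g   ≈⟨ K.+-congʳ (K.+-congˡ (eval-neg φ g)) ⟨
    (eval φ f + eval φ (neg g)) + eval φ g ≈⟨ K.+-congʳ (eval-++ φ f (neg g)) ⟨
    eval φ (f ++ neg g) + eval φ g       ≈⟨ K.+-congʳ (eval-zero φ _ (f ++ neg g) ℕP.≤-refl z) ⟩
    0# + eval φ g                        ≈⟨ K.+-identityˡ _ ⟩
    eval φ g                             ∎
    where
    open ≈-R
    z : ∀ m → cf (f ++ neg g) m ≈ 0#
    z m = K.trans (cf-++ f (neg g) m) (K.trans (K.+-cong (e .≋-at m) (cf-neg g m)) (K.-‿inverseʳ _))

  ≋-refl : ∀ {f} → f ≋ f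
  ≋-refl .≋-at m = K.refl

  ≋-sym : ∀ {f g} → f ≋ g → g ≋ f
  ≋-sym e .≋-at m = K.sym (e .≋-at m)

  ≋-trans : ∀ {f g h} → f ≋ g → g ≋ h → f ≋ h
  ≋-trans e e' .≋-at m = K.trans (e .≋-at m) (e' .≋-at m)

  ≋-reflexive : ∀ {f g} → f ≡ g → f ≋ g
  ≋-reflexive refl = ≋-refl

  ⊕-cong : ∀ {f f' g g'} → f ≋ f' → g ≋ g' → f ⊕ g ≋ f' ⊕ g'
  ⊕-cong {f} {f'} {g} {g'} e e' .≋-at m =
    K.trans (cf-++ f g m) (K.trans (K.+-cong (e .≋-at m) (e' .≋-at m)) (K.sym (cf-++ f' g' m)))

  neg-cong : ∀ {f g} → f ≋ g → neg f ≋ neg g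
  neg-cong {f} {g} e .≋-at m = K.trans (cf-neg f m) (K.trans (K.-‿cong (e .≋-at m)) (K.sym (cf-neg g m)))

  ⊗-comm : ∀ f g → f ⊗ g ≋ g ⊗ f
  ⊗-comm f g = ext λ φ → begin
    eval φ (f ⊗ g)                            ≈⟨ eval-⊗ φ f g ⟩
    eval (λ s → eval (λ t → φ (s · t)) g) f   ≈⟨ eval-swap (λ s t → φ (s · t)) f g ⟩
    eval (λ t → eval (λ s → φ (s · t)) f) g
      ≈⟨ eval-cong′ g (λ t → eval-cong′ f (λ s → K.reflexive (cong φ (·-comm s t)))) ⟩
    eval (λ t → eval (λ s → φ (t · s)) f) g   ≈⟨ eval-⊗ φ g f ⟨
    eval φ (g ⊗ f)                            ∎
    where open ≈-R

  ⊗-congˡ : ∀ f {g g'} → g ≋ g' → f ⊗ g ≋ f ⊗ g'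
  ⊗-congˡ f {g} {g'} e = ext λ φ →
    K.trans (eval-⊗ φ f g) (K.trans (eval-cong′ f (λ s → eval-≋ _ e)) (K.sym (eval-⊗ φ f g')))

  ⊗-congʳ : ∀ g {f f'} → f ≋ f' → f ⊗ g ≋ f' ⊗ g
  ⊗-congʳ g {f} {f'} e = ≋-trans (⊗-comm f g) (≋-trans (⊗-congˡ g e) (⊗-comm g f'))

  ⊗-cong : ∀ {f f' g g'} → f ≋ f' → g ≋ g' → f ⊗ g ≋ f' ⊗ g'
  ⊗-cong {f} {f'} {g} {g'} e e' = ≋-trans (⊗-congʳ g e) (⊗-congˡ f' e')

  ⊗-assoc : ∀ f g h → (f ⊗ g) ⊗ h ≋ f ⊗ (g ⊗ h)
  ⊗-assoc f g h = ext λ φ → begin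
    eval φ ((f ⊗ g) ⊗ h)                                             ≈⟨ eval-⊗ φ (f ⊗ g) h ⟩
    eval (λ s → eval (λ t → φ (s · t)) h) (f ⊗ g)                    ≈⟨ eval-⊗ _ f g ⟩
    eval (λ s → eval (λ s' → eval (λ t → φ ((s · s') · t)) h) g) f
      ≈⟨ eval-cong′ f (λ s → eval-cong′ g (λ s' → eval-cong′ h (λ t → K.reflexive (cong φ (·-assoc s s' t))))) ⟩
    eval (λ s → eval (λ s' → eval (λ t → φ (s · (s' · t))) h) g) f
      ≈⟨ eval-cong′ f (λ s → eval-⊗ (λ u → φ (s · u)) g h) ⟨
    eval (λ s → eval (λ u → φ (s · u)) (g ⊗ h)) f                    ≈⟨ eval-⊗ φ f (g ⊗ h) ⟨
    eval φ (f ⊗ (g ⊗ h))                                             ∎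
    where open ≈-R

  ⊗-identityˡ : ∀ f → 𝟏 ⊗ f ≋ f
  ⊗-identityˡ f = ext λ φ → begin
    eval φ (𝟏 ⊗ f)                            ≈⟨ eval-⊗ φ 𝟏 f ⟩
    1# * eval (λ t → φ (one · t)) f + 0#      ≈⟨ K.+-identityʳ _ ⟩
    1# * eval (λ t → φ (one · t)) f           ≈⟨ K.*-identityˡ _ ⟩
    eval (λ t → φ (one · t)) f
      ≈⟨ eval-cong′ f (λ t → K.reflexive (cong φ (·-identityˡ t))) ⟩
    eval φ f                                  ∎
    where open ≈-R

  ⊗-identityʳ : ∀ f → f ⊗ 𝟏 ≋ f
  ⊗-identityʳ f = ≋-trans (⊗-comm f 𝟏) (⊗-identityˡ f)

  opaque
    unfolding _⊗_
    ⊗-distribʳ : ∀ h f g → (f ⊕ g) ⊗ h ≋ f ⊗ h ⊕ g ⊗ h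
    ⊗-distribʳ h f g = ≋-reflexive (ListP.concatMap-++ _ f g)

  ⊗-distribˡ : ∀ h f g → h ⊗ (f ⊕ g) ≋ h ⊗ f ⊕ h ⊗ g
  ⊗-distribˡ h f g = ≋-trans (⊗-comm h (f ⊕ g)) (≋-trans (⊗-distribʳ h f g)
    (⊕-cong {f ⊗ h} {h ⊗ f} {g ⊗ h} {h ⊗ g} (⊗-comm f h) (⊗-comm g h)))

  ⊕-comm : ∀ f g → f ⊕ g ≋ g ⊕ f
  ⊕-comm f g .≋-at m = K.trans (cf-++ f g m) (K.trans (K.+-comm _ _) (K.sym (cf-++ g f m)))

  neg-inverseʳ : ∀ f → f ⊕ neg f ≋ 𝟎
  neg-inverseʳ f .≋-at m = K.trans (cf-++ f (neg f) m) (K.trans (K.+-congˡ (cf-neg f m)) (K.-‿inverseʳ _))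

  neg-inverseˡ : ∀ f → neg f ⊕ f ≋ 𝟎
  neg-inverseˡ f = ≋-trans (⊕-comm (neg f) f) (neg-inverseʳ f)

  𝕃-ring : CommutativeRing c ℓ
  𝕃-ring = record
    { Carrier = 𝕃 ; _≈_ = _≋_ ; _+_ = _⊕_ ; _*_ = _⊗_ ; -_ = neg ; 0# = 𝟎 ; 1# = 𝟏
    ; isCommutativeRing = record
      { isRing = record
        { +-isAbelianGroup = record
          { isGroup = record
            { isMonoid = record
              { isSemigroup = record
                { isMagma = record
                  { isEquivalence = record
                    { refl = λ {f} → ≋-refl {f} ; sym = λ {f} {g} → ≋-sym {f} {g}
                    ; trans = λ {f} {g} {h} → ≋-trans {f} {g} {h} }
                  ; ∙-cong = λ {f} {f'} {g} {g'} → ⊕-cong {f} {f'} {g} {g'} }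
                ; assoc = λ f g h → ≋-reflexive (ListP.++-assoc f g h) }
              ; identity = (λ f → ≋-refl {f}) , (λ f → ≋-reflexive (ListP.++-identityʳ f)) }
            ; inverse = neg-inverseˡ , neg-inverseʳ
            ; ⁻¹-cong = λ {f} {g} → neg-cong {f} {g} }
          ; comm = ⊕-comm }
        ; *-cong = λ {f} {f'} {g} {g'} → ⊗-cong {f} {f'} {g} {g'}
        ; *-assoc = ⊗-assoc
        ; *-identity = ⊗-identityˡ , ⊗-identityʳ
        ; distrib = ⊗-distribˡ , ⊗-distribʳ }
      ; *-comm = ⊗-comm } }

  T-cong : ∀ w {f g} → f ≋ g → T w f ≋ T w g
  T-cong w {f} {g} e = ext λ φ →
    K.trans (eval-T φ w f) (K.trans (eval-≋ _ e) (K.sym (eval-T φ w g)))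

  T-cong′ : ∀ {w v} f → All (λ t → w (proj₂ t) ≋ v (proj₂ t)) f → T w f ≋ T v f
  T-cong′ {w} {v} f e = ext λ φ →
    K.trans (eval-T φ w f) (K.trans (eval-cong f (All.map (eval-≋ φ) e)) (K.sym (eval-T φ v f)))

  opaque
    unfolding T
    T-++ : ∀ w f g → T w (f ++ g) ≋ T w f ⊕ T w g
    T-++ w f g = ≋-reflexive (ListP.concatMap-++ _ f g)

  T-mono : ∀ f → T mono f ≋ f
  T-mono f = ext λ φ → K.trans (eval-T φ mono f)
    (eval-cong′ f (λ m → K.trans (K.+-identityʳ _) (K.*-identityˡ _)))

  T-⊕ : ∀ w v f → T (λ m → w m ⊕ v m) f ≋ T w f ⊕ T v f
  T-⊕ w v f = ext λ φ → begin
    eval φ (T (λ m → w m ⊕ v m) f)                      ≈⟨ eval-T φ _ f ⟩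
    eval (λ m → eval φ (w m ⊕ v m)) f                   ≈⟨ eval-cong′ f (λ m → eval-++ φ (w m) (v m)) ⟩
    eval (λ m → eval φ (w m) + eval φ (v m)) f          ≈⟨ eval-+ _ _ f ⟩
    eval (λ m → eval φ (w m)) f + eval (λ m → eval φ (v m)) f
      ≈⟨ K.+-cong (eval-T φ w f) (eval-T φ v f) ⟨
    eval φ (T w f) + eval φ (T v f)                     ≈⟨ eval-++ φ (T w f) (T v f) ⟨
    eval φ (T w f ⊕ T v f)                              ∎
    where open ≈-R

  T-T : ∀ w v f → T w (T v f) ≋ T (λ m → T w (v m)) f
  T-T w v f = ext λ φ → begin
    eval φ (T w (T v f))                              ≈⟨ eval-T φ w (T v f) ⟩
    eval (λ m → eval φ (w m)) (T v f)                 ≈⟨ eval-T _ v f ⟩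
    eval (λ n → eval (λ m → eval φ (w m)) (v n)) f    ≈⟨ eval-cong′ f (λ n → eval-T φ w (v n)) ⟨
    eval (λ n → eval φ (T w (v n))) f                 ≈⟨ eval-T φ _ f ⟨
    eval φ (T (λ m → T w (v m)) f)                    ∎
    where open ≈-R

  T-⊗ : ∀ w f g → T w f ⊗ g ≋ T (λ m → w m ⊗ g) f
  T-⊗ w f g = ext λ φ → begin
    eval φ (T w f ⊗ g)                                        ≈⟨ eval-⊗ φ (T w f) g ⟩
    eval (λ s → eval (λ t → φ (s · t)) g) (T w f)             ≈⟨ eval-T _ w f ⟩
    eval (λ m → eval (λ s → eval (λ t → φ (s · t)) g) (w m)) f ≈⟨ eval-cong′ f (λ m → eval-⊗ φ (w m) g) ⟨
    eval (λ m → eval φ (w m ⊗ g)) f                           ≈⟨ eval-T φ _ f ⟨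
    eval φ (T (λ m → w m ⊗ g) f)                              ∎
    where open ≈-R

  T-neg : ∀ w f → T w (neg f) ≋ neg (T w f)
  T-neg w f = ext λ φ → K.trans (eval-T φ w (neg f)) (K.trans (eval-neg _ f)
    (K.trans (K.-‿cong (K.sym (eval-T φ w f))) (K.sym (eval-neg φ (T w f)))))

  ⊗-as-T : ∀ f g → f ⊗ g ≋ T (λ m → mono m ⊗ g) f
  ⊗-as-T f g = ≋-trans (⊗-congʳ g (≋-sym (T-mono f))) (T-⊗ mono f g)

  mono-· : ∀ m n → mono m ⊗ mono n ≋ mono (m · n)
  mono-· m n = ext λ φ → K.trans (eval-⊗ φ (mono m) (mono n))
    (K.trans (K.+-identityʳ _) (K.*-identityˡ _))

module RingIdentities {c ℓ} (R : CommutativeRing c ℓ) where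
  open CommutativeRing R renaming (refl to ≈-refl)
  open SemiringSolver commutativeSemiring using (solve; _:+_; _:*_; _:=_)

  foil : ∀ a r b s → (a + r) * (b + s) ≈ a * b + (a * s + (r * b + r * s))
  foil = solve 4 (λ a r b s → (a :+ r) :* (b :+ s) := a :* b :+ (a :* s :+ (r :* b :+ r :* s))) ≈-refl

  *-interchange : ∀ a b d e → (a * b) * (d * e) ≈ (a * d) * (b * e)
  *-interchange = solve 4 (λ a b d e → (a :* b) :* (d :* e) := (a :* d) :* (b :* e)) ≈-refl

  *-swapˡ : ∀ a b d → a * (b * d) ≈ b * (a * d)
  *-swapˡ = solve 3 (λ a b d → a :* (b :* d) := b :* (a :* d)) ≈-refl

  *-swapʳ : ∀ a b d → (a * b) * d ≈ (a * d) * b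
  *-swapʳ = solve 3 (λ a b d → (a :* b) :* d := (a :* d) :* b) ≈-refl

  +-move : ∀ {a b d} → a ≈ b + d → d ≈ a + - b
  +-move {a} {b} {d} e = begin
    d               ≈⟨ +-identityʳ d ⟨
    d + 0#          ≈⟨ +-congˡ (-‿inverseʳ b) ⟨
    d + (b + - b)   ≈⟨ +-assoc d b (- b) ⟨
    (d + b) + - b   ≈⟨ +-congʳ (+-comm d b) ⟩
    (b + d) + - b   ≈⟨ +-congʳ e ⟨
    a + - b         ∎
    where open SetoidReasoning setoid

  +-unmove : ∀ {a b d} → d ≈ a + - b → a ≈ b + d
  +-unmove {a} {b} {d} e = begin
    a               ≈⟨ +-identityʳ a ⟨
    a + 0#          ≈⟨ +-congˡ (-‿inverseˡ b) ⟨
    a + (- b + b)   ≈⟨ +-assoc a (- b) b ⟨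
    (a + - b) + b   ≈⟨ +-congʳ e ⟨
    d + b           ≈⟨ +-comm d b ⟩
    b + d           ∎
    where open SetoidReasoning setoid

-- Supports, lowest terms and unitriangular operators.

module Supports {c ℓ} (K : CommutativeRing c ℓ) (ℓ₁ ℓ₂ : ℕ) where

  open CommutativeRing K using (Carrier; _≈_; _+_; _*_; -_; 0#; 1#)
  private module K = CommutativeRing K
  open LaurentRing K ℓ₁ ℓ₂ public
  module 𝕃 = CommutativeRing 𝕃-ring
  module RI = RingIdentities 𝕃-ring
  module ≋-R = SetoidReasoning 𝕃.setoid
  private module ≈-R = SetoidReasoning K.setoid

  AllM : (𝕄 → Set) → 𝕃 → Set c
  AllM D = All (D ∘ proj₂)

  -- A list may contain cancelling terms outside D, so only some representative is required to lie
  -- in D.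
  record In (D : 𝕄 → Set) (f : 𝕃) : Set (c ⊔ ℓ) where
    constructor mkIn
    field
      rep : 𝕃
      all : AllM D rep
      eq  : f ≋ rep
  open In public

  In-resp : ∀ {D f g} → f ≋ g → In D f → In D g
  In-resp e (mkIn r a e') = mkIn r a (≋-trans (≋-sym e) e')

  In-weaken : ∀ {D E f} → (∀ {m} → D m → E m) → In D f → In E f
  In-weaken h (mkIn r a e) = mkIn r (All.map h a) e

  In-𝟎 : ∀ {D} → In D 𝟎
  In-𝟎 = mkIn [] [] ≋-refl

  In-mono : ∀ {D m} → D m → In D (mono m)
  In-mono d = mkIn (mono _) (d ∷ []) ≋-refl

  In-list : ∀ {D f} → AllM D f → In D f
  In-list a = mkIn _ a ≋-refl

  In-⊕ : ∀ {D f g} → In D f → In D g → In D (f ⊕ g)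
  In-⊕ (mkIn r a e) (mkIn r' a' e') = mkIn (r ⊕ r') (AllP.++⁺ a a') (⊕-cong e e')

  In-neg : ∀ {D f} → In D f → In D (neg f)
  In-neg (mkIn r a e) = mkIn (neg r) (AllP.map⁺ a) (neg-cong e)

  opaque
    unfolding _⊗_

    AllM-⊗ : ∀ {D E F : 𝕄 → Set} → (∀ {m n} → D m → E n → F (m · n)) →
             ∀ {f g} → AllM D f → AllM E g → AllM F (f ⊗ g)
    AllM-⊗ h []       b = []
    AllM-⊗ h (d ∷ ds) b = AllP.++⁺ (AllP.map⁺ (All.map (h d) b)) (AllM-⊗ h ds b)

  In-⊗ : ∀ {D E F : 𝕄 → Set} → (∀ {m n} → D m → E n → F (m · n)) →
         ∀ {f g} → In D f → In E g → In F (f ⊗ g)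
  In-⊗ h (mkIn r a e) (mkIn r' a' e') = mkIn (r ⊗ r') (AllM-⊗ h a a') (⊗-cong e e')

  In-^ : ∀ {D : 𝕄 → Set} → D one → (∀ {m n} → D m → D n → D (m · n)) →
         ∀ {f} → In D f → ∀ n → In D (f ^ n)
  In-^ d₁ h {f} i zero    rewrite ^-zero f  = In-mono d₁
  In-^ d₁ h {f} i (suc n) rewrite ^-suc f n = In-⊗ h i (In-^ d₁ h i n)

  cf-vanish : ∀ {D f m} → AllM D f → ¬ D m → cf f m ≈ 0#
  cf-vanish []                       nd = K.refl
  cf-vanish {f = (a , n) ∷ f} {m} (d ∷ ds) nd with n ≟M m
  ... | yes refl = ⊥-elim (nd d)
  ... | no _     = cf-vanish ds nd

  In-vanish : ∀ {D f m} → In D f → ¬ D m → cf f m ≈ 0#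
  In-vanish i nd = K.trans (i .eq .≋-at _) (cf-vanish (i .all) nd)

  restrict : ∀ {D : 𝕄 → Set} → Decidable D → 𝕃 → 𝕃
  restrict D? = filter (D? ∘ proj₂)

  restrict-all : ∀ {D} (D? : Decidable D) f → AllM D (restrict D? f)
  restrict-all D? f = AllP.all-filter (D? ∘ proj₂) f

  cf-restrict : ∀ {D} (D? : Decidable D) f {m} → D m → cf (restrict D? f) m ≈ cf f m
  cf-restrict D? []            d = K.refl
  cf-restrict D? ((a , n) ∷ f) {m} d with D? n
  ... | yes _ with n ≟M m
  ...   | yes _ = K.+-congˡ (cf-restrict D? f d)
  ...   | no _  = cf-restrict D? f d
  cf-restrict D? ((a , n) ∷ f) {m} d | no nd with n ≟M m
  ...   | yes refl = ⊥-elim (nd d)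
  ...   | no _     = cf-restrict D? f d

  eval-restrict : ∀ {D} (D? : Decidable D) φ f → (∀ m → ¬ D m → φ m ≈ 0#) →
                  eval φ (restrict D? f) ≈ eval φ f
  eval-restrict D? φ []            z = K.refl
  eval-restrict D? φ ((a , n) ∷ f) z with D? n
  ... | yes _ = K.+-congˡ (eval-restrict D? φ f z)
  ... | no nd = K.trans (eval-restrict D? φ f z) (K.sym (K.trans
    (K.+-congʳ (K.trans (K.*-congˡ (z n nd)) (K.zeroʳ a))) (K.+-identityˡ _)))

  ≋-restrict : ∀ {D} (D? : Decidable D) f → (∀ m → ¬ D m → cf f m ≈ 0#) → f ≋ restrict D? f
  ≋-restrict D? f z .≋-at m with D? m
  ... | yes d = K.sym (cf-restrict D? f d)
  ... | no nd = K.trans (z m nd) (K.sym (cf-vanish (restrict-all D? f) nd))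

  In-decide : ∀ {D} (D? : Decidable D) f → (∀ m → ¬ D m → cf f m ≈ 0#) → In D f
  In-decide D? f z = mkIn (restrict D? f) (restrict-all D? f) (≋-restrict D? f z)

  cf-T : ∀ w f m → cf (T w f) m ≈ eval (λ t → cf (w t) m) f
  cf-T w f m = K.trans (cf-eval (T w f) m) (K.trans (eval-T (δ m) w f)
    (eval-cong′ f (λ t → K.sym (cf-eval (w t) m))))

  -- The coefficient 1 of the lowest term is built in. The predicate `E` on the remaining terms lets
  -- degree bounds travel together with support conditions such as integrality.
  record Lead (E : 𝕄 → Set) (m : 𝕄) (f : 𝕃) : Set (c ⊔ ℓ) where
    constructor mkLead
    field
      rest   : 𝕃
      higher : AllM E rest
      split  : f ≋ mono m ⊕ rest
  open Lead public

  Pointed : 𝕄 → 𝕃 → Set (c ⊔ ℓ)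
  Pointed m = Lead (λ n → deg m ℤ.< deg n) m

  Lead-weaken : ∀ {E F m f} → (∀ {n} → E n → F n) → Lead E m f → Lead F m f
  Lead-weaken h (mkLead r a e) = mkLead r (All.map h a) e

  Lead-resp : ∀ {E m f g} → f ≋ g → Lead E m f → Lead E m g
  Lead-resp e (mkLead r a e') = mkLead r a (≋-trans (≋-sym e) e')

  Lead-mono : ∀ {E} m → Lead E m (mono m)
  Lead-mono m = mkLead [] [] (≋-sym (𝕃.+-identityʳ (mono m)))

  Lead-⊕ : ∀ {E m f g} → Lead E m f → In E g → Lead E m (f ⊕ g)
  Lead-⊕ (mkLead r a e) (mkIn s b e') = mkLead (r ⊕ s) (AllP.++⁺ a b)
    (≋-trans (⊕-cong e e') (𝕃.+-assoc (mono _) r s))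

  Lead-⊗ : ∀ {E F H : 𝕄 → Set} {m n f g} →
    (∀ {s} → E s → H (s · n)) → (∀ {t} → F t → H (m · t)) → (∀ {s t} → E s → F t → H (s · t)) →
    Lead E m f → Lead F n g → Lead H (m · n) (f ⊗ g)
  Lead-⊗ {m = m} {n} {f} {g} h₁ h₂ h₃ (mkLead r a e) (mkLead s b e') = mkLead
    (mono m ⊗ s ⊕ (r ⊗ mono n ⊕ r ⊗ s))
    (AllP.++⁺ (AllM-⊗ {D = _≡ m} (λ { refl → h₂ }) (refl ∷ []) b)
      (AllP.++⁺ (AllM-⊗ {E = _≡ n} (λ { d refl → h₁ d }) a (refl ∷ [])) (AllM-⊗ h₃ a b)))
    (≋-trans (⊗-cong e e') (≋-trans (RI.foil (mono m) r (mono n) s)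
      (⊕-cong (mono-· m n) ≋-refl)))

  deg<-·ʳ : ∀ {m n} o → deg m ℤ.< deg n → deg (m · o) ℤ.< deg (n · o)
  deg<-·ʳ {m} {n} o lt rewrite deg-· m o | deg-· n o = ℤP.+-monoˡ-< (deg o) lt

  deg<-·ˡ : ∀ {m n} o → deg m ℤ.< deg n → deg (o · m) ℤ.< deg (o · n)
  deg<-·ˡ {m} {n} o lt rewrite deg-· o m | deg-· o n = ℤP.+-monoʳ-< (deg o) lt

  Pointed-⊗ : ∀ {m n f g} → Pointed m f → Pointed n g → Pointed (m · n) (f ⊗ g)
  Pointed-⊗ {m} {n} = Lead-⊗ (λ {s} → deg<-·ʳ {m} {s} n) (λ {t} → deg<-·ˡ {n} {t} m)
    (λ {s} {t} p q → ℤP.<-trans (deg<-·ʳ {m} {s} n p) (deg<-·ˡ {n} {t} s q))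

  _^ᴹ_ : 𝕄 → ℕ → 𝕄
  m ^ᴹ zero  = one
  m ^ᴹ suc n = m · (m ^ᴹ n)

  mono-^ : ∀ m n → mono m ^ n ≋ mono (m ^ᴹ n)
  mono-^ m zero    rewrite ^-zero (mono m) = ≋-refl
  mono-^ m (suc n) rewrite ^-suc (mono m) n =
    ≋-trans (⊗-congˡ (mono m) (mono-^ m n)) (mono-· m (m ^ᴹ n))

  ^-cong : ∀ {f g} n → f ≋ g → f ^ n ≋ g ^ n
  ^-cong {f} {g} zero    e rewrite ^-zero f | ^-zero g = ≋-refl
  ^-cong {f} {g} (suc n) e rewrite ^-suc f n | ^-suc g n = ⊗-cong e (^-cong n e)

  ^-+ : ∀ f m n → f ^ (m ℕ.+ n) ≋ f ^ m ⊗ f ^ n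
  ^-+ f zero    n rewrite ^-zero f = ≋-sym (⊗-identityˡ (f ^ n))
  ^-+ f (suc m) n rewrite ^-suc f (m ℕ.+ n) | ^-suc f m =
    ≋-trans (⊗-congˡ f (^-+ f m n)) (≋-sym (⊗-assoc f (f ^ m) (f ^ n)))

  ⊗-^ : ∀ f g n → (f ⊗ g) ^ n ≋ f ^ n ⊗ g ^ n
  ⊗-^ f g zero    rewrite ^-zero (f ⊗ g) | ^-zero f | ^-zero g = ≋-sym (⊗-identityˡ 𝟏)
  ⊗-^ f g (suc n) rewrite ^-suc (f ⊗ g) n | ^-suc f n | ^-suc g n =
    ≋-trans (⊗-congˡ (f ⊗ g) (⊗-^ f g n)) (RI.*-interchange f g (f ^ n) (g ^ n))

  ^-one : ∀ f → f ^ 1 ≋ f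
  ^-one f rewrite ^-suc f 0 | ^-zero f = ⊗-identityʳ f

  Pointed-^ : ∀ {m f} n → Pointed m f → Pointed (m ^ᴹ n) (f ^ n)
  Pointed-^ {m} {f} zero    p rewrite ^-zero f  = Lead-mono one
  Pointed-^ {m} {f} (suc n) p rewrite ^-suc f n = Pointed-⊗ p (Pointed-^ n p)

  cf-mono : ∀ m n → cf (mono m) n ≈ δ n m
  cf-mono m n = K.trans (cf-eval (mono m) n) (K.trans (K.+-identityʳ _) (K.*-identityˡ _))

  cf-Pointed-self : ∀ {m f} → Pointed m f → cf f m ≈ 1#
  cf-Pointed-self {m} {f} (mkLead r a e) = begin
    cf f m              ≈⟨ e .≋-at m ⟩
    cf (mono m ⊕ r) m   ≈⟨ cf-++ (mono m) r m ⟩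
    cf (mono m) m + cf r m
      ≈⟨ K.+-cong (K.trans (cf-mono m m) (δ-same m)) (cf-vanish a (ℤP.<-irrefl refl)) ⟩
    1# + 0#             ≈⟨ K.+-identityʳ 1# ⟩
    1#                  ∎
    where open ≈-R

  cf-Pointed-other : ∀ {m f n} → Pointed m f → n ≢ m → deg n ℤ.≤ deg m → cf f n ≈ 0#
  cf-Pointed-other {m} {f} {n} (mkLead r a e) ne le = begin
    cf f n              ≈⟨ e .≋-at n ⟩
    cf (mono m ⊕ r) n   ≈⟨ cf-++ (mono m) r n ⟩
    cf (mono m) n + cf r n
      ≈⟨ K.+-cong (K.trans (cf-mono m n) (δ-diff (ne ∘ ≡.sym))) (cf-vanish a (ℤP.≤⇒≯ le)) ⟩
    0# + 0#             ≈⟨ K.+-identityʳ 0# ⟩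
    0#                  ∎
    where open ≈-R

  -- If the two monomials differed, the one of smaller or equal degree would have coefficient 1 in
  -- one description and 0 in the other. Applied to both sides of an exchange relation, this
  -- produces the recurrences for exponents.
  Pointed-unique : ¬ (0# ≈ 1#) → ∀ {m n f g} → f ≋ g → Pointed m f → Pointed n g → m ≡ n
  Pointed-unique 0≉1 {m} {n} e p q with Lead-resp e p
  ... | p' with m ≟M n
  ...   | yes m≡n = m≡n
  ...   | no m≢n with ℤP.≤-total (deg m) (deg n)
  ...     | inj₁ le = ⊥-elim (0≉1 (K.trans (K.sym (cf-Pointed-other q m≢n le)) (cf-Pointed-self p')))
  ...     | inj₂ le = ⊥-elim (0≉1 (K.trans (K.sym (cf-Pointed-other p' (m≢n ∘ ≡.sym) le)) (cf-Pointed-self q)))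

  private
    lower-bound : ∀ f → Σ ℤ λ lo → AllM (λ m → lo ℤ.≤ deg m) f
    lower-bound []            = + 0 , []
    lower-bound ((a , m) ∷ f) with lower-bound f
    ... | lo , b = deg m ℤ.⊓ lo , ℤP.i⊓j≤i (deg m) lo ∷ All.map (ℤP.≤-trans (ℤP.i⊓j≤j (deg m) lo)) b

    within : ∀ lo i → i ℤ.< lo ℤ.+ + suc ℤ.∣ i ℤ.- lo ∣
    within lo i = ℤP.≤-<-trans (ℤP.≤-reflexive (eq′ lo i))
      (ℤP.+-monoʳ-< lo (ℤP.≤-<-trans (i≤∣i∣ (i ℤ.- lo)) (ℤ.+<+ (ℕP.n<1+n _))))
      where
      eq′ : ∀ lo i → i ≡ lo ℤ.+ (i ℤ.- lo)
      eq′ = solve-∀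
      i≤∣i∣ : ∀ i → i ℤ.≤ + ℤ.∣ i ∣
      i≤∣i∣ (+ n)      = ℤP.≤-refl
      i≤∣i∣ -[1+ n ]   = ℤ.-≤+

    <-step : ∀ lo k i j → j ℤ.< i → i ℤ.< lo ℤ.+ + suc k → j ℤ.< lo ℤ.+ + k
    <-step lo k i j j<i i< = ℤP.<-≤-trans j<i (ℤP.≤-trans (ℤP.i<j⇒i≤pred[j] i<)
      (ℤP.≤-reflexive (pred′ lo (+ k))))
      where
      pred′ : ∀ lo k → ℤ.- + 1 ℤ.+ (lo ℤ.+ (+ 1 ℤ.+ k)) ≡ lo ℤ.+ k
      pred′ = solve-∀

  -- Comparing coefficients in increasing total degree, the operator T w is unitriangular
  -- and so reflects every support condition C that the correction terms of w preserve.
  triangular : ∀ {C : 𝕄 → Set} → Decidable C → ∀ {w} →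
    (∀ t → Lead (λ n → deg t ℤ.< deg n × (C t → C n)) t (w t)) →
    ∀ cs → In C (T w cs) → ∀ m → ¬ C m → cf cs m ≈ 0#
  triangular {C} C? {w} L cs i m ¬Cm =
    -- No term of `cs` has degree below `lo`, so the distance of `deg m` from `lo` bounds the
    -- induction on degree.
    go (suc ℤ.∣ deg m ℤ.- lo ∣) m ¬Cm (within lo (deg m))
    where
    open ≈-R
    lo = proj₁ (lower-bound cs)
    lo≤ = proj₂ (lower-bound cs)
    r : 𝕄 → 𝕃
    r t = L t .rest

    split-T : T w cs ≋ cs ⊕ T r cs
    split-T = ≋-trans (T-cong′ cs (All.universal (λ t → L (proj₂ t) .split) cs))
      (≋-trans (T-⊕ mono r cs) (⊕-cong (T-mono cs) ≋-refl))

    go : ∀ k m → ¬ C m → deg m ℤ.< lo ℤ.+ + k → cf cs m ≈ 0#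
    go zero    m ¬Cm lt = cf-vanish lo≤ λ le → ℤP.≤⇒≯ le (≡.subst (deg m ℤ.<_) (ℤP.+-identityʳ lo) lt)
    go (suc k) m ¬Cm lt = begin
      cf cs m                   ≈⟨ K.+-identityʳ _ ⟨
      cf cs m + 0#              ≈⟨ K.+-congˡ rest≈0 ⟨
      cf cs m + cf (T r cs) m   ≈⟨ cf-++ cs (T r cs) m ⟨
      cf (cs ⊕ T r cs) m        ≈⟨ split-T .≋-at m ⟨
      cf (T w cs) m             ≈⟨ In-vanish i ¬Cm ⟩
      0#                        ∎
      where
      ψ : 𝕄 → Carrier
      ψ t = cf (r t) m

      -- Corrections raise the degree and preserve `C`, so only such t can contribute to the
      -- coefficient of m in `T r cs`; their own coefficients vanish by induction on degree.
      Bad : 𝕄 → Set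
      Bad t = ¬ C t × deg t ℤ.< deg m

      Bad? : Decidable Bad
      Bad? t = ¬? (C? t) ×-dec (deg t ℤP.<? deg m)

      ψ-zero : ∀ t → ¬ Bad t → ψ t ≈ 0#
      ψ-zero t ¬bad = cf-vanish (L t .higher) λ { (d , h) → ¬bad ((λ Ct → ¬Cm (h Ct)) , d) }

      bad-zero : restrict Bad? cs ≋ 𝟎
      bad-zero .≋-at n with Bad? n
      ... | yes (¬Cn , d) = K.trans (cf-restrict Bad? cs (¬Cn , d))
                              (go k n ¬Cn (<-step lo k (deg m) (deg n) d lt))
      ... | no ¬bad = cf-vanish (restrict-all Bad? cs) ¬bad

      rest≈0 : cf (T r cs) m ≈ 0#
      rest≈0 = begin
        cf (T r cs) m             ≈⟨ cf-T r cs m ⟩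
        eval ψ cs                 ≈⟨ eval-restrict Bad? ψ cs ψ-zero ⟨
        eval ψ (restrict Bad? cs) ≈⟨ eval-≋ ψ bad-zero ⟩
        0#                        ∎

  triangular-restrict : ∀ {C : 𝕄 → Set} (C? : Decidable C) → ∀ {w} →
    (∀ t → Lead (λ n → deg t ℤ.< deg n × (C t → C n)) t (w t)) →
    ∀ {f} cs → f ≋ T w cs → In C f → f ≋ T w (restrict C? cs)
  triangular-restrict C? {w} L cs e i = ≋-trans e
    (T-cong w (≋-restrict C? cs (triangular C? L cs (In-resp e i))))

  -- The map t ↦ μ⁻¹ t g is unitriangular when g has lowest monomial μ. Hence `triangular` carries a
  -- support condition from the product back to f, shifted by μ.
  division : ∀ {C : 𝕄 → Set} → Decidable C → ∀ {μ f g} → Lead (λ n → deg μ ℤ.< deg n × (∀ t → C (t · μ) → C (t · n))) μ g →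
    In C (f ⊗ g) → ∀ m → ¬ C (m · μ) → cf f m ≈ 0#
  division {C} C? {μ} {f} {g} (mkLead r a e) i = triangular (λ m → C? (m · μ)) L f (In-resp e₁ i₁)
    where
    w : 𝕄 → 𝕃
    w t = mono (inv μ) ⊗ (mono t ⊗ g)

    cancel-inv : ∀ t n → (inv μ · (t · n)) · μ ≡ t · n
    cancel-inv t n = ≡.trans (·-comm (inv μ · (t · n)) μ) (≡.trans (≡.sym (·-assoc μ (inv μ) (t · n)))
      (≡.trans (cong (_· (t · n)) (·-inverseʳ μ)) (·-identityˡ (t · n))))

    lead≡ : ∀ t → inv μ · (t · μ) ≡ t
    lead≡ t = ≡.trans (cong (inv μ ·_) (·-comm t μ)) (≡.trans (≡.sym (·-assoc (inv μ) μ t))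
      (≡.trans (cong (_· t) (·-inverseˡ μ)) (·-identityˡ t)))

    L : ∀ t → Lead (λ n → deg t ℤ.< deg n × (C (t · μ) → C (n · μ))) t (w t)
    L t = ≡.subst (λ z → Lead (λ n → deg t ℤ.< deg n × (C (t · μ) → C (n · μ))) z (w t)) (lead≡ t)
      (Lead-⊗ {E = λ _ → ⊥} (λ ()) step (λ ()) (Lead-mono (inv μ))
        (Lead-⊗ {E = λ _ → ⊥} {F = λ n → deg μ ℤ.< deg n × (∀ t → C (t · μ) → C (t · n))}
          {H = λ n → deg (t · μ) ℤ.< deg n × (C (t · μ) → C n)}
          (λ ()) (λ { {n} (d , h) → deg<-·ˡ {μ} {n} t d , h t }) (λ ()) (Lead-mono t) (mkLead r a e)))
      where
      step : ∀ {n} → deg (t · μ) ℤ.< deg n × (C (t · μ) → C n) →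
             deg t ℤ.< deg (inv μ · n) × (C (t · μ) → C ((inv μ · n) · μ))
      step {n} (d , h) = ≡.subst (ℤ._< deg (inv μ · n)) (cong deg (lead≡ t)) (deg<-·ˡ {t · μ} {n} (inv μ) d) ,
        λ Ct → ≡.subst C (≡.sym (≡.trans (cong (λ z → (inv μ · z) · μ) (≡.sym (·-identityˡ n)))
          (≡.trans (cancel-inv one n) (·-identityˡ n)))) (h Ct)

    e₁ : mono (inv μ) ⊗ (f ⊗ g) ≋ T w f
    e₁ = ≋-trans (⊗-congˡ (mono (inv μ)) (⊗-as-T f g)) (≋-trans (⊗-comm (mono (inv μ)) _)
      (≋-trans (T-⊗ (λ m → mono m ⊗ g) f (mono (inv μ)))
        (T-cong′ f (All.universal (λ t → ⊗-comm (mono (proj₂ t) ⊗ g) (mono (inv μ))) f))))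

    i₁ : In (λ m → C (m · μ)) (mono (inv μ) ⊗ (f ⊗ g))
    i₁ = In-⊗ {D = _≡ inv μ} (λ { {n = n} refl Cn → ≡.subst C (≡.sym (≡.trans
      (cong (λ z → (inv μ · z) · μ) (≡.sym (·-identityˡ n))) (≡.trans (cancel-inv one n) (·-identityˡ n)))) Cn })
      (In-mono refl) i

  -- `division` with the empty support condition: a product that vanishes has a vanishing first
  -- factor when the second is pointed.
  ⊗-cancelʳ : ∀ {μ f f' g} → Pointed μ g → f ⊗ g ≋ f' ⊗ g → f ≋ f'
  ⊗-cancelʳ {μ} {f} {f'} {g} p e = ≋-trans (RI.+-unmove {f} {f'} {𝟎} (≋-sym z)) (𝕃.+-identityʳ f')
    where
    open RingProperties 𝕃.ring using (-‿distribˡ-*)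
    zero⊗ : (f ⊕ neg f') ⊗ g ≋ 𝟎
    zero⊗ = ≋-trans (⊗-distribʳ g f (neg f')) (≋-trans (⊕-cong e (≋-sym (-‿distribˡ-* f' g))) (neg-inverseʳ (f' ⊗ g)))
    z : f ⊕ neg f' ≋ 𝟎
    z .≋-at m = division {C = λ _ → ⊥} (λ _ → no (λ ())) (Lead-weaken (λ d → d , λ _ ()) p)
      (In-resp (≋-sym zero⊗) In-𝟎) m (λ ())

i≤[i]₊ : ∀ i → i ℤ.≤ + [ i ]₊
i≤[i]₊ (+ n)    = ℤP.≤-refl
i≤[i]₊ -[1+ n ] = ℤ.-≤+

[]₊-least : ∀ {i n} → i ℤ.≤ + n → [ i ]₊ ℕ.≤ n
[]₊-least {+ m}      (ℤ.+≤+ le) = le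
[]₊-least { -[1+ m ]} _         = z≤n

[]₊-+ : ∀ i j → [ i ℤ.+ j ]₊ ℕ.≤ [ i ]₊ ℕ.+ [ j ]₊
[]₊-+ i j = []₊-least (ℤP.+-mono-≤ (i≤[i]₊ i) (i≤[i]₊ j))

[]₊-mono : ∀ {i j} → i ℤ.≤ j → [ i ]₊ ℕ.≤ [ j ]₊
[]₊-mono {i} {j} le = []₊-least (ℤP.≤-trans le (i≤[i]₊ j))

[-]₊≡0 : ∀ {i} → + 0 ℤ.≤ i → [ ℤ.- i ]₊ ≡ 0
[-]₊≡0 {i} le = ℕP.n≤0⇒n≡0 ([]₊-least (ℤP.neg-mono-≤ le))

module ExponentVectors where

  infixl 6 _⊞_

  _⊞_ : ∀ {n} → Vec ℤ n → Vec ℤ n → Vec ℤ n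
  _⊞_ = Vec.zipWith ℤ._+_

  NonNeg : ∀ {n} → Vec ℤ n → Set
  NonNeg v = All (ℤ._≤_ (+ 0)) (Vec.toList v)

  NonNeg-⊞ : ∀ {n} {u v : Vec ℤ n} → NonNeg u → NonNeg v → NonNeg (u ⊞ v)
  NonNeg-⊞ {u = []}    {[]}    []       []       = []
  NonNeg-⊞ {u = _ ∷ _} {_ ∷ _} (p ∷ ps) (q ∷ qs) = ℤP.+-mono-≤ p q ∷ NonNeg-⊞ ps qs

  NonNeg-zeros : ∀ n → NonNeg (zeros n)
  NonNeg-zeros zero    = []
  NonNeg-zeros (suc n) = ℤP.≤-refl ∷ NonNeg-zeros n

  NonNeg-expAt : ∀ n j {e} → + 0 ℤ.≤ e → NonNeg (expAt n j e)
  NonNeg-expAt zero    j             p = []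
  NonNeg-expAt (suc n) zero          p = NonNeg-zeros (suc n)
  NonNeg-expAt (suc n) (suc zero)    p = p ∷ NonNeg-zeros n
  NonNeg-expAt (suc n) (suc (suc j)) p = ℤP.≤-refl ∷ NonNeg-expAt n (suc j) p

  zeros-⊞ : ∀ n → zeros n ⊞ zeros n ≡ zeros n
  zeros-⊞ zero    = refl
  zeros-⊞ (suc n) = cong (+ 0 ∷_) (zeros-⊞ n)

  expAt-⊞ : ∀ n j a b → expAt n j a ⊞ expAt n j b ≡ expAt n j (a ℤ.+ b)
  expAt-⊞ zero    j             a b = refl
  expAt-⊞ (suc n) zero          a b = zeros-⊞ (suc n)
  expAt-⊞ (suc n) (suc zero)    a b = cong (_ ∷_) (zeros-⊞ n)
  expAt-⊞ (suc n) (suc (suc j)) a b = cong (+ 0 ∷_) (expAt-⊞ n (suc j) a b)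

  expAt-0 : ∀ n j → expAt n j (+ 0) ≡ zeros n
  expAt-0 zero    j             = refl
  expAt-0 (suc n) zero          = refl
  expAt-0 (suc n) (suc zero)    = refl
  expAt-0 (suc n) (suc (suc j)) = cong (+ 0 ∷_) (expAt-0 n (suc j))

open ExponentVectors

-- Spans of families indexed by monomials, and poles along one variable.

module Spans {c ℓ} (K : CommutativeRing c ℓ) (ℓ₁ ℓ₂ : ℕ) where

  open CommutativeRing K using (Carrier; _≈_; _+_; _*_; -_; 0#; 1#)
  private module K = CommutativeRing K
  open Supports K ℓ₁ ℓ₂ public

  Integral-· : ∀ {m n} → Integral m → Integral n → Integral (m · n)
  Integral-· (p , q) (p' , q') = NonNeg-⊞ p p' , NonNeg-⊞ q q'

  Integral-one : Integral one
  Integral-one = NonNeg-zeros ℓ₁ , NonNeg-zeros ℓ₂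

  Integral? : Decidable Integral
  Integral? m = All.all? (+ 0 ℤ.≤?_) _ ×-dec All.all? (+ 0 ℤ.≤?_) _

  scale : Carrier → 𝕃 → 𝕃
  scale a = map (λ u → (a * proj₁ u , proj₂ u))

  eval-scaled : ∀ φ a f → eval φ (scale a f) ≈ a * eval φ f
  eval-scaled φ a f = eval-scale φ a (λ n → n) f

  scale-cong : ∀ a {f g} → f ≋ g → scale a f ≋ scale a g
  scale-cong a {f} {g} e = ext λ φ → K.trans (eval-scaled φ a f)
    (K.trans (K.*-congˡ (eval-≋ φ e)) (K.sym (eval-scaled φ a g)))

  T-scale : ∀ w a f → T w (scale a f) ≋ scale a (T w f)
  T-scale w a f = ext λ φ → K.trans (eval-T φ w (scale a f)) (K.trans (eval-scaled _ a f)
    (K.trans (K.*-congˡ (K.sym (eval-T φ w f))) (K.sym (eval-scaled φ a (T w f)))))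

  opaque
    unfolding T

    T-∷ : ∀ w a m f → T w ((a , m) ∷ f) ≡ scale a (w m) ⊕ T w f
    T-∷ w a m f = refl

    T-[] : ∀ w → T w [] ≡ 𝟎
    T-[] w = refl

  -- The coefficients are taken from K only: powers of p_{i,j} are part of the index m. For the
  -- families used here, restricting indices to `Integral` gives the span over K[p_{i,j}].
  record Span (w : 𝕄 → 𝕃) (D : 𝕄 → Set) (f : 𝕃) : Set (c ⊔ ℓ) where
    constructor mkSpan
    field
      coords : 𝕃
      within : AllM D coords
      expand : f ≋ T w coords
  open Span public

  Span-resp : ∀ {w D f g} → f ≋ g → Span w D f → Span w D g
  Span-resp e (mkSpan cs a e') = mkSpan cs a (≋-trans (≋-sym e) e')

  Span-weaken : ∀ {w D E f} → (∀ {m} → D m → E m) → Span w D f → Span w E f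
  Span-weaken h (mkSpan cs a e) = mkSpan cs (All.map h a) e

  Span-𝟎 : ∀ {w D} → Span w D 𝟎
  Span-𝟎 {w} = mkSpan [] [] (≋-reflexive (≡.sym (T-[] w)))

  Span-⊕ : ∀ {w D f g} → Span w D f → Span w D g → Span w D (f ⊕ g)
  Span-⊕ {w} (mkSpan cs a e) (mkSpan ds b e') = mkSpan (cs ⊕ ds) (AllP.++⁺ a b)
    (≋-trans (⊕-cong e e') (≋-sym (T-++ w cs ds)))

  Span-neg : ∀ {w D f} → Span w D f → Span w D (neg f)
  Span-neg {w} (mkSpan cs a e) = mkSpan (neg cs) (AllP.map⁺ a)
    (≋-trans (neg-cong e) (≋-sym (T-neg w cs)))

  Span-scale : ∀ {w D f} a → Span w D f → Span w D (scale a f)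
  Span-scale {w} a (mkSpan cs b e) = mkSpan (scale a cs) (AllP.map⁺ b)
    (≋-trans (scale-cong a e) (≋-sym (T-scale w a cs)))

  Span-T : ∀ {w D E v f} → (∀ {m} → D m → Span w E (v m)) → AllM D f → Span w E (T v f)
  Span-T {v = v} h []                          rewrite T-[] v      = Span-𝟎
  Span-T {v = v} {f = (a , m) ∷ f} h (d ∷ ds)  rewrite T-∷ v a m f =
    Span-⊕ (Span-scale a (h d)) (Span-T h ds)

  Span-gen : ∀ {w} {D : 𝕄 → Set} {m} → D m → Span w D (w m)
  Span-gen {w} {m = m} d = mkSpan (mono m) (d ∷ []) (ext λ φ → K.sym (K.trans (eval-T φ w (mono m))
    (K.trans (K.+-identityʳ _) (K.*-identityˡ _))))

  -- For ε = exp₁ and Q = P₂(x₂) the span of the w m is K[p^{±1}][x₁, x₂^{±1}, x₃],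
  -- since x₁⁻¹ Q = x₃; symmetrically for ε = exp₂ and Q = P₁(x₁).
  module OneSided (ε : 𝕄 → ℤ) (ε-· : ∀ m n → ε (m · n) ≡ ε m ℤ.+ ε n) (ε-one : ε one ≡ + 0) (Q : 𝕃)
    (Q-lead : Lead (λ n → Integral n × + 0 ℤ.≤ exp₁ n × + 0 ℤ.< deg n × ε n ≡ + 0) one Q) where

    -- The terms other than 1 in a power of Q. Nonnegativity of `exp₁` is imposed for both choices
    -- of ε: it keeps the elimination in x₂ inside the polynomials in x₁.
    Corr : 𝕄 → Set
    Corr n = Integral n × + 0 ℤ.≤ exp₁ n × + 0 ℤ.< deg n × ε n ≡ + 0

    w : 𝕄 → 𝕃
    w m = mono m ⊗ Q ^ [ ℤ.- ε m ]₊

    private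
      ·-0ε : ∀ {m n} → ε n ≡ + 0 → ε (m · n) ≡ ε m
      ·-0ε {m} {n} e = ≡.trans (ε-· m n) (≡.trans (cong (λ z → ε m ℤ.+ z) e) (ℤP.+-identityʳ (ε m)))

      Corr-· : ∀ {m n} → Corr m → Corr n → Corr (m · n)
      Corr-· {m} {n} (i , x , d , e) (i' , x' , d' , e') =
        Integral-· {m} {n} i i' , ℤP.+-mono-≤ x x' ,
        ≡.subst (+ 0 ℤ.<_) (≡.sym (deg-· m n)) (ℤP.+-mono-< d d') , ≡.trans (·-0ε e') e

    Q^-lead : ∀ k → Lead Corr one (Q ^ k)
    Q^-lead zero    rewrite ^-zero Q  = Lead-mono one
    Q^-lead (suc k) rewrite ^-suc Q k = ≡.subst (λ z → Lead Corr z (Q ⊗ Q ^ k)) (·-identityˡ one)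
      (Lead-⊗ (λ {s} → ≡.subst Corr (≡.sym (·-identityʳ s))) (λ {t} → ≡.subst Corr (≡.sym (·-identityˡ t)))
        Corr-· Q-lead (Q^-lead k))

    Q^-in : ∀ k → In (λ n → Integral n × ε n ≡ + 0) (Q ^ k)
    Q^-in k with Q^-lead k
    ... | mkLead r a e = In-resp (≋-sym e)
      (In-⊕ (In-mono (Integral-one , ε-one)) (In-list (All.map (λ { (i , _ , _ , z) → i , z }) a)))

    w-lead : ∀ {C : 𝕄 → Set} → (∀ {m n} → C m → Corr n → C (m · n)) →
             ∀ t → Lead (λ n → deg t ℤ.< deg n × (C t → C n)) t (w t)
    w-lead {C} h t = ≡.subst (λ z → Lead (λ n → deg t ℤ.< deg n × (C t → C n)) z (w t)) (·-identityʳ t)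
      (Lead-⊗ {E = λ _ → ⊥} {F = Corr} (λ ())
        (λ { {n} co@(_ , _ , d , _) → ≡.subst (deg t ℤ.<_) (≡.sym (deg-· t n))
               (≡.subst (ℤ._< deg t ℤ.+ deg n) (ℤP.+-identityʳ (deg t)) (ℤP.+-monoʳ-< (deg t) d)) ,
             λ Ct → h Ct co })
        (λ ()) (Lead-mono t) (Q^-lead [ ℤ.- ε t ]₊))

    -- A monomial whose pole order j is at most k absorbs Q^j from Q^k; the surplus Q^(k - j) does
    -- not change ε and is expanded into further monomials with the same pole order.
    span-lift : ∀ {D : 𝕄 → Set} {f k} → In D f → (∀ {n} → D n → [ ℤ.- ε n ]₊ ℕ.≤ k) →
                (∀ {m n} → D m → Integral n → ε n ≡ + 0 → D (m · n)) → Span w D (f ⊗ Q ^ k)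
    span-lift {D} {f} {k} (mkIn r a e) bound closed =
      Span-resp (≋-sym (≋-trans (⊗-congʳ (Q ^ k) e) (⊗-as-T r (Q ^ k))))
        (Span-T lifted a)
      where
      lifted : ∀ {m} → D m → Span w D (mono m ⊗ Q ^ k)
      lifted {m} d = mkSpan (s .rep) (All.map proj₁ (s .all)) (begin
        mono m ⊗ Q ^ k                               ≡⟨ cong (λ z → mono m ⊗ Q ^ z) (≡.sym (ℕP.m∸n+n≡m (bound d))) ⟩
        mono m ⊗ Q ^ ((k ℕ.∸ j) ℕ.+ j)               ≈⟨ ⊗-congˡ (mono m) (^-+ Q (k ℕ.∸ j) j) ⟩
        mono m ⊗ (Q ^ (k ℕ.∸ j) ⊗ Q ^ j)             ≈⟨ ⊗-assoc (mono m) (Q ^ (k ℕ.∸ j)) (Q ^ j) ⟨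
        (mono m ⊗ Q ^ (k ℕ.∸ j)) ⊗ Q ^ j             ≈⟨ ⊗-congʳ (Q ^ j) (s .eq) ⟩
        s .rep ⊗ Q ^ j                               ≈⟨ ⊗-as-T (s .rep) (Q ^ j) ⟩
        T (λ n → mono n ⊗ Q ^ j) (s .rep)
          ≈⟨ T-cong′ (s .rep) (All.map (λ { {t} (_ , e') →
               ≋-reflexive (cong (λ z → mono (proj₂ t) ⊗ Q ^ [ ℤ.- z ]₊) (≡.sym e')) }) (s .all)) ⟩
        T w (s .rep)                                 ∎)
        where
        open ≋-R
        j = [ ℤ.- ε m ]₊
        s : In (λ n → D n × ε n ≡ ε m) (mono m ⊗ Q ^ (k ℕ.∸ j))
        s = In-⊗ {D = _≡ m} (λ { refl (i , z) → closed d i z , ·-0ε z }) (In-mono refl) (Q^-in (k ℕ.∸ j))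

    V : 𝕃 → Set (c ⊔ ℓ)
    V = Span w (λ _ → ⊤)

    -- Pole orders are subadditive, so the product of two basis elements carries at least as many
    -- factors Q as its monomial requires.
    V-⊗ : ∀ {f g} → V f → V g → V (f ⊗ g)
    V-⊗ {f} {g} (mkSpan cs a e) (mkSpan ds b e') =
      Span-resp (≋-sym (≋-trans (⊗-cong e e') (T-⊗ w cs (T w ds)))) (Span-T outer a)
      where
      inner : ∀ m n → V (w n ⊗ w m)
      inner m n = Span-resp (≋-trans
          (⊗-cong (≋-sym (mono-· n m)) (^-+ Q [ ℤ.- ε n ]₊ [ ℤ.- ε m ]₊))
          (RI.*-interchange (mono n) (mono m) (Q ^ [ ℤ.- ε n ]₊) (Q ^ [ ℤ.- ε m ]₊)))
        (Span-weaken (λ _ → tt) (span-lift {D = λ o → ε o ≡ ε (n · m)} (In-mono refl)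
          (λ { {o} eo → ≡.subst (ℕ._≤ [ ℤ.- ε n ]₊ ℕ.+ [ ℤ.- ε m ]₊)
            (cong [_]₊ (≡.sym (≡.trans (cong ℤ.-_ (≡.trans eo (ε-· n m))) (ℤP.neg-distrib-+ (ε n) (ε m)))))
            ([]₊-+ (ℤ.- ε n) (ℤ.- ε m)) })
          (λ eo _ z → ≡.trans (·-0ε z) eo)))
      outer : ∀ {m} → ⊤ → V (w m ⊗ T w ds)
      outer {m} _ = Span-resp (≋-trans (≋-sym (T-⊗ w ds (w m))) (⊗-comm (T w ds) (w m)))
        (Span-T (λ {n} _ → inner m n) b)

    w-plain : ∀ {m} → + 0 ℤ.≤ ε m → w m ≋ mono m
    w-plain {m} le rewrite [-]₊≡0 le | ^-zero Q = ⊗-identityʳ (mono m)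

    T-plain : ∀ {f} → AllM (λ m → + 0 ℤ.≤ ε m) f → T w f ≋ f
    T-plain {f} a = ≋-trans (T-cong′ f (All.map w-plain a)) (T-mono f)

    V-plain : ∀ {f} → In (λ m → + 0 ℤ.≤ ε m) f → V f
    V-plain (mkIn r a e) = mkSpan r (All.map (λ _ → tt) a) (≋-trans e (≋-sym (T-plain a)))

≤⇒≤ᵇ≡true : ∀ {m n} → m ℕ.≤ n → (m ≤ᵇ n) ≡ true
≤⇒≤ᵇ≡true {m} {n} le with m ≤ᵇ n | ℕP.≤⇒≤ᵇ le
... | true | _ = refl

-- Elimination of negative powers for a general family G.

module Elimination {c ℓ} (K : CommutativeRing c ℓ) (ℓ₁ ℓ₂ : ℕ) where

  open Spans K ℓ₁ ℓ₂ public

  Σ₁′ : ℕ → (ℕ → 𝕃) → 𝕃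
  Σ₁′ = Defs.Σ₁ K ℓ₁ ℓ₂

  Σ₁-cong : ∀ n {F G : ℕ → 𝕃} → (∀ j → 1 ℕ.≤ j → j ℕ.≤ n → F j ≋ G j) → Σ₁′ n F ≋ Σ₁′ n G
  Σ₁-cong zero    h = ≋-refl
  Σ₁-cong (suc n) h = ⊕-cong (h 1 (s≤s z≤n) (s≤s z≤n))
    (Σ₁-cong n (λ j 1≤j j≤n → h (suc j) (s≤s z≤n) (s≤s j≤n)))

  Σ₁-closed : ∀ {p} (S : 𝕃 → Set p) → S 𝟎 → (∀ {f g} → S f → S g → S (f ⊕ g)) →
              ∀ n {F : ℕ → 𝕃} → (∀ j → 1 ℕ.≤ j → j ℕ.≤ n → S (F j)) → S (Σ₁′ n F)
  Σ₁-closed S z s zero    h = z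
  Σ₁-closed S z s (suc n) h = s (h 1 (s≤s z≤n) (s≤s z≤n))
    (Σ₁-closed S z s n (λ j 1≤j j≤n → h (suc j) (s≤s z≤n) (s≤s j≤n)))

  ⊗-Σ₁ : ∀ f n F → f ⊗ Σ₁′ n F ≋ Σ₁′ n (λ j → f ⊗ F j)
  ⊗-Σ₁ f zero    F = 𝕃.zeroʳ f
  ⊗-Σ₁ f (suc n) F = ≋-trans (⊗-distribˡ f (F 1) _) (⊕-cong ≋-refl (⊗-Σ₁ f n (F ∘ suc)))

  In-Σ₁ : ∀ {D} n {F : ℕ → 𝕃} → (∀ j → 1 ℕ.≤ j → j ℕ.≤ n → In D (F j)) → In D (Σ₁′ n F)
  In-Σ₁ {D} = Σ₁-closed (In D) In-𝟎 In-⊕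

  xm : ℤ → ℤ → 𝕄
  xm i j = zeros ℓ₁ , zeros ℓ₂ , i , j

  pm₁ pm₂ : ℕ → 𝕄
  pm₁ j = expAt ℓ₁ j (+ 1) , zeros ℓ₂ , + 0 , + 0
  pm₂ j = zeros ℓ₁ , expAt ℓ₂ j (+ 1) , + 0 , + 0

  xm-· : ∀ i j i' j' → xm i j · xm i' j' ≡ xm (i ℤ.+ i') (j ℤ.+ j')
  xm-· i j i' j' = pairs≡ (zeros-⊞ ℓ₁) (zeros-⊞ ℓ₂) refl refl

  xm₁-^ : ∀ n → xm (+ 1) (+ 0) ^ᴹ n ≡ xm (+ n) (+ 0)
  xm₁-^ zero    = refl
  xm₁-^ (suc n) = ≡.trans (cong (xm (+ 1) (+ 0) ·_) (xm₁-^ n)) (xm-· (+ 1) (+ 0) (+ n) (+ 0))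

  xm₂-^ : ∀ n → xm (+ 0) (+ 1) ^ᴹ n ≡ xm (+ 0) (+ n)
  xm₂-^ zero    = refl
  xm₂-^ (suc n) = ≡.trans (cong (xm (+ 0) (+ 1) ·_) (xm₂-^ n)) (xm-· (+ 0) (+ 1) (+ 0) (+ n))

  monoP-x : ∀ d e → Defs.monoP K ℓ₁ ℓ₂ (+ 0) (+ 0) d e ≡ mono (xm d e)
  monoP-x d e = cong mono (pairs≡ (expAt-0 ℓ₁ ℓ₁) (expAt-0 ℓ₂ ℓ₂) refl refl)

  pm₁-0 : pm₁ 0 ≡ one
  pm₁-0 = pairs≡ (expAt-at-0 ℓ₁) refl refl refl
    where
    expAt-at-0 : ∀ n → expAt n 0 (+ 1) ≡ zeros n
    expAt-at-0 zero    = refl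
    expAt-at-0 (suc n) = refl

  pm₂-0 : pm₂ 0 ≡ one
  pm₂-0 = pairs≡ refl (expAt-at-0 ℓ₂) refl refl
    where
    expAt-at-0 : ∀ n → expAt n 0 (+ 1) ≡ zeros n
    expAt-at-0 zero    = refl
    expAt-at-0 (suc n) = refl

  p₁-mono : ∀ j → j ℕ.≤ ℓ₁ → Defs.p₁ K ℓ₁ ℓ₂ j ≡ mono (pm₁ j)
  p₁-mono zero    le = ≡.sym (cong mono pm₁-0)
  p₁-mono (suc j) le rewrite ≤⇒≤ᵇ≡true le = refl

  p₂-mono : ∀ j → j ℕ.≤ ℓ₂ → Defs.p₂ K ℓ₁ ℓ₂ j ≡ mono (pm₂ j)
  p₂-mono zero    le = ≡.sym (cong mono pm₂-0)
  p₂-mono (suc j) le rewrite ≤⇒≤ᵇ≡true le = refl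

  Integral-pm₁ : ∀ j → Integral (pm₁ j)
  Integral-pm₁ j = NonNeg-expAt ℓ₁ j (ℤ.+≤+ z≤n) , NonNeg-zeros ℓ₂

  Integral-pm₂ : ∀ j → Integral (pm₂ j)
  Integral-pm₂ j = NonNeg-zeros ℓ₁ , NonNeg-expAt ℓ₂ j (ℤ.+≤+ z≤n)

  Integral-xm : ∀ i j → Integral (xm i j)
  Integral-xm i j = NonNeg-zeros ℓ₁ , NonNeg-zeros ℓ₂

  P₁-sum : ∀ z → Defs.P₁ K ℓ₁ ℓ₂ z ≋ 𝟏 ⊕ Σ₁′ ℓ₁ (λ j → mono (pm₁ j) ⊗ z ^ j)
  P₁-sum z = ⊕-cong {𝟏} ≋-refl (Σ₁-cong ℓ₁ λ j _ le → ≋-reflexive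
    (≡.trans (cong (Defs._⊗_ K ℓ₁ ℓ₂ (Defs.p₁ K ℓ₁ ℓ₂ j)) (≡.sym (^-unfold z j)))
      (≡.trans (≡.sym (⊗-unfold (Defs.p₁ K ℓ₁ ℓ₂ j) (z ^ j))) (cong (_⊗ z ^ j) (p₁-mono j le)))))

  P₂-sum : ∀ z → Defs.P₂ K ℓ₁ ℓ₂ z ≋ 𝟏 ⊕ Σ₁′ ℓ₂ (λ j → mono (pm₂ j) ⊗ z ^ j)
  P₂-sum z = ⊕-cong {𝟏} ≋-refl (Σ₁-cong ℓ₂ λ j _ le → ≋-reflexive
    (≡.trans (cong (Defs._⊗_ K ℓ₁ ℓ₂ (Defs.p₂ K ℓ₁ ℓ₂ j)) (≡.sym (^-unfold z j)))
      (≡.trans (≡.sym (⊗-unfold (Defs.p₂ K ℓ₁ ℓ₂ j) (z ^ j))) (cong (_⊗ z ^ j) (p₂-mono j le)))))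

  ξ₁ ξ₂ : 𝕃
  ξ₁ = mono (xm (+ 1) (+ 0))
  ξ₂ = mono (xm (+ 0) (+ 1))

  Q₁ Q₂ : 𝕃
  Q₁ = 𝟏 ⊕ Σ₁′ ℓ₁ (λ j → mono (pm₁ j) ⊗ ξ₁ ^ j)
  Q₂ = 𝟏 ⊕ Σ₁′ ℓ₂ (λ j → mono (pm₂ j) ⊗ ξ₂ ^ j)

  Q-term₁ : ∀ j → mono (pm₁ j) ⊗ ξ₁ ^ j ≋ mono (pm₁ j · xm (+ j) (+ 0))
  Q-term₁ j = ≋-trans (⊗-congˡ _ (≋-trans (mono-^ _ j) (≋-reflexive (cong mono (xm₁-^ j))))) (mono-· _ _)

  Q-term₂ : ∀ j → mono (pm₂ j) ⊗ ξ₂ ^ j ≋ mono (pm₂ j · xm (+ 0) (+ j))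
  Q-term₂ j = ≋-trans (⊗-congˡ _ (≋-trans (mono-^ _ j) (≋-reflexive (cong mono (xm₂-^ j))))) (mono-· _ _)

  Q₁-lead : Lead (λ n → Integral n × + 0 ℤ.≤ exp₁ n × + 0 ℤ.< deg n × exp₂ n ≡ + 0) one Q₁
  Q₁-lead = Lead-⊕ (Lead-mono one) (In-Σ₁ ℓ₁ λ j 1≤j _ → In-resp (≋-sym (Q-term₁ j))
    (In-mono (Integral-· {pm₁ j} {xm (+ j) (+ 0)} (Integral-pm₁ j) (Integral-xm (+ j) (+ 0)) ,
              ℤ.+≤+ z≤n , ℤ.+<+ (≡.subst (1 ℕ.≤_) (≡.sym (ℕP.+-identityʳ j)) 1≤j) , refl)))

  Q₂-lead : Lead (λ n → Integral n × + 0 ℤ.≤ exp₁ n × + 0 ℤ.< deg n × exp₁ n ≡ + 0) one Q₂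
  Q₂-lead = Lead-⊕ (Lead-mono one) (In-Σ₁ ℓ₂ λ j 1≤j _ → In-resp (≋-sym (Q-term₂ j))
    (In-mono (Integral-· {pm₂ j} {xm (+ 0) (+ j)} (Integral-pm₂ j) (Integral-xm (+ 0) (+ j)) ,
              ℤ.+≤+ z≤n , ℤ.+<+ 1≤j , refl)))

  module W₁ = OneSided exp₁ (λ _ _ → refl) refl Q₂ Q₂-lead
  module W₂ = OneSided exp₂ (λ _ _ → refl) refl Q₁ Q₁-lead

  private
    Deep : ℕ → 𝕄 → Set
    Deep n m = Integral m × ℤ.- + n ℤ.≤ exp₁ m

  module _ {G : 𝕄 → 𝕃}
    (G-left : ∀ {m} → Integral m → exp₁ m ℤ.< + 0 →
       Σ 𝕃 λ h → Span W₁.w (λ n → Integral n × exp₁ m ℤ.< exp₁ n) h × G m ≋ W₁.w m ⊕ h)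
    (G-right : ∀ {m} → Integral m → + 0 ℤ.≤ exp₁ m → G m ≋ W₂.w m)
    (G-V₂ : ∀ {m} → Integral m → W₂.V (G m)) where

    private
      -- A stage of the sweep: `g` has already been expressed through G, while `h` still has poles
      -- of order at most n in x₁.
      record Mixed (n : ℕ) (f : 𝕃) : Set (c ⊔ ℓ) where
        constructor mkMixed
        field
          {g h} : 𝕃
          g∈ : Span G Integral g
          h∈ : Span W₁.w (Deep n) h
          eq : f ≋ g ⊕ h

      Mixed-⊕ : ∀ {n f f'} → Mixed n f → Mixed n f' → Mixed n (f ⊕ f')
      Mixed-⊕ (mkMixed {g} {h} a b e) (mkMixed {g'} {h'} a' b' e') = mkMixed (Span-⊕ a a') (Span-⊕ b b')
        (≋-trans (⊕-cong e e') (interchange g h g' h'))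
        where open CommutativeSemigroupProperties 𝕃.+-commutativeSemigroup using (interchange)

      Mixed-resp : ∀ {n f f'} → f ≋ f' → Mixed n f → Mixed n f'
      Mixed-resp e (mkMixed a b e') = mkMixed a b (≋-trans (≋-sym e) e')

      scale-⊕ : ∀ a f g → scale a (f ⊕ g) ≋ scale a f ⊕ scale a g
      scale-⊕ a f g = ≋-reflexive (ListP.map-++ _ f g)

      Mixed-T : ∀ {n D v f} → (∀ {m} → D m → Mixed n (v m)) → AllM D f → Mixed n (T v f)
      Mixed-T {v = v} h [] rewrite T-[] v = mkMixed Span-𝟎 Span-𝟎 ≋-refl
      Mixed-T {v = v} {f = (a , m) ∷ f} h (d ∷ ds) rewrite T-∷ v a m f with h d
      ... | mkMixed {g} {k} x y e = Mixed-⊕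
        (mkMixed (Span-scale a x) (Span-scale a y) (≋-trans (scale-cong a e) (scale-⊕ a g k)))
        (Mixed-T h ds)

      -- At depth exactly n + 1, `G-left` trades `W₁.w m` for `G m` and terms with strictly larger
      -- exponent of x₁.
      step : ∀ n {m} → Deep (suc n) m → Mixed n (W₁.w m)
      step n {m} (i , lo) with (ℤ.- + n) ℤ.≤? exp₁ m
      ... | yes le = mkMixed Span-𝟎 (Span-gen (i , le)) ≋-refl
      ... | no ¬le with G-left i (ℤP.<-≤-trans (ℤP.≰⇒> ¬le) (ℤP.neg-mono-≤ {+ 0} {+ n} (ℤ.+≤+ z≤n)))
      ...   | h , h∈ , e = mkMixed (Span-gen i)
        (Span-neg (Span-weaken (λ { (i' , lt) → i' , ℤP.≤-trans (bump n) (ℤP.i<j⇒suc[i]≤j (ℤP.≤-<-trans lo lt)) }) h∈))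
        (RI.+-move {G m} {h} {W₁.w m} (≋-trans e (⊕-comm (W₁.w m) h)))
        where
        bump : ∀ n → ℤ.- + n ℤ.≤ + 1 ℤ.+ ℤ.- + suc n
        bump zero    = ℤP.≤-refl
        bump (suc n) = ℤP.≤-refl

      sweep : ∀ n {f} → Mixed n f → Mixed 0 f
      sweep zero    x = x
      sweep (suc n) (mkMixed {g} {h} a (mkSpan cs b e') e) = sweep n
        (Mixed-resp (≋-sym e) (Mixed-⊕ (mkMixed a Span-𝟎 (≋-sym (𝕃.+-identityʳ g)))
          (Mixed-resp (≋-sym e') (Mixed-T (step n) b))))

      depth : ∀ cs → AllM Integral cs → Σ ℕ λ n → AllM (Deep n) cs
      depth [] [] = 0 , []
      depth ((a , m) ∷ cs) (i ∷ is) with depth cs is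
      ... | n , ds = k ℕ.⊔ n ,
        (i , ℤP.≤-trans (ℤP.neg-mono-≤ (ℤ.+≤+ (ℕP.m≤m⊔n k n))) (lower (exp₁ m))) ∷
        All.map (λ { (i' , le) → i' , ℤP.≤-trans (ℤP.neg-mono-≤ (ℤ.+≤+ (ℕP.m≤n⊔m k n))) le }) ds
        where
        k = ℤ.∣ exp₁ m ∣
        lower : ∀ i → ℤ.- + ℤ.∣ i ∣ ℤ.≤ i
        lower (+ n)    = ℤP.≤-trans (ℤP.neg-mono-≤ {+ 0} {+ n} (ℤ.+≤+ z≤n)) (ℤ.+≤+ z≤n)
        lower -[1+ n ] = ℤP.≤-refl

      Right : 𝕄 → Set
      Right m = Integral m × + 0 ℤ.≤ exp₁ m

      Right? : Decidable Right
      Right? m = Integral? m ×-dec (+ 0 ℤ.≤? exp₁ m)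

      -- The remainder h has no negative powers of x₁, and it lies in `W₂.V` because f and all `G m`
      -- do. Its coordinates in `W₂.w` can therefore be confined to `Right`, where G and `W₂.w`
      -- agree.
      finish : ∀ {f} → W₂.V f → Mixed 0 f → Span G Integral f
      finish {f} f∈V₂ (mkMixed {g} {h} g∈@(mkSpan gs a eg) (mkSpan hs b eh) e') =
        Span-resp (≋-sym e') (Span-⊕ g∈ (h∈span h∈V₂))
        where
        h∈Right : In Right h
        h∈Right = mkIn hs b (≋-trans eh (W₁.T-plain (All.map proj₂ b)))

        h∈V₂ : W₂.V h
        h∈V₂ = Span-resp (≋-sym (RI.+-move {f} {g} {h} e'))
          (Span-⊕ f∈V₂ (Span-neg (Span-resp (≋-sym eg) (Span-T G-V₂ a))))

        h∈span : W₂.V h → Span G Integral h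
        h∈span (mkSpan ds _ ed) = mkSpan (restrict Right? ds) (All.map proj₁ (restrict-all Right? ds))
          (≋-trans (triangular-restrict Right? (W₂.w-lead (λ { {m} {k} (i , x) (i' , x' , _) →
                      Integral-· {m} {k} i i' , ℤP.+-mono-≤ x x' })) ds ed h∈Right)
            (T-cong′ (restrict Right? ds) (All.map (λ { (i , x) → ≋-sym (G-right i x) }) (restrict-all Right? ds))))

    elimination : ∀ {f} → W₁.V f → W₂.V f → In Integral f → Span G Integral f
    elimination {f} (mkSpan cs _ e) f∈V₂ f∈R = finish f∈V₂ (sweep (proj₁ d) (mkMixed Span-𝟎 f∈ ≋-refl))
      where
      d : Σ ℕ λ n → AllM (Deep n) (restrict Integral? cs)
      d = depth (restrict Integral? cs) (restrict-all Integral? cs)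

      f∈ : Span W₁.w (Deep (proj₁ d)) f
      -- The coordinates given by `W₁.V` may involve negative powers of p_{i,j}; as f is integral,
      -- dropping those terms leaves the sum unchanged.
      f∈ = mkSpan _ (proj₂ d) (triangular-restrict Integral?
        (W₁.w-lead (λ {m} {k} i co → Integral-· {m} {k} i (proj₁ co))) cs e f∈R)

any-upTo-true : ∀ {f : ℕ → Bool} {n t} → t ℕ.< n → f t ≡ true → Bools.any f (upTo n) ≡ true
any-upTo-true {f} = go (λ x → x)
  where
  go : ∀ (g : ℕ → ℕ) {n t} → t ℕ.< n → f (g t) ≡ true → Bools.any f (applyUpTo g n) ≡ true
  go g {suc n} {zero}  lt       e rewrite e = refl
  go g {suc n} {suc t} (s≤s lt) e rewrite go (g ∘ suc) lt e = BoolP.∨-zeroʳ (f (g 0))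

any-cong : ∀ {A : Set} {f g : A → Bool} → (∀ x → f x ≡ g x) → ∀ xs → Bools.any f xs ≡ Bools.any g xs
any-cong e []       = refl
any-cong e (x ∷ xs) = cong₂ _∨_ (e x) (any-cong e xs)

all-upTo-cong : ∀ {f g : ℕ → Bool} n → (∀ i → i ℕ.< n → f i ≡ g i) → Bools.all f (upTo n) ≡ Bools.all g (upTo n)
all-upTo-cong {f} {g} = go (λ x → x)
  where
  go : ∀ (h : ℕ → ℕ) n → (∀ i → i ℕ.< n → f (h i) ≡ g (h i)) → Bools.all f (applyUpTo h n) ≡ Bools.all g (applyUpTo h n)
  go h zero    e = refl
  go h (suc n) e = cong₂ _∧_ (e 0 (s≤s z≤n)) (go (h ∘ suc) n (λ i lt → e (suc i) (s≤s lt)))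

≡ᵇ-true : ∀ {m n} → m ≡ n → (m ≡ᵇ n) ≡ true
≡ᵇ-true {zero}  refl = refl
≡ᵇ-true {suc m} refl = ≡ᵇ-true {m} refl

≡ᵇ-false : ∀ {m n} → m ≢ n → (m ≡ᵇ n) ≡ false
≡ᵇ-false {zero}  {zero}  ne = ⊥-elim (ne refl)
≡ᵇ-false {zero}  {suc n} ne = refl
≡ᵇ-false {suc m} {zero}  ne = refl
≡ᵇ-false {suc m} {suc n} ne = ≡ᵇ-false {m} (ne ∘ cong suc)

-- Compatibility along cyclic subpaths.

module Compatibility {c ℓ} (K : CommutativeRing c ℓ) (ℓ₁ ℓ₂ : ℕ) where

  Dir : Set
  Dir = Step K ℓ₁ ℓ₂

  Edge : Set
  Edge = Dir × ℕ

  isE′ isN′ : Dir → Bool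
  isE′ = isE K ℓ₁ ℓ₂
  isN′ = isN K ℓ₁ ℓ₂

  nth : ∀ {A : Set} → A → List A → ℕ → A
  nth = at K ℓ₁ ℓ₂

  #E #N ωE ωN : List Edge → ℕ
  #E = foldr ℕ._+_ 0 ∘ map (λ x → if isE′ (proj₁ x) then 1 else 0)
  #N = foldr ℕ._+_ 0 ∘ map (λ x → if isN′ (proj₁ x) then 1 else 0)
  ωE = foldr ℕ._+_ 0 ∘ map (λ x → if isE′ (proj₁ x) then proj₂ x else 0)
  ωN = foldr ℕ._+_ 0 ∘ map (λ x → if isN′ (proj₁ x) then proj₂ x else 0)

  okAt : List Edge → ℕ → Bool
  okAt s t = (not (t ≡ᵇ (length s ℕ.∸ 1)) ∧ (#N (take (suc t) s) ≡ᵇ ωE (take (suc t) s)))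
           ∨ (not (t ≡ᵇ 0) ∧ (#E (drop t s) ≡ᵇ ωN (drop t s)))

  ok : List Edge → Bool
  ok s = Bools.any (okAt s) (upTo (length s))

  -- The last edge of `a ∷ A` serves as e; it differs from the final edge because `b ∷ B` follows.
  ok-prefix : ∀ a A b B → #N (a ∷ A) ≡ ωE (a ∷ A) → ok (a ∷ A ++ b ∷ B) ≡ true
  ok-prefix a A b B e = any-upTo-true {okAt (a ∷ A ++ b ∷ B)} {t = length A}
      (s≤s (ℕP.≤-trans (ℕP.m≤m+n (length A) _) (ℕP.≤-reflexive (sym (ListP.length-++ A))))) at-A
    where
    take-A : ∀ A → take (length A) (A ++ b ∷ B) ≡ A
    take-A []      = refl
    take-A (x ∷ A) = cong (x ∷_) (take-A A)
    len : length A ≢ length (A ++ b ∷ B)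
    len e' = ℕP.m+1+n≢m (length A) (sym (trans e' (ListP.length-++ A)))
    at-A : okAt (a ∷ A ++ b ∷ B) (length A) ≡ true
    at-A rewrite take-A A | ≡ᵇ-false len | ≡ᵇ-true e = refl

  -- The edge `b` serves as e; it differs from the initial edge because `a` precedes it.
  ok-suffix : ∀ a A b B → #E (b ∷ B) ≡ ωN (b ∷ B) → ok (a ∷ A ++ b ∷ B) ≡ true
  ok-suffix a A b B e = any-upTo-true {okAt (a ∷ A ++ b ∷ B)} {t = suc (length A)}
      (s≤s (ℕP.≤-trans (ℕP.≤-reflexive (ℕP.+-comm 1 (length A)))
        (ℕP.≤-trans (ℕP.+-monoʳ-≤ (length A) (s≤s z≤n)) (ℕP.≤-reflexive (sym (ListP.length-++ A)))))) at-B
    where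
    drop-A : ∀ A → drop (length A) (A ++ b ∷ B) ≡ b ∷ B
    drop-A []      = refl
    drop-A (x ∷ A) = drop-A A
    at-B : okAt (a ∷ A ++ b ∷ B) (suc (length A)) ≡ true
    at-B rewrite drop-A A | ≡ᵇ-true e = BoolP.∨-zeroʳ _

  private
    -- The clause of `compatible` for one pair of positions, restated because it is local to that
    -- definition; the two agree definitionally.
    okI : List Dir → List ℕ → ℕ → ℕ → Bool
    okI P ω i j = Bools.any (λ t →
        (not (t ≡ᵇ (length uv ℕ.∸ 1)) ∧ (#N′ (take (suc t) uv) ≡ᵇ ωE′ (take (suc t) uv)))
      ∨ (not (t ≡ᵇ 0) ∧ (#E′ (drop t uv) ≡ᵇ ωN′ (drop t uv)))) (upTo (length uv))
      where
      uv = cyc K ℓ₁ ℓ₂ (length P) i j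
      sumL : List ℕ → ℕ
      sumL = foldr ℕ._+_ 0
      #N′ #E′ ωE′ ωN′ : List ℕ → ℕ
      #N′ es = sumL (map (λ k → if isN′ (nth E P k) then 1 else 0) es)
      #E′ es = sumL (map (λ k → if isE′ (nth E P k) then 1 else 0) es)
      ωE′ es = sumL (map (λ k → if isE′ (nth E P k) then nth 0 ω k else 0) es)
      ωN′ es = sumL (map (λ k → if isN′ (nth E P k) then nth 0 ω k else 0) es)

    okI-ok : ∀ P ω i j →
      okI P ω i j ≡ ok (map (λ k → (nth E P k , nth 0 ω k)) (cyc K ℓ₁ ℓ₂ (length P) i j))
    okI-ok P ω i j = trans (any-cong pointwise (upTo (length uv)))
      (cong (λ n → Bools.any (okAt (map it uv)) (upTo n)) (sym (ListP.length-map it uv)))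
      where
      it : ℕ → Edge
      it k = nth E P k , nth 0 ω k
      uv = cyc K ℓ₁ ℓ₂ (length P) i j
      take-it : ∀ (f : Edge → ℕ) n → map (f ∘ it) (take n uv) ≡ map f (take n (map it uv))
      take-it f n = trans (ListP.map-∘ (take n uv)) (cong (map f) (sym (ListP.take-map n uv)))
      drop-it : ∀ (f : Edge → ℕ) n → map (f ∘ it) (drop n uv) ≡ map f (drop n (map it uv))
      drop-it f n = trans (ListP.map-∘ (drop n uv)) (cong (map f) (sym (ListP.drop-map n uv)))
      sumL : List ℕ → ℕ
      sumL = foldr ℕ._+_ 0
      pointwise : ∀ t → _ ≡ okAt (map it uv) t
      pointwise t = cong₂ _∨_
        (cong₂ _∧_ (cong (λ n → not (t ≡ᵇ (n ℕ.∸ 1))) (sym (ListP.length-map it uv)))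
          (cong₂ _≡ᵇ_ (cong sumL (take-it _ (suc t))) (cong sumL (take-it _ (suc t)))))
        (cong (not (t ≡ᵇ 0) ∧_)
          (cong₂ _≡ᵇ_ (cong sumL (drop-it _ t)) (cong sumL (drop-it _ t))))

    nth-segment : ∀ {X : Set} (d : X) A W C →
      map (nth d (A ++ W ++ C)) (applyUpTo (length A ℕ.+_) (length W)) ≡ W
    nth-segment d A W C = trans (ListP.map-applyUpTo (length A ℕ.+_) (nth d (A ++ W ++ C)) (length W)) (outer A)
      where
      inner : ∀ W → applyUpTo (λ x → nth d (W ++ C) x) (length W) ≡ W
      inner []      = refl
      inner (w ∷ W) = cong (w ∷_) (inner W)
      outer : ∀ A → applyUpTo (λ x → nth d (A ++ W ++ C) (length A ℕ.+ x)) (length W) ≡ W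
      outer []      = inner W
      outer (a ∷ A) = outer A

    nth-here : ∀ {X : Set} (d : X) A u R → nth d (A ++ u ∷ R) (length A) ≡ u
    nth-here d []      u R = refl
    nth-here d (a ∷ A) u R = nth-here d A u R

    nth-map : ∀ {X Y : Set} (f : X → Y) d M k → nth (f d) (map f M) k ≡ f (nth d M k)
    nth-map f d []      k       = refl
    nth-map f d (x ∷ M) zero    = refl
    nth-map f d (x ∷ M) (suc k) = nth-map f d M k

    split-at : ∀ {X : Set} (M : List X) i → i ℕ.< length M →
      Σ (List X) λ A → Σ X λ u → Σ (List X) λ R → M ≡ A ++ u ∷ R × length A ≡ i
    split-at (x ∷ M) zero    lt       = [] , x , M , refl , refl
    split-at (x ∷ M) (suc i) (s≤s lt) with split-at M i lt
    ... | A , u , R , refl , refl = x ∷ A , u , R , refl , refl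

  -- The list index is the interior of the cyclic subpath. When v precedes u it runs to the end of M
  -- and resumes at its beginning.
  data Subpath {X : Set} (M : List X) : X → List X → X → Set where
    straight : ∀ A u B v C → M ≡ A ++ u ∷ B ++ v ∷ C → Subpath M u B v
    wrapping : ∀ A u B v C → M ≡ A ++ v ∷ B ++ u ∷ C → Subpath M u (C ++ A) v

  private
    cyc-straight : ∀ {X : Set} (d : X) A u B v C →
      map (nth d (A ++ u ∷ B ++ v ∷ C))
        (cyc K ℓ₁ ℓ₂ (length (A ++ u ∷ B ++ v ∷ C)) (length A) (length A ℕ.+ suc (length B))) ≡ u ∷ B ++ v ∷ []
    cyc-straight d A u B v C with length A ≤ᵇ (length A ℕ.+ suc (length B))
                               | ℕP.≤⇒≤ᵇ (ℕP.m≤m+n (length A) (suc (length B)))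
    ... | true | _ = trans (cong₂ (λ M n → map (nth d M) (applyUpTo (length A ℕ.+_) n)) lists len)
                       (nth-segment d A (u ∷ B ++ v ∷ []) C)
      where
      lists : A ++ u ∷ B ++ v ∷ C ≡ A ++ (u ∷ B ++ v ∷ []) ++ C
      lists = cong (λ z → A ++ u ∷ z) (sym (ListP.++-assoc B (v ∷ []) C))
      len : suc (length A ℕ.+ suc (length B) ℕ.∸ length A) ≡ length (u ∷ B ++ v ∷ [])
      len = cong suc (trans (ℕP.m+n∸m≡n (length A) (suc (length B)))
        (trans (ℕP.+-comm 1 (length B)) (sym (ListP.length-++ B))))

    cyc-wrapping : ∀ {X : Set} (d : X) A u B v C →
      map (nth d (A ++ v ∷ B ++ u ∷ C))
        (cyc K ℓ₁ ℓ₂ (length (A ++ v ∷ B ++ u ∷ C)) (length A ℕ.+ suc (length B)) (length A)) ≡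
      u ∷ (C ++ A) ++ v ∷ []
    cyc-wrapping d A u B v C with (length A ℕ.+ suc (length B)) ≤ᵇ length A
                               | ℕP.≤ᵇ⇒≤ (length A ℕ.+ suc (length B)) (length A)
    ... | true  | le = ⊥-elim (ℕP.<⇒≱ (ℕP.m<m+n (length A) (s≤s z≤n)) (le _))
    ... | false | _  = trans (ListP.map-++ (nth d M) (applyUpTo (i ℕ.+_) (length M ℕ.∸ i)) (upTo (suc (length A))))
                         (trans (cong₂ _++_ first second) (cong (u ∷_) (sym (ListP.++-assoc C A (v ∷ [])))))
      where
      M = A ++ v ∷ B ++ u ∷ C
      i = length A ℕ.+ suc (length B)
      i≡ : length (A ++ v ∷ B) ≡ i
      i≡ = ListP.length-++ A
      M≡ : M ≡ (A ++ v ∷ B) ++ (u ∷ C) ++ []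
      M≡ = trans (sym (ListP.++-assoc A (v ∷ B) (u ∷ C)))
        (cong ((A ++ v ∷ B) ++_) (sym (ListP.++-identityʳ (u ∷ C))))
      len : length M ℕ.∸ i ≡ length (u ∷ C)
      len = trans (cong₂ ℕ._∸_ (trans (cong length (sym (ListP.++-assoc A (v ∷ B) (u ∷ C))))
              (ListP.length-++ (A ++ v ∷ B))) (sym i≡)) (ℕP.m+n∸m≡n (length (A ++ v ∷ B)) (length (u ∷ C)))
      first : map (nth d M) (applyUpTo (i ℕ.+_) (length M ℕ.∸ i)) ≡ u ∷ C
      first = trans (cong₂ (λ k n → map (nth d M) (applyUpTo (k ℕ.+_) n)) (sym i≡) len)
        (trans (cong (λ L → map (nth d L) (applyUpTo (length (A ++ v ∷ B) ℕ.+_) (length (u ∷ C)))) M≡)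
          (nth-segment d (A ++ v ∷ B) (u ∷ C) []))
      second : map (nth d M) (upTo (suc (length A))) ≡ A ++ v ∷ []
      second = trans (cong₂ (λ L n → map (nth d L) (applyUpTo (λ x → x) n)) (sym (ListP.++-assoc A (v ∷ []) (B ++ u ∷ C)))
          (trans (ℕP.+-comm 1 (length A)) (sym (ListP.length-++ A))))
        (nth-segment d [] (A ++ v ∷ []) (B ++ u ∷ C))

    subpath : ∀ {X : Set} (d : X) (M : List X) i j → i ℕ.< length M → j ℕ.< length M → i ≢ j →
      Σ X λ u → Σ (List X) λ B → Σ X λ v → Subpath M u B v × nth d M i ≡ u × nth d M j ≡ v ×
        map (nth d M) (cyc K ℓ₁ ℓ₂ (length M) i j) ≡ u ∷ B ++ v ∷ []
    subpath d M i j i< j< i≢j with ℕP.<-cmp i j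
    ... | tri≈ _ e _ = ⊥-elim (i≢j e)
    ... | tri< i<j _ _ with split-at M i i<
    ...   | A , u , R , refl , refl with split-at R (j ℕ.∸ suc (length A)) (ℕP.+-cancelˡ-< (suc (length A)) _ _
              (≡.subst₂ ℕ._<_ (sym (ℕP.m+[n∸m]≡n i<j)) (trans (ListP.length-++ A) (ℕP.+-suc (length A) (length R))) j<))
    ...     | B , v , C , refl , lB with trans (cong (length A ℕ.+_) (cong suc lB))
                                          (trans (ℕP.+-suc (length A) _) (ℕP.m+[n∸m]≡n i<j))
    ...       | refl = u , B , v , straight A u B v C refl , nth-here d A u (B ++ v ∷ C) ,
      trans (cong₂ (nth d) (sym (ListP.++-assoc A (u ∷ B) (v ∷ C))) (sym (ListP.length-++ A))) (nth-here d (A ++ u ∷ B) v C) ,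
      cyc-straight d A u B v C
    subpath d M i j i< j< i≢j | tri> _ _ j<i with split-at M j j<
    ...   | A , v , R , refl , refl with split-at R (i ℕ.∸ suc (length A)) (ℕP.+-cancelˡ-< (suc (length A)) _ _
              (≡.subst₂ ℕ._<_ (sym (ℕP.m+[n∸m]≡n j<i)) (trans (ListP.length-++ A) (ℕP.+-suc (length A) (length R))) i<))
    ...     | B , u , C , refl , lB with trans (cong (length A ℕ.+_) (cong suc lB))
                                          (trans (ℕP.+-suc (length A) _) (ℕP.m+[n∸m]≡n j<i))
    ...       | refl = u , C ++ A , v , wrapping A u B v C refl ,
      trans (cong₂ (nth d) (sym (ListP.++-assoc A (v ∷ B) (u ∷ C))) (sym (ListP.length-++ A))) (nth-here d (A ++ v ∷ B) u C) ,
      nth-here d A v (B ++ u ∷ C) ,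
      cyc-wrapping d A u B v C

  -- Items carrying one direction and several values allow two gradings of the same path to be
  -- compared along a single list. `d` matches the defaults of out of range lookups.
  module Labelled {X : Set} (dir : X → Dir) (d : X) (dir-d : dir d ≡ E) where

    edge : (X → ℕ) → X → Edge
    edge val x = dir x , val x

    private
      segments : ∀ M i j → i ℕ.< length (map dir M) → j ℕ.< length (map dir M) →
        nth E (map dir M) i ≡ E → nth E (map dir M) j ≡ N →
        Σ X λ u → Σ (List X) λ B → Σ X λ v → Subpath M u B v × dir u ≡ E × dir v ≡ N ×
          (∀ val → val d ≡ 0 → okI (map dir M) (map val M) i j ≡ ok (map (edge val) (u ∷ B ++ v ∷ [])))
      segments M i j i< j< ei ej with subpath d M i j (≡.subst (i ℕ.<_) (ListP.length-map dir M) i<)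
                                        (≡.subst (j ℕ.<_) (ListP.length-map dir M) j<) i≢j
        where
        i≢j : i ≢ j
        i≢j refl with trans (sym ei) ej
        ... | ()
      ... | u , B , v , sp , nu , nv , mp =
        u , B , v , sp , trans (cong dir (sym nu)) (at-dir i ei) , trans (cong dir (sym nv)) (at-dir j ej) ,
        λ val z → trans (okI-ok P (map val M) i j) (cong ok (seg val z))
        where
        P = map dir M
        at-dir : ∀ k {s} → nth E P k ≡ s → dir (nth d M k) ≡ s
        at-dir k e = trans (sym (nth-map dir d M k)) (trans (cong (λ z → nth z P k) dir-d) e)
        seg : ∀ val → val d ≡ 0 →
          map (λ k → (nth E P k , nth 0 (map val M) k)) (cyc K ℓ₁ ℓ₂ (length P) i j) ≡ map (edge val) (u ∷ B ++ v ∷ [])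
        seg val z = trans (ListP.map-cong (λ k → cong₂ _,_
            (trans (cong (λ e → nth e P k) (sym dir-d)) (nth-map dir d M k))
            (trans (cong (λ e → nth e (map val M) k) (sym z)) (nth-map val d M k))) (cyc K ℓ₁ ℓ₂ (length P) i j))
          (trans (ListP.map-∘ (cyc K ℓ₁ ℓ₂ (length P) i j)) (cong (map (edge val))
            (trans (cong (λ n → map (nth d M) (cyc K ℓ₁ ℓ₂ n i j)) (ListP.length-map dir M)) mp)))

    compatible-cong : ∀ (val val' : X → ℕ) → val d ≡ 0 → val' d ≡ 0 → ∀ M →
      (∀ {u B v} → Subpath M u B v → dir u ≡ E → dir v ≡ N →
         ok (map (edge val) (u ∷ B ++ v ∷ [])) ≡ ok (map (edge val') (u ∷ B ++ v ∷ []))) →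
      compatible K ℓ₁ ℓ₂ (map dir M) (map val M) ≡ compatible K ℓ₁ ℓ₂ (map dir M) (map val' M)
    compatible-cong val val' z z' M h = all-upTo-cong (length P) λ i i< → all-upTo-cong (length P) λ j j< → clause i j i< j<
      where
      P = map dir M
      clause : ∀ i j → i ℕ.< length P → j ℕ.< length P →
        (not (isE′ (nth E P i)) ∨ not (isN′ (nth E P j)) ∨ okI P (map val M) i j) ≡
        (not (isE′ (nth E P i)) ∨ not (isN′ (nth E P j)) ∨ okI P (map val' M) i j)
      clause i j i< j< with nth E P i in ei | nth E P j in ej
      ... | N | _ = refl
      ... | E | E = refl
      ... | E | N with segments M i j i< j< ei ej
      ...   | u , B , v , sp , du , dv , e = trans (e val z) (trans (h sp du dv) (sym (e val' z')))

    compatible-true : ∀ (val : X → ℕ) → val d ≡ 0 → ∀ M →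
      (∀ {u B v} → Subpath M u B v → dir u ≡ E → dir v ≡ N → ok (map (edge val) (u ∷ B ++ v ∷ [])) ≡ true) →
      compatible K ℓ₁ ℓ₂ (map dir M) (map val M) ≡ true
    compatible-true val z M h = trans (all-upTo-cong (length P) λ i i< →
        trans (all-upTo-cong (length P) λ j j< → clause i j i< j<) (all-true (upTo (length P))))
        (all-true (upTo (length P)))
      where
      P = map dir M
      all-true : ∀ (xs : List ℕ) → Bools.all (λ _ → true) xs ≡ true
      all-true []       = refl
      all-true (_ ∷ xs) = all-true xs
      clause : ∀ i j → i ℕ.< length P → j ℕ.< length P →
        (not (isE′ (nth E P i)) ∨ not (isN′ (nth E P j)) ∨ okI P (map val M) i j) ≡ true
      clause i j i< j< with nth E P i in ei | nth E P j in ej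
      ... | N | _ = refl
      ... | E | E = refl
      ... | E | N with segments M i j i< j< ei ej
      ...   | u , B , v , sp , du , dv , e = trans (e val z) (h sp du dv)

module _ {X : Set} where

  ++-split : ∀ (U V : List X) {A x C} → U ++ V ≡ A ++ x ∷ C →
    (Σ (List X) λ D → U ≡ A ++ x ∷ D × C ≡ D ++ V) ⊎ (Σ (List X) λ D → V ≡ D ++ x ∷ C × A ≡ U ++ D)
  ++-split []      V {A}     e = inj₂ (A , e , refl)
  ++-split (u ∷ U) V {[]}    refl = inj₁ (U , refl , refl)
  ++-split (u ∷ U) V {a ∷ A} e with ListP.∷-injective e
  ... | refl , e' with ++-split U V {A} e'
  ...   | inj₁ (D , refl , f) = inj₁ (D , refl , f)
  ...   | inj₂ (D , f , refl) = inj₂ (D , f , refl)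

  find-true : ∀ (fl : X → Bool) s → All (λ x → fl x ≡ false) s ⊎
    (Σ (List X) λ A → Σ X λ x → Σ (List X) λ C → s ≡ A ++ x ∷ C × fl x ≡ true)
  find-true fl [] = inj₁ []
  find-true fl (x ∷ s) with fl x in e
  ... | true = inj₂ ([] , x , s , refl , e)
  ... | false with find-true fl s
  ...   | inj₁ a = inj₁ (e ∷ a)
  ...   | inj₂ (A , y , C , refl , f) = inj₂ (x ∷ A , y , C , refl , f)

trues : List Bool → ℕ
trues []          = 0
trues (true ∷ bs)  = suc (trues bs)
trues (false ∷ bs) = trues bs

≡ᵇ0⇒≡0 : ∀ n → (n ≡ᵇ 0) ≡ true → n ≡ 0
≡ᵇ0⇒≡0 zero e = refl

-- Queues on the path and the edges whose values do not affect compatibility.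

module Queues {c ℓ} (K : CommutativeRing c ℓ) (ℓ₁ ℓ₂ : ℕ) where

  open Compatibility K ℓ₁ ℓ₂ public

  -- `base` is the grading that drives the queue, `val` and `val'` are the two gradings under
  -- comparison, and `fl` marks the servers that find the queue empty.
  record Cell : Set where
    constructor cell
    field
      dir            : Dir
      base val val' : ℕ
      fl             : Bool
  open Cell public

  open Labelled dir (cell E 0 0 0 false) refl using (compatible-cong)

  edgeᵇ edgeᵛ edgeᵛ' : Cell → Edge
  edgeᵇ  x = dir x , base x
  edgeᵛ  x = dir x , val x
  edgeᵛ' x = dir x , val' x

  Good : Dir → Cell → Set
  Good τ x = (dir x ≢ τ → val x ≡ base x × val' x ≡ base x) × (fl x ≡ false → val x ≡ val' x)

  private
    unflagged-same : ∀ {τ s} → All (Good τ) s → All (λ x → fl x ≡ false) s → map edgeᵛ s ≡ map edgeᵛ' s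
    unflagged-same []             []       = refl
    unflagged-same ((_ , h) ∷ gs) (f ∷ fs) = cong₂ _∷_ (cong (_ ,_) (h f)) (unflagged-same gs fs)

    Good-subpath : ∀ {τ M u B v} → All (Good τ) M → Subpath M u B v → All (Good τ) (u ∷ B ++ v ∷ [])
    Good-subpath g (straight A u B v C refl) with AllP.++⁻ʳ A g
    ... | gu ∷ g' with AllP.++⁻ B g'
    ...   | gB , gv ∷ _ = gu ∷ AllP.++⁺ gB (gv ∷ [])
    Good-subpath g (wrapping A u B v C refl) with AllP.++⁻ A g
    ... | gA , gv ∷ g' with AllP.++⁻ʳ B g'
    ...   | gu ∷ gC = gu ∷ AllP.++⁺ (AllP.++⁺ gC gA) (gv ∷ [])

  -- Vertical edges are read from right to left as arrivals of ω customers, horizontal edges as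
  -- departures of one customer.  A horizontal edge meeting an empty queue, in the second of two
  -- passes around the path, is compatible with every vertical edge whatever its own value.

  runʳ : ℕ → List Edge → ℕ
  runʳ q []            = q
  runʳ q ((E , _) ∷ l) = runʳ q l ℕ.∸ 1
  runʳ q ((N , v) ∷ l) = v ℕ.+ runʳ q l

  flagsʳ : ℕ → List Edge → List Bool
  flagsʳ q []            = []
  flagsʳ q ((E , _) ∷ l) = (runʳ q l ≡ᵇ 0) ∷ flagsʳ q l
  flagsʳ q ((N , _) ∷ l) = false ∷ flagsʳ q l

  freeʳ : List Edge → List Bool
  freeʳ l = flagsʳ (runʳ 0 l) l

  runʳ-++ : ∀ q l l' → runʳ q (l ++ l') ≡ runʳ (runʳ q l') l
  runʳ-++ q []            l' = refl
  runʳ-++ q ((E , _) ∷ l) l' = cong (ℕ._∸ 1) (runʳ-++ q l l')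
  runʳ-++ q ((N , v) ∷ l) l' = cong (v ℕ.+_) (runʳ-++ q l l')

  private
    runʳ-mono : ∀ {q q'} l → q ℕ.≤ q' → runʳ q l ℕ.≤ runʳ q' l
    runʳ-mono []            le = le
    runʳ-mono ((E , _) ∷ l) le = ℕP.∸-monoˡ-≤ 1 (runʳ-mono l le)
    runʳ-mono ((N , v) ∷ l) le = ℕP.+-monoʳ-≤ v (runʳ-mono l le)

    -- Conservation of customers: each horizontal edge either serves one of them or is flagged.
    balanceʳ : ∀ q l → runʳ q l ℕ.+ #E l ≡ q ℕ.+ (ωN l ℕ.+ trues (flagsʳ q l))
    balanceʳ q [] = refl
    balanceʳ q ((E , _) ∷ l) with runʳ q l | balanceʳ q l
    ... | zero  | ih = trans (cong suc ih) (shift q (ωN l) _)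
      where
      shift : ∀ a b d → suc (a ℕ.+ (b ℕ.+ d)) ≡ a ℕ.+ (b ℕ.+ suc d)
      shift = solveℕ-∀
    ... | suc r | ih = trans (ℕP.+-suc r (#E l)) ih
    balanceʳ q ((N , v) ∷ l) = trans (ℕP.+-assoc v _ _) (trans (cong (v ℕ.+_) (balanceʳ q l)) (shift v q (ωN l) _))
      where
      shift : ∀ v a b d → v ℕ.+ (a ℕ.+ (b ℕ.+ d)) ≡ a ℕ.+ (v ℕ.+ b ℕ.+ d)
      shift = solveℕ-∀

  -- The second pass starts with the queue q left by the first, which started empty; by monotonicity
  -- it ends with at least q. Conservation then leaves at least `#E l` minus `ωN l` idle servers.
  freeʳ-many : ∀ l → #E l ℕ.≤ ωN l ℕ.+ trues (freeʳ l)
  freeʳ-many l = ℕP.+-cancelˡ-≤ q _ _ (ℕP.≤-trans (ℕP.+-monoˡ-≤ (#E l) (runʳ-mono l z≤n)) (ℕP.≤-reflexive (balanceʳ q l)))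
    where q = runʳ 0 l

  private
    flaggedʳ : ∀ q A {M x C} → M ≡ A ++ x ∷ C → map fl M ≡ flagsʳ q (map edgeᵇ M) → fl x ≡ true →
      dir x ≡ E × runʳ q (map edgeᵇ C) ≡ 0
    flaggedʳ q [] {x = cell E _ _ _ _} refl e f =
      refl , ≡ᵇ0⇒≡0 _ (trans (sym (proj₁ (ListP.∷-injective e))) f)
    flaggedʳ q [] {x = cell N _ _ _ _} refl e f with trans (sym f) (proj₁ (ListP.∷-injective e))
    ... | ()
    flaggedʳ q (cell E _ _ _ _ ∷ A) refl e f = flaggedʳ q A refl (proj₂ (ListP.∷-injective e)) f
    flaggedʳ q (cell N _ _ _ _ ∷ A) refl e f = flaggedʳ q A refl (proj₂ (ListP.∷-injective e)) f

    EmptySuffix : List Cell → Set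
    EmptySuffix s = Σ (List Cell) λ A → Σ Cell λ b → Σ (List Cell) λ B →
      s ≡ A ++ b ∷ B × #E (map edgeᵇ (b ∷ B)) ≡ ωN (map edgeᵇ (b ∷ B))

    -- Going left from v, the surplus of arrivals over departures drops by at most one per edge, so
    -- it cannot leave the positive range without passing 0, which gives an empty suffix. While
    -- positive, it is a lower bound for the queue whatever the initial q.
    suffix-or-queue : ∀ q v → dir v ≡ N → ∀ s → EmptySuffix (s ++ v ∷ []) ⊎
      (Σ ℕ λ k → ωN (map edgeᵇ (s ++ v ∷ [])) ≡ suc k ℕ.+ #E (map edgeᵇ (s ++ v ∷ [])) ×
                 suc k ℕ.≤ runʳ q (map edgeᵇ (s ++ v ∷ [])))
    suffix-or-queue q (cell N zero    _ _ _) refl [] = inj₁ ([] , _ , [] , refl , refl)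
    suffix-or-queue q (cell N (suc n) _ _ _) refl [] = inj₂ (n ℕ.+ 0 , cong suc (sym (ℕP.+-identityʳ _)) , s≤s (ℕP.+-monoʳ-≤ n z≤n))
    suffix-or-queue q v dv (x ∷ s) with suffix-or-queue q v dv s
    ... | inj₁ (A , b , B , eq , r) = inj₁ (x ∷ A , b , B , cong (x ∷_) eq , r)
    suffix-or-queue q v dv (cell N n _ _ _ ∷ s) | inj₂ (k , eq , le) = inj₂ (n ℕ.+ k ,
      trans (cong (n ℕ.+_) eq) (shift n k _) ,
      ℕP.≤-trans (ℕP.≤-reflexive (sym (ℕP.+-suc n k))) (ℕP.+-monoʳ-≤ n le))
      where
      shift : ∀ a b d → a ℕ.+ (suc b ℕ.+ d) ≡ suc (a ℕ.+ b) ℕ.+ d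
      shift = solveℕ-∀
    suffix-or-queue q v dv (x@(cell E _ _ _ _) ∷ s) | inj₂ (zero  , eq , le) = inj₁ ([] , x , s ++ v ∷ [] , refl , sym eq)
    suffix-or-queue q v dv (x@(cell E _ _ _ _) ∷ s) | inj₂ (suc k , eq , le) =
      inj₂ (k , trans eq (shift k _) , ℕP.∸-monoˡ-≤ 1 le)
      where
      shift : ∀ a d → suc (suc a) ℕ.+ d ≡ suc a ℕ.+ suc d
      shift = solveℕ-∀

    suffixʳ : ∀ q s v → dir v ≡ N → runʳ q (map edgeᵇ (s ++ v ∷ [])) ≡ 0 → EmptySuffix (s ++ v ∷ [])
    suffixʳ q s v dv e with suffix-or-queue q v dv s
    ... | inj₁ r = r
    ... | inj₂ (k , _ , le) = ⊥-elim (ℕP.n≮0 (≡.subst (suc k ℕ.≤_) e le))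

    -- This is where two passes matter. If the subpath wraps and x lies before the end of M, reading
    -- from v to the left crosses the beginning of M in the first pass and reaches x in the second.
    emptyʳ : ∀ {M u B v A x C} → Subpath M u B v → map fl M ≡ freeʳ (map edgeᵇ M) →
      u ∷ B ≡ A ++ x ∷ C → fl x ≡ true → Σ ℕ λ q → runʳ q (map edgeᵇ (C ++ v ∷ [])) ≡ 0
    emptyʳ {M} {A = A'} {x} {C'} (straight A u B v C refl) e eq f =
      runʳ q₀ (map edgeᵇ C) , trans (sym (run-split C' v C q₀)) (proj₂ (flaggedʳ q₀ (A ++ A') {M} M≡ e f))
      where
      q₀ = runʳ 0 (map edgeᵇ M)
      M≡ : A ++ u ∷ B ++ v ∷ C ≡ (A ++ A') ++ x ∷ (C' ++ v ∷ C)
      M≡ = trans (cong (λ z → A ++ (z ++ v ∷ C)) eq) (trans (cong (A ++_) (ListP.++-assoc A' (x ∷ C') (v ∷ C)))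
        (sym (ListP.++-assoc A A' _)))
      run-split : ∀ C' v C q → runʳ q (map edgeᵇ (C' ++ v ∷ C)) ≡ runʳ (runʳ q (map edgeᵇ C)) (map edgeᵇ (C' ++ v ∷ []))
      run-split C' v C q = trans (cong (runʳ q) (trans (cong (map edgeᵇ) (sym (ListP.++-assoc C' (v ∷ []) C)))
        (ListP.map-++ edgeᵇ (C' ++ v ∷ []) C))) (runʳ-++ q (map edgeᵇ (C' ++ v ∷ [])) (map edgeᵇ C))
    emptyʳ {M} {A = A'} {x} {C'} (wrapping A u B v C refl) e eq f with ++-split (u ∷ C) A {A'} eq
    ... | inj₁ (D , eq₁ , refl) = q₁ , trans (cong (runʳ q₁) (trans (cong (map edgeᵇ) (ListP.++-assoc D A (v ∷ [])))
            (ListP.map-++ edgeᵇ D (A ++ v ∷ [])))) (trans (runʳ-++ q₁ (map edgeᵇ D) (map edgeᵇ (A ++ v ∷ [])))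
            (trans (cong (λ q → runʳ q (map edgeᵇ D)) (sym q₀≡)) (proj₂ (flaggedʳ q₀ (A ++ v ∷ B ++ A') {M} M≡ e f))))
      where
      q₀ = runʳ 0 (map edgeᵇ M)
      q₁ = runʳ 0 (map edgeᵇ (B ++ u ∷ C))
      q₀≡ : q₀ ≡ runʳ q₁ (map edgeᵇ (A ++ v ∷ []))
      q₀≡ = trans (cong (runʳ 0) (trans (cong (map edgeᵇ) (sym (ListP.++-assoc A (v ∷ []) (B ++ u ∷ C))))
        (ListP.map-++ edgeᵇ (A ++ v ∷ []) (B ++ u ∷ C)))) (runʳ-++ 0 (map edgeᵇ (A ++ v ∷ [])) _)
      M≡ : A ++ v ∷ B ++ u ∷ C ≡ (A ++ v ∷ B ++ A') ++ x ∷ D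
      M≡ = trans (cong (λ z → A ++ v ∷ B ++ z) eq₁) (trans (cong (λ z → A ++ v ∷ z) (sym (ListP.++-assoc B A' (x ∷ D))))
        (sym (ListP.++-assoc A (v ∷ B ++ A') (x ∷ D))))
    ... | inj₂ (D , refl , _) = q₂ , trans (sym run≡) (proj₂ (flaggedʳ q₀ D {M} M≡ e f))
      where
      q₀ = runʳ 0 (map edgeᵇ M)
      q₂ = runʳ q₀ (map edgeᵇ (B ++ u ∷ C))
      M≡ : (D ++ x ∷ C') ++ v ∷ B ++ u ∷ C ≡ D ++ x ∷ (C' ++ v ∷ B ++ u ∷ C)
      M≡ = ListP.++-assoc D (x ∷ C') (v ∷ B ++ u ∷ C)
      run≡ : runʳ q₀ (map edgeᵇ (C' ++ v ∷ B ++ u ∷ C)) ≡ runʳ q₂ (map edgeᵇ (C' ++ v ∷ []))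
      run≡ = trans (cong (runʳ q₀) (trans (cong (map edgeᵇ) (sym (ListP.++-assoc C' (v ∷ []) (B ++ u ∷ C))))
        (ListP.map-++ edgeᵇ (C' ++ v ∷ []) (B ++ u ∷ C)))) (runʳ-++ q₀ (map edgeᵇ (C' ++ v ∷ [])) _)

    #E-dirs : ∀ (g : Cell → ℕ) s → #E (map (λ x → dir x , g x) s) ≡ #E (map edgeᵇ s)
    #E-dirs g []      = refl
    #E-dirs g (x ∷ s) = cong (_ ℕ.+_) (#E-dirs g s)

    #N-dirs : ∀ (g : Cell → ℕ) s → #N (map (λ x → dir x , g x) s) ≡ #N (map edgeᵇ s)
    #N-dirs g []      = refl
    #N-dirs g (x ∷ s) = cong (_ ℕ.+_) (#N-dirs g s)

    ωN-base : ∀ (g : Cell → ℕ) {s} → All (λ x → dir x ≢ E → g x ≡ base x) s →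
      ωN (map (λ x → dir x , g x) s) ≡ ωN (map edgeᵇ s)
    ωN-base g [] = refl
    ωN-base g {cell E _ _ _ _ ∷ s} (h ∷ hs) = ωN-base g hs
    ωN-base g {cell N _ _ _ _ ∷ s} (h ∷ hs) = cong₂ ℕ._+_ (h (λ ())) (ωN-base g hs)

    ωE-base : ∀ (g : Cell → ℕ) {s} → All (λ x → dir x ≢ N → g x ≡ base x) s →
      ωE (map (λ x → dir x , g x) s) ≡ ωE (map edgeᵇ s)
    ωE-base g [] = refl
    ωE-base g {cell N _ _ _ _ ∷ s} (h ∷ hs) = ωE-base g hs
    ωE-base g {cell E _ _ _ _ ∷ s} (h ∷ hs) = cong₂ ℕ._+_ (h (λ ())) (ωE-base g hs)

    ok-suffix′ : ∀ (g : Cell → ℕ) A x D b B → #E (map (λ x → dir x , g x) (b ∷ B)) ≡ ωN (map (λ x → dir x , g x) (b ∷ B)) →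
      ok (map (λ x → dir x , g x) (A ++ x ∷ D ++ b ∷ B)) ≡ true
    ok-suffix′ g [] x D b B e = trans (cong (λ z → ok ((dir x , g x) ∷ z)) (ListP.map-++ (λ x → dir x , g x) D (b ∷ B))) (ok-suffix (dir x , g x) (map (λ x → dir x , g x) D) _ (map (λ x → dir x , g x) B) e)
    ok-suffix′ g (a ∷ A) x D b B e = trans (cong (λ z → ok ((dir a , g a) ∷ z)) (trans
        (cong (map (λ x → dir x , g x)) (sym (ListP.++-assoc A (x ∷ D) (b ∷ B)))) (ListP.map-++ (λ x → dir x , g x) (A ++ x ∷ D) (b ∷ B))))
      (ok-suffix (dir a , g a) (map (λ x → dir x , g x) (A ++ x ∷ D)) _ (map (λ x → dir x , g x) B) e)

  -- If a subpath contains no flagged edge, both gradings coincide on it. Otherwise an empty suffix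
  -- between a flagged edge and v satisfies the second alternative of compatibility, which involves
  -- only the values on vertical edges.
  independentʳ : ∀ M → All (Good E) M → map fl M ≡ freeʳ (map edgeᵇ M) →
    compatible K ℓ₁ ℓ₂ (map dir M) (map val M) ≡ compatible K ℓ₁ ℓ₂ (map dir M) (map val' M)
  independentʳ M good flags = compatible-cong val val' refl refl M same
    where
    same : ∀ {u B v} → Subpath M u B v → dir u ≡ E → dir v ≡ N →
      ok (map edgeᵛ (u ∷ B ++ v ∷ [])) ≡ ok (map edgeᵛ' (u ∷ B ++ v ∷ []))
    same {u} {B} {v} sp du dv with find-true fl (u ∷ B ++ v ∷ [])
    ... | inj₁ none = cong ok (unflagged-same (Good-subpath good sp) none)
    ... | inj₂ (A , x , C , eq , f) with ++-split (u ∷ B) (v ∷ []) {A} eq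
    -- The flagged edge cannot be v, since flagged edges are horizontal.
    ...   | inj₂ ([] , refl , _) = ⊥-elim (flag-v sp)
      where
      flag-v : Subpath M u B v → ⊥
      flag-v (straight A u B v C refl) with trans (sym dv) (proj₁ (flaggedʳ _ (A ++ u ∷ B) (sym (ListP.++-assoc A (u ∷ B) (v ∷ C))) flags f))
      ... | ()
      flag-v (wrapping A u B v C refl) with trans (sym dv) (proj₁ (flaggedʳ _ A refl flags f))
      ... | ()
    ...   | inj₂ (_ ∷ [] , () , _)
    ...   | inj₂ (_ ∷ _ ∷ _ , () , _)
    ...   | inj₁ (D , eq₁ , refl) with emptyʳ sp flags eq₁ f
    ...     | q , e₀ with suffixʳ q D v dv e₀
    ...       | D₁ , y , D₂ , eq₂ , r = trans (true-for val (proj₁ ∘_)) (sym (true-for val' (proj₂ ∘_)))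
      where
      whole : u ∷ B ++ v ∷ [] ≡ A ++ x ∷ D₁ ++ y ∷ D₂
      whole = trans eq (cong (λ z → A ++ x ∷ z) eq₂)
      tail-good : All (Good E) (y ∷ D₂)
      tail-good = AllP.++⁻ʳ D₁ (All.tail (AllP.++⁻ʳ A (≡.subst (All (Good E)) whole (Good-subpath good sp))))
      true-for : ∀ (g : Cell → ℕ) → (∀ {x : Cell} → (dir x ≢ E → val x ≡ base x × val' x ≡ base x) → dir x ≢ E → g x ≡ base x) →
        ok (map (λ x → dir x , g x) (u ∷ B ++ v ∷ [])) ≡ true
      true-for g h = trans (cong (λ z → ok (map (λ x → dir x , g x) z)) whole) (ok-suffix′ g A x D₁ y D₂
        (trans (#E-dirs g (y ∷ D₂)) (trans r (sym (ωN-base g (All.map (λ { {x} (k , _) → h {x} k }) tail-good))))))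

  -- The mirror image, used for divisibility by Q₁: read from left to right, horizontal edges bring
  -- customers and vertical edges serve them.
  runˡ : ℕ → List Edge → ℕ
  runˡ q []            = q
  runˡ q ((E , v) ∷ l) = runˡ (q ℕ.+ v) l
  runˡ q ((N , _) ∷ l) = runˡ (q ℕ.∸ 1) l

  flagsˡ : ℕ → List Edge → List Bool
  flagsˡ q []            = []
  flagsˡ q ((E , v) ∷ l) = false ∷ flagsˡ (q ℕ.+ v) l
  flagsˡ q ((N , _) ∷ l) = (q ≡ᵇ 0) ∷ flagsˡ (q ℕ.∸ 1) l

  freeˡ : List Edge → List Bool
  freeˡ l = flagsˡ (runˡ 0 l) l

  runˡ-++ : ∀ q l l' → runˡ q (l ++ l') ≡ runˡ (runˡ q l) l'
  runˡ-++ q []            l' = refl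
  runˡ-++ q ((E , v) ∷ l) l' = runˡ-++ (q ℕ.+ v) l l'
  runˡ-++ q ((N , _) ∷ l) l' = runˡ-++ (q ℕ.∸ 1) l l'

  private
    runˡ-mono : ∀ {q q'} l → q ℕ.≤ q' → runˡ q l ℕ.≤ runˡ q' l
    runˡ-mono []            le = le
    runˡ-mono ((E , v) ∷ l) le = runˡ-mono l (ℕP.+-monoˡ-≤ v le)
    runˡ-mono ((N , _) ∷ l) le = runˡ-mono l (ℕP.∸-monoˡ-≤ 1 le)

    balanceˡ : ∀ q l → runˡ q l ℕ.+ #N l ≡ q ℕ.+ (ωE l ℕ.+ trues (flagsˡ q l))
    balanceˡ q [] = refl
    balanceˡ q ((E , v) ∷ l) = trans (balanceˡ (q ℕ.+ v) l) (shift q v (ωE l) _)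
      where
      shift : ∀ a v b d → a ℕ.+ v ℕ.+ (b ℕ.+ d) ≡ a ℕ.+ (v ℕ.+ b ℕ.+ d)
      shift = solveℕ-∀
    balanceˡ zero    ((N , _) ∷ l) = trans (ℕP.+-suc (runˡ 0 l) (#N l)) (trans (cong suc (balanceˡ 0 l)) (sym (ℕP.+-suc (ωE l) _)))
    balanceˡ (suc q) ((N , _) ∷ l) = trans (ℕP.+-suc (runˡ q l) (#N l)) (cong suc (balanceˡ q l))

  freeˡ-many : ∀ l → #N l ℕ.≤ ωE l ℕ.+ trues (freeˡ l)
  freeˡ-many l = ℕP.+-cancelˡ-≤ q _ _ (ℕP.≤-trans (ℕP.+-monoˡ-≤ (#N l) (runˡ-mono l z≤n)) (ℕP.≤-reflexive (balanceˡ q l)))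
    where q = runˡ 0 l

  private
    flaggedˡ : ∀ q A {M x C} → M ≡ A ++ x ∷ C → map fl M ≡ flagsˡ q (map edgeᵇ M) → fl x ≡ true →
      dir x ≡ N × runˡ q (map edgeᵇ A) ≡ 0
    flaggedˡ q [] {x = cell N _ _ _ _} refl e f =
      refl , ≡ᵇ0⇒≡0 _ (trans (sym (proj₁ (ListP.∷-injective e))) f)
    flaggedˡ q [] {x = cell E _ _ _ _} refl e f with trans (sym f) (proj₁ (ListP.∷-injective e))
    ... | ()
    flaggedˡ q (cell E v _ _ _ ∷ A) refl e f = flaggedˡ (q ℕ.+ v) A refl (proj₂ (ListP.∷-injective e)) f
    flaggedˡ q (cell N _ _ _ _ ∷ A) refl e f = flaggedˡ (q ℕ.∸ 1) A refl (proj₂ (ListP.∷-injective e)) f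

    -- The number k in `go` is the surplus of arrivals over departures since u. The queue is never
    -- shorter than k, so once the queue is empty k must have passed through 0.
    prefixˡ : ∀ q u s → dir u ≡ E → runˡ q (map edgeᵇ (u ∷ s)) ≡ 0 →
      Σ (List Cell) λ A → Σ (List Cell) λ B →
        s ≡ A ++ B × #N (map edgeᵇ (u ∷ A)) ≡ ωE (map edgeᵇ (u ∷ A))
    prefixˡ q (cell E n _ _ _) s du e with go s n (q ℕ.+ n) (ℕP.m≤n+m n q) e
      where
      go : ∀ s k q → k ℕ.≤ q → runˡ q (map edgeᵇ s) ≡ 0 →
        Σ (List Cell) λ A → Σ (List Cell) λ B → s ≡ A ++ B × #N (map edgeᵇ A) ≡ k ℕ.+ ωE (map edgeᵇ A)
      go s zero q le e = [] , s , refl , refl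
      go [] (suc k) q le e = ⊥-elim (ℕP.n≮0 (≡.subst (suc k ℕ.≤_) e le))
      go (x@(cell E v _ _ _) ∷ s) (suc k) q le e with go s (suc k ℕ.+ v) (q ℕ.+ v) (ℕP.+-monoˡ-≤ v le) e
      ... | A , B , refl , r = x ∷ A , B , refl , trans r (ℕP.+-assoc (suc k) v _)
      go (x@(cell N _ _ _ _) ∷ s) (suc k) (suc q) (s≤s le) e with go s k q le e
      ... | A , B , refl , r = x ∷ A , B , refl , cong suc r
    ... | A , B , eq , r = A , B , eq , r

    emptyˡ : ∀ {M u B v A x C} → Subpath M u B v → map fl M ≡ freeˡ (map edgeᵇ M) →
      B ++ v ∷ [] ≡ A ++ x ∷ C → fl x ≡ true → Σ ℕ λ q → runˡ q (map edgeᵇ (u ∷ A)) ≡ 0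
    emptyˡ {M} {A = A'} {x} {C'} (straight A u B v C refl) e eq f =
      runˡ q₀ (map edgeᵇ A) , trans (sym (trans (cong (runˡ q₀) (ListP.map-++ edgeᵇ A (u ∷ A'))) (runˡ-++ q₀ (map edgeᵇ A) _)))
        (proj₂ (flaggedˡ q₀ (A ++ u ∷ A') {M} M≡ e f))
      where
      q₀ = runˡ 0 (map edgeᵇ M)
      M≡ : A ++ u ∷ B ++ v ∷ C ≡ (A ++ u ∷ A') ++ x ∷ (C' ++ C)
      M≡ = trans (cong (λ z → A ++ u ∷ z) (trans (sym (ListP.++-assoc B (v ∷ []) C)) (trans (cong (_++ C) eq) (ListP.++-assoc A' (x ∷ C') C))))
        (sym (ListP.++-assoc A (u ∷ A') _))
    emptyˡ {M} {A = A'} {x} {C'} (wrapping A u B v C refl) e eq f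
      with ++-split C (A ++ v ∷ []) {A'} (trans (sym (ListP.++-assoc C A (v ∷ []))) eq)
    ... | inj₁ (D , refl , _) = runˡ q₀ (map edgeᵇ (A ++ v ∷ B)) ,
          trans (sym (trans (cong (runˡ q₀) (ListP.map-++ edgeᵇ (A ++ v ∷ B) (u ∷ A'))) (runˡ-++ q₀ (map edgeᵇ (A ++ v ∷ B)) _)))
            (proj₂ (flaggedˡ q₀ ((A ++ v ∷ B) ++ u ∷ A') {M} M≡ e f))
      where
      q₀ = runˡ 0 (map edgeᵇ M)
      M≡ : A ++ v ∷ B ++ u ∷ A' ++ x ∷ D ≡ ((A ++ v ∷ B) ++ u ∷ A') ++ x ∷ D
      M≡ = trans (sym (ListP.++-assoc A (v ∷ B) (u ∷ A' ++ x ∷ D))) (sym (ListP.++-assoc (A ++ v ∷ B) (u ∷ A') (x ∷ D)))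
    ... | inj₂ (D , eq₁ , refl) = q₁ , trans (cong (runˡ q₁) (ListP.map-++ edgeᵇ (u ∷ C) D))
          (trans (runˡ-++ q₁ (map edgeᵇ (u ∷ C)) (map edgeᵇ D)) (trans (cong (λ q → runˡ q (map edgeᵇ D)) (sym q₀≡))
            (proj₂ (flaggedˡ q₀ D {M} M≡ e f))))
      where
      q₀ = runˡ 0 (map edgeᵇ M)
      q₁ = runˡ 0 (map edgeᵇ (A ++ v ∷ B))
      q₀≡ : q₀ ≡ runˡ q₁ (map edgeᵇ (u ∷ C))
      q₀≡ = trans (cong (runˡ 0) (trans (cong (map edgeᵇ) (sym (ListP.++-assoc A (v ∷ B) (u ∷ C))))
        (ListP.map-++ edgeᵇ (A ++ v ∷ B) (u ∷ C)))) (runˡ-++ 0 (map edgeᵇ (A ++ v ∷ B)) _)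
      M≡ : A ++ v ∷ B ++ u ∷ C ≡ D ++ x ∷ (C' ++ B ++ u ∷ C)
      M≡ = trans (sym (ListP.++-assoc A (v ∷ []) (B ++ u ∷ C))) (trans (cong (_++ (B ++ u ∷ C)) eq₁) (ListP.++-assoc D (x ∷ C') _))

    ok-prefix′ : ∀ (g : Cell → ℕ) u A B x C → #N (map (λ x → dir x , g x) (u ∷ A)) ≡ ωE (map (λ x → dir x , g x) (u ∷ A)) →
      ok (map (λ x → dir x , g x) (u ∷ (A ++ B) ++ x ∷ C)) ≡ true
    ok-prefix′ g u A [] x C e = trans (cong (λ z → ok ((dir u , g u) ∷ z)) (trans (cong (λ z → map (λ x → dir x , g x) (z ++ x ∷ C)) (ListP.++-identityʳ A)) (ListP.map-++ (λ x → dir x , g x) A (x ∷ C))))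
      (ok-prefix (dir u , g u) (map (λ x → dir x , g x) A) _ (map (λ x → dir x , g x) C) e)
    ok-prefix′ g u A (b ∷ B) x C e = trans (cong (λ z → ok ((dir u , g u) ∷ z)) (trans (cong (map (λ x → dir x , g x)) (ListP.++-assoc A (b ∷ B) (x ∷ C))) (ListP.map-++ (λ x → dir x , g x) A (b ∷ B ++ x ∷ C))))
      (ok-prefix (dir u , g u) (map (λ x → dir x , g x) A) _ (map (λ x → dir x , g x) (B ++ x ∷ C)) e)

  -- As for `independentʳ`, but through the first alternative of compatibility: a balanced prefix
  -- between u and a flagged vertical edge involves only the values on horizontal edges.
  independentˡ : ∀ M → All (Good N) M → map fl M ≡ freeˡ (map edgeᵇ M) →
    compatible K ℓ₁ ℓ₂ (map dir M) (map val M) ≡ compatible K ℓ₁ ℓ₂ (map dir M) (map val' M)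
  independentˡ M good flags = compatible-cong val val' refl refl M same
    where
    same : ∀ {u B v} → Subpath M u B v → dir u ≡ E → dir v ≡ N →
      ok (map edgeᵛ (u ∷ B ++ v ∷ [])) ≡ ok (map edgeᵛ' (u ∷ B ++ v ∷ []))
    same {u} {B} {v} sp du dv with find-true fl (u ∷ B ++ v ∷ [])
    ... | inj₁ none = cong ok (unflagged-same (Good-subpath good sp) none)
    ... | inj₂ ([] , x , C , refl , f) = ⊥-elim (flag-u sp)
      where
      flag-u : Subpath M u B v → ⊥
      flag-u (straight A u B v C refl) with trans (sym du) (proj₁ (flaggedˡ _ A refl flags f))
      ... | ()
      flag-u (wrapping A u B v C refl) with trans (sym du) (proj₁ (flaggedˡ _ (A ++ v ∷ B) (sym (ListP.++-assoc A (v ∷ B) (u ∷ C))) flags f))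
      ... | ()
    ... | inj₂ (a ∷ A , x , C , eq , f) with ListP.∷-injective eq
    ...   | refl , eq₁ with emptyˡ sp flags eq₁ f
    ...     | q , e₀ with prefixˡ q u A du e₀
    ...       | D₁ , D₂ , refl , r = trans (true-for val (proj₁ ∘_)) (sym (true-for val' (proj₂ ∘_)))
      where
      head-good : All (Good N) (u ∷ D₁)
      head-good with ≡.subst (All (Good N)) eq (Good-subpath good sp)
      ... | gu ∷ g = gu ∷ AllP.++⁻ˡ D₁ (AllP.++⁻ˡ (D₁ ++ D₂) g)
      true-for : ∀ (g : Cell → ℕ) → (∀ {x : Cell} → (dir x ≢ N → val x ≡ base x × val' x ≡ base x) → dir x ≢ N → g x ≡ base x) →
        ok (map (λ x → dir x , g x) (u ∷ B ++ v ∷ [])) ≡ true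
      true-for g h = trans (cong (λ z → ok (map (λ x → dir x , g x) z)) eq) (ok-prefix′ g u D₁ D₂ x C
        (trans (#N-dirs g (u ∷ D₁)) (trans r (sym (ωE-base g (All.map (λ { {x} (k , _) → h {x} k }) head-good))))))

-- Edge counts of maximal Dyck paths.

module DyckPaths {c ℓ} (K : CommutativeRing c ℓ) (ℓ₁ ℓ₂ : ℕ) where

  open Queues K ℓ₁ ℓ₂ public

  -- The local recursion inside dyck has no name of its own; it is the solution of the first
  -- equation, found by unification once the arguments in the second have been abstracted.
  private mutual
    walk : (m n : ℕ) → ℕ → ℕ → ℕ → List Dir
    walk = _

    dyck-walk : ∀ m n → dyck K ℓ₁ ℓ₂ (suc m) (suc n) ≡ E ∷ walk (suc m) (suc n) (m ℕ.+ suc n) 1 0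
    dyck-walk m n with m ℕ.+ suc n
    ... | f with 1 | 0 | suc m | suc n
    ...   | i | j | m′ | n′ = refl

  count : (Dir → Bool) → List Dir → ℕ
  count k []      = 0
  count k (s ∷ P) = (if k s then 1 else 0) ℕ.+ count k P

  private
    -- The walk tests only whether a north step is allowed; the bound i < m before each east step
    -- has to be extracted from the failure of that test.
    walk-counts : ∀ m n f i j → i ℕ.≤ m → j ℕ.≤ n → f ℕ.+ (i ℕ.+ j) ≡ m ℕ.+ n →
      count isE′ (walk m n f i j) ℕ.+ i ≡ m × count isN′ (walk m n f i j) ℕ.+ j ≡ n
    walk-counts m n zero i j i≤m j≤n e = i≡m ,
      ℕP.+-cancelˡ-≡ m _ _ (trans (cong (ℕ._+ j) (sym i≡m)) e)
      where
      i≡m : i ≡ m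
      i≡m = ℕP.≤-antisym i≤m (ℕP.+-cancelʳ-≤ n m i (ℕP.≤-trans (ℕP.≤-reflexive (sym e)) (ℕP.+-monoʳ-≤ i j≤n)))
    walk-counts m n (suc f) i j i≤m j≤n e
      with j <ᵇ n | ℕP.<ᵇ⇒< j n | ℕP.<⇒<ᵇ {j} {n} | (suc j ℕ.* m) ≤ᵇ (i ℕ.* n) | ℕP.≤⇒≤ᵇ {suc j ℕ.* m} {i ℕ.* n}
    ... | true | j<n | _ | true | _ with walk-counts m n f i (suc j) i≤m (j<n tt)
              (trans (cong (f ℕ.+_) (ℕP.+-suc i j)) (trans (ℕP.+-suc f (i ℕ.+ j)) e))
    ...   | a , b = a , trans (sym (ℕP.+-suc (count isN′ (walk m n f i (suc j))) j)) b
    walk-counts m n (suc f) i j i≤m j≤n e | true | j<n | _ | false | ¬le =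
      -- At i = m the diagonal condition holds for every j < n, so its failure excludes i = m.
      east (ℕP.≤∧≢⇒< i≤m λ { refl → ¬le (ℕP.≤-trans (ℕP.*-monoˡ-≤ m (j<n tt)) (ℕP.≤-reflexive (ℕP.*-comm n m))) })
      where
      east : i ℕ.< m → _
      east i<m with walk-counts m n f (suc i) j i<m j≤n (trans (ℕP.+-suc f (i ℕ.+ j)) e)
      ... | a , b = trans (sym (ℕP.+-suc (count isE′ (walk m n f (suc i) j)) i)) a , b
    walk-counts m n (suc f) i j i≤m j≤n e | false | _ | ¬lt | _ | _ =
      -- Here j = n, and i = m as well would leave no step to take.
      east (ℕP.≤∧≢⇒< i≤m λ { refl → ¬lt (ℕP.≤∧≢⇒< j≤n λ { refl → ℕP.m+1+n≢n f
        (trans (ℕP.+-suc f (i ℕ.+ j)) e) }) })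
      where
      east : i ℕ.< m → _
      east i<m with walk-counts m n f (suc i) j i<m j≤n (trans (ℕP.+-suc f (i ℕ.+ j)) e)
      ... | a , b = trans (sym (ℕP.+-suc (count isE′ (walk m n f (suc i) j)) i)) a , b

  #E-dyck : ∀ m n → count isE′ (dyck K ℓ₁ ℓ₂ m n) ≡ m
  #E-dyck m n = trans (sym (ℕP.+-identityʳ _)) (proj₁ (walk-counts m n (m ℕ.+ n) 0 0 z≤n z≤n (ℕP.+-identityʳ (m ℕ.+ n))))

  #N-dyck : ∀ m n → count isN′ (dyck K ℓ₁ ℓ₂ m n) ≡ n
  #N-dyck m n = trans (sym (ℕP.+-identityʳ _)) (proj₂ (walk-counts m n (m ℕ.+ n) 0 0 z≤n z≤n (ℕP.+-identityʳ (m ℕ.+ n))))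

-- Weighted sums over gradings and their factorisation.

module GradingSums {c ℓ} (K : CommutativeRing c ℓ) (ℓ₁ ℓ₂ : ℕ) where

  open Elimination K ℓ₁ ℓ₂ public
  open DyckPaths K ℓ₁ ℓ₂ public

  ΣL : ∀ {A : Set} → (A → 𝕃) → List A → 𝕃
  ΣL F l = foldr _⊕_ 𝟎 (map F l)

  ΣL-++ : ∀ {A : Set} (F : A → 𝕃) l l' → ΣL F (l ++ l') ≋ ΣL F l ⊕ ΣL F l'
  ΣL-++ F []      l' = ≋-refl
  ΣL-++ F (x ∷ l) l' = ≋-trans (⊕-cong {F x} ≋-refl (ΣL-++ F l l')) (≋-sym (𝕃.+-assoc (F x) (ΣL F l) (ΣL F l')))

  ΣL-cong : ∀ {A : Set} {F G : A → 𝕃} {l} → All (λ x → F x ≋ G x) l → ΣL F l ≋ ΣL G l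
  ΣL-cong []       = ≋-refl
  ΣL-cong (e ∷ es) = ⊕-cong e (ΣL-cong es)

  ΣL-⊗ : ∀ {A : Set} f (F : A → 𝕃) l → f ⊗ ΣL F l ≋ ΣL (λ x → f ⊗ F x) l
  ΣL-⊗ f F []      = 𝕃.zeroʳ f
  ΣL-⊗ f F (x ∷ l) = ≋-trans (⊗-distribˡ f (F x) (ΣL F l)) (⊕-cong {f ⊗ F x} ≋-refl (ΣL-⊗ f F l))

  ΣL-concatMap : ∀ {A B : Set} (F : B → 𝕃) (g : A → List B) l → ΣL F (concatMap g l) ≋ ΣL (λ x → ΣL F (g x)) l
  ΣL-concatMap F g []      = ≋-refl
  ΣL-concatMap F g (x ∷ l) = ≋-trans (ΣL-++ F (g x) (concatMap g l)) (⊕-cong {ΣL F (g x)} ≋-refl (ΣL-concatMap F g l))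

  ΣL-⊕ : ∀ {A : Set} (F G : A → 𝕃) l → ΣL (λ x → F x ⊕ G x) l ≋ ΣL F l ⊕ ΣL G l
  ΣL-⊕ F G []      = ≋-refl
  ΣL-⊕ F G (x ∷ l) = ≋-trans (⊕-cong {F x ⊕ G x} ≋-refl (ΣL-⊕ F G l)) (interchange (F x) (G x) (ΣL F l) (ΣL G l))
    where open CommutativeSemigroupProperties 𝕃.+-commutativeSemigroup using (interchange)

  ΣL-closed : ∀ {p} (S : 𝕃 → Set p) → S 𝟎 → (∀ {f g} → S f → S g → S (f ⊕ g)) →
              ∀ {A : Set} {F : A → 𝕃} {l} → All (λ x → S (F x)) l → S (ΣL F l)
  ΣL-closed S z s []       = z
  ΣL-closed S z s (x ∷ xs) = s x (ΣL-closed S z s xs)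

  bd : Dir → ℕ
  bd E = ℓ₂
  bd N = ℓ₁

  range : Dir → List ℕ
  range s = upTo (suc (bd s))

  -- Sums over gradings, the values on the edges rejected by k being fixed (to 0, respectively by η).
  SO : (Dir → Bool) → List Dir → (List ℕ → 𝕃) → 𝕃
  SO k []      F = F []
  SO k (s ∷ P) F = if k s then ΣL (λ v → SO k P (λ ω → F (v ∷ ω))) (range s) else SO k P (λ ω → F (0 ∷ ω))

  SI : (Dir → Bool) → List Dir → List ℕ → (List ℕ → 𝕃) → 𝕃
  SI k []      η       F = F []
  SI k (s ∷ P) []      F = 𝟎
  SI k (s ∷ P) (n ∷ η) F = if k s then ΣL (λ v → SI k P η (λ ω → F (v ∷ ω))) (range s) else SI k P η (λ ω → F (n ∷ ω))

  every : Dir → Bool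
  every _ = true

  data Bounded : List Dir → List ℕ → Set where
    []  : Bounded [] []
    _∷_ : ∀ {s P v ω} → v ℕ.≤ bd s → Bounded P ω → Bounded (s ∷ P) (v ∷ ω)

  gradings-SO : ∀ P F → ΣL F (gradings K ℓ₁ ℓ₂ P) ≋ SO every P F
  gradings-SO []      F = 𝕃.+-identityʳ (F [])
  gradings-SO (s ∷ P) F = ≋-trans (by-cases s) (ΣL-cong (All.universal (λ v →
      ≋-trans (≋-reflexive (cong (foldr _⊕_ 𝟎) (sym (ListP.map-∘ (gradings K ℓ₁ ℓ₂ P)))))
        (gradings-SO P (λ ω → F (v ∷ ω)))) (range s)))
    where
    by-cases : ∀ s → ΣL F (gradings K ℓ₁ ℓ₂ (s ∷ P)) ≋ ΣL (λ v → ΣL F (map (v ∷_) (gradings K ℓ₁ ℓ₂ P))) (range s)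
    by-cases E = ΣL-concatMap F (λ v → map (v ∷_) (gradings K ℓ₁ ℓ₂ P)) (range E)
    by-cases N = ΣL-concatMap F (λ v → map (v ∷_) (gradings K ℓ₁ ℓ₂ P)) (range N)

  private
    range-bounded : ∀ s → All (ℕ._≤ bd s) (range s)
    range-bounded s = All.map ℕP.<⇒≤pred (AllP.applyUpTo⁺₁ (λ x → x) (suc (bd s)) (λ lt → lt))

  SO-cong : ∀ P {F G} → (∀ ω → Bounded P ω → F ω ≋ G ω) → SO every P F ≋ SO every P G
  SO-cong []      h = h [] []
  SO-cong (s ∷ P) h = ΣL-cong (All.map (λ le → SO-cong P (λ ω b → h _ (le ∷ b))) (range-bounded s))

  SO-cong′ : ∀ k P {F G} → (∀ ω → F ω ≋ G ω) → SO k P F ≋ SO k P G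
  SO-cong′ k []      h = h []
  SO-cong′ k (s ∷ P) h with k s
  ... | true  = ΣL-cong (All.universal (λ v → SO-cong′ k P (λ ω → h (v ∷ ω))) (range s))
  ... | false = SO-cong′ k P (λ ω → h (0 ∷ ω))

  SO-⊗ : ∀ k P f F → f ⊗ SO k P F ≋ SO k P (λ ω → f ⊗ F ω)
  SO-⊗ k []      f F = ≋-refl
  SO-⊗ k (s ∷ P) f F with k s
  ... | true  = ≋-trans (ΣL-⊗ f _ (range s)) (ΣL-cong (All.universal (λ v → SO-⊗ k P f (λ ω → F (v ∷ ω))) (range s)))
  ... | false = SO-⊗ k P f (λ ω → F (0 ∷ ω))

  SI-⊗ : ∀ k P η f F → f ⊗ SI k P η F ≋ SI k P η (λ ω → f ⊗ F ω)
  SI-⊗ k []      η       f F = ≋-refl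
  SI-⊗ k (s ∷ P) []      f F = 𝕃.zeroʳ f
  SI-⊗ k (s ∷ P) (n ∷ η) f F with k s
  ... | true  = ≋-trans (ΣL-⊗ f _ (range s)) (ΣL-cong (All.universal (λ v → SI-⊗ k P η f (λ ω → F (v ∷ ω))) (range s)))
  ... | false = SI-⊗ k P η f (λ ω → F (n ∷ ω))

  SI-cong : ∀ k P η {F G} → (∀ ω → F ω ≋ G ω) → SI k P η F ≋ SI k P η G
  SI-cong k []      η       h = h []
  SI-cong k (s ∷ P) []      h = ≋-refl
  SI-cong k (s ∷ P) (n ∷ η) h with k s
  ... | true  = ΣL-cong (All.universal (λ v → SI-cong k P η (λ ω → h (v ∷ ω))) (range s))
  ... | false = SI-cong k P η (λ ω → h (n ∷ ω))

  private
    SO-⊕ : ∀ k P F G → SO k P (λ ω → F ω ⊕ G ω) ≋ SO k P F ⊕ SO k P G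
    SO-⊕ k []      F G = ≋-refl
    SO-⊕ k (s ∷ P) F G with k s
    ... | true  = ≋-trans (ΣL-cong (All.universal (λ v → SO-⊕ k P (λ ω → F (v ∷ ω)) (λ ω → G (v ∷ ω))) (range s))) (ΣL-⊕ (λ v → SO k P (λ ω → F (v ∷ ω))) (λ v → SO k P (λ ω → G (v ∷ ω))) (range s))
    ... | false = SO-⊕ k P (λ ω → F (0 ∷ ω)) (λ ω → G (0 ∷ ω))

    SO-𝟎 : ∀ k P → SO k P (λ _ → 𝟎) ≋ 𝟎
    SO-𝟎 k P = ≋-trans (SO-cong′ k P (λ _ → ≋-sym (𝕃.zeroˡ 𝟎))) (≋-trans (≋-sym (SO-⊗ k P 𝟎 (λ _ → 𝟎))) (𝕃.zeroˡ _))

    ΣL-SO : ∀ k P (G : ℕ → List ℕ → 𝕃) l → ΣL (λ v → SO k P (G v)) l ≋ SO k P (λ η → ΣL (λ v → G v η) l)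
    ΣL-SO k P G []      = ≋-sym (SO-𝟎 k P)
    ΣL-SO k P G (v ∷ l) = ≋-trans (⊕-cong {SO k P (G v)} ≋-refl (ΣL-SO k P G l)) (≋-sym (SO-⊕ k P (G v) _))

  -- Interchange of finite sums: the outer sum runs over the edges rejected by k, the inner one over
  -- the others. The zeros that the outer sum places on accepted edges are mere placeholders,
  -- ignored by `SI`.
  SO-split : ∀ k P F → SO every P F ≋ SO (not ∘ k) P (λ η → SI k P η F)
  SO-split k []      F = ≋-refl
  SO-split k (s ∷ P) F with k s
  ... | true  = ≋-trans (ΣL-cong (All.universal (λ v → SO-split k P (λ ω → F (v ∷ ω))) (range s)))
                  (ΣL-SO (not ∘ k) P (λ v η → SI k P η (λ ω → F (v ∷ ω))) (range s))
  ... | false = ΣL-cong (All.universal (λ v → SO-split k P (λ ω → F (v ∷ ω))) (range s))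

  zeroes : List Dir → List ℕ
  zeroes = map (λ _ → 0)

  total : (Dir → Bool) → List Dir → List ℕ → ℕ
  total k []      η       = 0
  total k (s ∷ P) []      = 0
  total k (s ∷ P) (n ∷ η) = (if k s then n else 0) ℕ.+ total k P η

  SO-closed : ∀ {p} (S : 𝕃 → Set p) → S 𝟎 → (∀ {f g} → S f → S g → S (f ⊕ g)) →
    ∀ k P {G} → (∀ η → length η ≡ length P → S (G η)) → S (SO k P G)
  SO-closed S z s k []      h = h [] refl
  SO-closed S z s k (t ∷ P) h with k t
  ... | true  = ΣL-closed S z s (All.universal (λ v → SO-closed S z s k P (λ η e → h (v ∷ η) (cong suc e))) (range t))
  ... | false = SO-closed S z s k P (λ η e → h (0 ∷ η) (cong suc e))

  private
    total-0 : ∀ k t P η → total k (t ∷ P) (0 ∷ η) ≡ total k P η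
    total-0 k t P η with k t
    ... | true  = refl
    ... | false = refl

    total-suc : ∀ k t P v η → k t ≡ true → 0 ℕ.< total k (t ∷ P) (suc v ∷ η)
    total-suc k t P v η e rewrite e = s≤s z≤n

  -- Separates the zero grading, which carries the lowest term, from gradings of positive total.
  SO-head : ∀ {p} (S : 𝕃 → Set p) → S 𝟎 → (∀ {f g} → S f → S g → S (f ⊕ g)) →
    ∀ k P {G} → (∀ η → length η ≡ length P → 0 ℕ.< total k P η → S (G η)) →
    Σ 𝕃 λ h → S h × SO k P G ≋ G (zeroes P) ⊕ h
  SO-head S z s k []      {G} h = 𝟎 , z , ≋-sym (𝕃.+-identityʳ (G []))
  SO-head S z s k (t ∷ P) {G} h
    with SO-head S z s k P {λ η → G (0 ∷ η)} (λ η e lt → h (0 ∷ η) (cong suc e) (≡.subst (0 ℕ.<_) (sym (total-0 k t P η)) lt))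
       | k t in kt
  ... | ih | false = ih
  ... | h₀ , s₀ , e₀ | true = h₀ ⊕ h₁ , s s₀ s₁ ,
    ≋-trans (⊕-cong {SO k P (λ η → G (0 ∷ η))} {_} {h₁} e₀ ≋-refl) (𝕃.+-assoc (G (0 ∷ zeroes P)) h₀ h₁)
    where
    h₁ = ΣL (λ v → SO k P (λ η → G (v ∷ η))) (applyUpTo suc (bd t))
    s₁ : S h₁
    s₁ = ΣL-closed S z s (AllP.applyUpTo⁺₂ suc (bd t) (λ v → SO-closed S z s k P
           (λ η e → h (suc v ∷ η) (cong suc e) (total-suc k t P v η kt))))

  wm : Dir → ℕ → 𝕄
  wm E v = pm₂ v · xm (+ 0) (+ v)
  wm N v = pm₁ v · xm (+ v) (+ 0)

  WM : List Dir → List ℕ → 𝕄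
  WM []      ω       = one
  WM (s ∷ P) []      = one
  WM (s ∷ P) (v ∷ ω) = wm s v · WM P ω

  when : Bool → 𝕃 → 𝕃
  when b f = if b then f else 𝟎

  weigh : (List ℕ → Bool) → List Dir → List ℕ → 𝕃
  weigh χ P ω = when (χ ω) (mono (WM P ω))

  when-⊗ : ∀ b f g → when b (f ⊗ g) ≋ f ⊗ when b g
  when-⊗ true  f g = ≋-refl
  when-⊗ false f g = ≋-sym (𝕃.zeroʳ f)

  when-cong : ∀ b {f g} → f ≋ g → when b f ≋ when b g
  when-cong true  e = e
  when-cong false e = ≋-refl

  weigh-∷ : ∀ χ s P v ω → weigh χ (s ∷ P) (v ∷ ω) ≋ mono (wm s v) ⊗ weigh (λ ω → χ (v ∷ ω)) P ω
  weigh-∷ χ s P v ω = ≋-trans (when-cong (χ (v ∷ ω)) (≋-sym (mono-· (wm s v) (WM P ω))))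
    (when-⊗ (χ (v ∷ ω)) (mono (wm s v)) (mono (WM P ω)))

  private
    Integral-wm : ∀ s v → Integral (wm s v)
    Integral-wm E v = Integral-· {pm₂ v} {xm (+ 0) (+ v)} (Integral-pm₂ v) (Integral-xm (+ 0) (+ v))
    Integral-wm N v = Integral-· {pm₁ v} {xm (+ v) (+ 0)} (Integral-pm₁ v) (Integral-xm (+ v) (+ 0))

  data Fits (k : Dir → Bool) : List Dir → List ℕ → List Bool → Set where
    []    : Fits k [] [] []
    fixed : ∀ {s P n η fl} → k s ≡ false → Fits k P η fl → Fits k (s ∷ P) (n ∷ η) (false ∷ fl)
    moves : ∀ {s P n η fl} b → k s ≡ true → Fits k P η fl → Fits k (s ∷ P) (n ∷ η) (b ∷ fl)

  -- Two gradings extending η that differ at most on flagged edges: the relation under which the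
  -- queue argument shows compatibility to be constant.
  data Sim (k : Dir → Bool) : List Dir → List ℕ → List Bool → List ℕ → List ℕ → Set where
    []    : Sim k [] [] [] [] []
    fixed : ∀ {s P n η fl ω ω'} → k s ≡ false → Sim k P η fl ω ω' → Sim k (s ∷ P) (n ∷ η) (false ∷ fl) (n ∷ ω) (n ∷ ω')
    same  : ∀ {s P n η b fl ω ω'} v → k s ≡ true → Sim k P η fl ω ω' → Sim k (s ∷ P) (n ∷ η) (b ∷ fl) (v ∷ ω) (v ∷ ω')
    free  : ∀ {s P n η fl ω ω'} v v' → k s ≡ true → Sim k P η fl ω ω' → Sim k (s ∷ P) (n ∷ η) (true ∷ fl) (v ∷ ω) (v' ∷ ω')

  module Side (k : Dir → Bool) (Q : 𝕃) (ε : 𝕄 → ℤ) (ε-· : ∀ m n → ε (m · n) ≡ ε m ℤ.+ ε n) (ε-one : ε one ≡ + 0)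
    (Q-sum : ∀ s → k s ≡ true → ΣL (λ v → mono (wm s v)) (range s) ≋ Q)
    (ε-moves : ∀ s v → k s ≡ true → ε (wm s v) ≡ + 0)
    (ε-fixed : ∀ s v → k s ≡ false → ε (wm s v) ≡ + v) where

    Y-supp : ℕ → 𝕄 → Set
    Y-supp t n = Integral n × ε n ≡ + t

    private
      Y-· : ∀ {s v t u n} → ε (wm s v) ≡ + u → Y-supp t n → Y-supp (u ℕ.+ t) (wm s v · n)
      Y-· {s} {v} {n = n} e (i , e') = Integral-· {wm s v} {n} (Integral-wm s v) i ,
        trans (ε-· (wm s v) n) (cong₂ ℤ._+_ e e')

      Y-⊗ : ∀ {s v t u Y} → ε (wm s v) ≡ + u → In (Y-supp t) Y → In (Y-supp (u ℕ.+ t)) (mono (wm s v) ⊗ Y)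
      Y-⊗ {s} {v} {t} {u} e i = In-⊗ {D = _≡ wm s v} {E = Y-supp t} {F = Y-supp (u ℕ.+ t)}
        (λ { {n = n} refl y → Y-· {s} {v} {n = n} e y }) (In-mono refl) i

    -- At a flagged edge the value may be replaced by 0 inside χ, so summing over it splits off
    -- `ΣL (λ v → mono (wm s v)) (range s)`, which is Q. Unflagged moving edges do not change ε, so
    -- the cofactor Y has ε equal to the total on the fixed edges.
    factor : ∀ {P η fl} → Fits k P η fl → ∀ χ → (∀ {ω ω'} → Sim k P η fl ω ω' → χ ω ≡ χ ω') →
      Σ 𝕃 λ Y → In (Y-supp (total (not ∘ k) P η)) Y × SI k P η (weigh χ P) ≋ Q ^ trues fl ⊗ Y
    factor [] χ h = weigh χ [] [] , by-cases (χ []) ,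
        ≋-sym (≋-trans (⊗-congʳ _ (≋-reflexive (^-zero Q))) (⊗-identityˡ _))
      where
      by-cases : ∀ b → In (Y-supp 0) (when b (mono one))
      by-cases true  = In-mono (Integral-one , ε-one)
      by-cases false = In-𝟎
    factor {s ∷ P} {n ∷ η} (fixed {fl = fl} ks fits) χ h with k s | ks
    ... | false | _ with factor fits (λ ω → χ (n ∷ ω)) (λ sim → h (fixed ks sim))
    ...   | Y , iY , e = mono (wm s n) ⊗ Y , Y-⊗ {s} {n} (ε-fixed s n ks) iY ,
      ≋-trans (SI-cong k P η (λ ω → weigh-∷ χ s P n ω)) (≋-trans (≋-sym (SI-⊗ k P η (mono (wm s n)) _))
        (≋-trans (⊗-congˡ (mono (wm s n)) e) (RI.*-swapˡ (mono (wm s n)) (Q ^ trues fl) Y)))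
    factor {s ∷ P} {n ∷ η} (moves {fl = fl} true ks fits) χ h with k s | ks
    ... | true | _ with factor fits (λ ω → χ (0 ∷ ω)) (λ sim → h (same 0 ks sim))
    ...   | Y , iY , e = Y , iY , ≋-trans (ΣL-cong (All.universal each (range s)))
        (≋-trans (≋-trans (ΣL-cong (All.universal (λ v → ⊗-comm (mono (wm s v)) R) (range s)))
            (≋-sym (ΣL-⊗ R (λ v → mono (wm s v)) (range s))))
          (≋-trans (⊗-comm R _) (≋-trans (⊗-cong (Q-sum s ks) e)
            (≋-trans (≋-sym (⊗-assoc Q (Q ^ trues fl) Y)) (⊗-congʳ Y (≋-reflexive (sym (^-suc Q (trues fl)))))))))
      where
      R = SI k P η (weigh (λ ω → χ (0 ∷ ω)) P)
      each : ∀ v → SI k P η (λ ω → weigh χ (s ∷ P) (v ∷ ω)) ≋ mono (wm s v) ⊗ R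
      each v = ≋-trans (SI-cong k P η (λ ω → weigh-∷ χ s P v ω)) (≋-trans (≋-sym (SI-⊗ k P η (mono (wm s v)) _))
        (⊗-congˡ (mono (wm s v)) (SI-ext fits (λ sim → cong (λ b → when b _) (h (free v 0 ks sim))))))
        where
        SI-ext : ∀ {P η fl F G} → Fits k P η fl → (∀ {ω} → Sim k P η fl ω ω → F ω ≡ G ω) → SI k P η F ≋ SI k P η G
        SI-ext [] h = ≋-reflexive (h [])
        SI-ext {s ∷ P} {n ∷ η} (fixed ks fits) h with k s | ks
        ... | false | _ = SI-ext fits (λ sim → h (fixed ks sim))
        SI-ext {s ∷ P} {n ∷ η} (moves b ks fits) h with k s | ks
        ... | true | _ = ΣL-cong (All.universal (λ v → SI-ext fits (λ sim → h (same v ks sim))) (range s))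
    factor {s ∷ P} {n ∷ η} (moves {fl = fl} false ks fits) χ h with k s | ks
    ... | true | _ = ΣL (λ v → mono (wm s v) ⊗ proj₁ (ih v)) (range s) ,
        ΣL-closed (In _) In-𝟎 In-⊕ (All.universal (λ v → Y-⊗ {s} {v} (ε-moves s v ks) (proj₁ (proj₂ (ih v)))) (range s)) ,
        ≋-trans (ΣL-cong (All.universal each (range s))) (≋-sym (ΣL-⊗ (Q ^ trues fl) _ (range s)))
      where
      ih = λ v → factor fits (λ ω → χ (v ∷ ω)) (λ sim → h (same v ks sim))
      each : ∀ v → SI k P η (λ ω → weigh χ (s ∷ P) (v ∷ ω)) ≋ Q ^ trues fl ⊗ (mono (wm s v) ⊗ proj₁ (ih v))
      each v = ≋-trans (SI-cong k P η (λ ω → weigh-∷ χ s P v ω)) (≋-trans (≋-sym (SI-⊗ k P η (mono (wm s v)) _))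
        (≋-trans (⊗-congˡ (mono (wm s v)) (proj₂ (proj₂ (ih v)))) (RI.*-swapˡ (mono (wm s v)) (Q ^ trues fl) (proj₁ (ih v)))))

    data Completion : List Dir → List ℕ → Set where
      []    : Completion [] []
      fixed : ∀ {s P ω} → k s ≡ false → Completion P ω → Completion (s ∷ P) (0 ∷ ω)
      moves : ∀ {s P ω} v → k s ≡ true → Completion P ω → Completion (s ∷ P) (v ∷ ω)

    full : (∀ s → wm s 0 ≡ one) → ∀ P χ → (∀ {ω} → Completion P ω → χ ω ≡ true) → SI k P (zeroes P) (weigh χ P) ≋ Q ^ count k P
    full wm0 [] χ h rewrite h [] = ≋-reflexive (sym (^-zero Q))
    full wm0 (s ∷ P) χ h with k s in ks
    ... | false = ≋-trans (SI-cong k P (zeroes P) (λ ω → weigh-∷ χ s P 0 ω)) (≋-trans (≋-sym (SI-⊗ k P (zeroes P) (mono (wm s 0)) _))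
      (≋-trans (⊗-cong (≋-reflexive (cong mono (wm0 s))) (full wm0 P (λ ω → χ (0 ∷ ω)) (λ co → h (fixed ks co)))) (⊗-identityˡ _)))
    ... | true  = ≋-trans (ΣL-cong (All.universal each (range s))) (≋-trans (≋-sym (ΣL-⊗ (Q ^ count k P) (λ v → mono (wm s v)) (range s)))
      (≋-trans (⊗-comm (Q ^ count k P) _) (≋-trans (⊗-congʳ _ (Q-sum s ks)) (≋-reflexive (sym (^-suc Q (count k P)))))))
      where
      each : ∀ v → SI k P (zeroes P) (λ ω → weigh χ (s ∷ P) (v ∷ ω)) ≋ Q ^ count k P ⊗ mono (wm s v)
      each v = ≋-trans (SI-cong k P (zeroes P) (λ ω → weigh-∷ χ s P v ω)) (≋-trans (≋-sym (SI-⊗ k P (zeroes P) (mono (wm s v)) _))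
        (≋-trans (⊗-congˡ (mono (wm s v)) (full wm0 P (λ ω → χ (v ∷ ω)) (λ co → h (moves v ks co)))) (⊗-comm (mono (wm s v)) _)))

-- Greedy elements: poles and lowest terms.

module Greedy {c ℓ} (K : CommutativeRing c ℓ) (ℓ₁ ℓ₂ : ℕ) where

  open GradingSums K ℓ₁ ℓ₂ public

  compat : List Dir → List ℕ → Bool
  compat = compatible K ℓ₁ ℓ₂

  Sχ : List Dir → 𝕃
  Sχ P = SO every P (weigh (compat P) P)

  path : 𝕄 → List Dir
  path m = dyck K ℓ₁ ℓ₂ [ ℤ.- exp₁ m ]₊ [ ℤ.- exp₂ m ]₊

  -- Ĝ (q · x₁^{-a₁} x₂^{-a₂}) is q · x[a₁, a₂] for a monomial q in the p_{i,j}.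
  Ĝ : 𝕄 → 𝕃
  Ĝ m = mono m ⊗ Sχ (path m)

  private
    cells : ∀ {k τ} → (∀ s → k s ≡ true → s ≡ τ) → ∀ {P η bs ω ω'} → Sim k P η bs ω ω' →
      Σ (List Cell) λ M → map dir M ≡ P × map val M ≡ ω × map val' M ≡ ω' ×
        map edgeᵇ M ≡ List.zip P η × map fl M ≡ bs × All (Good τ) M
    cells kτ [] = [] , refl , refl , refl , refl , refl , []
    cells kτ (fixed {s} {n = n} ks sim) with cells kτ sim
    ... | M , refl , refl , refl , e , refl , g =
      cell s n n n false ∷ M , refl , refl , refl , cong (_ ∷_) e , refl , ((λ _ → refl , refl) , λ _ → refl) ∷ g
    cells kτ (same {s} {n = n} {b = b} v ks sim) with cells kτ sim
    ... | M , refl , refl , refl , e , refl , g =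
      cell s n v v b ∷ M , refl , refl , refl , cong (_ ∷_) e , refl , ((λ ne → ⊥-elim (ne (kτ s ks))) , λ _ → refl) ∷ g
    cells kτ (free {s} {n = n} v v' ks sim) with cells kτ sim
    ... | M , refl , refl , refl , e , refl , g =
      cell s n v v' true ∷ M , refl , refl , refl , cong (_ ∷_) e , refl , ((λ ne → ⊥-elim (ne (kτ s ks))) , λ ()) ∷ g

    isE⇒ : ∀ s → isE′ s ≡ true → s ≡ E
    isE⇒ E e = refl

    isN⇒ : ∀ s → isN′ s ≡ true → s ≡ N
    isN⇒ N e = refl

    indepʳ : ∀ {P η ω ω'} → Sim isE′ P η (freeʳ (List.zip P η)) ω ω' → compat P ω ≡ compat P ω'
    indepʳ {P} {η} sim with cells isE⇒ sim
    ... | M , refl , refl , refl , e , e' , g = independentʳ M g (trans e' (cong freeʳ (sym e)))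

    indepˡ : ∀ {P η ω ω'} → Sim isN′ P η (freeˡ (List.zip P η)) ω ω' → compat P ω ≡ compat P ω'
    indepˡ {P} {η} sim with cells isN⇒ sim
    ... | M , refl , refl , refl , e , e' , g = independentˡ M g (trans e' (cong freeˡ (sym e)))

    fitsʳ : ∀ q P η → length η ≡ length P → Fits isE′ P η (flagsʳ q (List.zip P η))
    fitsʳ q []      []      e = []
    fitsʳ q (E ∷ P) (n ∷ η) e = moves _ refl (fitsʳ q P η (ℕP.suc-injective e))
    fitsʳ q (N ∷ P) (n ∷ η) e = fixed refl (fitsʳ q P η (ℕP.suc-injective e))

    fitsˡ : ∀ q P η → length η ≡ length P → Fits isN′ P η (flagsˡ q (List.zip P η))
    fitsˡ q []      []      e = []
    fitsˡ q (E ∷ P) (n ∷ η) e = fixed refl (fitsˡ (q ℕ.+ n) P η (ℕP.suc-injective e))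
    fitsˡ q (N ∷ P) (n ∷ η) e = moves _ refl (fitsˡ (q ℕ.∸ 1) P η (ℕP.suc-injective e))

    #E-zip : ∀ P η → length η ≡ length P → #E (List.zip P η) ≡ count isE′ P
    #E-zip []      []      e = refl
    #E-zip (s ∷ P) (n ∷ η) e = cong (_ ℕ.+_) (#E-zip P η (ℕP.suc-injective e))

    #N-zip : ∀ P η → length η ≡ length P → #N (List.zip P η) ≡ count isN′ P
    #N-zip []      []      e = refl
    #N-zip (s ∷ P) (n ∷ η) e = cong (_ ℕ.+_) (#N-zip P η (ℕP.suc-injective e))

    ωN-zip : ∀ P η → length η ≡ length P → ωN (List.zip P η) ≡ total (not ∘ isE′) P η
    ωN-zip []      []      e = refl
    ωN-zip (s ∷ P) (n ∷ η) e = cong (_ ℕ.+_) (ωN-zip P η (ℕP.suc-injective e))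

    ωE-zip : ∀ P η → length η ≡ length P → ωE (List.zip P η) ≡ total (not ∘ isN′) P η
    ωE-zip []      []      e = refl
    ωE-zip (E ∷ P) (n ∷ η) e = cong (n ℕ.+_) (ωE-zip P η (ℕP.suc-injective e))
    ωE-zip (N ∷ P) (n ∷ η) e = ωE-zip P η (ℕP.suc-injective e)

    manyʳ : ∀ P η → length η ≡ length P →
      count isE′ P ℕ.≤ total (not ∘ isE′) P η ℕ.+ trues (freeʳ (List.zip P η))
    manyʳ P η e = ≡.subst₂ (λ a b → a ℕ.≤ b ℕ.+ trues (freeʳ (List.zip P η))) (#E-zip P η e) (ωN-zip P η e) (freeʳ-many (List.zip P η))

    manyˡ : ∀ P η → length η ≡ length P →
      count isN′ P ℕ.≤ total (not ∘ isN′) P η ℕ.+ trues (freeˡ (List.zip P η))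
    manyˡ P η e = ≡.subst₂ (λ a b → a ℕ.≤ b ℕ.+ trues (freeˡ (List.zip P η))) (#N-zip P η e) (ωE-zip P η e) (freeˡ-many (List.zip P η))

  wm-0 : ∀ s → wm s 0 ≡ one
  wm-0 E = trans (cong (_· one) pm₂-0) (·-identityˡ one)
  wm-0 N = trans (cong (_· one) pm₁-0) (·-identityˡ one)

  private
    Q-sum : ∀ s n F → mono (wm s 0) ≋ 𝟏 → (∀ j → F j ≋ mono (wm s j)) →
      ΣL (λ v → mono (wm s v)) (upTo (suc n)) ≋ 𝟏 ⊕ Σ₁′ n F
    Q-sum s n F e₀ e = ⊕-cong e₀ (≋-trans (≋-reflexive (cong (foldr _⊕_ 𝟎) (ListP.map-applyUpTo suc (λ v → mono (wm s v)) n)))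
      (Σ₁-cong n (λ j _ _ → ≋-sym (e j))))

    Q-sumE : ∀ s → isE′ s ≡ true → ΣL (λ v → mono (wm s v)) (range s) ≋ Q₂
    Q-sumE E _ = Q-sum E ℓ₂ _ (≋-reflexive (cong mono (wm-0 E))) Q-term₂

    Q-sumN : ∀ s → isN′ s ≡ true → ΣL (λ v → mono (wm s v)) (range s) ≋ Q₁
    Q-sumN N _ = Q-sum N ℓ₁ _ (≋-reflexive (cong mono (wm-0 N))) Q-term₁

  module Half (k : Dir → Bool) (Q : 𝕃) (ε : 𝕄 → ℤ) (ε-· : ∀ m n → ε (m · n) ≡ ε m ℤ.+ ε n) (ε-one : ε one ≡ + 0)
    (Q-sum : ∀ s → k s ≡ true → ΣL (λ v → mono (wm s v)) (range s) ≋ Q)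
    (ε-moves : ∀ s v → k s ≡ true → ε (wm s v) ≡ + 0)
    (ε-fixed : ∀ s v → k s ≡ false → ε (wm s v) ≡ + v)
    (Q-lead : Lead (λ n → Integral n × + 0 ℤ.≤ exp₁ n × + 0 ℤ.< deg n × ε n ≡ + 0) one Q)
    (flag : List Dir → List ℕ → List Bool)
    (fits : ∀ P η → length η ≡ length P → Fits k P η (flag P η))
    (many : ∀ P η → length η ≡ length P → count k P ℕ.≤ total (not ∘ k) P η ℕ.+ trues (flag P η))
    (indep : ∀ {P η ω ω'} → Sim k P η (flag P η) ω ω' → compat P ω ≡ compat P ω') where

    open OneSided ε ε-· ε-one Q Q-lead
    open Side k Q ε ε-· ε-one Q-sum ε-moves ε-fixed using (factor; Y-supp)

    -- For fixed η of total t the pole order is at most `[ ℤ.- ε m ]₊` minus t, while the flags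
    -- supply at least that many factors Q; `span-lift` then applies.
    piece : ∀ m P η → Integral m → count k P ≡ [ ℤ.- ε m ]₊ → length η ≡ length P →
      Span w (λ n → Integral n × ε n ≡ ε m ℤ.+ + total (not ∘ k) P η) (mono m ⊗ SI k P η (weigh (compat P) P))
    piece m P η i cnt len = from-factor (factor (fits P η len) (compat P) indep)
      where
      t = total (not ∘ k) P η
      tr = trues (flag P η)
      bound : ∀ {n} → Integral n × ε n ≡ ε m ℤ.+ + t → [ ℤ.- ε n ]₊ ℕ.≤ tr
      bound {n} (_ , e) = []₊-least (≡.subst (ℤ._≤ + tr) (sym (trans (cong ℤ.-_ e) (rearrange (ε m) (+ t))))
        (≡.subst (λ z → (ℤ.- ε m) ℤ.- + t ℤ.≤ z) (cancel (+ t) (+ tr))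
          (ℤP.+-monoˡ-≤ (ℤ.- + t) (ℤP.≤-trans (i≤[i]₊ (ℤ.- ε m))
            (ℤ.+≤+ (≡.subst (ℕ._≤ t ℕ.+ tr) cnt (many P η len)))))))
        where
        rearrange : ∀ a b → ℤ.- (a ℤ.+ b) ≡ (ℤ.- a) ℤ.- b
        rearrange = solve-∀
        cancel : ∀ a b → (a ℤ.+ b) ℤ.- a ≡ b
        cancel = solve-∀
      from-factor : (Σ 𝕃 λ Y → In (Y-supp t) Y × SI k P η (weigh (compat P) P) ≋ Q ^ tr ⊗ Y) →
        Span w (λ n → Integral n × ε n ≡ ε m ℤ.+ + t) (mono m ⊗ SI k P η (weigh (compat P) P))
      from-factor (Y , iY , e) = Span-resp
        (≋-sym (≋-trans (⊗-congˡ (mono m) (≋-trans e (⊗-comm (Q ^ tr) Y))) (≋-sym (⊗-assoc (mono m) Y (Q ^ tr)))))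
        (span-lift (In-⊗ {D = _≡ m} {E = Y-supp t} (λ { {n = n} refl (j , e') → Integral-· {m} {n} i j ,
            trans (ε-· m n) (cong (λ z → ε m ℤ.+ z) e') }) (In-mono refl) iY)
          (λ {n} → bound {n})
          (λ { {a} {b} (j , e') j' e″ → Integral-· {a} {b} j j' ,
            trans (ε-· a b) (trans (cong₂ ℤ._+_ e' e″) (ℤP.+-identityʳ _)) }))

  private
    εE-moves : ∀ s v → isE′ s ≡ true → exp₁ (wm s v) ≡ + 0
    εE-moves E v _ = refl
    εE-fixed : ∀ s v → isE′ s ≡ false → exp₁ (wm s v) ≡ + v
    εE-fixed N v _ = refl
    εN-moves : ∀ s v → isN′ s ≡ true → exp₂ (wm s v) ≡ + 0
    εN-moves N v _ = refl
    εN-fixed : ∀ s v → isN′ s ≡ false → exp₂ (wm s v) ≡ + v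
    εN-fixed E v _ = refl

  private
    module HE = Half isE′ Q₂ exp₁ (λ _ _ → refl) refl Q-sumE εE-moves εE-fixed Q₂-lead
      (λ P η → freeʳ (List.zip P η)) (λ P η → fitsʳ _ P η) manyʳ indepʳ
    module HN = Half isN′ Q₁ exp₂ (λ _ _ → refl) refl Q-sumN εN-moves εN-fixed Q₁-lead
      (λ P η → freeˡ (List.zip P η)) (λ P η → fitsˡ _ P η) manyˡ indepˡ
    module SE = Side isE′ Q₂ exp₁ (λ _ _ → refl) refl Q-sumE εE-moves εE-fixed
    module SN = Side isN′ Q₁ exp₂ (λ _ _ → refl) refl Q-sumN εN-moves εN-fixed

    open Labelled {Edge} proj₁ (E , 0) refl using (compatible-true)

    zip-dirs : ∀ (P : List Dir) (ω : List ℕ) → length ω ≡ length P → map proj₁ (List.zip P ω) ≡ P × map proj₂ (List.zip P ω) ≡ ω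
    zip-dirs []      []      e = refl , refl
    zip-dirs (s ∷ P) (v ∷ ω) e with zip-dirs P ω (ℕP.suc-injective e)
    ... | a , b = cong (s ∷_) a , cong (v ∷_) b

    All-subpath : ∀ {p} {Pr : Edge → Set p} {M u B v} → All Pr M → Subpath M u B v → Pr u × Pr v
    All-subpath a (straight A u B v C refl) with AllP.++⁻ʳ A a
    ... | pu ∷ a' with AllP.++⁻ʳ B a'
    ...   | pv ∷ _ = pu , pv
    All-subpath a (wrapping A u B v C refl) with AllP.++⁻ʳ A a
    ... | pv ∷ a' with AllP.++⁻ʳ B a'
    ...   | pu ∷ _ = pu , pv

    -- With value 0 on v, the edge e = v itself satisfies the second alternative: its one-edge
    -- suffix has no horizontal edges and total value 0.
    compat-zeroN : ∀ {P ω} → SE.Completion P ω → compat P ω ≡ true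
    compat-zeroN {P} {ω} co = ≡.subst₂ (λ a b → compat a b ≡ true) (proj₁ zs) (proj₂ zs)
      (compatible-true proj₂ refl (List.zip P ω) seg)
      where
      len : ∀ {P ω} → SE.Completion P ω → length ω ≡ length P
      len SE.[]            = refl
      len (SE.fixed _ co)  = cong suc (len co)
      len (SE.moves _ _ co) = cong suc (len co)
      zs = zip-dirs P ω (len co)
      zeroN : ∀ {P ω} → SE.Completion P ω → All (λ x → proj₁ x ≡ N → proj₂ x ≡ 0) (List.zip P ω)
      zeroN SE.[]                = []
      zeroN (SE.fixed _ co)      = (λ _ → refl) ∷ zeroN co
      zeroN (SE.moves {E} v ks co) = (λ ()) ∷ zeroN co
      seg : ∀ {u B v} → Subpath (List.zip P ω) u B v → proj₁ u ≡ E → proj₁ v ≡ N →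
        ok (map (λ x → proj₁ x , proj₂ x) (u ∷ B ++ v ∷ [])) ≡ true
      seg {u} {B} {v = s , n} sp du refl with proj₂ (All-subpath (zeroN co) sp) refl
      ... | refl = trans (cong ok (ListP.map-id (u ∷ B ++ (N , 0) ∷ []))) (ok-suffix u B (N , 0) [] refl)

    compat-noE : ∀ {P ω} → count isE′ P ≡ 0 → SN.Completion P ω → compat P ω ≡ true
    compat-noE {P} {ω} c0 co = ≡.subst₂ (λ a b → compat a b ≡ true) (proj₁ zs) (proj₂ zs)
      (compatible-true proj₂ refl (List.zip P ω) seg)
      where
      len : ∀ {P ω} → SN.Completion P ω → length ω ≡ length P
      len SN.[]            = refl
      len (SN.fixed _ co)  = cong suc (len co)
      len (SN.moves _ _ co) = cong suc (len co)
      zs = zip-dirs P ω (len co)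
      noE : ∀ P ω → count isE′ P ≡ 0 → All (λ x → proj₁ x ≢ E) (List.zip P ω)
      noE []      ω       c0 = []
      noE (N ∷ P) []      c0 = []
      noE (N ∷ P) (v ∷ ω) c0 = (λ ()) ∷ noE P ω c0
      seg : ∀ {u B v} → Subpath (List.zip P ω) u B v → proj₁ u ≡ E → proj₁ v ≡ N →
        ok (map (λ x → proj₁ x , proj₂ x) (u ∷ B ++ v ∷ [])) ≡ true
      seg sp du _ = ⊥-elim (proj₁ (All-subpath (noE P ω c0) sp) du)

    mono-closed-𝟎 : ∀ {w D} m → Span w D (mono m ⊗ 𝟎)
    mono-closed-𝟎 m = Span-resp (≋-sym (𝕃.zeroʳ (mono m))) Span-𝟎

    mono-closed-⊕ : ∀ {w D} m {f g} → Span w D (mono m ⊗ f) → Span w D (mono m ⊗ g) → Span w D (mono m ⊗ (f ⊕ g))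
    mono-closed-⊕ m {f} {g} a b = Span-resp (≋-sym (⊗-distribˡ (mono m) f g)) (Span-⊕ a b)

  -- Gradings vanishing on all vertical edges are compatible and sum to Q₂ to the number of
  -- horizontal edges, which gives `W₁.w m`. Every other choice of vertical values raises the
  -- exponent of x₁ by its total.
  Ĝ-left : ∀ {m} → Integral m →
    Σ 𝕃 λ h → Span W₁.w (λ n → Integral n × exp₁ m ℤ.< exp₁ n) h × Ĝ m ≋ W₁.w m ⊕ h
  Ĝ-left {m} i = from-head (SO-head (λ f → Span W₁.w (λ n → Integral n × exp₁ m ℤ.< exp₁ n) (mono m ⊗ f))
      (mono-closed-𝟎 m) (mono-closed-⊕ m) (not ∘ isE′) P {λ η → SI isE′ P η (weigh (compat P) P)}
      (λ η len lt → Span-weaken (λ { {n} (j , e) → j , ≡.subst (exp₁ m ℤ.<_) (sym e) (bigger lt) })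
        (HE.piece m P η i (#E-dyck [ ℤ.- exp₁ m ]₊ [ ℤ.- exp₂ m ]₊) len)))
    where
    P = path m
    bigger : ∀ {t} → 0 ℕ.< t → exp₁ m ℤ.< exp₁ m ℤ.+ + t
    bigger {t} lt = ≡.subst (ℤ._< exp₁ m ℤ.+ + t) (ℤP.+-identityʳ (exp₁ m)) (ℤP.+-monoʳ-< (exp₁ m) (ℤ.+<+ lt))
    from-head : (Σ 𝕃 λ h → Span W₁.w (λ n → Integral n × exp₁ m ℤ.< exp₁ n) (mono m ⊗ h) ×
        SO (not ∘ isE′) P (λ η → SI isE′ P η (weigh (compat P) P)) ≋ SI isE′ P (zeroes P) (weigh (compat P) P) ⊕ h) →
      Σ 𝕃 λ h → Span W₁.w (λ n → Integral n × exp₁ m ℤ.< exp₁ n) h × Ĝ m ≋ W₁.w m ⊕ h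
    from-head (h , s , e) = mono m ⊗ h , s , (begin
      mono m ⊗ Sχ P                                           ≈⟨ ⊗-congˡ (mono m) (≋-trans (SO-split isE′ P (weigh (compat P) P)) e) ⟩
      mono m ⊗ (SI isE′ P (zeroes P) (weigh (compat P) P) ⊕ h) ≈⟨ ⊗-distribˡ (mono m) _ h ⟩
      mono m ⊗ SI isE′ P (zeroes P) (weigh (compat P) P) ⊕ mono m ⊗ h
        ≈⟨ ⊕-cong (⊗-congˡ (mono m) (≋-trans (SE.full wm-0 P (compat P) compat-zeroN)
             (≋-reflexive (cong (Q₂ ^_) (#E-dyck [ ℤ.- exp₁ m ]₊ [ ℤ.- exp₂ m ]₊))))) ≋-refl ⟩
      W₁.w m ⊕ mono m ⊗ h                                     ∎)
      where open ≋-R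

  Ĝ-V₁ : ∀ {m} → Integral m → W₁.V (Ĝ m)
  Ĝ-V₁ {m} i = Span-resp (≋-sym (⊗-congˡ (mono m) (SO-split isE′ P (weigh (compat P) P))))
    (SO-closed (λ f → W₁.V (mono m ⊗ f)) (mono-closed-𝟎 m) (mono-closed-⊕ m) (not ∘ isE′) P
      (λ η len → Span-weaken (λ _ → tt) (HE.piece m P η i (#E-dyck [ ℤ.- exp₁ m ]₊ [ ℤ.- exp₂ m ]₊) len)))
    where P = path m

  Ĝ-V₂ : ∀ {m} → Integral m → W₂.V (Ĝ m)
  Ĝ-V₂ {m} i = Span-resp (≋-sym (⊗-congˡ (mono m) (SO-split isN′ P (weigh (compat P) P))))
    (SO-closed (λ f → W₂.V (mono m ⊗ f)) (mono-closed-𝟎 m) (mono-closed-⊕ m) (not ∘ isN′) P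
      (λ η len → Span-weaken (λ _ → tt) (HN.piece m P η i (#N-dyck [ ℤ.- exp₁ m ]₊ [ ℤ.- exp₂ m ]₊) len)))
    where P = path m

  -- The path has no horizontal edges, so compatibility is vacuous and the vertical edges contribute
  -- a full power of Q₁.
  Ĝ-right : ∀ {m} → + 0 ℤ.≤ exp₁ m → Ĝ m ≋ W₂.w m
  Ĝ-right {m} le = ⊗-congˡ (mono m) (≋-trans (SO-split isN′ P (weigh (compat P) P))
    (≋-trans (≋-reflexive (no-fixed P noE))
      (≋-trans (SN.full wm-0 P (compat P) (compat-noE noE)) (≋-reflexive (cong (Q₁ ^_) (#N-dyck [ ℤ.- exp₁ m ]₊ [ ℤ.- exp₂ m ]₊))))))
    where
    P = path m
    noE : count isE′ P ≡ 0
    noE = trans (#E-dyck [ ℤ.- exp₁ m ]₊ [ ℤ.- exp₂ m ]₊) ([-]₊≡0 le)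
    no-fixed : ∀ P {G} → count isE′ P ≡ 0 → SO (not ∘ isN′) P G ≡ G (zeroes P)
    no-fixed []      c0 = refl
    no-fixed (N ∷ P) c0 = no-fixed P c0

  private
    deg-wm : ∀ s v → deg (wm s v) ≡ + v
    deg-wm E v = refl
    deg-wm N v = cong +_ (ℕP.+-identityʳ v)

    deg-WM : ∀ P η → length η ≡ length P → deg (WM P η) ≡ + total every P η
    deg-WM []      []      e = refl
    deg-WM (s ∷ P) (v ∷ η) e = trans (deg-· (wm s v) (WM P η)) (cong₂ ℤ._+_ (deg-wm s v) (deg-WM P η (ℕP.suc-injective e)))

    WM-zeroes : ∀ P → WM P (zeroes P) ≡ one
    WM-zeroes []      = refl
    WM-zeroes (s ∷ P) = trans (cong₂ _·_ (wm-0 s) (WM-zeroes P)) (·-identityˡ one)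

  Sχ-lead : ∀ P → Lead (λ n → + 0 ℤ.< deg n) one (Sχ P)
  Sχ-lead P = from-head (SO-head (In (λ n → + 0 ℤ.< deg n)) In-𝟎 In-⊕ every P {weigh (compat P) P} each)
    where
    each : ∀ η → length η ≡ length P → 0 ℕ.< total every P η → In (λ n → + 0 ℤ.< deg n) (weigh (compat P) P η)
    each η len lt with compat P η
    ... | true  = In-mono (≡.subst (+ 0 ℤ.<_) (sym (deg-WM P η len)) (ℤ.+<+ lt))
    ... | false = In-𝟎
    zero-completion : ∀ P → SE.Completion P (zeroes P)
    zero-completion []      = SE.[]
    zero-completion (E ∷ P) = SE.moves 0 refl (zero-completion P)
    zero-completion (N ∷ P) = SE.fixed refl (zero-completion P)
    from-head : (Σ 𝕃 λ h → In (λ n → + 0 ℤ.< deg n) h × Sχ P ≋ weigh (compat P) P (zeroes P) ⊕ h) →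
      Lead (λ n → + 0 ℤ.< deg n) one (Sχ P)
    from-head (h , ih , e) = Lead-resp (≋-sym (≋-trans e (⊕-cong (≋-reflexive zero-weight) ≋-refl))) (Lead-⊕ (Lead-mono one) ih)
      where
      zero-weight : weigh (compat P) P (zeroes P) ≡ mono one
      zero-weight = trans (cong (λ b → when b (mono (WM P (zeroes P)))) (compat-zeroN (zero-completion P))) (cong mono (WM-zeroes P))

  Ĝ-lead : ∀ m → Pointed m (Ĝ m)
  Ĝ-lead m = ≡.subst (λ z → Lead (λ n → deg m ℤ.< deg n) z (Ĝ m)) (·-identityʳ m)
    (Lead-⊗ {E = λ _ → ⊥} {F = λ n → + 0 ℤ.< deg n} (λ ())
      (λ { {n} lt → ≡.subst₂ ℤ._<_ (ℤP.+-identityʳ (deg m)) (sym (deg-· m n)) (ℤP.+-monoʳ-< (deg m) lt) })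
      (λ ()) (Lead-mono m) (Sχ-lead (path m)))

-- Greedy elements in coordinates, and their linear independence.

module GreedyElements {c ℓ} (K : CommutativeRing c ℓ) (ℓ₁ ℓ₂ : ℕ) where

  open CommutativeRing K using (Carrier; _≈_; _+_; _*_; -_; 0#; 1#)
  private module K = CommutativeRing K
  open Greedy K ℓ₁ ℓ₂ public

  private
    PM : List Dir → List ℕ → 𝕄
    PM []      ω       = one
    PM (s ∷ P) []      = one
    PM (E ∷ P) (v ∷ ω) = pm₂ v · PM P ω
    PM (N ∷ P) (v ∷ ω) = pm₁ v · PM P ω

    hE hN : List Dir → List ℕ → ℕ
    hE P ω = foldr ℕ._+_ 0 (List.zipWith (λ s v → if isE′ s then v else 0) P ω)
    hN P ω = foldr ℕ._+_ 0 (List.zipWith (λ s v → if isN′ s then v else 0) P ω)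

    WM-split : ∀ P ω → WM P ω ≡ PM P ω · xm (+ hN P ω) (+ hE P ω)
    WM-split []      ω       = sym (·-identityˡ one)
    WM-split (s ∷ P) []      = sym (trans (·-identityˡ _) refl)
    WM-split (E ∷ P) (v ∷ ω) = trans (cong (wm E v ·_) (WM-split P ω)) (trans
      (·-interchange (pm₂ v) (xm (+ 0) (+ v)) (PM P ω) (xm (+ hN P ω) (+ hE P ω)))
      (cong ((pm₂ v · PM P ω) ·_) (xm-· (+ 0) (+ v) (+ hN P ω) (+ hE P ω))))
    WM-split (N ∷ P) (v ∷ ω) = trans (cong (wm N v ·_) (WM-split P ω)) (trans
      (·-interchange (pm₁ v) (xm (+ v) (+ 0)) (PM P ω) (xm (+ hN P ω) (+ hE P ω)))
      (cong ((pm₁ v · PM P ω) ·_) (xm-· (+ v) (+ 0) (+ hN P ω) (+ hE P ω))))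

    prod-mono : ∀ (f : Dir → ℕ → 𝕃) → (∀ v → f E v ≡ Defs.p₂ K ℓ₁ ℓ₂ v) → (∀ v → f N v ≡ Defs.p₁ K ℓ₁ ℓ₂ v) →
      ∀ {P ω} → Bounded P ω → foldr (Defs._⊗_ K ℓ₁ ℓ₂) 𝟏 (List.zipWith f P ω) ≋ mono (PM P ω)
    prod-mono f fE fN [] = ≋-refl
    prod-mono f fE fN {E ∷ P} {v ∷ ω} (le ∷ b) = ≋-trans (≋-reflexive (sym (⊗-unfold (f E v) _)))
      (≋-trans (⊗-cong (≋-reflexive (trans (fE v) (p₂-mono v le))) (prod-mono f fE fN b)) (mono-· (pm₂ v) (PM P ω)))
    prod-mono f fE fN {N ∷ P} {v ∷ ω} (le ∷ b) = ≋-trans (≋-reflexive (sym (⊗-unfold (f N v) _)))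
      (≋-trans (⊗-cong (≋-reflexive (trans (fN v) (p₁-mono v le))) (prod-mono f fE fN b)) (mono-· (pm₁ v) (PM P ω)))

    -- The weight function inside `term` is local and has no name; f stands for it and is found by
    -- unification in `term-mono`.
    term-gen : ∀ (f : Dir → ℕ → 𝕃) → (∀ v → f E v ≡ Defs.p₂ K ℓ₁ ℓ₂ v) → (∀ v → f N v ≡ Defs.p₁ K ℓ₁ ℓ₂ v) →
      ∀ a₁ a₂ {P ω} → Bounded P ω →
      Defs._⊗_ K ℓ₁ ℓ₂ (foldr (Defs._⊗_ K ℓ₁ ℓ₂) 𝟏 (List.zipWith f P ω))
        (Defs.monoP K ℓ₁ ℓ₂ (+ 0) (+ 0) (+ hN P ω ℤ.- a₁) (+ hE P ω ℤ.- a₂)) ≋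
      mono (xm (ℤ.- a₁) (ℤ.- a₂)) ⊗ mono (WM P ω)
    term-gen f fE fN a₁ a₂ {P} {ω} b = ≋-trans (≋-reflexive (sym (⊗-unfold (foldr (Defs._⊗_ K ℓ₁ ℓ₂) 𝟏 (List.zipWith f P ω)) _)))
      (≋-trans (⊗-cong (prod-mono f fE fN b) (≋-reflexive (monoP-x _ _)))
        (≋-trans (mono-· (PM P ω) _) (≋-trans (≋-reflexive (cong mono rearrange)) (≋-sym (mono-· _ _)))))
      where
      rearrange : PM P ω · xm (+ hN P ω ℤ.- a₁) (+ hE P ω ℤ.- a₂) ≡ xm (ℤ.- a₁) (ℤ.- a₂) · WM P ω
      rearrange = trans (cong (PM P ω ·_) (sym (xm-· (+ hN P ω) (+ hE P ω) (ℤ.- a₁) (ℤ.- a₂))))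
        (trans (sym (·-assoc (PM P ω) (xm (+ hN P ω) (+ hE P ω)) (xm (ℤ.- a₁) (ℤ.- a₂))))
          (trans (cong (_· xm (ℤ.- a₁) (ℤ.- a₂)) (sym (WM-split P ω))) (·-comm (WM P ω) (xm (ℤ.- a₁) (ℤ.- a₂)))))

    term-mono : ∀ a₁ a₂ {P ω} → Bounded P ω →
      Defs.term K ℓ₁ ℓ₂ P ω a₁ a₂ ≋ mono (xm (ℤ.- a₁) (ℤ.- a₂)) ⊗ mono (WM P ω)
    term-mono a₁ a₂ b = term-gen _ (λ _ → refl) (λ _ → refl) a₁ a₂ b

  greedy-sum : ∀ a₁ a₂ → Defs.greedy K ℓ₁ ℓ₂ (a₁ , a₂) ≋ mono (xm (ℤ.- a₁) (ℤ.- a₂)) ⊗ Sχ (dyck K ℓ₁ ℓ₂ [ a₁ ]₊ [ a₂ ]₊)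
  greedy-sum a₁ a₂ = ≋-trans (gradings-SO P (λ ω → when (compat P ω) (Defs.term K ℓ₁ ℓ₂ P ω a₁ a₂)))
    (≋-trans (SO-cong P (λ ω b → ≋-trans (when-cong (compat P ω) (term-mono a₁ a₂ b)) (when-⊗ (compat P ω) (mono (xm (ℤ.- a₁) (ℤ.- a₂))) (mono (WM P ω)))))
      (≋-sym (SO-⊗ every P (mono (xm (ℤ.- a₁) (ℤ.- a₂))) (weigh (compat P) P))))
    where P = dyck K ℓ₁ ℓ₂ [ a₁ ]₊ [ a₂ ]₊

  gr : ℤ × ℤ → 𝕃
  gr = Defs.greedy K ℓ₁ ℓ₂

  xm⁻ : ℤ × ℤ → 𝕄
  xm⁻ (a₁ , a₂) = xm (ℤ.- a₁) (ℤ.- a₂)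

  greedy-Ĝ : ∀ q a → exp₁ q ≡ + 0 → exp₂ q ≡ + 0 → mono q ⊗ gr a ≋ Ĝ (q · xm⁻ a)
  greedy-Ĝ q a@(a₁ , a₂) e₁ e₂ = ≋-trans (⊗-congˡ (mono q) (greedy-sum a₁ a₂))
    (≋-trans (≋-sym (⊗-assoc (mono q) _ _)) (⊗-cong (mono-· q (xm⁻ a))
      (≋-reflexive (cong Sχ (cong₂ (λ i j → dyck K ℓ₁ ℓ₂ [ i ]₊ [ j ]₊) (back e₁ a₁) (back e₂ a₂))))))
    where
    back : ∀ {e} → e ≡ + 0 → ∀ i → i ≡ ℤ.- (e ℤ.+ ℤ.- i)
    back refl i = trans (sym (ℤP.neg-involutive i)) (cong ℤ.-_ (sym (ℤP.+-identityˡ (ℤ.- i))))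

  pure : 𝕄 → 𝕄
  pure (a , b , _ , _) = a , b , + 0 , + 0

  pure-· : ∀ m → m ≡ pure m · xm⁻ (ℤ.- exp₁ m , ℤ.- exp₂ m)
  pure-· (a , b , d , e) = pairs≡ (sym (trans (cong (Vec.zipWith ℤ._+_ a) refl) (VecZ a))) (sym (VecZ b))
    (sym (trans (ℤP.+-identityˡ _) (ℤP.neg-involutive d))) (sym (trans (ℤP.+-identityˡ _) (ℤP.neg-involutive e)))
    where
    VecZ : ∀ {n} (v : Vec ℤ n) → Vec.zipWith ℤ._+_ v (zeros n) ≡ v
    VecZ v = VecP.zipWith-identityʳ ℤP.+-identityʳ v

  Ĝ-greedy : ∀ m → Ĝ m ≋ mono (pure m) ⊗ gr (ℤ.- exp₁ m , ℤ.- exp₂ m)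
  Ĝ-greedy m = ≋-sym (≋-trans (greedy-Ĝ (pure m) (ℤ.- exp₁ m , ℤ.- exp₂ m) refl refl) (≋-reflexive (cong Ĝ (sym (pure-· m)))))

  Coeff : 𝕃 → Set ℓ
  Coeff = Defs.IsCoeffPoly K ℓ₁ ℓ₂

  lin : List (𝕃 × (ℤ × ℤ)) → 𝕃
  lin = Defs.linComb K ℓ₁ ℓ₂ gr

  lin-∷ : ∀ f a cs → lin ((f , a) ∷ cs) ≋ f ⊗ gr a ⊕ lin cs
  lin-∷ f a cs = ⊕-cong (≋-reflexive (sym (⊗-unfold f (gr a)))) ≋-refl

  span-to-combination : ∀ {f} → Span Ĝ Integral f →
    Σ (List (𝕃 × (ℤ × ℤ))) λ cs → All (λ t → Coeff (proj₁ t)) cs × f ≋ lin cs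
  span-to-combination (mkSpan cs a e) = proj₁ (go cs a) , proj₁ (proj₂ (go cs a)) , ≋-trans e (proj₂ (proj₂ (go cs a)))
    where
    coeff-poly : ∀ k m → Integral m → Coeff ((k , pure m) ∷ [])
    coeff-poly k m i n bad = cf-vanish {D = λ z → z ≡ pure m} {f = (k , pure m) ∷ []} (refl ∷ [])
      (λ { refl → bad (proj₁ i , proj₂ i , refl , refl) })
    scale-mono : ∀ k m g → scale k (mono m ⊗ g) ≋ ((k , m) ∷ []) ⊗ g
    scale-mono k m g = ext λ φ → K.trans (eval-scaled φ k (mono m ⊗ g)) (K.trans (K.*-congˡ (K.trans (eval-⊗ φ (mono m) g)
      (K.trans (K.+-identityʳ _) (K.*-identityˡ _)))) (K.sym (K.trans (eval-⊗ φ ((k , m) ∷ []) g) (K.+-identityʳ _))))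
    go : ∀ cs → AllM Integral cs → Σ (List (𝕃 × (ℤ × ℤ))) λ ds → All (λ t → Coeff (proj₁ t)) ds × T Ĝ cs ≋ lin ds
    go [] [] = [] , [] , ≋-reflexive (T-[] Ĝ)
    go ((k , m) ∷ cs) (i ∷ is) with go cs is
    ... | ds , p , e = (((k , pure m) ∷ []) , (ℤ.- exp₁ m , ℤ.- exp₂ m)) ∷ ds , coeff-poly k m i ∷ p ,
      ≋-trans (≋-reflexive (T-∷ Ĝ k m cs)) (≋-trans
        (⊕-cong (≋-trans (scale-cong k (Ĝ-greedy m)) (scale-mono k (pure m) (gr (ℤ.- exp₁ m , ℤ.- exp₂ m)))) e)
        (≋-sym (lin-∷ ((k , pure m) ∷ []) (ℤ.- exp₁ m , ℤ.- exp₂ m) ds)))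

  private
    Flat : 𝕄 → Set
    Flat m = exp₁ m ≡ + 0 × exp₂ m ≡ + 0

    Flat? : ∀ m → Dec (Flat m)
    Flat? m = (exp₁ m ℤ.≟ + 0) ×-dec (exp₂ m ℤ.≟ + 0)

    -- `Coeff` constrains coefficients only, so the list may still hold cancelling terms with powers
    -- of x₁ and x₂. They are discarded because `greedy-Ĝ` is applied term by term.
    flat : 𝕃 → 𝕃
    flat f = restrict Flat? f

    flat-≋ : ∀ f → Coeff f → f ≋ flat f
    flat-≋ f cf₀ = ≋-restrict Flat? f (λ m nf → cf₀ m (λ { (_ , _ , e₁ , e₂) → nf (e₁ , e₂) }))

    spread : List (𝕃 × (ℤ × ℤ)) → 𝕃
    spread []             = 𝟎
    spread ((f , a) ∷ cs) = flat f ⊗ mono (xm⁻ a) ⊕ spread cs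

    lin-spread : ∀ cs → All (λ t → Coeff (proj₁ t)) cs → lin cs ≋ T Ĝ (spread cs)
    lin-spread [] [] = ≋-reflexive (sym (T-[] Ĝ))
    lin-spread ((f , a) ∷ cs) (p ∷ ps) = ≋-trans (lin-∷ f a cs) (≋-trans (⊕-cong first (lin-spread cs ps))
      (≋-sym (T-++ Ĝ (flat f ⊗ mono (xm⁻ a)) (spread cs))))
      where
      shift-T : ∀ q → T Ĝ (mono q ⊗ mono (xm⁻ a)) ≋ Ĝ (q · xm⁻ a)
      shift-T q = ≋-trans (T-cong Ĝ (mono-· q (xm⁻ a))) (≋-trans (≋-reflexive (T-∷ Ĝ 1# (q · xm⁻ a) []))
        (ext λ φ → K.trans (eval-++ φ (scale 1# (Ĝ (q · xm⁻ a))) (T Ĝ [])) (K.trans (K.+-cong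
          (K.trans (eval-scaled φ 1# (Ĝ (q · xm⁻ a))) (K.*-identityˡ _)) (eval-≋ φ {T Ĝ []} {𝟎} (≋-reflexive (T-[] Ĝ)))) (K.+-identityʳ _))))
      first : f ⊗ gr a ≋ T Ĝ (flat f ⊗ mono (xm⁻ a))
      first = begin
        f ⊗ gr a                                           ≈⟨ ⊗-congʳ (gr a) (flat-≋ f p) ⟩
        flat f ⊗ gr a                                      ≈⟨ ⊗-as-T (flat f) (gr a) ⟩
        T (λ m → mono m ⊗ gr a) (flat f)
          ≈⟨ T-cong′ (flat f) (All.map (λ { {t} (e₁ , e₂) → ≋-trans (greedy-Ĝ (proj₂ t) a e₁ e₂) (≋-sym (shift-T (proj₂ t))) }) (restrict-all Flat? f)) ⟩
        T (λ m → T Ĝ (mono m ⊗ mono (xm⁻ a))) (flat f)     ≈⟨ T-T Ĝ (λ m → mono m ⊗ mono (xm⁻ a)) (flat f) ⟨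
        T Ĝ (T (λ m → mono m ⊗ mono (xm⁻ a)) (flat f))     ≈⟨ T-cong Ĝ (⊗-as-T (flat f) (mono (xm⁻ a))) ⟨
        T Ĝ (flat f ⊗ mono (xm⁻ a))                        ∎
        where open ≋-R

    -- Each `Ĝ m` is pointed at m, so `T Ĝ` is unitriangular and hence injective.
    spread-zero : ∀ cs → All (λ t → Coeff (proj₁ t)) cs → lin cs ≋ 𝟎 → spread cs ≋ 𝟎
    spread-zero cs p e .≋-at m = triangular {C = λ _ → ⊥} (λ _ → no (λ ()))
      (λ t → Lead-weaken (λ lt → lt , λ ()) (Ĝ-lead t)) (spread cs)
      (In-resp (≋-trans (≋-sym e) (lin-spread cs p)) In-𝟎) m (λ ())

    Above : ℤ × ℤ → 𝕄 → Set
    Above a m = exp₁ m ≡ ℤ.- proj₁ a × exp₂ m ≡ ℤ.- proj₂ a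

    flat-above : ∀ f a → AllM (Above a) (flat f ⊗ mono (xm⁻ a))
    flat-above f a = AllM-⊗ {E = _≡ xm⁻ a} {F = Above a} (λ { {m} (e₁ , e₂) refl →
        trans (cong (ℤ._+ ℤ.- proj₁ a) e₁) (ℤP.+-identityˡ _) , trans (cong (ℤ._+ ℤ.- proj₂ a) e₂) (ℤP.+-identityˡ _) })
      (restrict-all Flat? f) (refl ∷ [])

    spread-avoid : ∀ {a} cs → All (λ b → a ≢ b) (map proj₂ cs) → AllM (λ m → ¬ Above a m) (spread cs)
    spread-avoid [] [] = []
    spread-avoid {a} ((f , b) ∷ cs) (ne ∷ nes) = AllP.++⁺
      (All.map (λ { (e₁ , e₂) (e₁′ , e₂′) → ne (cong₂ _,_ (ℤP.neg-injective (trans (sym e₁′) e₁)) (ℤP.neg-injective (trans (sym e₂′) e₂))) }) (flat-above f b))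
      (spread-avoid cs nes)

    Above? : ∀ a m → Dec (Above a m)
    Above? a m = (exp₁ m ℤ.≟ ℤ.- proj₁ a) ×-dec (exp₂ m ℤ.≟ ℤ.- proj₂ a)

    -- Contributions of distinct indices have distinct x-exponents, so they cannot cancel each
    -- other.
    spread-split : ∀ {cs} → Unique (map proj₂ cs) → spread cs ≋ 𝟎 →
      All (λ t → flat (proj₁ t) ⊗ mono (xm⁻ (proj₂ t)) ≋ 𝟎) cs
    spread-split {[]} u e = []
    spread-split {(f , a) ∷ cs} (ne ∷ u) e = head≋0 ∷ spread-split u
        (≋-trans (≋-sym (⊕-cong head≋0 (≋-refl {spread cs}))) e)
      where
      head≋0 : flat f ⊗ mono (xm⁻ a) ≋ 𝟎
      head≋0 .≋-at m with Above? a m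
      ... | no ¬ab = cf-vanish (flat-above f a) ¬ab
      ... | yes ab = K.trans (K.sym (K.+-identityʳ _)) (K.trans (K.+-congˡ (K.sym (cf-vanish (spread-avoid cs ne) (λ n → n ab))))
        (K.trans (K.sym (cf-++ (flat f ⊗ mono (xm⁻ a)) (spread cs) m)) (e .≋-at m)))

  greedy-independent : ∀ cs → All (λ t → Coeff (proj₁ t)) cs → Unique (map proj₂ cs) → lin cs ≋ 𝟎 →
    All (λ t → proj₁ t ≋ 𝟎) cs
  greedy-independent cs p u e = All.zipWith (λ { {t} (p , z) → ≋-trans (flat-≋ (proj₁ t) p)
      (⊗-cancelʳ (Lead-mono (xm⁻ (proj₂ t))) (≋-trans z (≋-sym (𝕃.zeroˡ (mono (xm⁻ (proj₂ t))))))) })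
    (p , spread-split u (spread-zero cs p e))

NonNeg-induction : ∀ {p} n (Pr : Vec ℤ n → Set p) → Pr (zeros n) → (∀ j → j ℕ.< n → Pr (expAt n (suc j) (+ 1))) →
  (∀ {u v} → Pr u → Pr v → Pr (u ⊞ v)) → ∀ v → NonNeg v → Pr v
NonNeg-induction zero    Pr z e s []      _        = z
NonNeg-induction (suc n) Pr z e s (+ k ∷ v) (_ ∷ nn) = ≡.subst Pr
    (cong₂ _∷_ (ℤP.+-identityʳ (+ k)) (VecP.zipWith-identityˡ ℤP.+-identityˡ v))
    (s (first k) (NonNeg-induction n (λ v → Pr (+ 0 ∷ v)) z (λ j j<n → e (suc j) (s≤s j<n)) s v nn))
  where
  first : ∀ k → Pr (+ k ∷ zeros n)
  first zero    = z
  first (suc k) = ≡.subst Pr (cong (+ suc k ∷_) (zeros-⊞ n)) (s (e 0 (s≤s z≤n)) (first k))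

-- Standard monomials in x₀, x₁, x₂, x₃.

module StandardMonomials {c ℓ} (K : CommutativeRing c ℓ) (ℓ₁ ℓ₂ : ℕ) where

  open CommutativeRing K using (Carrier; _≈_; _+_; _*_; -_; 0#; 1#)
  private module K = CommutativeRing K
  open Elimination K ℓ₁ ℓ₂

  -- Up to a monomial in the p_{i,j}, a power of x₁ or x₃ times a power of x₂ or x₀, chosen by the
  -- signs of the two exponents.
  ẑ : 𝕄 → 𝕃
  ẑ m = W₁.w m ⊗ Q₁ ^ [ ℤ.- exp₂ m ]₊

  private
    0<exp : ∀ {i j} → + 0 ℤ.< i ℤ.+ j → j ≡ + 0 → + 0 ℤ.< i
    0<exp {i} lt refl = ≡.subst (+ 0 ℤ.<_) (ℤP.+-identityʳ i) lt

    0≤exp : ∀ {i j} → + 0 ℤ.< i ℤ.+ j → i ≡ + 0 → + 0 ℤ.≤ j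
    0≤exp {j = j} lt refl = ℤP.<⇒≤ (≡.subst (+ 0 ℤ.<_) (ℤP.+-identityˡ j) lt)

    Q₂^-in : ∀ k → In (λ n → + 0 ℤ.≤ exp₂ n) (Q₂ ^ k)
    Q₂^-in k = In-resp (≋-sym (L .split)) (In-⊕ (In-mono ℤP.≤-refl)
        (In-list (All.map (λ { {t} (_ , _ , d , e) → 0≤exp {exp₁ (proj₂ t)} {exp₂ (proj₂ t)} d e }) (L .higher))))
      where L = W₁.Q^-lead k

  -- A power of Q₁ is 1 plus terms of positive exponent in x₁, so multiplying `W₁.w m` by it only
  -- adds terms further to the right.
  ẑ-left : ∀ {m} → Integral m → exp₁ m ℤ.< + 0 →
    Σ 𝕃 λ h → Span W₁.w (λ n → Integral n × exp₁ m ℤ.< exp₁ n) h × ẑ m ≋ W₁.w m ⊕ h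
  ẑ-left {m} i _ = W₁.w m ⊗ r , Span-resp swap (W₁.span-lift in-D
        (λ { (_ , lt) → []₊-mono (ℤP.neg-mono-≤ (ℤP.<⇒≤ lt)) })
        (λ { {a} {b} (j , lt) j' e → Integral-· {a} {b} j j' ,
             ≡.subst (exp₁ m ℤ.<_) (sym (trans (cong (λ z → exp₁ a ℤ.+ z) e) (ℤP.+-identityʳ (exp₁ a)))) lt })) ,
      ≋-trans (⊗-congˡ (W₁.w m) (L .split)) (≋-trans (⊗-distribˡ (W₁.w m) (mono one) r) (⊕-cong (⊗-identityʳ (W₁.w m)) ≋-refl))
    where
    L = W₂.Q^-lead [ ℤ.- exp₂ m ]₊
    r = L .rest
    in-D : In (λ n → Integral n × exp₁ m ℤ.< exp₁ n) (mono m ⊗ r)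
    in-D = In-⊗ {D = _≡ m} {E = W₂.Corr} (λ { {n = n} refl (j , _ , d , e) → Integral-· {m} {n} i j ,
        ≡.subst (ℤ._< exp₁ m ℤ.+ exp₁ n) (ℤP.+-identityʳ (exp₁ m)) (ℤP.+-monoʳ-< (exp₁ m) (0<exp {exp₁ n} {exp₂ n} d e)) })
      (In-mono refl) (In-list (L .higher))
    swap : (mono m ⊗ r) ⊗ Q₂ ^ [ ℤ.- exp₁ m ]₊ ≋ W₁.w m ⊗ r
    swap = RI.*-swapʳ (mono m) r (Q₂ ^ [ ℤ.- exp₁ m ]₊)

  ẑ-right : ∀ {m} → Integral m → + 0 ℤ.≤ exp₁ m → ẑ m ≋ W₂.w m
  ẑ-right {m} _ le = ⊗-congʳ (Q₁ ^ [ ℤ.- exp₂ m ]₊) (W₁.w-plain le)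

  ẑ-V₂ : ∀ {m} → Integral m → W₂.V (ẑ m)
  ẑ-V₂ {m} _ = Span-resp (RI.*-swapʳ (mono m) (Q₁ ^ [ ℤ.- exp₂ m ]₊) (Q₂ ^ [ ℤ.- exp₁ m ]₊))
    (W₂.V-⊗ (Span-gen tt) (W₂.V-plain (Q₂^-in [ ℤ.- exp₁ m ]₊)))

  module _ {p} (S : 𝕃 → Set p) (S-resp : ∀ {f g} → f ≋ g → S f → S g)
    (S-⊕ : ∀ {f g} → S f → S g → S (f ⊕ g)) (S-⊗ : ∀ {f g} → S f → S g → S (f ⊗ g))
    (S-const : ∀ k → S (Defs.const K ℓ₁ ℓ₂ k))
    (S-p₁ : ∀ j → S (Defs.p₁ K ℓ₁ ℓ₂ j)) (S-p₂ : ∀ j → S (Defs.p₂ K ℓ₁ ℓ₂ j))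
    (S-x₀ : S (mono (xm (+ 0) (ℤ.- + 1)) ⊗ Q₁)) (S-x₁ : S ξ₁) (S-x₂ : S ξ₂)
    (S-x₃ : S (mono (xm (ℤ.- + 1) (+ 0)) ⊗ Q₂)) where

    private
      S-𝟎 : S 𝟎
      S-𝟎 = S-resp zero≋ (S-const 0#)
        where
        zero≋ : Defs.const K ℓ₁ ℓ₂ 0# ≋ 𝟎
        zero≋ = ext λ φ → K.trans (K.+-identityʳ _) (K.zeroˡ _)

      S-^ : ∀ {f} n → S f → S (f ^ n)
      S-^ {f} zero    s = S-resp (≋-reflexive (sym (^-zero f))) (S-const 1#)
      S-^ {f} (suc n) s = S-resp (≋-reflexive (sym (^-suc f n))) (S-⊗ s (S-^ n s))

      S-pm₁ : ∀ v → NonNeg v → S (mono (v , zeros ℓ₂ , + 0 , + 0))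
      S-pm₁ = NonNeg-induction ℓ₁ (λ v → S (mono (v , zeros ℓ₂ , + 0 , + 0))) (S-const 1#)
        (λ j j<ℓ → S-resp (≋-reflexive (p₁-mono (suc j) j<ℓ)) (S-p₁ (suc j)))
        (λ {u} {v} su sv → S-resp (≋-trans (mono-· _ _) (≋-reflexive (cong mono (pairs≡ refl (zeros-⊞ ℓ₂) refl refl)))) (S-⊗ su sv))

      S-pm₂ : ∀ v → NonNeg v → S (mono (zeros ℓ₁ , v , + 0 , + 0))
      S-pm₂ = NonNeg-induction ℓ₂ (λ v → S (mono (zeros ℓ₁ , v , + 0 , + 0))) (S-const 1#)
        (λ j j<ℓ → S-resp (≋-reflexive (p₂-mono (suc j) j<ℓ)) (S-p₂ (suc j)))
        (λ {u} {v} su sv → S-resp (≋-trans (mono-· _ _) (≋-reflexive (cong mono (pairs≡ (zeros-⊞ ℓ₁) refl refl refl)))) (S-⊗ su sv))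

      xm₁⁻-^ : ∀ n → xm (ℤ.- + 1) (+ 0) ^ᴹ n ≡ xm (ℤ.- + n) (+ 0)
      xm₁⁻-^ zero    = refl
      xm₁⁻-^ (suc n) = trans (cong (xm (ℤ.- + 1) (+ 0) ·_) (xm₁⁻-^ n)) (trans (xm-· (ℤ.- + 1) (+ 0) (ℤ.- + n) (+ 0))
        (cong (λ z → xm z (+ 0)) (sym (ℤP.neg-distrib-+ (+ 1) (+ n)))))

      xm₂⁻-^ : ∀ n → xm (+ 0) (ℤ.- + 1) ^ᴹ n ≡ xm (+ 0) (ℤ.- + n)
      xm₂⁻-^ zero    = refl
      xm₂⁻-^ (suc n) = trans (cong (xm (+ 0) (ℤ.- + 1) ·_) (xm₂⁻-^ n)) (trans (xm-· (+ 0) (ℤ.- + 1) (+ 0) (ℤ.- + n))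
        (cong (λ z → xm (+ 0) z) (sym (ℤP.neg-distrib-+ (+ 1) (+ n)))))

      S-left : ∀ d → S (mono (xm d (+ 0)) ⊗ Q₂ ^ [ ℤ.- d ]₊)
      S-left (+ n) = S-resp (≋-trans (mono-^ (xm (+ 1) (+ 0)) n) (≋-trans (≋-reflexive (cong mono (xm₁-^ n)))
          (≋-sym (≋-trans (⊗-congˡ (mono (xm (+ n) (+ 0))) (≋-reflexive (trans (cong (Q₂ ^_) ([-]₊≡0 {+ n} (ℤ.+≤+ z≤n))) (^-zero Q₂)))) (⊗-identityʳ _)))))
        (S-^ n S-x₁)
      S-left -[1+ n ] = S-resp (≋-trans (⊗-^ _ Q₂ (suc n)) (⊗-congʳ (Q₂ ^ suc n)
          (≋-trans (mono-^ _ (suc n)) (≋-reflexive (cong mono (xm₁⁻-^ (suc n))))))) (S-^ (suc n) S-x₃)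

      S-right : ∀ d → S (mono (xm (+ 0) d) ⊗ Q₁ ^ [ ℤ.- d ]₊)
      S-right (+ n) = S-resp (≋-trans (mono-^ (xm (+ 0) (+ 1)) n) (≋-trans (≋-reflexive (cong mono (xm₂-^ n)))
          (≋-sym (≋-trans (⊗-congˡ (mono (xm (+ 0) (+ n))) (≋-reflexive (trans (cong (Q₁ ^_) ([-]₊≡0 {+ n} (ℤ.+≤+ z≤n))) (^-zero Q₁)))) (⊗-identityʳ _)))))
        (S-^ n S-x₂)
      S-right -[1+ n ] = S-resp (≋-trans (⊗-^ _ Q₁ (suc n)) (⊗-congʳ (Q₁ ^ suc n)
          (≋-trans (mono-^ _ (suc n)) (≋-reflexive (cong mono (xm₂⁻-^ (suc n))))))) (S-^ (suc n) S-x₀)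

      S-ẑ : ∀ m → Integral m → S (ẑ m)
      S-ẑ m@(a , b , d , e) (i , j) = S-resp regroup (S-⊗ (S-⊗ (S-pm₁ a i) (S-pm₂ b j)) (S-⊗ (S-left d) (S-right e)))
        where
        m≡ : ((a , zeros ℓ₂ , + 0 , + 0) · (zeros ℓ₁ , b , + 0 , + 0)) · (xm d (+ 0) · xm (+ 0) e) ≡ m
        m≡ = trans (cong (_· (xm d (+ 0) · xm (+ 0) e)) (pairs≡ {d = + 0} {+ 0} {+ 0} {+ 0} (VecP.zipWith-identityʳ ℤP.+-identityʳ a) (VecP.zipWith-identityˡ ℤP.+-identityˡ b) refl refl))
          (trans (cong ((a , b , + 0 , + 0) ·_) (xm-· d (+ 0) (+ 0) e))
            (pairs≡ (VecP.zipWith-identityʳ ℤP.+-identityʳ a) (VecP.zipWith-identityʳ ℤP.+-identityʳ b)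
              (trans (ℤP.+-identityˡ _) (ℤP.+-identityʳ d)) (trans (ℤP.+-identityˡ _) (ℤP.+-identityˡ e))))
        regroup : (mono (a , zeros ℓ₂ , + 0 , + 0) ⊗ mono (zeros ℓ₁ , b , + 0 , + 0)) ⊗
          ((mono (xm d (+ 0)) ⊗ Q₂ ^ [ ℤ.- d ]₊) ⊗ (mono (xm (+ 0) e) ⊗ Q₁ ^ [ ℤ.- e ]₊)) ≋ ẑ m
        regroup = begin
          A ⊗ ((D ⊗ q₂) ⊗ (H ⊗ q₁))   ≈⟨ ⊗-congˡ A (RI.*-interchange D q₂ H q₁) ⟩
          A ⊗ ((D ⊗ H) ⊗ (q₂ ⊗ q₁))   ≈⟨ ⊗-assoc A (D ⊗ H) (q₂ ⊗ q₁) ⟨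
          (A ⊗ (D ⊗ H)) ⊗ (q₂ ⊗ q₁)
            ≈⟨ ⊗-congʳ (q₂ ⊗ q₁) (≋-trans (⊗-cong (mono-· _ _) (mono-· _ _)) (≋-trans (mono-· _ _) (≋-reflexive (cong mono m≡)))) ⟩
          mono m ⊗ (q₂ ⊗ q₁)          ≈⟨ ⊗-assoc (mono m) q₂ q₁ ⟨
          (mono m ⊗ q₂) ⊗ q₁          ∎
          where
          open ≋-R
          A = mono (a , zeros ℓ₂ , + 0 , + 0) ⊗ mono (zeros ℓ₁ , b , + 0 , + 0)
          D = mono (xm d (+ 0))
          H = mono (xm (+ 0) e)
          q₂ = Q₂ ^ [ ℤ.- d ]₊
          q₁ = Q₁ ^ [ ℤ.- e ]₊

    standard-span : ∀ {f} → Span ẑ Integral f → S f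
    standard-span (mkSpan cs a e) = S-resp (≋-sym e) (go cs a)
      where
      const-scale : ∀ k f → Defs.const K ℓ₁ ℓ₂ k ⊗ f ≋ scale k f
      const-scale k f = ext λ φ → K.trans (eval-⊗ φ (Defs.const K ℓ₁ ℓ₂ k) f) (K.trans (K.+-identityʳ _)
        (K.trans (K.*-congˡ (eval-cong′ f (λ t → K.reflexive (cong φ (·-identityˡ t))))) (K.sym (eval-scaled φ k f))))
      go : ∀ cs → AllM Integral cs → S (T ẑ cs)
      go [] [] = S-resp (≋-reflexive (sym (T-[] ẑ))) S-𝟎
      go ((k , m) ∷ cs) (i ∷ is) = S-resp (≋-reflexive (sym (T-∷ ẑ k m cs)))
        (S-⊕ (S-resp (const-scale k (ẑ m)) (S-⊗ (S-const k) (S-ẑ m i))) (go cs is))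

-- Sign-coherence in a rank 2 root system.

module Denominators where

  open import Data.Integer using (_+_; _*_; -_; _-_; _≤_; _<_)

  data Sign (u v : ℤ) : Set where
    pos : + 0 ≤ u → + 0 ≤ v → Sign u v
    neg : u ≤ + 0 → v ≤ + 0 → Sign u v

  -- The sign of the form on consecutive vectors. It is negative only when both are negative, as for
  -- the initial pair (-1, 0), (0, -1).
  β : ∀ {u v u' v'} → Sign u v → Sign u' v' → ℤ
  β (neg _ _) (neg _ _) = ℤ.- + 1
  β _         _         = + 1

  module _ (L₁ L₂ : ℤ) where

    q : ℤ → ℤ → ℤ
    q u v = L₂ * (u * u) - L₁ * L₂ * (u * v) + L₁ * (v * v)

    B : ℤ → ℤ → ℤ → ℤ → ℤ
    B u v u' v' = + 2 * (L₂ * (u * u')) - L₁ * L₂ * (u * v' + v * u') + + 2 * (L₁ * (v * v'))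

    -- Consecutive denominator vectors (s₁, s₂), (y₁, y₂) are real roots of the rank 2 root system
    -- with invariant form q: B is the polarisation of q, and they form a positively oriented basis.
    record State (λs λy s₁ s₂ y₁ y₂ : ℤ) : Set where
      field
        det   : s₁ * y₂ - s₂ * y₁ ≡ + 1
        q-s   : λs * q s₁ s₂ ≡ L₁ * L₂
        q-y   : λy * q y₁ y₂ ≡ L₁ * L₂
        sgn-s : Sign s₁ s₂
        sgn-y : Sign y₁ y₂
        form  : B s₁ s₂ y₁ y₂ ≡ β sgn-s sgn-y * (L₁ * L₂)

    private
      move : ∀ {a b d : ℤ} → a + b ≡ d → b ≡ d - a
      move {a} {b} refl = lemma a b
        where
        lemma : ∀ a b → b ≡ a + b - a
        lemma = solve-∀

    β-posʳ : ∀ {u v u' v'} (s : Sign u v) (y : Sign u' v') → + 0 < u' ⊎ + 0 < v' → β s y ≡ + 1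
    β-posʳ (pos _ _) y         h = refl
    β-posʳ (neg _ _) (pos _ _) h = refl
    β-posʳ (neg _ _) (neg a b) (inj₁ h) = ⊥-elim (ℤP.≤⇒≯ a h)
    β-posʳ (neg _ _) (neg a b) (inj₂ h) = ⊥-elim (ℤP.≤⇒≯ b h)

    private
      det-pos : ∀ λy s₁ s₂ y₁ y₂ → y₁ * (λy * y₂ - s₂) - y₂ * (λy * y₁ - s₁) ≡ s₁ * y₂ - s₂ * y₁
      det-pos = solve-∀

      det-neg : ∀ s₁ s₂ y₁ y₂ → y₁ * (+ 0 - s₂) - y₂ * (+ 0 - s₁) ≡ s₁ * y₂ - s₂ * y₁
      det-neg = solve-∀

      q-pos : ∀ L₁ L₂ λs λy s₁ s₂ y₁ y₂ →
        λs * (L₂ * ((λy * y₁ - s₁) * (λy * y₁ - s₁)) - L₁ * L₂ * ((λy * y₁ - s₁) * (λy * y₂ - s₂)) + L₁ * ((λy * y₂ - s₂) * (λy * y₂ - s₂)))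
        ≡ λs * (L₂ * (s₁ * s₁) - L₁ * L₂ * (s₁ * s₂) + L₁ * (s₂ * s₂))
          + λs * λy * (λy * (L₂ * (y₁ * y₁) - L₁ * L₂ * (y₁ * y₂) + L₁ * (y₂ * y₂))
            - (+ 2 * (L₂ * (s₁ * y₁)) - L₁ * L₂ * (s₁ * y₂ + s₂ * y₁) + + 2 * (L₁ * (s₂ * y₂))))
      q-pos = solve-∀

      q-neg : ∀ L₁ L₂ s₁ s₂ → L₂ * ((+ 0 - s₁) * (+ 0 - s₁)) - L₁ * L₂ * ((+ 0 - s₁) * (+ 0 - s₂)) + L₁ * ((+ 0 - s₂) * (+ 0 - s₂))
        ≡ L₂ * (s₁ * s₁) - L₁ * L₂ * (s₁ * s₂) + L₁ * (s₂ * s₂)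
      q-neg = solve-∀

      B-pos : ∀ L₁ L₂ λy s₁ s₂ y₁ y₂ →
        + 2 * (L₂ * (y₁ * (λy * y₁ - s₁))) - L₁ * L₂ * (y₁ * (λy * y₂ - s₂) + y₂ * (λy * y₁ - s₁)) + + 2 * (L₁ * (y₂ * (λy * y₂ - s₂)))
        ≡ + 2 * (λy * (L₂ * (y₁ * y₁) - L₁ * L₂ * (y₁ * y₂) + L₁ * (y₂ * y₂)))
          - (+ 2 * (L₂ * (s₁ * y₁)) - L₁ * L₂ * (s₁ * y₂ + s₂ * y₁) + + 2 * (L₁ * (s₂ * y₂)))
      B-pos = solve-∀

      B-neg : ∀ L₁ L₂ s₁ s₂ y₁ y₂ →
        + 2 * (L₂ * (y₁ * (+ 0 - s₁))) - L₁ * L₂ * (y₁ * (+ 0 - s₂) + y₂ * (+ 0 - s₁)) + + 2 * (L₁ * (y₂ * (+ 0 - s₂)))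
        ≡ - (+ 2 * (L₂ * (s₁ * y₁)) - L₁ * L₂ * (s₁ * y₂ + s₂ * y₁) + + 2 * (L₁ * (s₂ * y₂)))
      B-neg = solve-∀

      sum-1 : ∀ a b d e → a ℕ.* suc d ℕ.+ b ℕ.* suc e ≡ 1 → (a ≡ 1 × b ≡ 0) ⊎ (a ≡ 0 × b ≡ 1 × e ≡ 0)
      sum-1 zero    (suc zero)    d e h = inj₂ (refl , refl , trans (sym (ℕP.+-identityʳ e)) (ℕP.suc-injective h))
      sum-1 (suc zero) zero       d e h = inj₁ (refl , refl)
      sum-1 zero    (suc (suc b)) d e h with ℕP.suc-injective h
      ... | h' = ⊥-elim (ℕP.m+1+n≢0 e h')
      sum-1 (suc zero) (suc b)    d e h = ⊥-elim (ℕP.m+1+n≢0 (d ℕ.+ 0) (ℕP.suc-injective h))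
      sum-1 (suc (suc a)) b       d e h with ℕP.suc-injective h
      ... | h' = ⊥-elim (ℕP.m+1+n≢0 d (ℕP.m+n≡0⇒m≡0 (d ℕ.+ suc (d ℕ.+ a ℕ.* suc d)) h'))

    module _ (0<L₁ : + 0 < L₁) where

      -- The determinant of (y, t) is again 1. Together with y ≥ 0 this excludes one mixed sign
      -- pattern of t and leaves only unit vectors y for the other.
      coherent : ∀ {λs λy s₁ s₂ y₁ y₂ t₁ t₂} → + 0 < λy → State λs λy s₁ s₂ y₁ y₂ → + 0 ≤ y₁ → + 0 ≤ y₂ →
        s₁ + t₁ ≡ λy * y₁ → s₂ + t₂ ≡ λy * y₂ → Sign t₁ t₂
      coherent {t₁ = + _}       {+ _}       _ _ _ _ _ _ = pos (ℤ.+≤+ z≤n) (ℤ.+≤+ z≤n)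
      coherent {t₁ = + zero}    { -[1+ _ ]} _ _ _ _ _ _ = neg (ℤ.+≤+ z≤n) ℤ.-≤+
      coherent {t₁ = -[1+ _ ]}  { -[1+ _ ]} _ _ _ _ _ _ = neg ℤ.-≤+ ℤ.-≤+
      coherent {t₁ = -[1+ _ ]}  {+ zero}    _ _ _ _ _ _ = neg ℤ.-≤+ (ℤ.+≤+ z≤n)
      -- With t₁ > 0 > t₂ both contributions to the determinant are at most 0, so it cannot equal 1.
      coherent {λs} {λy} {s₁} {s₂} {+ a} {+ b} {+ suc g} { -[1+ d ]} 0<λ st _ _ e₁ e₂ = ⊥-elim (absurd a b det-t)
        where
        open State st
        det-t : + a * -[1+ d ] - + b * + suc g ≡ + 1
        det-t = trans (cong₂ (λ u v → + a * u - + b * v) (move {s₂} { -[1+ d ]} e₂) (move {s₁} {+ suc g} e₁)) (trans (det-pos λy s₁ s₂ (+ a) (+ b)) det)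
        absurd : ∀ a b → + a * -[1+ d ] - + b * + suc g ≡ + 1 → ⊥
        absurd zero    zero    ()
        absurd zero    (suc b) ()
        absurd (suc a) zero    ()
        absurd (suc a) (suc b) ()
      -- With t₁ < 0 < t₂ the determinant is a sum of nonnegative products equal to 1, which forces
      -- y to be (1, 0) or (0, 1).
      coherent {λs} {λy} {s₁} {s₂} {+ a} {+ b} { -[1+ g ]} {+ suc d} 0<λ st _ _ e₁ e₂ with sum-1 a b d g det-ℕ
        where
        open State st
        det-t : + a * + suc d - + b * -[1+ g ] ≡ + 1
        det-t = trans (cong₂ (λ u v → + a * u - + b * v) (move {s₂} {+ suc d} e₂) (move {s₁} { -[1+ g ]} e₁)) (trans (det-pos λy s₁ s₂ (+ a) (+ b)) det)
        to-+ : ∀ x y z w → x * y - z * (- w) ≡ x * y + z * w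
        to-+ = solve-∀
        det-ℕ : a ℕ.* suc d ℕ.+ b ℕ.* suc g ≡ 1
        det-ℕ = ℤP.+-injective (trans (cong₂ _+_ (ℤP.pos-* a (suc d)) (ℤP.pos-* b (suc g)))
          (trans (sym (to-+ (+ a) (+ suc d) (+ b) (+ suc g))) det-t))
      -- For y = (1, 0) the previous vector s would itself have s₁ > 0 > s₂.
      ... | inj₁ (refl , refl) = ⊥-elim (mixed (State.sgn-s st))
        where
        s₁≡ : s₁ ≡ λy + + suc g
        s₁≡ = trans (move { -[1+ g ]} {s₁} (trans (ℤP.+-comm -[1+ g ] s₁) e₁)) (cong (_+ + suc g) (ℤP.*-identityʳ λy))
        s₂≡ : s₂ ≡ -[1+ d ]
        s₂≡ = trans (move {+ suc d} {s₂} (trans (ℤP.+-comm (+ suc d) s₂) e₂)) (cong (_+ -[1+ d ]) (ℤP.*-zeroʳ λy))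
        mixed : Sign s₁ s₂ → ⊥
        mixed (pos _ p) = ℤP.≤⇒≯ p (≡.subst (_< + 0) (sym s₂≡) ℤ.-<+)
        mixed (neg p _) = ℤP.≤⇒≯ p (≡.subst (+ 0 <_) (sym s₁≡) (ℤP.+-mono-< 0<λ (ℤ.+<+ (s≤s z≤n))))
      -- For y = (0, 1) signs alone give no contradiction. The norm of y gives λy L₁ = L₁L₂, and the
      -- value of `form` then gives 2 L₁ t₂ = 0, although L₁ and t₂ are positive.
      ... | inj₂ (refl , refl , refl) = ⊥-elim (ℤP.<-irrefl (sym zero-prod) (positive L₁ 0<L₁))
        where
        open State st
        s₁≡ : s₁ ≡ + 1
        s₁≡ = trans (move { -[1+ 0 ]} {s₁} (trans (ℤP.+-comm -[1+ 0 ] s₁) e₁)) (cong (_+ + 1) (ℤP.*-zeroʳ λy))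
        s₂≡ : s₂ ≡ λy - + suc d
        s₂≡ = trans (move {+ suc d} {s₂} (trans (ℤP.+-comm (+ suc d) s₂) e₂)) (cong (_+ -[1+ d ]) (ℤP.*-identityʳ λy))
        q-01 : ∀ L₁ L₂ λy → λy * (L₂ * (+ 0 * + 0) - L₁ * L₂ * (+ 0 * + 1) + L₁ * (+ 1 * + 1)) ≡ λy * L₁
        q-01 = solve-∀
        λL : λy * L₁ ≡ L₁ * L₂
        λL = trans (sym (q-01 L₁ L₂ λy)) q-y
        B-01 : ∀ L₁ L₂ λy D → + 2 * (L₂ * (+ 1 * + 0)) - L₁ * L₂ * (+ 1 * + 1 + (λy - D) * + 0) + + 2 * (L₁ * ((λy - D) * + 1))
                 ≡ + 2 * (λy * L₁) - L₁ * L₂ - + 2 * (L₁ * D)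
        B-01 = solve-∀
        B≡ : B s₁ s₂ (+ 0) (+ 1) ≡ + 1 * (L₁ * L₂)
        B≡ = trans form (cong (_* (L₁ * L₂)) (β-posʳ sgn-s sgn-y (inj₂ (ℤ.+<+ (s≤s z≤n)))))
        two : + 2 * (λy * L₁) - L₁ * L₂ - + 2 * (L₁ * + suc d) ≡ + 1 * (L₁ * L₂)
        two = trans (sym (B-01 L₁ L₂ λy (+ suc d))) (trans (sym (cong₂ (λ u v → B u v (+ 0) (+ 1)) s₁≡ s₂≡)) B≡)
        isolate : ∀ p x → + 2 * p - p - + 2 * x ≡ + 1 * p → + 2 * x ≡ + 0
        isolate p x h = trans (lemma p x) (trans (cong (λ z → p - z) h) (lemma' p))
          where
          lemma : ∀ p x → + 2 * x ≡ p - (+ 2 * p - p - + 2 * x)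
          lemma = solve-∀
          lemma' : ∀ p → p - + 1 * p ≡ + 0
          lemma' = solve-∀
        zero-prod : + 2 * (L₁ * + suc d) ≡ + 0
        zero-prod = isolate (L₁ * L₂) (L₁ * + suc d) (≡.subst (λ z → + 2 * z - L₁ * L₂ - + 2 * (L₁ * + suc d) ≡ + 1 * (L₁ * L₂)) λL two)
        positive : ∀ L → + 0 < L → + 0 < + 2 * (L * + suc d)
        positive (+ zero)  (ℤ.+<+ ())
        positive (+ suc l) _ = ℤ.+<+ (s≤s z≤n)

      -- Since B(s, y) = L₁L₂ = λy q(y), the vector t = λy y - s is the negative of the reflection
      -- of s in y. Hence q(t) = q(s), and the form on (y, t) keeps its value.
      step-pos : ∀ {λs λy s₁ s₂ y₁ y₂ t₁ t₂} → + 0 < λy → State λs λy s₁ s₂ y₁ y₂ → + 0 ≤ y₁ → + 0 ≤ y₂ →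
        (+ 0 < y₁ ⊎ + 0 < y₂) → s₁ + t₁ ≡ λy * y₁ → s₂ + t₂ ≡ λy * y₂ → State λy λs y₁ y₂ t₁ t₂
      step-pos {λs} {λy} {s₁} {s₂} {y₁} {y₂} {t₁} {t₂} 0<λ st p₁ p₂ nz e₁ e₂ = record
        { det = trans (cong₂ (λ u v → y₁ * v - y₂ * u) m₁ m₂) (trans (det-pos λy s₁ s₂ y₁ y₂) det)
        ; q-s = q-y
        ; q-y = trans (cong₂ (λ u v → λs * q u v) m₁ m₂) (trans (q-pos L₁ L₂ λs λy s₁ s₂ y₁ y₂)
            (trans (cong₂ (λ u v → u + λs * λy * v) q-s (trans (cong₂ _-_ q-y form₁) (ℤP.+-inverseʳ (L₁ * L₂))))
              (trans (cong (λ z → L₁ * L₂ + z) (ℤP.*-zeroʳ (λs * λy))) (ℤP.+-identityʳ _))))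
        ; sgn-s = pos p₁ p₂
        ; sgn-y = sgn-t
        ; form = trans (cong₂ (λ u v → B y₁ y₂ u v) m₁ m₂) (trans (B-pos L₁ L₂ λy s₁ s₂ y₁ y₂)
            (trans (cong₂ (λ u v → + 2 * u - v) q-y form₁) (trans (twice (L₁ * L₂)) (cong (_* (L₁ * L₂)) (β-posˡ sgn-t)))))
        }
        where
        open State st
        m₁ : t₁ ≡ λy * y₁ - s₁
        m₁ = move {s₁} {t₁} e₁
        m₂ : t₂ ≡ λy * y₂ - s₂
        m₂ = move {s₂} {t₂} e₂
        sgn-t : Sign t₁ t₂
        sgn-t = coherent 0<λ st p₁ p₂ e₁ e₂
        form₁ : B s₁ s₂ y₁ y₂ ≡ L₁ * L₂
        form₁ = trans form (trans (cong (_* (L₁ * L₂)) (β-posʳ sgn-s sgn-y nz)) (ℤP.*-identityˡ _))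
        twice : ∀ p → + 2 * p - p ≡ + 1 * p
        twice = solve-∀
        β-posˡ : ∀ {u v} (t : Sign u v) → + 1 ≡ β (pos p₁ p₂) t
        β-posˡ (pos _ _) = refl
        β-posˡ (neg _ _) = refl

      -- Negative y belongs to a variable of positive degree: the lowest term of its exchange
      -- polynomial is 1, so the neighbouring vectors are opposite.
      step-neg : ∀ {λs λy s₁ s₂ y₁ y₂ t₁ t₂} → State λs λy s₁ s₂ y₁ y₂ → y₁ ≤ + 0 → y₂ ≤ + 0 → (y₁ < + 0 ⊎ y₂ < + 0) →
        s₁ + t₁ ≡ + 0 → s₂ + t₂ ≡ + 0 → State λy λs y₁ y₂ t₁ t₂
      step-neg {λs} {λy} {s₁} {s₂} {y₁} {y₂} {t₁} {t₂} st n₁ n₂ nz e₁ e₂ = record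
        { det = trans (cong₂ (λ u v → y₁ * v - y₂ * u) m₁ m₂) (trans (det-neg s₁ s₂ y₁ y₂) det)
        ; q-s = q-y
        ; q-y = trans (cong₂ (λ u v → λs * q u v) m₁ m₂) (trans (cong (λs *_) (q-neg L₁ L₂ s₁ s₂)) q-s)
        ; sgn-s = neg n₁ n₂
        ; sgn-y = flip sgn-s
        ; form = trans (cong₂ (λ u v → B y₁ y₂ u v) m₁ m₂) (trans (B-neg L₁ L₂ s₁ s₂ y₁ y₂)
            (trans (cong (λ z → - z) form) (flip-β sgn-s sgn-y)))
        }
        where
        open State st
        m₁ : t₁ ≡ + 0 - s₁
        m₁ = move {s₁} {t₁} e₁
        m₂ : t₂ ≡ + 0 - s₂
        m₂ = move {s₂} {t₂} e₂
        opp : ∀ {s t : ℤ} → s + t ≡ + 0 → t ≡ - s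
        opp {s} {t} e = trans (move {s} {t} e) (ℤP.+-identityˡ (- s))
        flip : Sign s₁ s₂ → Sign t₁ t₂
        flip (pos a b) = neg (≡.subst (_≤ + 0) (sym (opp {s₁} {t₁} e₁)) (ℤP.neg-mono-≤ a)) (≡.subst (_≤ + 0) (sym (opp {s₂} {t₂} e₂)) (ℤP.neg-mono-≤ b))
        flip (neg a b) = pos (≡.subst (+ 0 ≤_) (sym (opp {s₁} {t₁} e₁)) (ℤP.neg-mono-≤ a)) (≡.subst (+ 0 ≤_) (sym (opp {s₂} {t₂} e₂)) (ℤP.neg-mono-≤ b))
        flip-β : (s : Sign s₁ s₂) (y : Sign y₁ y₂) → - (β s y * (L₁ * L₂)) ≡ β (neg n₁ n₂) (flip s) * (L₁ * L₂)
        flip-β (pos _ _) y         = ℤP.neg-distribˡ-* (+ 1) (L₁ * L₂)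
        flip-β (neg _ _) (neg _ _) = ℤP.neg-distribˡ-* (ℤ.- + 1) (L₁ * L₂)
        flip-β (neg _ _) (pos a b) = ⊥-elim (absurd nz)
          where
          absurd : y₁ < + 0 ⊎ y₂ < + 0 → ⊥
          absurd (inj₁ h) = ℤP.≤⇒≯ a h
          absurd (inj₂ h) = ℤP.≤⇒≯ b h

  -- Exchanging the two coordinates and the order of the vectors preserves orientation, so steps to
  -- smaller indices reduce to steps to larger ones.
  State-swap : ∀ {L₁ L₂ λs λy s₁ s₂ y₁ y₂} → State L₁ L₂ λs λy s₁ s₂ y₁ y₂ → State L₂ L₁ λy λs y₂ y₁ s₂ s₁
  State-swap {L₁} {L₂} {λs} {λy} {s₁} {s₂} {y₁} {y₂} st = record
    { det = trans (d s₁ s₂ y₁ y₂) det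
    ; q-s = trans (cong (λy *_) (q-swap L₁ L₂ y₁ y₂)) (trans q-y (ℤP.*-comm L₁ L₂))
    ; q-y = trans (cong (λs *_) (q-swap L₁ L₂ s₁ s₂)) (trans q-s (ℤP.*-comm L₁ L₂))
    ; sgn-s = sw sgn-y
    ; sgn-y = sw sgn-s
    ; form = trans (B-swap L₁ L₂ s₁ s₂ y₁ y₂) (trans form (cong₂ _*_ (β-swap sgn-s sgn-y) (ℤP.*-comm L₁ L₂)))
    }
    where
    open State st
    d : ∀ s₁ s₂ y₁ y₂ → y₂ * s₁ - y₁ * s₂ ≡ s₁ * y₂ - s₂ * y₁
    d = solve-∀
    q-swap : ∀ L₁ L₂ u v → L₁ * (v * v) - L₂ * L₁ * (v * u) + L₂ * (u * u) ≡ L₂ * (u * u) - L₁ * L₂ * (u * v) + L₁ * (v * v)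
    q-swap = solve-∀
    B-swap : ∀ L₁ L₂ s₁ s₂ y₁ y₂ → + 2 * (L₁ * (y₂ * s₂)) - L₂ * L₁ * (y₂ * s₁ + y₁ * s₂) + + 2 * (L₂ * (y₁ * s₁))
      ≡ + 2 * (L₂ * (s₁ * y₁)) - L₁ * L₂ * (s₁ * y₂ + s₂ * y₁) + + 2 * (L₁ * (s₂ * y₂))
    B-swap = solve-∀
    sw : ∀ {u v} → Sign u v → Sign v u
    sw (pos a b) = pos b a
    sw (neg a b) = neg b a
    β-swap : ∀ {u v u' v'} (s : Sign u v) (y : Sign u' v') → β s y ≡ β (sw y) (sw s)
    β-swap (pos _ _) (pos _ _) = refl
    β-swap (pos _ _) (neg _ _) = refl
    β-swap (neg _ _) (pos _ _) = refl
    β-swap (neg _ _) (neg _ _) = refl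

-- Residue classes of indices modulo 4.

data Class : Set where
  C₁ C₂ C₃ C₀ : Class

next : Class → Class
next C₁ = C₂
next C₂ = C₃
next C₃ = C₀
next C₀ = C₁

private
  of4 : ℕ → Class
  of4 1 = C₁
  of4 2 = C₂
  of4 3 = C₃
  of4 _ = C₀

  -- The class of the negative of a residue.
  of4⁻ : ℕ → Class
  of4⁻ 1 = C₃
  of4⁻ 2 = C₂
  of4⁻ 3 = C₁
  of4⁻ _ = C₀

cls : ℤ → Class
cls k = of4 (k %ℕ 4)

private
  cls-neg : ∀ n → cls -[1+ n ] ≡ of4⁻ (suc n ℕ.% 4)
  cls-neg n with suc n ℕ.% 4
  ... | 0 = refl
  ... | 1 = refl
  ... | 2 = refl
  ... | 3 = refl
  ... | suc (suc (suc (suc r))) = cong of4 (ℕP.0∸n≡0 r)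

  cls-suc⁺ : ∀ n → of4 ((n ℕ.+ 1) ℕ.% 4) ≡ next (of4 (n ℕ.% 4))
  cls-suc⁺ 0 = refl
  cls-suc⁺ 1 = refl
  cls-suc⁺ 2 = refl
  cls-suc⁺ 3 = refl
  cls-suc⁺ (suc (suc (suc (suc n)))) = cls-suc⁺ n

  cls-suc⁻ : ∀ n → of4⁻ (suc n ℕ.% 4) ≡ next (of4⁻ (suc (suc n) ℕ.% 4))
  cls-suc⁻ 0 = refl
  cls-suc⁻ 1 = refl
  cls-suc⁻ 2 = refl
  cls-suc⁻ 3 = refl
  cls-suc⁻ (suc (suc (suc (suc n)))) = cls-suc⁻ n

cls-suc : ∀ k → cls (k ℤ.+ + 1) ≡ next (cls k)
cls-suc (+ n)          = cls-suc⁺ n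
cls-suc -[1+ zero ]    = refl
cls-suc -[1+ suc n ]   = trans (cls-neg n) (trans (cls-suc⁻ n) (cong next (sym (cls-neg (suc n)))))

ℤ-induction : ∀ {p} (P : ℤ → Set p) → P (+ 0) → (∀ k → P k → P (k ℤ.+ + 1)) → (∀ k → P (k ℤ.+ + 1) → P k) → ∀ k → P k
ℤ-induction P z up down = go
  where
  go⁺ : ∀ n → P (+ n)
  go⁺ zero    = z
  go⁺ (suc n) = ≡.subst (P ∘ +_) (ℕP.+-comm n 1) (up (+ n) (go⁺ n))
  go⁻ : ∀ n → P -[1+ n ]
  go⁻ zero    = down -[1+ 0 ] z
  go⁻ (suc n) = down -[1+ suc n ] (go⁻ n)
  go : ∀ k → P k
  go (+ n)    = go⁺ n
  go -[1+ n ] = go⁻ n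

-- Exchange polynomials and mutation.

module Exchange {c ℓ} (K : CommutativeRing c ℓ) (ℓ₁ ℓ₂ : ℕ) where

  open Elimination K ℓ₁ ℓ₂

  Σ≤ : ℕ → (ℕ → 𝕃) → 𝕃
  Σ≤ n F = F 0 ⊕ Σ₁′ n F

  Σ≤-cong : ∀ n {F G : ℕ → 𝕃} → (∀ j → j ℕ.≤ n → F j ≋ G j) → Σ≤ n F ≋ Σ≤ n G
  Σ≤-cong n h = ⊕-cong (h 0 z≤n) (Σ₁-cong n (λ j _ le → h j le))

  ⊗-Σ≤ : ∀ f n F → f ⊗ Σ≤ n F ≋ Σ≤ n (λ j → f ⊗ F j)
  ⊗-Σ≤ f n F = ≋-trans (⊗-distribˡ f (F 0) (Σ₁′ n F)) (⊕-cong {f ⊗ F 0} ≋-refl (⊗-Σ₁ f n F))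

  Σ≤-closed : ∀ {p} (S : 𝕃 → Set p) → S 𝟎 → (∀ {f g} → S f → S g → S (f ⊕ g)) →
              ∀ n {F : ℕ → 𝕃} → (∀ j → j ℕ.≤ n → S (F j)) → S (Σ≤ n F)
  Σ≤-closed S z s n h = s (h 0 z≤n) (Σ₁-closed S z s n (λ j _ le → h j le))

  Σ≤-pick : ∀ {p} (S : 𝕃 → Set p) → S 𝟎 → (∀ {f g} → S f → S g → S (f ⊕ g)) →
    ∀ n i {F : ℕ → 𝕃} → i ℕ.≤ n → (∀ j → j ℕ.≤ n → j ≢ i → S (F j)) → Σ 𝕃 λ G → S G × Σ≤ n F ≋ F i ⊕ G
  Σ≤-pick S z s n       zero    {F} le h = Σ₁′ n F , Σ₁-closed S z s n (λ j 1≤j j≤n → h j j≤n λ { refl → ℕP.<⇒≱ 1≤j z≤n }) , ≋-refl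
  Σ≤-pick S z s (suc n) (suc i) {F} (s≤s le) h
    with Σ≤-pick S z s n i {F ∘ suc} le (λ j j≤n ne → h (suc j) (s≤s j≤n) (ne ∘ ℕP.suc-injective))
  ... | G , sG , e = F 0 ⊕ G , s (h 0 z≤n (λ ())) sG , (begin
    F 0 ⊕ Σ≤ n (F ∘ suc)       ≈⟨ ⊕-cong {F 0} ≋-refl e ⟩
    F 0 ⊕ (F (suc i) ⊕ G)      ≈⟨ 𝕃.+-assoc (F 0) (F (suc i)) G ⟨
    (F 0 ⊕ F (suc i)) ⊕ G      ≈⟨ ⊕-cong (⊕-comm (F 0) (F (suc i))) (≋-refl {G}) ⟩
    (F (suc i) ⊕ F 0) ⊕ G      ≈⟨ 𝕃.+-assoc (F (suc i)) (F 0) G ⟩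
    F (suc i) ⊕ (F 0 ⊕ G)      ∎)
    where open ≋-R

  record Subring {p} (V : 𝕃 → Set p) : Set (p ⊔ c ⊔ ℓ) where
    field
      V-resp : ∀ {f g} → f ≋ g → V f → V g
      V-⊕    : ∀ {f g} → V f → V g → V (f ⊕ g)
      V-⊗    : ∀ {f g} → V f → V g → V (f ⊗ g)
      V-neg  : ∀ {f} → V f → V (neg f)
      V-𝟏    : V 𝟏

    V-𝟎 : V 𝟎
    V-𝟎 = V-resp (neg-inverseʳ 𝟏) (V-⊕ V-𝟏 (V-neg V-𝟏))

    V-^ : ∀ {f} n → V f → V (f ^ n)
    V-^ {f} zero    v = V-resp (≋-reflexive (sym (^-zero f))) V-𝟏
    V-^ {f} (suc n) v = V-resp (≋-reflexive (sym (^-suc f n))) (V-⊗ v (V-^ n v))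

  -- If y₁ and y₃ satisfy reciprocal exchange relations, then modulo y₂ the product y₁ y₃ is 1,
  -- so y₀ y₂ y₃ⁿ and y₂ y₄ agree modulo y₂ up to units; dividing by y₂ expresses y₄ through y₀,…,y₃.
  module Mutation {p} {V : 𝕃 → Set p} (sub : Subring V) where
    open Subring sub

    Modulo : 𝕃 → 𝕃 → 𝕃 → Set _
    Modulo y f f' = Σ 𝕃 λ h → V h × f ≋ f' ⊕ y ⊗ h

    private
      Modulo-⊕ : ∀ {y f f' g g'} → Modulo y f f' → Modulo y g g' → Modulo y (f ⊕ g) (f' ⊕ g')
      Modulo-⊕ {y} {f' = f'} {g' = g'} (h , vh , e) (k , vk , e') = h ⊕ k , V-⊕ vh vk ,
        ≋-trans (⊕-cong e e') (≋-trans (interchange f' (y ⊗ h) g' (y ⊗ k))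
          (⊕-cong (≋-refl {f' ⊕ g'}) (≋-sym (⊗-distribˡ y h k))))
        where open CommutativeSemigroupProperties 𝕃.+-commutativeSemigroup using (interchange)

      Modulo-Σ₁ : ∀ {y} n {F G : ℕ → 𝕃} → (∀ j → 1 ℕ.≤ j → j ℕ.≤ n → Modulo y (F j) (G j)) → Modulo y (Σ₁′ n F) (Σ₁′ n G)
      Modulo-Σ₁ {y} zero h = 𝟎 , V-𝟎 , ≋-sym (𝕃.zeroʳ y)
      Modulo-Σ₁ (suc n) h = Modulo-⊕ (h 1 (s≤s z≤n) (s≤s z≤n)) (Modulo-Σ₁ n (λ j 1≤j j≤n → h (suc j) (s≤s z≤n) (s≤s j≤n)))

      Modulo-Σ≤ : ∀ {y} n {F G : ℕ → 𝕃} → (∀ j → j ℕ.≤ n → Modulo y (F j) (G j)) → Modulo y (Σ≤ n F) (Σ≤ n G)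
      Modulo-Σ≤ n h = Modulo-⊕ (h 0 z≤n) (Modulo-Σ₁ n (λ j _ le → h j le))

      Modulo-^ : ∀ {y f} → V y → Modulo y f 𝟏 → ∀ n → Modulo y (f ^ n) 𝟏
      Modulo-^ {y} {f} vy m zero = 𝟎 , V-𝟎 , ≋-trans (≋-reflexive (^-zero f))
        (≋-sym (≋-trans (⊕-cong (≋-refl {𝟏}) (𝕃.zeroʳ y)) (𝕃.+-identityʳ 𝟏)))
      Modulo-^ {y} {f} vy m@(g , vg , e) (suc n) with Modulo-^ vy m n
      ... | h , vh , e' = h ⊕ (g ⊕ g ⊗ (y ⊗ h)) , V-⊕ vh (V-⊕ vg (V-⊗ vg (V-⊗ vy vh))) , (begin
        f ^ suc n                                       ≡⟨ ^-suc f n ⟩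
        f ⊗ f ^ n                                       ≈⟨ ⊗-cong e e' ⟩
        (𝟏 ⊕ y ⊗ g) ⊗ (𝟏 ⊕ y ⊗ h)                       ≈⟨ RI.foil 𝟏 (y ⊗ g) 𝟏 (y ⊗ h) ⟩
        𝟏 ⊗ 𝟏 ⊕ (𝟏 ⊗ (y ⊗ h) ⊕ ((y ⊗ g) ⊗ 𝟏 ⊕ (y ⊗ g) ⊗ (y ⊗ h)))
          ≈⟨ ⊕-cong (⊗-identityˡ 𝟏) (⊕-cong (⊗-identityˡ (y ⊗ h)) (⊕-cong (⊗-identityʳ (y ⊗ g)) (⊗-assoc y g (y ⊗ h)))) ⟩
        𝟏 ⊕ (y ⊗ h ⊕ (y ⊗ g ⊕ y ⊗ (g ⊗ (y ⊗ h))))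
          ≈⟨ ⊕-cong (≋-refl {𝟏}) (⊕-cong (≋-refl {y ⊗ h}) (⊗-distribˡ y g (g ⊗ (y ⊗ h)))) ⟨
        𝟏 ⊕ (y ⊗ h ⊕ y ⊗ (g ⊕ g ⊗ (y ⊗ h)))
          ≈⟨ ⊕-cong (≋-refl {𝟏}) (⊗-distribˡ y h (g ⊕ g ⊗ (y ⊗ h))) ⟨
        𝟏 ⊕ y ⊗ (h ⊕ (g ⊕ g ⊗ (y ⊗ h)))                 ∎)
        where open ≋-R

    mutate : ∀ {n} {c : ℕ → 𝕃} {e e' : ℕ → ℕ} {y₀ y₁ y₂ y₃ y₄ u u' u″ μ} →
      (∀ j → j ℕ.≤ n → e j ℕ.+ e' j ≡ n) → (∀ j → V (c j)) →
      V y₀ → V y₂ → V y₃ → V u → V u″ → Pointed μ y₂ → u″ ⊗ u' ≋ 𝟏 →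
      y₀ ⊗ y₂ ≋ u' ⊗ Σ≤ n (λ j → c j ⊗ y₁ ^ e j) → Modulo y₂ (y₁ ⊗ y₃) 𝟏 →
      y₂ ⊗ y₄ ≋ u ⊗ Σ≤ n (λ j → c j ⊗ y₃ ^ e' j) → V y₄
    mutate {n} {c} {e} {e'} {y₀} {y₁} {y₂} {y₃} {y₄} {u} {u'} {u″} sum vc v₀ v₂ v₃ vu vu″ pt unit r₀ m r₄ =
      -- The resulting formula is y₄ = u (u″ y₀ y₃ⁿ - H), with H the quotient of the congruence
      -- `total-mod`.
      V-resp (≋-sym (⊗-cancelʳ pt y₄-eq)) (V-⊗ vu (V-⊕ (V-⊗ vu″ (V-⊗ v₀ (V-^ n v₃))) (V-neg vH)))
      where
      open ≋-R
      A A' : 𝕃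
      A  = Σ≤ n (λ j → c j ⊗ y₁ ^ e j)
      A' = Σ≤ n (λ j → c j ⊗ y₃ ^ e' j)

      -- Because e j + e' j = n, the factor y₃ⁿ pairs y₁^(e j) with y₃^(e j), a power of y₁ y₃, and
      -- leaves y₃^(e' j).
      termwise : ∀ j → j ℕ.≤ n → Modulo y₂ (y₃ ^ n ⊗ (c j ⊗ y₁ ^ e j)) (c j ⊗ y₃ ^ e' j)
      termwise j le with Modulo-^ v₂ m (e j)
      ... | h , vh , eh = h ⊗ (c j ⊗ y₃ ^ e' j) , V-⊗ vh (V-⊗ (vc j) (V-^ (e' j) v₃)) , (begin
        y₃ ^ n ⊗ (c j ⊗ y₁ ^ e j)
          ≈⟨ ⊗-congʳ (c j ⊗ y₁ ^ e j) (≋-trans (≋-reflexive (cong (y₃ ^_) (sym (sum j le)))) (^-+ y₃ (e j) (e' j))) ⟩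
        (y₃ ^ e j ⊗ y₃ ^ e' j) ⊗ (c j ⊗ y₁ ^ e j)   ≈⟨ shuffle (y₃ ^ e j) (y₃ ^ e' j) (c j) (y₁ ^ e j) ⟩
        (y₁ ^ e j ⊗ y₃ ^ e j) ⊗ (c j ⊗ y₃ ^ e' j)   ≈⟨ ⊗-congʳ (c j ⊗ y₃ ^ e' j) (⊗-^ y₁ y₃ (e j)) ⟨
        (y₁ ⊗ y₃) ^ e j ⊗ (c j ⊗ y₃ ^ e' j)         ≈⟨ ⊗-congʳ (c j ⊗ y₃ ^ e' j) eh ⟩
        (𝟏 ⊕ y₂ ⊗ h) ⊗ (c j ⊗ y₃ ^ e' j)            ≈⟨ ⊗-distribʳ (c j ⊗ y₃ ^ e' j) 𝟏 (y₂ ⊗ h) ⟩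
        𝟏 ⊗ (c j ⊗ y₃ ^ e' j) ⊕ (y₂ ⊗ h) ⊗ (c j ⊗ y₃ ^ e' j)
          ≈⟨ ⊕-cong (⊗-identityˡ _) (⊗-assoc y₂ h (c j ⊗ y₃ ^ e' j)) ⟩
        c j ⊗ y₃ ^ e' j ⊕ y₂ ⊗ (h ⊗ (c j ⊗ y₃ ^ e' j)) ∎)
        where
        shuffle : ∀ a b d f → (a ⊗ b) ⊗ (d ⊗ f) ≋ (f ⊗ a) ⊗ (d ⊗ b)
        shuffle a b d f = ≋-trans (RI.*-interchange a b d f) (≋-trans (⊗-congˡ (a ⊗ d) (⊗-comm b f))
          (≋-trans (RI.*-interchange a d f b) (⊗-congʳ (d ⊗ b) (⊗-comm a f))))

      total-mod : Modulo y₂ (Σ≤ n (λ j → y₃ ^ n ⊗ (c j ⊗ y₁ ^ e j))) A'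
      total-mod = Modulo-Σ≤ n termwise
      H = proj₁ total-mod
      vH : V H
      vH = proj₁ (proj₂ total-mod)

      W : 𝕃
      W = u″ ⊗ (y₀ ⊗ y₃ ^ n)

      A'-eq : A' ≋ (W ⊕ neg H) ⊗ y₂
      A'-eq = begin
        A'                                 ≈⟨ RI.+-move {y₃ ^ n ⊗ A} {y₂ ⊗ H} {A'} (≋-trans (≋-trans (⊗-Σ≤ (y₃ ^ n) n (λ j → c j ⊗ y₁ ^ e j)) (proj₂ (proj₂ total-mod))) (⊕-comm A' (y₂ ⊗ H))) ⟩
        y₃ ^ n ⊗ A ⊕ neg (y₂ ⊗ H)          ≈⟨ ⊕-cong A-eq (-‿distribʳ-* y₂ H) ⟩
        W ⊗ y₂ ⊕ y₂ ⊗ neg H                ≈⟨ ⊕-cong (≋-refl {W ⊗ y₂}) (⊗-comm y₂ (neg H)) ⟩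
        W ⊗ y₂ ⊕ neg H ⊗ y₂                ≈⟨ ⊗-distribʳ y₂ W (neg H) ⟨
        (W ⊕ neg H) ⊗ y₂                   ∎
        where
        open RingProperties 𝕃.ring using (-‿distribʳ-*)
        A-eq : y₃ ^ n ⊗ A ≋ W ⊗ y₂
        A-eq = begin
          y₃ ^ n ⊗ A                       ≈⟨ ⊗-congˡ (y₃ ^ n) (≋-sym (⊗-identityˡ A)) ⟩
          y₃ ^ n ⊗ (𝟏 ⊗ A)                 ≈⟨ ⊗-congˡ (y₃ ^ n) (⊗-congʳ A (≋-sym unit)) ⟩
          y₃ ^ n ⊗ ((u″ ⊗ u') ⊗ A)         ≈⟨ ⊗-congˡ (y₃ ^ n) (⊗-assoc u″ u' A) ⟩
          y₃ ^ n ⊗ (u″ ⊗ (u' ⊗ A))         ≈⟨ ⊗-congˡ (y₃ ^ n) (⊗-congˡ u″ (≋-sym r₀)) ⟩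
          y₃ ^ n ⊗ (u″ ⊗ (y₀ ⊗ y₂))        ≈⟨ RI.*-swapˡ (y₃ ^ n) u″ (y₀ ⊗ y₂) ⟩
          u″ ⊗ (y₃ ^ n ⊗ (y₀ ⊗ y₂))        ≈⟨ ⊗-congˡ u″ (≋-trans (≋-sym (⊗-assoc (y₃ ^ n) y₀ y₂)) (⊗-congʳ y₂ (⊗-comm (y₃ ^ n) y₀))) ⟩
          u″ ⊗ ((y₀ ⊗ y₃ ^ n) ⊗ y₂)        ≈⟨ ⊗-assoc u″ (y₀ ⊗ y₃ ^ n) y₂ ⟨
          W ⊗ y₂                           ∎

      y₄-eq : y₄ ⊗ y₂ ≋ (u ⊗ (W ⊕ neg H)) ⊗ y₂
      y₄-eq = begin
        y₄ ⊗ y₂                    ≈⟨ ⊗-comm y₄ y₂ ⟩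
        y₂ ⊗ y₄                    ≈⟨ r₄ ⟩
        u ⊗ A'                     ≈⟨ ⊗-congˡ u A'-eq ⟩
        u ⊗ ((W ⊕ neg H) ⊗ y₂)     ≈⟨ ⊗-assoc u (W ⊕ neg H) y₂ ⟨
        (u ⊗ (W ⊕ neg H)) ⊗ y₂     ∎

  -- Monomials in the invertible p_{1,ℓ₁} and p_{2,ℓ₂} and in x₁, x₂: the only ones that occur as
  -- lowest terms of the x_k.
  pe : ℤ → ℤ → ℤ → ℤ → 𝕄
  pe α β d e = expAt ℓ₁ ℓ₁ α , expAt ℓ₂ ℓ₂ β , d , e

  pe-· : ∀ α β d e α' β' d' e' → pe α β d e · pe α' β' d' e' ≡ pe (α ℤ.+ α') (β ℤ.+ β') (d ℤ.+ d') (e ℤ.+ e')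
  pe-· α β d e α' β' d' e' = pairs≡ (expAt-⊞ ℓ₁ ℓ₁ α α') (expAt-⊞ ℓ₂ ℓ₂ β β') refl refl

  pe-0 : ∀ d e → pe (+ 0) (+ 0) d e ≡ xm d e
  pe-0 d e = pairs≡ (expAt-0 ℓ₁ ℓ₁) (expAt-0 ℓ₂ ℓ₂) refl refl

  pe-^ : ∀ α β d e n → pe α β d e ^ᴹ n ≡ pe (+ n ℤ.* α) (+ n ℤ.* β) (+ n ℤ.* d) (+ n ℤ.* e)
  pe-^ α β d e zero = sym (trans (cong₂ (λ u v → pe u v (+ 0 ℤ.* d) (+ 0 ℤ.* e)) (ℤP.*-zeroˡ α) (ℤP.*-zeroˡ β))
    (trans (pe-0 _ _) (cong₂ xm (ℤP.*-zeroˡ d) (ℤP.*-zeroˡ e))))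
  pe-^ α β d e (suc n) = trans (cong (pe α β d e ·_) (pe-^ α β d e n)) (trans (pe-· α β d e _ _ _ _)
      (pairs≡ (cong (expAt ℓ₁ ℓ₁) (more α)) (cong (expAt ℓ₂ ℓ₂) (more β)) (more d) (more e)))
    where
    more : ∀ i → i ℤ.+ + n ℤ.* i ≡ + suc n ℤ.* i
    more i = sym (ℤP.suc-* (+ n) i)

  -- All four exchange polynomials are Σ_j c_j z^{ce j} with c_j = p_{1,ℓ₁}^{v₁} p_{2,ℓ₂}^{v₂} p_{i,j};
  -- the coefficients of z⁰ and of the leading power are 1 and p_{1,ℓ₁}^{w₁} p_{2,ℓ₂}^{w₂}.
  w₁ w₂ v₁ v₂ : Class → ℤ
  w₁ C₁ = + 1
  w₁ C₃ = -[1+ 0 ]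
  w₁ _  = + 0
  w₂ C₂ = + 1
  w₂ C₀ = -[1+ 0 ]
  w₂ _  = + 0
  v₁ C₃ = -[1+ 0 ]
  v₁ _  = + 0
  v₂ C₀ = -[1+ 0 ]
  v₂ _  = + 0

  cn : Class → ℕ
  cn C₁ = ℓ₁
  cn C₂ = ℓ₂
  cn C₃ = ℓ₁
  cn C₀ = ℓ₂

  cpm : Class → ℕ → 𝕄
  cpm C₁ = pm₁
  cpm C₂ = pm₂
  cpm C₃ = pm₁
  cpm C₀ = pm₂

  ce : Class → ℕ → ℕ
  ce C₁ j = j
  ce C₂ j = j
  ce C₃ j = ℓ₁ ℕ.∸ j
  ce C₀ j = ℓ₂ ℕ.∸ j

  cv : Class → 𝕄
  cv r = pe (v₁ r) (v₂ r) (+ 0) (+ 0)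

  cm : Class → ℕ → 𝕄
  cm r j = cv r · cpm r j

  X : Class → 𝕃 → 𝕃
  X r z = Σ≤ (cn r) (λ j → mono (cm r j) ⊗ z ^ ce r j)

  X-factored : ∀ r z → X r z ≋ mono (cv r) ⊗ Σ≤ (cn r) (λ j → mono (cpm r j) ⊗ z ^ ce r j)
  X-factored r z = ≋-sym (≋-trans (⊗-Σ≤ (mono (cv r)) (cn r) (λ j → mono (cpm r j) ⊗ z ^ ce r j)) (Σ≤-cong (cn r) λ j _ →
    ≋-trans (≋-sym (⊗-assoc (mono (cv r)) (mono (cpm r j)) (z ^ ce r j))) (⊗-congʳ (z ^ ce r j) (mono-· (cv r) (cpm r j)))))

  private
    cv-one : pe (+ 0) (+ 0) (+ 0) (+ 0) ≡ one
    cv-one = pe-0 (+ 0) (+ 0)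

    plain : ∀ n (pm : ℕ → 𝕄) z → pm 0 ≡ one →
      𝟏 ⊕ Σ₁′ n (λ j → mono (pm j) ⊗ z ^ j) ≋ Σ≤ n (λ j → mono (pe (+ 0) (+ 0) (+ 0) (+ 0) · pm j) ⊗ z ^ j)
    plain n pm z pm0 = ⊕-cong
      (≋-sym (≋-trans (⊗-cong (≋-reflexive (cong mono (trans (cong₂ _·_ cv-one pm0) (·-identityˡ one)))) (≋-reflexive (^-zero z))) (⊗-identityˡ 𝟏)))
      (Σ₁-cong n λ j _ _ → ⊗-congʳ (z ^ j) (≋-reflexive (cong mono (sym (trans (cong (_· pm j) cv-one) (·-identityˡ (pm j)))))))

    reversed : ∀ n (p : ℕ → 𝕃) (pm : ℕ → 𝕄) v z → (∀ j → j ℕ.≤ n → p j ≡ mono (pm j)) → pm 0 ≡ one →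
      Defs._⊗_ K ℓ₁ ℓ₂ (mono v) (Defs._^_ K ℓ₁ ℓ₂ z n ⊕ Σ₁′ n (λ j → Defs._⊗_ K ℓ₁ ℓ₂ (p j) (Defs._^_ K ℓ₁ ℓ₂ z (n ℕ.∸ j)))) ≋
      Σ≤ n (λ j → mono (v · pm j) ⊗ z ^ (n ℕ.∸ j))
    reversed n p pm v z pj pm0 = ≋-trans (≋-reflexive (sym (⊗-unfold (mono v) _))) (≋-trans
      (⊗-congˡ (mono v) (⊕-cong
        (≋-trans (≋-reflexive (sym (^-unfold z n))) (≋-sym (≋-trans (⊗-congʳ (z ^ n) (≋-reflexive (cong mono pm0))) (⊗-identityˡ (z ^ n)))))
        (Σ₁-cong n λ j _ le → ≋-trans (≋-reflexive (trans (cong (Defs._⊗_ K ℓ₁ ℓ₂ (p j)) (sym (^-unfold z (n ℕ.∸ j)))) (sym (⊗-unfold (p j) (z ^ (n ℕ.∸ j))))))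
          (⊗-congʳ (z ^ (n ℕ.∸ j)) (≋-reflexive (pj j le))))))
      (≋-trans (⊗-Σ≤ (mono v) n (λ j → mono (pm j) ⊗ z ^ (n ℕ.∸ j))) (Σ≤-cong n λ j _ →
        ≋-trans (≋-sym (⊗-assoc (mono v) (mono (pm j)) (z ^ (n ℕ.∸ j)))) (⊗-congʳ (z ^ (n ℕ.∸ j)) (mono-· v (pm j))))))

  exch-X : ∀ k z → Defs.exch K ℓ₁ ℓ₂ k z ≋ X (cls k) z
  exch-X k z with k %ℕ 4
  ... | 0 = reversed ℓ₂ (Defs.p₂ K ℓ₁ ℓ₂) pm₂ (cv C₀) z p₂-mono pm₂-0
  ... | 1 = ≋-trans (P₁-sum z) (plain ℓ₁ pm₁ z pm₁-0)
  ... | 2 = ≋-trans (P₂-sum z) (plain ℓ₂ pm₂ z pm₂-0)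
  ... | 3 = reversed ℓ₁ (Defs.p₁ K ℓ₁ ℓ₂) pm₁ (cv C₃) z p₁-mono pm₁-0
  ... | suc (suc (suc (suc _))) = reversed ℓ₂ (Defs.p₂ K ℓ₁ ℓ₂) pm₂ (cv C₀) z p₂-mono pm₂-0

  -- The summation indices of z⁰ and of the leading power; the reversed polynomials interchange
  -- them.
  j₀ jₙ : Class → ℕ
  j₀ C₁ = 0
  j₀ C₂ = 0
  j₀ C₃ = ℓ₁
  j₀ C₀ = ℓ₂
  jₙ C₁ = ℓ₁
  jₙ C₂ = ℓ₂
  jₙ C₃ = 0
  jₙ C₀ = 0

  private
    pm₁-top : pm₁ ℓ₁ ≡ pe (+ 1) (+ 0) (+ 0) (+ 0)
    pm₁-top = pairs≡ refl (sym (expAt-0 ℓ₂ ℓ₂)) refl refl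
    pm₂-top : pm₂ ℓ₂ ≡ pe (+ 0) (+ 1) (+ 0) (+ 0)
    pm₂-top = pairs≡ (sym (expAt-0 ℓ₁ ℓ₁)) refl refl refl

    j₀≤ : ∀ r → j₀ r ℕ.≤ cn r
    j₀≤ C₁ = z≤n
    j₀≤ C₂ = z≤n
    j₀≤ C₃ = ℕP.≤-refl
    j₀≤ C₀ = ℕP.≤-refl

    jₙ≤ : ∀ r → jₙ r ℕ.≤ cn r
    jₙ≤ C₁ = ℕP.≤-refl
    jₙ≤ C₂ = ℕP.≤-refl
    jₙ≤ C₃ = z≤n
    jₙ≤ C₀ = z≤n

    ce-j₀ : ∀ r → ce r (j₀ r) ≡ 0
    ce-j₀ C₁ = refl
    ce-j₀ C₂ = refl
    ce-j₀ C₃ = ℕP.n∸n≡0 ℓ₁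
    ce-j₀ C₀ = ℕP.n∸n≡0 ℓ₂

    ce-jₙ : ∀ r → ce r (jₙ r) ≡ cn r
    ce-jₙ C₁ = refl
    ce-jₙ C₂ = refl
    ce-jₙ C₃ = refl
    ce-jₙ C₀ = refl

    cm-j₀ : ∀ r → cm r (j₀ r) ≡ one
    cm-j₀ C₁ = trans (cong₂ _·_ cv-one pm₁-0) (·-identityˡ one)
    cm-j₀ C₂ = trans (cong₂ _·_ cv-one pm₂-0) (·-identityˡ one)
    cm-j₀ C₃ = trans (cong (cv C₃ ·_) pm₁-top) (trans (pe-· -[1+ 0 ] (+ 0) (+ 0) (+ 0) (+ 1) (+ 0) (+ 0) (+ 0)) cv-one)
    cm-j₀ C₀ = trans (cong (cv C₀ ·_) pm₂-top) (trans (pe-· (+ 0) -[1+ 0 ] (+ 0) (+ 0) (+ 0) (+ 1) (+ 0) (+ 0)) cv-one)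

    cm-jₙ : ∀ r → cm r (jₙ r) ≡ pe (w₁ r) (w₂ r) (+ 0) (+ 0)
    cm-jₙ C₁ = trans (cong₂ _·_ cv-one pm₁-top) (·-identityˡ _)
    cm-jₙ C₂ = trans (cong₂ _·_ cv-one pm₂-top) (·-identityˡ _)
    cm-jₙ C₃ = trans (cong (cv C₃ ·_) pm₁-0) (·-identityʳ _)
    cm-jₙ C₀ = trans (cong (cv C₀ ·_) pm₂-0) (·-identityʳ _)

    ce-pos : ∀ r j → j ℕ.≤ cn r → j ≢ j₀ r → 1 ℕ.≤ ce r j
    ce-pos C₁ j le ne = ℕP.n≢0⇒n>0 ne
    ce-pos C₂ j le ne = ℕP.n≢0⇒n>0 ne
    ce-pos C₃ j le ne = ℕP.m<n⇒0<n∸m (ℕP.≤∧≢⇒< le ne)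
    ce-pos C₀ j le ne = ℕP.m<n⇒0<n∸m (ℕP.≤∧≢⇒< le ne)

    ce-lt : ∀ r j → j ℕ.≤ cn r → j ≢ jₙ r → ce r j ℕ.< cn r
    ce-lt C₁ j le ne = ℕP.≤∧≢⇒< le ne
    ce-lt C₂ j le ne = ℕP.≤∧≢⇒< le ne
    ce-lt C₃ j le ne = ℕP.∸-monoʳ-< (ℕP.n≢0⇒n>0 ne) le
    ce-lt C₀ j le ne = ℕP.∸-monoʳ-< (ℕP.n≢0⇒n>0 ne) le

    deg-cm : ∀ r j → deg (cm r j) ≡ + 0
    deg-cm C₁ j = refl
    deg-cm C₂ j = refl
    deg-cm C₃ j = refl
    deg-cm C₀ j = refl

  ce-opposite : ∀ r j → j ℕ.≤ cn r → ce r j ℕ.+ ce (next (next r)) j ≡ cn r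
  ce-opposite C₁ j le = ℕP.m+[n∸m]≡n le
  ce-opposite C₂ j le = ℕP.m+[n∸m]≡n le
  ce-opposite C₃ j le = ℕP.m∸n+n≡m le
  ce-opposite C₀ j le = ℕP.m∸n+n≡m le

  X-opposite : ∀ r z → X (next (next r)) z ≋
    mono (cv (next (next r))) ⊗ Σ≤ (cn r) (λ j → mono (cpm r j) ⊗ z ^ ce (next (next r)) j)
  X-opposite C₁ = X-factored C₃
  X-opposite C₂ = X-factored C₀
  X-opposite C₃ = X-factored C₁
  X-opposite C₀ = X-factored C₂

  module _ {p} {V : 𝕃 → Set p} (sub : Subring V) where
    open Subring sub
    open Mutation sub

    -- The constant coefficient is 1 and all other terms contain z. In a mutation this makes y₁ y₃ a
    -- unit modulo y₂.
    X-modulo : (∀ r j → V (mono (cm r j))) → ∀ r {z} → V z → Modulo z (X r z) 𝟏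
    X-modulo vc r {z} vz = from-pick (Σ≤-pick (λ f → Σ 𝕃 λ g → V g × f ≋ z ⊗ g)
        (𝟎 , V-𝟎 , ≋-sym (𝕃.zeroʳ z))
        (λ { (g , vg , e) (g' , vg' , e') → g ⊕ g' , V-⊕ vg vg' , ≋-trans (⊕-cong e e') (≋-sym (⊗-distribˡ z g g')) })
        (cn r) (j₀ r) (j₀≤ r) multiple)
      where
      multiple : ∀ j → j ℕ.≤ cn r → j ≢ j₀ r → Σ 𝕃 λ g → V g × mono (cm r j) ⊗ z ^ ce r j ≋ z ⊗ g
      multiple j le ne with ce r j | ce-pos r j le ne
      ... | suc i | _ = mono (cm r j) ⊗ z ^ i , V-⊗ (vc r j) (V-^ i vz) ,
        ≋-trans (⊗-congˡ (mono (cm r j)) (≋-reflexive (^-suc z i))) (RI.*-swapˡ (mono (cm r j)) z (z ^ i))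
      from-pick : (Σ 𝕃 λ G → (Σ 𝕃 λ g → V g × G ≋ z ⊗ g) × X r z ≋ mono (cm r (j₀ r)) ⊗ z ^ ce r (j₀ r) ⊕ G) → Modulo z (X r z) 𝟏
      from-pick (G , (g , vg , e) , e') = g , vg , ≋-trans e' (⊕-cong
        (≋-trans (⊗-cong (≋-reflexive (cong mono (cm-j₀ r))) (≋-reflexive (trans (cong (z ^_) (ce-j₀ r)) (^-zero z)))) (⊗-identityˡ 𝟏)) e)

  private
    deg-^ᴹ : ∀ m n → deg (m ^ᴹ n) ≡ + n ℤ.* deg m
    deg-^ᴹ m zero    = sym (ℤP.*-zeroˡ (deg m))
    deg-^ᴹ m (suc n) = trans (deg-· m (m ^ᴹ n)) (trans (cong (λ z → deg m ℤ.+ z) (deg-^ᴹ m n)) (sym (ℤP.suc-* (+ n) (deg m))))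

    Pointed⇒In : ∀ {m f} {D : 𝕄 → Set} → Pointed m f → (∀ {n} → deg m ℤ.≤ deg n → D n) → In D f
    Pointed⇒In (mkLead r a e) h = In-resp (≋-sym e) (In-⊕ (In-mono (h ℤP.≤-refl)) (In-list (All.map (λ lt → h (ℤP.<⇒≤ lt)) a)))

    term-pointed : ∀ r {μ z} → Pointed μ z → ∀ j → Pointed (cm r j · (μ ^ᴹ ce r j)) (mono (cm r j) ⊗ z ^ ce r j)
    term-pointed r pz j = Pointed-⊗ (Lead-mono (cm r j)) (Pointed-^ (ce r j) pz)

    deg-term : ∀ r μ j → deg (cm r j · (μ ^ᴹ ce r j)) ≡ + ce r j ℤ.* deg μ
    deg-term r μ j = trans (deg-· (cm r j) (μ ^ᴹ ce r j)) (trans (cong₂ ℤ._+_ (deg-cm r j) (deg-^ᴹ μ (ce r j))) (ℤP.+-identityˡ _))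

    X-pointed-at : ∀ r {μ z} i → i ℕ.≤ cn r → Pointed μ z →
      (∀ j → j ℕ.≤ cn r → j ≢ i → + ce r i ℤ.* deg μ ℤ.< + ce r j ℤ.* deg μ) → Pointed (cm r i · (μ ^ᴹ ce r i)) (X r z)
    X-pointed-at r {μ} {z} i le pz above = from-pick
        (Σ≤-pick (In (λ n → deg (cm r i · (μ ^ᴹ ce r i)) ℤ.< deg n)) In-𝟎 In-⊕ (cn r) i le λ j j≤n ne →
          Pointed⇒In (term-pointed r pz j) (ℤP.<-≤-trans (≡.subst₂ ℤ._<_ (sym (deg-term r μ i)) (sym (deg-term r μ j)) (above j j≤n ne))))
      where
      from-pick : (Σ 𝕃 λ G → In (λ n → deg (cm r i · (μ ^ᴹ ce r i)) ℤ.< deg n) G × X r z ≋ mono (cm r i) ⊗ z ^ ce r i ⊕ G) →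
        Pointed (cm r i · (μ ^ᴹ ce r i)) (X r z)
      from-pick (G , iG , e) = Lead-resp (≋-sym e) (Lead-⊕ (term-pointed r pz i) iG)

  -- Powers of an element of positive degree have increasing degrees, so the constant term is
  -- lowest.
  X-pointed⁺ : ∀ r {μ z} → Pointed μ z → + 0 ℤ.< deg μ → Pointed one (X r z)
  X-pointed⁺ r {μ} {z} pz d = ≡.subst (λ m → Pointed m (X r z))
      (trans (cong₂ _·_ (cm-j₀ r) (cong (μ ^ᴹ_) (ce-j₀ r))) (·-identityˡ one))
      (X-pointed-at r (j₀ r) (j₀≤ r) pz λ j le ne →
        ≡.subst (ℤ._< + ce r j ℤ.* deg μ) (sym (cong (λ n → + n ℤ.* deg μ) (ce-j₀ r))) (positive (deg μ) d (ce-pos r j le ne)))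
    where
    positive : ∀ i → + 0 ℤ.< i → ∀ {n} → 1 ℕ.≤ n → + 0 ℤ.* i ℤ.< + n ℤ.* i
    positive (+ zero)  (ℤ.+<+ ()) _
    positive (+ suc i) _ {suc n} _ = ℤ.+<+ (s≤s z≤n)

  -- For negative degree the order is reversed and the leading power is lowest.
  X-pointed⁻ : ∀ r {μ z} → Pointed μ z → deg μ ℤ.< + 0 → Pointed (pe (w₁ r) (w₂ r) (+ 0) (+ 0) · (μ ^ᴹ cn r)) (X r z)
  X-pointed⁻ r {μ} {z} pz d = ≡.subst (λ m → Pointed m (X r z))
      (cong₂ _·_ (cm-jₙ r) (cong (μ ^ᴹ_) (ce-jₙ r)))
      (X-pointed-at r (jₙ r) (jₙ≤ r) pz λ j le ne →
        ≡.subst (ℤ._< + ce r j ℤ.* deg μ) (sym (cong (λ n → + n ℤ.* deg μ) (ce-jₙ r)))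
          (negative (deg μ) d (ce-lt r j le ne)))
    where
    negative : ∀ i → i ℤ.< + 0 → ∀ {m n} → m ℕ.< n → + n ℤ.* i ℤ.< + m ℤ.* i
    negative -[1+ i ] _ lt = ℤP.*-monoʳ-<-neg -[1+ i ] (ℤ.+<+ lt)
    negative (+ i) (ℤ.+<+ ())

-- Exponents of p_{i,ℓᵢ} in the normalised exchange relations, for the polynomials Pᵢ and P̄ᵢ
-- and for cluster variables of positive (⁺) and negative (⁻) degree.
module ExponentBounds where

  Own : ℕ → ℕ → ℤ → Set
  Own n j i = NonNeg (expAt n n i ⊞ expAt n j (+ 1))

  private
    -- The coefficient p_{i,j} raises the exponent of p_{i,ℓᵢ} by one exactly when j is the top
    -- index, where an exponent -1 is thus harmless.
    own : ∀ {n j i} → j ℕ.≤ n → (j ℕ.< n → + 0 ℤ.≤ i) → (j ≡ n → + 0 ℤ.≤ i ℤ.+ + 1) → Own n j i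
    own {n} {j} {i} le h h' with ℕP.m≤n⇒m<n∨m≡n le
    ... | inj₁ lt   = NonNeg-⊞ (NonNeg-expAt n n (h lt)) (NonNeg-expAt n j (ℤ.+≤+ z≤n))
    ... | inj₂ refl = ≡.subst NonNeg (sym (expAt-⊞ n n i (+ 1))) (NonNeg-expAt n n (h' refl))

    *-nonneg : ∀ {n i} → + 0 ℤ.≤ i → + 0 ℤ.≤ + n ℤ.* i
    *-nonneg {n} {+ i} _ = ≡.subst (+ 0 ℤ.≤_) (ℤP.pos-* n i) (ℤ.+≤+ z≤n)

    -- If a is positive, n a ≤ 1 forces n = 1, and then j = 0.
    small-product : ∀ n a → + n ℤ.* a ℤ.≤ + 1 → ∀ {j} → j ℕ.< n → + 0 ℤ.≤ + j ℤ.* ℤ.- a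
    small-product n (+ zero) _ {j} _ = ≡.subst (+ 0 ℤ.≤_) (sym (ℤP.*-zeroʳ (+ j))) ℤP.≤-refl
    small-product n -[1+ a ] _ {j} _ = *-nonneg {j} (ℤ.+≤+ z≤n)
    small-product n (+ suc a) le {zero} _ = ≡.subst (+ 0 ℤ.≤_) (sym (ℤP.*-zeroˡ (ℤ.- + suc a))) ℤP.≤-refl
    small-product (suc (suc n)) (+ suc a) (ℤ.+≤+ (s≤s le)) {suc j} (s≤s (s≤s _)) = ⊥-elim (ℕP.m+1+n≰m a {0} (ℕP.≤-trans (ℕP.+-monoʳ-≤ a (s≤s z≤n)) (ℕP.≤-trans le z≤n)))

    large-product : ∀ n a → + 1 ℤ.≤ + n ℤ.* a → + 1 ℤ.≤ a
    large-product n (+ zero) le = ⊥-elim (ℤP.≤⇒≯ (≡.subst (+ 1 ℤ.≤_) (ℤP.*-zeroʳ (+ n)) le) (ℤ.+<+ (s≤s z≤n)))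
    large-product n (+ suc a) le = ℤ.+≤+ (s≤s z≤n)
    large-product zero -[1+ a ] (ℤ.+≤+ ())
    large-product (suc n) -[1+ a ] ()

    pos-product : ∀ {i a} → 1 ℕ.≤ i → + 1 ℤ.≤ a → + 1 ℤ.≤ + i ℤ.* a
    pos-product {suc i} {+ suc a} _ _ = ℤ.+≤+ (s≤s z≤n)
    pos-product {a = + zero} _ (ℤ.+≤+ ())

    -≤ : ∀ {i j} → i ℤ.≤ j → + 0 ℤ.≤ j ℤ.- i
    -≤ = ℤP.i≤j⇒0≤j-i

    ∸-* : ∀ {n j} → j ℕ.≤ n → ∀ a → + (n ℕ.∸ j) ℤ.* a ≡ + n ℤ.* a ℤ.- + j ℤ.* a
    ∸-* {n} {j} le a = trans (cong (ℤ._* a) (trans (sym (ℤP.⊖-≥ le)) (sym (ℤP.m-n≡m⊖n n j)))) (dist (+ n) (+ j) a)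
      where
      dist : ∀ x y a → (x ℤ.- y) ℤ.* a ≡ x ℤ.* a ℤ.- y ℤ.* a
      dist = solve-∀

  -- The sign of d turns the weight relation into n a ≤ 1; the exponent is -j a.
  own-P⁺ : ∀ {n j d a} → + 0 ℤ.≤ d → d ℤ.+ + n ℤ.* a ≡ + 1 → j ℕ.≤ n → Own n j (+ 0 ℤ.+ (+ 0 ℤ.+ + j ℤ.* ℤ.- a))
  own-P⁺ {n} {j} {d} {a} 0≤d e le = own le
      (λ lt → ≡.subst (+ 0 ℤ.≤_) (s₀ (+ j ℤ.* ℤ.- a)) (small-product n a na≤1 lt))
      (λ { refl → ≡.subst (+ 0 ℤ.≤_) (s₁ (+ n) a) (-≤ na≤1) })
    where
    na≤1 : + n ℤ.* a ℤ.≤ + 1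
    na≤1 = ≡.subst₂ ℤ._≤_ (ℤP.+-identityˡ _) e (ℤP.+-monoˡ-≤ (+ n ℤ.* a) 0≤d)
    s₀ : ∀ x → x ≡ + 0 ℤ.+ (+ 0 ℤ.+ x)
    s₀ = solve-∀
    s₁ : ∀ n a → + 1 ℤ.- n ℤ.* a ≡ + 0 ℤ.+ (+ 0 ℤ.+ n ℤ.* ℤ.- a) ℤ.+ + 1
    s₁ = solve-∀

  -- The exponent is (n - j) a - 1, and the weight relation gives n a ≥ 1, hence a ≥ 1.
  own-P⁻ : ∀ {n j d a} → d ℤ.≤ + 0 → d ℤ.+ + n ℤ.* a ≡ + 1 → j ℕ.≤ n →
    Own n j ((+ n ℤ.* a ℤ.- + 1) ℤ.+ (+ 0 ℤ.+ + j ℤ.* ℤ.- a))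
  own-P⁻ {n} {j} {d} {a} d≤0 e le = own le
      (λ lt → ≡.subst (+ 0 ℤ.≤_) (trans (cong (ℤ._- + 1) (∸-* le a)) (s₀ (+ n) (+ j) a))
        (-≤ (pos-product {n ℕ.∸ j} (ℕP.m<n⇒0<n∸m lt) 1≤a)))
      (λ { refl → ≡.subst (+ 0 ℤ.≤_) (s₁ (+ n) a) ℤP.≤-refl })
    where
    1≤a : + 1 ℤ.≤ a
    1≤a = large-product n a (≡.subst₂ ℤ._≤_ e (ℤP.+-identityˡ _) (ℤP.+-monoˡ-≤ (+ n ℤ.* a) d≤0))
    s₀ : ∀ n j a → (n ℤ.* a ℤ.- j ℤ.* a) ℤ.- + 1 ≡ (n ℤ.* a ℤ.- + 1) ℤ.+ (+ 0 ℤ.+ j ℤ.* ℤ.- a)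
    s₀ = solve-∀
    s₁ : ∀ n a → + 0 ≡ (n ℤ.* a ℤ.- + 1) ℤ.+ (+ 0 ℤ.+ n ℤ.* ℤ.- a) ℤ.+ + 1
    s₁ = solve-∀

  -- The exponent is -(n - j) a - 1, and the weight relation gives n a ≤ -1, hence -a ≥ 1.
  own-P̄⁺ : ∀ {n j d a} → + 0 ℤ.≤ d → d ℤ.+ + n ℤ.* a ≡ -[1+ 0 ] → j ℕ.≤ n →
    Own n j (+ 0 ℤ.+ (-[1+ 0 ] ℤ.+ + (n ℕ.∸ j) ℤ.* ℤ.- a))
  own-P̄⁺ {n} {j} {d} {a} 0≤d e le = own le
      (λ lt → ≡.subst (+ 0 ℤ.≤_) (s₀ (+ (n ℕ.∸ j) ℤ.* ℤ.- a)) (-≤ (pos-product {n ℕ.∸ j} (ℕP.m<n⇒0<n∸m lt) 1≤-a)))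
      (λ { refl → ≡.subst (+ 0 ℤ.≤_) (cong (λ z → + 0 ℤ.+ (-[1+ 0 ] ℤ.+ z ℤ.* ℤ.- a) ℤ.+ + 1) (cong +_ (sym (ℕP.n∸n≡0 n)))) ℤP.≤-refl })
    where
    1≤-a : + 1 ℤ.≤ ℤ.- a
    1≤-a = large-product n (ℤ.- a) (≡.subst (+ 1 ℤ.≤_) (ℤP.neg-distribʳ-* (+ n) a)
      (ℤP.neg-mono-≤ (≡.subst₂ ℤ._≤_ (ℤP.+-identityˡ _) e (ℤP.+-monoˡ-≤ (+ n ℤ.* a) 0≤d))))
    s₀ : ∀ x → x ℤ.- + 1 ≡ + 0 ℤ.+ (-[1+ 0 ] ℤ.+ x)
    s₀ = solve-∀

  -- The exponent simplifies to j a, while the weight relation gives n a ≥ -1.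
  own-P̄⁻ : ∀ {n j d a} → d ℤ.≤ + 0 → d ℤ.+ + n ℤ.* a ≡ -[1+ 0 ] → j ℕ.≤ n →
    Own n j ((+ n ℤ.* a ℤ.- -[1+ 0 ]) ℤ.+ (-[1+ 0 ] ℤ.+ + (n ℕ.∸ j) ℤ.* ℤ.- a))
  own-P̄⁻ {n} {j} {d} {a} d≤0 e le = own le
      (λ lt → ≡.subst (+ 0 ℤ.≤_) (trans (s₀ (+ n) (+ j) a) (shift (sym (∸-* le (ℤ.- a)))))
        (small-product n (ℤ.- a) (≡.subst (ℤ._≤ + 1) (ℤP.neg-distribʳ-* (+ n) a) (ℤP.neg-mono-≤ -1≤na)) lt))
      (λ { refl → ≡.subst (+ 0 ℤ.≤_) (trans (s₁ (+ n ℤ.* a)) (cong (λ z → (+ n ℤ.* a ℤ.- -[1+ 0 ]) ℤ.+ (-[1+ 0 ] ℤ.+ z ℤ.* ℤ.- a) ℤ.+ + 1) (cong +_ (sym (ℕP.n∸n≡0 n)))))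
        (-≤ -1≤na) })
    where
    -1≤na : -[1+ 0 ] ℤ.≤ + n ℤ.* a
    -1≤na = ≡.subst₂ ℤ._≤_ e (ℤP.+-identityˡ _) (ℤP.+-monoˡ-≤ (+ n ℤ.* a) d≤0)
    s₀ : ∀ n j a → j ℤ.* ℤ.- (ℤ.- a) ≡ (n ℤ.* a ℤ.- -[1+ 0 ]) ℤ.+ (-[1+ 0 ] ℤ.+ (n ℤ.* ℤ.- a ℤ.- j ℤ.* ℤ.- a))
    s₀ = solve-∀
    shift : ∀ {x y} → x ≡ y → (+ n ℤ.* a ℤ.- -[1+ 0 ]) ℤ.+ (-[1+ 0 ] ℤ.+ x) ≡ (+ n ℤ.* a ℤ.- -[1+ 0 ]) ℤ.+ (-[1+ 0 ] ℤ.+ y)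
    shift refl = refl
    s₁ : ∀ x → x ℤ.- -[1+ 0 ] ≡ (x ℤ.- -[1+ 0 ]) ℤ.+ (-[1+ 0 ] ℤ.+ + 0) ℤ.+ + 1
    s₁ = solve-∀

  private
    0≤-of : ∀ n b → 1 ℕ.≤ n → + 0 ℤ.≤ + n ℤ.* b → + 0 ℤ.≤ b
    0≤-of n (+ b) _ _ = ℤ.+≤+ z≤n
    0≤-of (suc n) -[1+ b ] _ ()

  -- For the variables of the polynomial not involved in the exchange the weight is 0, so b has the
  -- sign opposite to e.
  other⁺ : ∀ {n e b} → 1 ℕ.≤ n → + 0 ℤ.≤ e → e ℤ.+ + n ℤ.* b ≡ + 0 → ∀ i → + 0 ℤ.≤ + 0 ℤ.+ (+ 0 ℤ.+ + i ℤ.* ℤ.- b)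
  other⁺ {n} {e} {b} 1≤n 0≤e eq i = ≡.subst (+ 0 ℤ.≤_) (s₀ (+ i ℤ.* ℤ.- b)) (*-nonneg {i} (0≤-of n (ℤ.- b) 1≤n
      (≡.subst (+ 0 ℤ.≤_) (ℤP.neg-distribʳ-* (+ n) b)
        (ℤP.neg-mono-≤ (≡.subst₂ ℤ._≤_ (ℤP.+-identityˡ _) eq (ℤP.+-monoˡ-≤ (+ n ℤ.* b) 0≤e))))))
    where
    s₀ : ∀ x → x ≡ + 0 ℤ.+ (+ 0 ℤ.+ x)
    s₀ = solve-∀

  other⁻ : ∀ {n e b} → 1 ℕ.≤ n → e ℤ.≤ + 0 → e ℤ.+ + n ℤ.* b ≡ + 0 → ∀ {m i} → i ℕ.≤ m →
    + 0 ℤ.≤ (+ m ℤ.* b ℤ.- + 0) ℤ.+ (+ 0 ℤ.+ + i ℤ.* ℤ.- b)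
  other⁻ {n} {e} {b} 1≤n e≤0 eq {m} {i} le = ≡.subst (+ 0 ℤ.≤_) (trans (∸-* le b) (s₀ (+ m) (+ i) b))
      (*-nonneg {m ℕ.∸ i} (0≤-of n b 1≤n (≡.subst₂ ℤ._≤_ eq (ℤP.+-identityˡ _) (ℤP.+-monoˡ-≤ (+ n ℤ.* b) e≤0))))
    where
    s₀ : ∀ m i b → m ℤ.* b ℤ.- i ℤ.* b ≡ (m ℤ.* b ℤ.- + 0) ℤ.+ (+ 0 ℤ.+ i ℤ.* ℤ.- b)
    s₀ = solve-∀

-- Cluster variables: lowest terms, integrality and membership in subrings.

module ClusterVariables {c ℓ} (K : CommutativeRing c ℓ) (0≉1 : ¬ (CommutativeRing._≈_ K (CommutativeRing.0# K) (CommutativeRing.1# K)))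
  (ℓ₁ ℓ₂ : ℕ) (1≤ℓ₁ : 1 ℕ.≤ ℓ₁) (1≤ℓ₂ : 1 ℕ.≤ ℓ₂)
  (x : ℤ → LP K ℓ₁ ℓ₂) (seq : IsPreClusterSeq K ℓ₁ ℓ₂ x) (a b : ℤ → ℤ)
  (lowest : ∀ k → LowestTermNormalized K ℓ₁ ℓ₂ (normalize K ℓ₁ ℓ₂ x a b k)) where

  open CommutativeRing K using (_≈_; 0#; 1#; _+_)
  private module K = CommutativeRing K
  open Elimination K ℓ₁ ℓ₂
  open Exchange K ℓ₁ ℓ₂
  open Denominators
  open ExponentBounds

  s : ℤ → ℤ
  s k = k ℤ.+ + 1

  ex : ∀ k → x (s (s k)) ⊗ x k ≋ X (next (cls k)) (x (s k))
  ex k = ≋-trans (≋-reflexive (trans (⊗-unfold (x (s (s k))) (x k)) (cong (λ i → Defs._⊗_ K ℓ₁ ℓ₂ (x (s (s k))) (x i)) (sym (back k)))))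
    (≋-trans (mk≋ (IsPreClusterSeq.exchange seq (s k))) (≋-trans (exch-X (s k) (x (s k)))
      (≋-reflexive (cong (λ r → X r (x (s k))) (cls-suc k)))))
    where
    back : ∀ k → k ℤ.+ + 1 ℤ.- + 1 ≡ k
    back = solve-∀

  X̂ : ℤ → 𝕃
  X̂ k = mono (pe (a k) (b k) (+ 0) (+ 0)) ⊗ x k

  normalize-X̂ : ∀ k → normalize K ℓ₁ ℓ₂ x a b k ≋ X̂ k
  normalize-X̂ k = ≋-reflexive (sym (⊗-unfold (mono (pe (a k) (b k) (+ 0) (+ 0))) (x k)))

  -- Exponents of the lowest term of `X̂ k`; the vector (-d, -e) plays the role of the denominator
  -- vector.
  d e : ℤ → ℤ
  d k = proj₁ (proj₁ (lowest k))
  e k = proj₂ (proj₁ (lowest k))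

  private
    lowest-pointed : ∀ {f} (l : LowestTermNormalized K ℓ₁ ℓ₂ f) → Pointed (xm (proj₁ (proj₁ l)) (proj₂ (proj₁ l))) f
    lowest-pointed {f} ((i , j) , one≈ , zero≈) = mkLead (restrict Hi? f) (restrict-all Hi? f) (mk≋ agree)
      where
      m₀ = xm i j
      Hi : 𝕄 → Set
      Hi n = deg m₀ ℤ.< deg n
      Hi? : ∀ n → Dec (Hi n)
      Hi? n = deg m₀ ℤP.<? deg n
      agree : ∀ n → cf f n ≈ cf (mono m₀ ⊕ restrict Hi? f) n
      agree n = K.trans (pieces n) (K.sym (cf-++ (mono m₀) (restrict Hi? f) n))
        where
        pieces : ∀ n → cf f n ≈ cf (mono m₀) n + cf (restrict Hi? f) n
        pieces n with Hi? n | n ≟M m₀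
        ... | yes hi | yes refl = ⊥-elim (ℤP.<-irrefl refl hi)
        ... | yes hi | no ne = K.trans (K.sym (cf-restrict Hi? f hi)) (K.sym (K.trans (K.+-congʳ
                (K.trans (cf-mono m₀ n) (δ-diff (ne ∘ sym)))) (K.+-identityˡ _)))
        ... | no ¬hi | yes refl = K.trans one≈ (K.sym (K.trans (K.+-cong (K.trans (cf-mono m₀ m₀) (δ-same m₀))
                (cf-vanish (restrict-all Hi? f) ¬hi)) (K.+-identityʳ _)))
        ... | no ¬hi | no ne = K.trans (zero≈ n ne (ℤP.≮⇒≥ ¬hi)) (K.sym (K.trans (K.+-cong
                (K.trans (cf-mono m₀ n) (δ-diff (ne ∘ sym))) (cf-vanish (restrict-all Hi? f) ¬hi)) (K.+-identityʳ _)))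

    expAt-top-injective : ∀ {n} → 1 ℕ.≤ n → ∀ {i j} → expAt n n i ≡ expAt n n j → i ≡ j
    expAt-top-injective {suc zero}    _ refl = refl
    expAt-top-injective {suc (suc n)} _ eq   = expAt-top-injective {suc n} (s≤s z≤n) (VecP.∷-injectiveʳ eq)

    pe-injective : ∀ {i j k l i' j' k' l'} → pe i j k l ≡ pe i' j' k' l' → i ≡ i' × j ≡ j' × k ≡ k' × l ≡ l'
    pe-injective eq = expAt-top-injective 1≤ℓ₁ (cong proj₁ eq) , expAt-top-injective 1≤ℓ₂ (cong (proj₁ ∘ proj₂) eq) ,
      cong exp₁ eq , cong exp₂ eq

  X̂-pointed : ∀ k → Pointed (xm (d k) (e k)) (X̂ k)
  X̂-pointed k = Lead-resp (normalize-X̂ k) (lowest-pointed (lowest k))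

  x-from-X̂ : ∀ k → x k ≋ mono (pe (ℤ.- a k) (ℤ.- b k) (+ 0) (+ 0)) ⊗ X̂ k
  x-from-X̂ k = ≋-sym (≋-trans (≋-sym (⊗-assoc _ _ (x k))) (≋-trans (⊗-congʳ (x k) (≋-trans (mono-· _ _)
    (≋-reflexive (cong mono (trans (pe-· (ℤ.- a k) (ℤ.- b k) (+ 0) (+ 0) (a k) (b k) (+ 0) (+ 0))
      (trans (cong₂ (λ i j → pe i j (+ 0) (+ 0)) (ℤP.+-inverseˡ (a k)) (ℤP.+-inverseˡ (b k))) (pe-0 (+ 0) (+ 0)))))))) (⊗-identityˡ (x k))))

  μ : ℤ → 𝕄
  μ k = pe (ℤ.- a k) (ℤ.- b k) (d k) (e k)

  x-pointed : ∀ k → Pointed (μ k) (x k)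
  x-pointed k = ≡.subst (λ m → Pointed m (x k)) μ≡
    (Lead-resp (≋-sym (x-from-X̂ k)) (Pointed-⊗ (Lead-mono _) (X̂-pointed k)))
    where
    μ≡ : pe (ℤ.- a k) (ℤ.- b k) (+ 0) (+ 0) · xm (d k) (e k) ≡ μ k
    μ≡ = trans (cong (pe (ℤ.- a k) (ℤ.- b k) (+ 0) (+ 0) ·_) (sym (pe-0 (d k) (e k)))) (trans (pe-· _ _ (+ 0) (+ 0) (+ 0) (+ 0) (d k) (e k))
      (pairs≡ (cong (expAt ℓ₁ ℓ₁) (ℤP.+-identityʳ _)) (cong (expAt ℓ₂ ℓ₂) (ℤP.+-identityʳ _)) (ℤP.+-identityˡ _) (ℤP.+-identityˡ _)))

  record Rec⁺ (k : ℤ) : Set where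
    field
      a-eq : a (s (s k)) ℤ.+ a k ≡ + 0
      b-eq : b (s (s k)) ℤ.+ b k ≡ + 0
      d-eq : d (s (s k)) ℤ.+ d k ≡ + 0
      e-eq : e (s (s k)) ℤ.+ e k ≡ + 0

  record Rec⁻ (k : ℤ) : Set where
    r : Class
    r = next (cls k)
    field
      a-eq : a (s (s k)) ℤ.+ a k ≡ + cn r ℤ.* a (s k) ℤ.- w₁ r
      b-eq : b (s (s k)) ℤ.+ b k ≡ + cn r ℤ.* b (s k) ℤ.- w₂ r
      d-eq : d (s (s k)) ℤ.+ d k ≡ + cn r ℤ.* d (s k)
      e-eq : e (s (s k)) ℤ.+ e k ≡ + cn r ℤ.* e (s k)

  private
    lhs-pointed : ∀ k → Pointed (pe (ℤ.- a (s (s k)) ℤ.+ ℤ.- a k) (ℤ.- b (s (s k)) ℤ.+ ℤ.- b k)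
      (d (s (s k)) ℤ.+ d k) (e (s (s k)) ℤ.+ e k)) (x (s (s k)) ⊗ x k)
    lhs-pointed k = ≡.subst (λ m → Pointed m (x (s (s k)) ⊗ x k)) (pe-· _ _ (d (s (s k))) (e (s (s k))) _ _ (d k) (e k))
      (Pointed-⊗ (x-pointed (s (s k))) (x-pointed k))

    neg-eq : ∀ {i j l} → ℤ.- i ℤ.+ ℤ.- j ≡ l → i ℤ.+ j ≡ ℤ.- l
    neg-eq {i} {j} refl = lemma i j
      where
      lemma : ∀ i j → i ℤ.+ j ≡ ℤ.- (ℤ.- i ℤ.+ ℤ.- j)
      lemma = solve-∀

    neg-lin : ∀ n i w → ℤ.- (w ℤ.+ n ℤ.* ℤ.- i) ≡ n ℤ.* i ℤ.- w
    neg-lin = solve-∀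

  -- Both sides of the exchange relation are pointed; equating their lowest monomials yields all
  -- four recurrences at once.
  rec⁺ : ∀ k → + 0 ℤ.< d (s k) ℤ.+ e (s k) → Rec⁺ k
  rec⁺ k h = record { a-eq = neg-eq {a (s (s k))} {a k} (proj₁ eqs) ; b-eq = neg-eq {b (s (s k))} {b k} (proj₁ (proj₂ eqs))
                    ; d-eq = proj₁ (proj₂ (proj₂ eqs)) ; e-eq = proj₂ (proj₂ (proj₂ eqs)) }
    where
    eqs = pe-injective (trans (Pointed-unique 0≉1 (ex k) (lhs-pointed k) (X-pointed⁺ (next (cls k)) (x-pointed (s k)) h)) (sym (pe-0 (+ 0) (+ 0))))

  rec⁻ : ∀ k → d (s k) ℤ.+ e (s k) ℤ.< + 0 → Rec⁻ k
  rec⁻ k h = record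
    { a-eq = trans (neg-eq {a (s (s k))} {a k} (proj₁ eqs)) (neg-lin (+ cn r) (a (s k)) (w₁ r))
    ; b-eq = trans (neg-eq {b (s (s k))} {b k} (proj₁ (proj₂ eqs))) (neg-lin (+ cn r) (b (s k)) (w₂ r))
    ; d-eq = trans (proj₁ (proj₂ (proj₂ eqs))) (ℤP.+-identityˡ _)
    ; e-eq = trans (proj₂ (proj₂ (proj₂ eqs))) (ℤP.+-identityˡ _) }
    where
    r = next (cls k)
    eqs = pe-injective (trans (Pointed-unique 0≉1 (ex k) (lhs-pointed k) (X-pointed⁻ r (x-pointed (s k)) h))
      (trans (cong (pe (w₁ r) (w₂ r) (+ 0) (+ 0) ·_) (pe-^ (ℤ.- a (s k)) (ℤ.- b (s k)) (d (s k)) (e (s k)) (cn r)))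
        (pe-· (w₁ r) (w₂ r) (+ 0) (+ 0) (+ cn r ℤ.* ℤ.- a (s k)) (+ cn r ℤ.* ℤ.- b (s k)) (+ cn r ℤ.* d (s k)) (+ cn r ℤ.* e (s k)))))

  data Mid (k : ℤ) : Set where
    mid⁺ : + 0 ℤ.≤ d (s k) → + 0 ℤ.≤ e (s k) → Rec⁺ k → Mid k
    mid⁻ : d (s k) ℤ.≤ + 0 → e (s k) ℤ.≤ + 0 → Rec⁻ k → Mid k

  private
    NonZero² : ℤ → ℤ → Set
    NonZero² i j = ¬ (i ≡ + 0 × j ≡ + 0)

    strict : ∀ {i j} → NonZero² i j → + 0 ℤ.≤ i → + 0 ℤ.≤ j → + 0 ℤ.< i ⊎ + 0 ℤ.< j
    strict {i} {j} nz p q with i ℤ.≟ + 0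
    ... | no i≢0  = inj₁ (ℤP.≤∧≢⇒< p (i≢0 ∘ sym))
    ... | yes i≡0 = inj₂ (ℤP.≤∧≢⇒< q (λ j≡0 → nz (i≡0 , sym j≡0)))

    strict⁻ : ∀ {i j} → NonZero² i j → i ℤ.≤ + 0 → j ℤ.≤ + 0 → i ℤ.< + 0 ⊎ j ℤ.< + 0
    strict⁻ {i} {j} nz p q with i ℤ.≟ + 0
    ... | no i≢0  = inj₁ (ℤP.≤∧≢⇒< p i≢0)
    ... | yes i≡0 = inj₂ (ℤP.≤∧≢⇒< q (λ j≡0 → nz (i≡0 , j≡0)))

    sum-pos : ∀ {i j} → + 0 ℤ.≤ i → + 0 ℤ.≤ j → + 0 ℤ.< i ⊎ + 0 ℤ.< j → + 0 ℤ.< i ℤ.+ j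
    sum-pos p q (inj₁ h) = ℤP.+-mono-<-≤ h q
    sum-pos p q (inj₂ h) = ℤP.+-mono-≤-< p h

    sum-neg : ∀ {i j} → i ℤ.≤ + 0 → j ℤ.≤ + 0 → i ℤ.< + 0 ⊎ j ℤ.< + 0 → i ℤ.+ j ℤ.< + 0
    sum-neg p q (inj₁ h) = ℤP.+-mono-<-≤ h q
    sum-neg p q (inj₂ h) = ℤP.+-mono-≤-< p h

    unneg-≤ : ∀ {i} → + 0 ℤ.≤ ℤ.- i → i ℤ.≤ + 0
    unneg-≤ {i} h = ≡.subst (ℤ._≤ + 0) (ℤP.neg-involutive i) (ℤP.neg-mono-≤ h)

    unneg-≥ : ∀ {i} → ℤ.- i ℤ.≤ + 0 → + 0 ℤ.≤ i
    unneg-≥ {i} h = ≡.subst (+ 0 ℤ.≤_) (ℤP.neg-involutive i) (ℤP.neg-mono-≤ h)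

    NonZero²-neg : ∀ {i j} → NonZero² (ℤ.- i) (ℤ.- j) → NonZero² i j
    NonZero²-neg nz (refl , refl) = nz (refl , refl)

  mid : ∀ k → NonZero² (ℤ.- d (s k)) (ℤ.- e (s k)) → Sign (ℤ.- d (s k)) (ℤ.- e (s k)) → Mid k
  mid k nz (Sign.pos p q) = mid⁻ (unneg-≤ p) (unneg-≤ q) (rec⁻ k (sum-neg (unneg-≤ p) (unneg-≤ q)
    (strict⁻ (NonZero²-neg nz) (unneg-≤ p) (unneg-≤ q))))
  mid k nz (Sign.neg p q) = mid⁺ (unneg-≥ p) (unneg-≥ q) (rec⁺ k (sum-pos (unneg-≥ p) (unneg-≥ q)
    (strict (NonZero²-neg nz) (unneg-≥ p) (unneg-≥ q))))

  -- Degrees of x_k for two gradings. In the first, x₁ has degree 1, p_{1,j} degree -j and all other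
  -- variables degree 0, so the exchange polynomials become homogeneous of degree 0; the second is
  -- its analogue for index 2. They tie the normalising exponents to the lowest ones.
  Weights : ℤ → Set
  Weights k = d k ℤ.+ + ℓ₁ ℤ.* a k ≡ w₁ (cls k) × e k ℤ.+ + ℓ₂ ℤ.* b k ≡ w₂ (cls k)

  private
    w-turn : ∀ r → w₁ (next (next r)) ≡ ℤ.- w₁ r × w₂ (next (next r)) ≡ ℤ.- w₂ r
    w-turn C₁ = refl , refl
    w-turn C₂ = refl , refl
    w-turn C₃ = refl , refl
    w-turn C₀ = refl , refl

    cn-turn : ∀ r → cn (next (next r)) ≡ cn r
    cn-turn C₁ = refl
    cn-turn C₂ = refl
    cn-turn C₃ = refl
    cn-turn C₀ = refl

    w-balance : ∀ r → + cn r ℤ.* w₁ r ≡ + ℓ₁ ℤ.* w₁ r × + cn r ℤ.* w₂ r ≡ + ℓ₂ ℤ.* w₂ r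
    w-balance C₁ = refl , trans (ℤP.*-zeroʳ (+ ℓ₁)) (sym (ℤP.*-zeroʳ (+ ℓ₂)))
    w-balance C₂ = trans (ℤP.*-zeroʳ (+ ℓ₂)) (sym (ℤP.*-zeroʳ (+ ℓ₁))) , refl
    w-balance C₃ = refl , trans (ℤP.*-zeroʳ (+ ℓ₁)) (sym (ℤP.*-zeroʳ (+ ℓ₂)))
    w-balance C₀ = trans (ℤP.*-zeroʳ (+ ℓ₂)) (sym (ℤP.*-zeroʳ (+ ℓ₁))) , refl

    weight-sum⁺ : ∀ L {D D' A A'} → D' ℤ.+ D ≡ + 0 → A' ℤ.+ A ≡ + 0 → (D' ℤ.+ L ℤ.* A') ℤ.+ (D ℤ.+ L ℤ.* A) ≡ + 0
    weight-sum⁺ L {D} {D'} {A} {A'} h k = trans (lemma L D D' A A') (trans (cong₂ (λ u v → u ℤ.+ L ℤ.* v) h k) (zero′ L))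
      where
      lemma : ∀ L D D' A A' → (D' ℤ.+ L ℤ.* A') ℤ.+ (D ℤ.+ L ℤ.* A) ≡ (D' ℤ.+ D) ℤ.+ L ℤ.* (A' ℤ.+ A)
      lemma = solve-∀
      zero′ : ∀ L → + 0 ℤ.+ L ℤ.* + 0 ≡ + 0
      zero′ = solve-∀

    weight-sum⁻ : ∀ L n w {D D' A A' Dm Am} → D' ℤ.+ D ≡ n ℤ.* Dm → A' ℤ.+ A ≡ n ℤ.* Am ℤ.- w → Dm ℤ.+ L ℤ.* Am ≡ w →
      n ℤ.* w ≡ L ℤ.* w → (D' ℤ.+ L ℤ.* A') ℤ.+ (D ℤ.+ L ℤ.* A) ≡ + 0
    weight-sum⁻ L n w {D} {D'} {A} {A'} {Dm} {Am} h k l bal = trans (lemma L D D' A A') (trans (cong₂ (λ u v → u ℤ.+ L ℤ.* v) h k)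
      (trans (lemma' L n w Dm Am) (trans (cong (λ z → n ℤ.* z ℤ.- L ℤ.* w) l) (trans (cong (ℤ._- L ℤ.* w) bal) (ℤP.+-inverseʳ (L ℤ.* w))))))
      where
      lemma : ∀ L D D' A A' → (D' ℤ.+ L ℤ.* A') ℤ.+ (D ℤ.+ L ℤ.* A) ≡ (D' ℤ.+ D) ℤ.+ L ℤ.* (A' ℤ.+ A)
      lemma = solve-∀
      lemma' : ∀ L n w Dm Am → n ℤ.* Dm ℤ.+ L ℤ.* (n ℤ.* Am ℤ.- w) ≡ n ℤ.* (Dm ℤ.+ L ℤ.* Am) ℤ.- L ℤ.* w
      lemma' = solve-∀

    weight-sums : ∀ k → Mid k → Weights (s k) →
      (d (s (s k)) ℤ.+ + ℓ₁ ℤ.* a (s (s k))) ℤ.+ (d k ℤ.+ + ℓ₁ ℤ.* a k) ≡ + 0 ×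
      (e (s (s k)) ℤ.+ + ℓ₂ ℤ.* b (s (s k))) ℤ.+ (e k ℤ.+ + ℓ₂ ℤ.* b k) ≡ + 0
    weight-sums k (mid⁺ _ _ rc) _ = weight-sum⁺ (+ ℓ₁) {d k} {d (s (s k))} {a k} {a (s (s k))} (Rec⁺.d-eq rc) (Rec⁺.a-eq rc) ,
      weight-sum⁺ (+ ℓ₂) {e k} {e (s (s k))} {b k} {b (s (s k))} (Rec⁺.e-eq rc) (Rec⁺.b-eq rc)
    weight-sums k (mid⁻ _ _ rc) (wa , wb) =
      weight-sum⁻ (+ ℓ₁) (+ cn r) (w₁ r) {d k} {d (s (s k))} {a k} {a (s (s k))} {d (s k)} {a (s k)} (Rec⁻.d-eq rc) (Rec⁻.a-eq rc) (trans wa (cong w₁ (cls-suc k))) (proj₁ (w-balance r)) ,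
      weight-sum⁻ (+ ℓ₂) (+ cn r) (w₂ r) {e k} {e (s (s k))} {b k} {b (s (s k))} {e (s k)} {b (s k)} (Rec⁻.e-eq rc) (Rec⁻.b-eq rc) (trans wb (cong w₂ (cls-suc k))) (proj₂ (w-balance r))
      where r = next (cls k)

    cls-ss : ∀ k → cls (s (s k)) ≡ next (next (cls k))
    cls-ss k = trans (cls-suc (s k)) (cong next (cls-suc k))

    neg-of : ∀ {i j w w'} → i ℤ.+ j ≡ + 0 → j ≡ w → w' ≡ ℤ.- w → i ≡ w'
    neg-of {i} {j} h refl refl = trans (lemma i j) (trans (cong (ℤ._- j) h) (ℤP.+-identityˡ (ℤ.- j)))
      where
      lemma : ∀ i j → i ≡ i ℤ.+ j ℤ.- j
      lemma = solve-∀

    weights-up : ∀ k → Mid k → Weights k → Weights (s k) → Weights (s (s k))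
    weights-up k m (wa , wb) ws with weight-sums k m ws
    ... | sa , sb = neg-of sa wa (trans (cong w₁ (cls-ss k)) (proj₁ (w-turn (cls k)))) ,
                    neg-of sb wb (trans (cong w₂ (cls-ss k)) (proj₂ (w-turn (cls k))))

    weights-down : ∀ k → Mid k → Weights (s k) → Weights (s (s k)) → Weights k
    weights-down k m ws (wa , wb) with weight-sums k m ws
    ... | sa , sb = neg-of (trans (ℤP.+-comm (d k ℤ.+ + ℓ₁ ℤ.* a k) _) sa) wa flip₁ ,
                    neg-of (trans (ℤP.+-comm (e k ℤ.+ + ℓ₂ ℤ.* b k) _) sb) wb flip₂
      where
      flip₁ : w₁ (cls k) ≡ ℤ.- w₁ (cls (s (s k)))
      flip₁ = sym (trans (cong (λ z → ℤ.- z) (trans (cong w₁ (cls-ss k)) (proj₁ (w-turn (cls k))))) (ℤP.neg-involutive (w₁ (cls k))))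
      flip₂ : w₂ (cls k) ≡ ℤ.- w₂ (cls (s (s k)))
      flip₂ = sym (trans (cong (λ z → ℤ.- z) (trans (cong w₂ (cls-ss k)) (proj₂ (w-turn (cls k))))) (ℤP.neg-involutive (w₂ (cls k))))

  record Inv (k : ℤ) : Set where
    field
      state : State (+ ℓ₁) (+ ℓ₂) (+ cn (cls k)) (+ cn (cls (s k))) (ℤ.- d k) (ℤ.- e k) (ℤ.- d (s k)) (ℤ.- e (s k))
      wt    : Weights k
      wt′   : Weights (s k)

  private
    0<ℓ₁ : + 0 ℤ.< + ℓ₁
    0<ℓ₁ = ℤ.+<+ 1≤ℓ₁
    0<ℓ₂ : + 0 ℤ.< + ℓ₂
    0<ℓ₂ = ℤ.+<+ 1≤ℓ₂

    0<cn : ∀ r → + 0 ℤ.< + cn r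
    0<cn C₁ = 0<ℓ₁
    0<cn C₂ = 0<ℓ₂
    0<cn C₃ = 0<ℓ₁
    0<cn C₀ = 0<ℓ₂

    det-nonzero : ∀ {s₁ s₂ y₁ y₂} → s₁ ℤ.* y₂ ℤ.- s₂ ℤ.* y₁ ≡ + 1 → NonZero² y₁ y₂ × NonZero² s₁ s₂
    det-nonzero {s₁} {s₂} {y₁} {y₂} h = (λ { (refl , refl) → absurd (trans (sym (zeroʸ s₁ s₂)) h) }) , λ { (refl , refl) → absurd (trans (sym (zeroˢ y₁ y₂)) h) }
      where
      absurd : + 0 ≢ + 1
      absurd ()
      zeroʸ : ∀ s₁ s₂ → s₁ ℤ.* + 0 ℤ.- s₂ ℤ.* + 0 ≡ + 0
      zeroʸ = solve-∀
      zeroˢ : ∀ y₁ y₂ → + 0 ℤ.* y₂ ℤ.- + 0 ℤ.* y₁ ≡ + 0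
      zeroˢ = solve-∀

    neg-sum⁺ : ∀ {i j} → i ℤ.+ j ≡ + 0 → ℤ.- j ℤ.+ ℤ.- i ≡ + 0
    neg-sum⁺ {i} {j} h = trans (lemma i j) (cong (λ z → ℤ.- z) h)
      where
      lemma : ∀ i j → ℤ.- j ℤ.+ ℤ.- i ≡ ℤ.- (i ℤ.+ j)
      lemma = solve-∀

    neg-sum⁻ : ∀ {i j n m} → i ℤ.+ j ≡ n ℤ.* m → ℤ.- j ℤ.+ ℤ.- i ≡ n ℤ.* ℤ.- m
    neg-sum⁻ {i} {j} {n} {m} h = trans (lemma i j) (trans (cong (λ z → ℤ.- z) h) (ℤP.neg-distribʳ-* n m))
      where
      lemma : ∀ i j → ℤ.- j ℤ.+ ℤ.- i ≡ ℤ.- (i ℤ.+ j)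
      lemma = solve-∀

    flip-sum : ∀ {i j l : ℤ} → j ℤ.+ i ≡ l → i ℤ.+ j ≡ l
    flip-sum {i} {j} h = trans (ℤP.+-comm i j) h

  Inv-mid : ∀ {k} → Inv k → Mid k
  Inv-mid {k} inv = mid k (proj₁ (det-nonzero {ℤ.- d k} {ℤ.- e k} (State.det st))) (State.sgn-y st)
    where st = Inv.state inv

  Inv-mid′ : ∀ {k} → Inv (s k) → Mid k
  Inv-mid′ {k} inv = mid k (proj₂ (det-nonzero {ℤ.- d (s k)} {ℤ.- e (s k)} {ℤ.- d (s (s k))} {ℤ.- e (s (s k))} (State.det st))) (State.sgn-s st)
    where st = Inv.state inv

  Inv-up : ∀ k → Inv k → Inv (s k)
  Inv-up k inv = record { state = next-state (Inv-mid inv) ; wt = wt′ ; wt′ = weights-up k (Inv-mid inv) wt wt′ }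
    where
    open Inv inv
    nz : NonZero² (ℤ.- d (s k)) (ℤ.- e (s k))
    nz = proj₁ (det-nonzero {ℤ.- d k} {ℤ.- e k} (State.det state))
    rs : cn (cls k) ≡ cn (cls (s (s k)))
    rs = sym (trans (cong cn (cls-ss k)) (cn-turn (cls k)))
    n≡ : + cn (next (cls k)) ≡ + cn (cls (s k))
    n≡ = cong (λ r → + cn r) (sym (cls-suc k))
    St : ℤ → Set
    St n = State (+ ℓ₁) (+ ℓ₂) (+ cn (cls (s k))) n (ℤ.- d (s k)) (ℤ.- e (s k)) (ℤ.- d (s (s k))) (ℤ.- e (s (s k)))
    next-state : Mid k → St (+ cn (cls (s (s k))))
    next-state (mid⁺ p q rc) = ≡.subst St (cong +_ rs) (step-neg (+ ℓ₁) (+ ℓ₂) 0<ℓ₁ state (ℤP.neg-mono-≤ p) (ℤP.neg-mono-≤ q)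
      (strict⁻ nz (ℤP.neg-mono-≤ p) (ℤP.neg-mono-≤ q))
      (neg-sum⁺ {d (s (s k))} {d k} (Rec⁺.d-eq rc)) (neg-sum⁺ {e (s (s k))} {e k} (Rec⁺.e-eq rc)))
    next-state (mid⁻ p q rc) = ≡.subst St (cong +_ rs) (step-pos (+ ℓ₁) (+ ℓ₂) 0<ℓ₁ (0<cn (cls (s k))) state (ℤP.neg-mono-≤ p) (ℤP.neg-mono-≤ q)
      (strict nz (ℤP.neg-mono-≤ p) (ℤP.neg-mono-≤ q))
      (neg-sum⁻ {d (s (s k))} {d k} {+ cn (cls (s k))} {d (s k)} (trans (Rec⁻.d-eq rc) (cong (ℤ._* d (s k)) n≡)))
      (neg-sum⁻ {e (s (s k))} {e k} {+ cn (cls (s k))} {e (s k)} (trans (Rec⁻.e-eq rc) (cong (ℤ._* e (s k)) n≡))))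

  -- The exchange relation is symmetric in its outer variables, so `State-swap` reduces this to the
  -- steps used in `Inv-up`.
  Inv-down : ∀ k → Inv (s k) → Inv k
  Inv-down k inv = record { state = prev-state (Inv-mid′ inv) ; wt = weights-down k (Inv-mid′ inv) wt wt′ ; wt′ = wt }
    where
    open Inv inv
    nz : NonZero² (ℤ.- d (s k)) (ℤ.- e (s k))
    nz = proj₂ (det-nonzero {ℤ.- d (s k)} {ℤ.- e (s k)} {ℤ.- d (s (s k))} {ℤ.- e (s (s k))} (State.det state))
    rs : cn (cls (s (s k))) ≡ cn (cls k)
    rs = trans (cong cn (cls-ss k)) (cn-turn (cls k))
    n≡ : + cn (next (cls k)) ≡ + cn (cls (s k))
    n≡ = cong (λ r → + cn r) (sym (cls-suc k))
    St : ℤ → Set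
    St n = State (+ ℓ₁) (+ ℓ₂) n (+ cn (cls (s k))) (ℤ.- d k) (ℤ.- e k) (ℤ.- d (s k)) (ℤ.- e (s k))
    swap⊎ : ∀ {A B : Set} → A ⊎ B → B ⊎ A
    swap⊎ (inj₁ x) = inj₂ x
    swap⊎ (inj₂ x) = inj₁ x
    prev-state : Mid k → St (+ cn (cls k))
    prev-state (mid⁺ p q rc) = ≡.subst St (cong +_ rs) (State-swap (step-neg (+ ℓ₂) (+ ℓ₁) 0<ℓ₂ (State-swap state) (ℤP.neg-mono-≤ q) (ℤP.neg-mono-≤ p)
      (swap⊎ (strict⁻ nz (ℤP.neg-mono-≤ p) (ℤP.neg-mono-≤ q)))
      (flip-sum {ℤ.- e (s (s k))} (neg-sum⁺ {e (s (s k))} {e k} (Rec⁺.e-eq rc))) (flip-sum {ℤ.- d (s (s k))} (neg-sum⁺ {d (s (s k))} {d k} (Rec⁺.d-eq rc)))))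
    prev-state (mid⁻ p q rc) = ≡.subst St (cong +_ rs) (State-swap (step-pos (+ ℓ₂) (+ ℓ₁) 0<ℓ₂ (0<cn (cls (s k))) (State-swap state) (ℤP.neg-mono-≤ q) (ℤP.neg-mono-≤ p)
      (swap⊎ (strict nz (ℤP.neg-mono-≤ p) (ℤP.neg-mono-≤ q)))
      (flip-sum {ℤ.- e (s (s k))} (neg-sum⁻ {e (s (s k))} {e k} {+ cn (cls (s k))} {e (s k)} (trans (Rec⁻.e-eq rc) (cong (ℤ._* e (s k)) n≡))))
      (flip-sum {ℤ.- d (s (s k))} (neg-sum⁻ {d (s (s k))} {d k} {+ cn (cls (s k))} {d (s k)} (trans (Rec⁻.d-eq rc) (cong (ℤ._* d (s k)) n≡))))))

  initial : ∀ k i j → Pointed (xm i j) (x k) → a k ≡ + 0 × b k ≡ + 0 × d k ≡ i × e k ≡ j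
  initial k i j h = trans (sym (ℤP.neg-involutive (a k))) (cong (λ z → ℤ.- z) (proj₁ eqs)) ,
    trans (sym (ℤP.neg-involutive (b k))) (cong (λ z → ℤ.- z) (proj₁ (proj₂ eqs))) , proj₁ (proj₂ (proj₂ eqs)) , proj₂ (proj₂ (proj₂ eqs))
    where
    eqs = pe-injective (trans (Pointed-unique 0≉1 ≋-refl (x-pointed k) h) (sym (pe-0 i j)))

  x₁-eq : x (+ 1) ≋ ξ₁
  x₁-eq = ≋-trans (mk≋ (IsPreClusterSeq.init₁ seq)) (≋-reflexive (monoP-x (+ 1) (+ 0)))

  x₂-eq : x (+ 2) ≋ ξ₂
  x₂-eq = ≋-trans (mk≋ (IsPreClusterSeq.init₂ seq)) (≋-reflexive (monoP-x (+ 0) (+ 1)))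

  Inv-1 : Inv (+ 1)
  Inv-1 = record
    { state = ≡.subst₂ (λ p q → State (+ ℓ₁) (+ ℓ₂) (+ ℓ₁) (+ ℓ₂) (ℤ.- proj₁ p) (ℤ.- proj₂ p) (ℤ.- proj₁ q) (ℤ.- proj₂ q))
        (sym (cong₂ _,_ d₁ e₁)) (sym (cong₂ _,_ d₂ e₂)) st
    ; wt  = trans (cong₂ (λ i j → i ℤ.+ + ℓ₁ ℤ.* j) d₁ a₁) (w+ (+ 1) (+ ℓ₁)) , trans (cong₂ (λ i j → i ℤ.+ + ℓ₂ ℤ.* j) e₁ b₁) (w+ (+ 0) (+ ℓ₂))
    ; wt′ = trans (cong₂ (λ i j → i ℤ.+ + ℓ₁ ℤ.* j) d₂ a₂) (w+ (+ 0) (+ ℓ₁)) , trans (cong₂ (λ i j → i ℤ.+ + ℓ₂ ℤ.* j) e₂ b₂) (w+ (+ 1) (+ ℓ₂))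
    }
    where
    i₁ : a (+ 1) ≡ + 0 × b (+ 1) ≡ + 0 × d (+ 1) ≡ + 1 × e (+ 1) ≡ + 0
    i₁ = initial (+ 1) (+ 1) (+ 0) (Lead-resp (≋-sym x₁-eq) (Lead-mono _))
    i₂ : a (+ 2) ≡ + 0 × b (+ 2) ≡ + 0 × d (+ 2) ≡ + 0 × e (+ 2) ≡ + 1
    i₂ = initial (+ 2) (+ 0) (+ 1) (Lead-resp (≋-sym x₂-eq) (Lead-mono _))
    a₁ = proj₁ i₁
    b₁ = proj₁ (proj₂ i₁)
    d₁ = proj₁ (proj₂ (proj₂ i₁))
    e₁ = proj₂ (proj₂ (proj₂ i₁))
    a₂ = proj₁ i₂
    b₂ = proj₁ (proj₂ i₂)
    d₂ = proj₁ (proj₂ (proj₂ i₂))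
    e₂ = proj₂ (proj₂ (proj₂ i₂))
    w+ : ∀ w L → w ℤ.+ L ℤ.* + 0 ≡ w
    w+ = solve-∀
    q₁ : ∀ L₁ L₂ → L₁ ℤ.* (L₂ ℤ.* (-[1+ 0 ] ℤ.* -[1+ 0 ]) ℤ.- L₁ ℤ.* L₂ ℤ.* (-[1+ 0 ] ℤ.* + 0) ℤ.+ L₁ ℤ.* (+ 0 ℤ.* + 0)) ≡ L₁ ℤ.* L₂
    q₁ = solve-∀
    q₂ : ∀ L₁ L₂ → L₂ ℤ.* (L₂ ℤ.* (+ 0 ℤ.* + 0) ℤ.- L₁ ℤ.* L₂ ℤ.* (+ 0 ℤ.* -[1+ 0 ]) ℤ.+ L₁ ℤ.* (-[1+ 0 ] ℤ.* -[1+ 0 ])) ≡ L₁ ℤ.* L₂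
    q₂ = solve-∀
    B₁₂ : ∀ L₁ L₂ → + 2 ℤ.* (L₂ ℤ.* (-[1+ 0 ] ℤ.* + 0)) ℤ.- L₁ ℤ.* L₂ ℤ.* (-[1+ 0 ] ℤ.* -[1+ 0 ] ℤ.+ + 0 ℤ.* + 0) ℤ.+ + 2 ℤ.* (L₁ ℤ.* (+ 0 ℤ.* -[1+ 0 ]))
            ≡ -[1+ 0 ] ℤ.* (L₁ ℤ.* L₂)
    B₁₂ = solve-∀
    st : State (+ ℓ₁) (+ ℓ₂) (+ ℓ₁) (+ ℓ₂) -[1+ 0 ] (+ 0) (+ 0) -[1+ 0 ]
    st = record
      { det = refl ; q-s = q₁ (+ ℓ₁) (+ ℓ₂) ; q-y = q₂ (+ ℓ₁) (+ ℓ₂)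
      ; sgn-s = Sign.neg ℤ.-≤+ ℤP.≤-refl ; sgn-y = Sign.neg ℤP.≤-refl ℤ.-≤+ ; form = B₁₂ (+ ℓ₁) (+ ℓ₂) }

  invariant : ∀ k → Inv k
  invariant = ℤ-induction Inv (Inv-down (+ 0) Inv-1) Inv-up Inv-down

  private
    X-cong : ∀ r {z z'} → z ≋ z' → X r z ≋ X r z'
    X-cong r h = Σ≤-cong (cn r) λ j _ → ⊗-congˡ (mono (cm r j)) (^-cong (ce r j) h)

    X-C₁ : ∀ z → X C₁ z ≋ 𝟏 ⊕ Σ₁′ ℓ₁ (λ j → mono (pm₁ j) ⊗ z ^ j)
    X-C₁ z = ≋-trans (≋-sym (exch-X (+ 1) z)) (P₁-sum z)

    X-C₂ : ∀ z → X C₂ z ≋ 𝟏 ⊕ Σ₁′ ℓ₂ (λ j → mono (pm₂ j) ⊗ z ^ j)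
    X-C₂ z = ≋-trans (≋-sym (exch-X (+ 2) z)) (P₂-sum z)

    divide-mono : ∀ {f g m n} → f ⊗ mono m ≋ g → n · m ≡ one → f ≋ mono n ⊗ g
    divide-mono {f} {g} {m} {n} h nm = ≋-sym (begin
      mono n ⊗ g               ≈⟨ ⊗-congˡ (mono n) (≋-trans (≋-sym h) (⊗-comm f (mono m))) ⟩
      mono n ⊗ (mono m ⊗ f)    ≈⟨ ⊗-assoc (mono n) (mono m) f ⟨
      (mono n ⊗ mono m) ⊗ f    ≈⟨ ⊗-congʳ f (≋-trans (mono-· n m) (≋-reflexive (cong mono nm))) ⟩
      𝟏 ⊗ f                    ≈⟨ ⊗-identityˡ f ⟩
      f                        ∎)
      where open ≋-R

  x₀-eq : x (+ 0) ≋ mono (xm (+ 0) -[1+ 0 ]) ⊗ Q₁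
  x₀-eq = divide-mono (≋-trans (≋-trans (⊗-comm (x (+ 0)) ξ₂) (⊗-congʳ (x (+ 0)) (≋-sym x₂-eq)))
    (≋-trans (ex (+ 0)) (≋-trans (X-cong C₁ x₁-eq) (X-C₁ ξ₁)))) (xm-· (+ 0) -[1+ 0 ] (+ 0) (+ 1))

  x₃-eq : x (+ 3) ≋ mono (xm -[1+ 0 ] (+ 0)) ⊗ Q₂
  x₃-eq = divide-mono (≋-trans (⊗-congˡ (x (+ 3)) (≋-sym x₁-eq))
    (≋-trans (ex (+ 1)) (≋-trans (X-cong C₂ x₂-eq) (X-C₂ ξ₂)))) (xm-· -[1+ 0 ] (+ 0) (+ 1) (+ 0))

  private
    -- If x k already has lowest coefficient 1, uniqueness of the lowest term forces a k = b k = 0.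
    -- This makes the first four variables equal to their normalisations.
    plain-normal : ∀ k i j → Pointed (xm i j) (x k) → X̂ k ≋ x k
    plain-normal k i j h = ≋-trans (⊗-congʳ (x k) (≋-reflexive (cong mono (trans (cong₂ (λ u v → pe u v (+ 0) (+ 0))
      (proj₁ (initial k i j h)) (proj₁ (proj₂ (initial k i j h)))) (pe-0 (+ 0) (+ 0)))))) (⊗-identityˡ (x k))

    shifted-pointed : ∀ {D : 𝕄 → Set} {q} m → Lead D one q → (∀ {n} → D n → + 0 ℤ.< deg n) → Pointed m (mono m ⊗ q)
    shifted-pointed {q = q} m L h = ≡.subst (λ z → Pointed z (mono m ⊗ q)) (·-identityʳ m) (Pointed-⊗ (Lead-mono m) (Lead-weaken h L))

  X̂₀ : X̂ (+ 0) ≋ mono (xm (+ 0) -[1+ 0 ]) ⊗ Q₁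
  X̂₀ = ≋-trans (plain-normal (+ 0) (+ 0) -[1+ 0 ] (Lead-resp (≋-sym x₀-eq) (shifted-pointed _ Q₁-lead (λ { (_ , _ , h , _) → h })))) x₀-eq

  X̂₁ : X̂ (+ 1) ≋ ξ₁
  X̂₁ = ≋-trans (plain-normal (+ 1) (+ 1) (+ 0) (Lead-resp (≋-sym x₁-eq) (Lead-mono _))) x₁-eq

  X̂₂ : X̂ (+ 2) ≋ ξ₂
  X̂₂ = ≋-trans (plain-normal (+ 2) (+ 0) (+ 1) (Lead-resp (≋-sym x₂-eq) (Lead-mono _))) x₂-eq

  X̂₃ : X̂ (+ 3) ≋ mono (xm -[1+ 0 ] (+ 0)) ⊗ Q₂
  X̂₃ = ≋-trans (plain-normal (+ 3) -[1+ 0 ] (+ 0) (Lead-resp (≋-sym x₃-eq) (shifted-pointed _ Q₂-lead (λ { (_ , _ , h , _) → h })))) x₃-eq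

  private
    Integral-x⁻ : ∀ {m i j} → Integral (m · xm i j) → Integral m
    Integral-x⁻ {m} (p , q) = ≡.subst NonNeg (VecP.zipWith-identityʳ ℤP.+-identityʳ (proj₁ m)) p ,
      ≡.subst NonNeg (VecP.zipWith-identityʳ ℤP.+-identityʳ (proj₁ (proj₂ m))) q

    integral-lead : ∀ {m f} → Integral m → Pointed m f → In Integral f → Lead (λ n → deg m ℤ.< deg n × Integral n) m f
    integral-lead {m} {f} im (mkLead r h eq) inf = mkLead (restrict Integral? r)
        (All.zipWith (λ p → p) (AllP.filter⁺ (Integral? ∘ proj₂) h , restrict-all Integral? r))
        (≋-trans eq (⊕-cong (≋-refl {mono m}) (≋-restrict Integral? r (λ n ¬i → In-vanish r-int ¬i))))
      where
      r-int : In Integral r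
      r-int = In-resp (≋-sym (RI.+-move {f} {mono m} {r} eq)) (In-⊕ inf (In-neg (In-mono im)))

    -- `division` with integrality as support condition. The lowest monomial of `X̂ k` has no
    -- p-part, so multiplying by it neither creates nor hides a negative power of p_{i,j}.
    integral-factor : ∀ {f k} → In Integral (X̂ k) → In Integral (f ⊗ X̂ k) → In Integral f
    integral-factor {f} {k} ik ifg = In-decide Integral? f λ m ¬i → division Integral?
      (Lead-weaken (λ { {n} (h , i) → h , λ t it → Integral-· {t} {n} (Integral-x⁻ {t} {d k} {e k} it) i })
        (integral-lead (Integral-xm (d k) (e k)) (X̂-pointed k) ik)) ifg m (¬i ∘ Integral-x⁻ {m} {d k} {e k})

    module _ (k : ℤ) where
      r : Class
      r = next (cls k)
      sum-a sum-b : ℤ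
      sum-a = a (s (s k)) ℤ.+ a k
      sum-b = b (s (s k)) ℤ.+ b k
      exp-a exp-b : ℤ → ℤ
      exp-a i = sum-a ℤ.+ (v₁ r ℤ.+ i ℤ.* ℤ.- a (s k))
      exp-b i = sum-b ℤ.+ (v₂ r ℤ.+ i ℤ.* ℤ.- b (s k))

      -- The coefficient of `X̂ (s k) ^ ce r j` in `X̂ (s (s k)) ⊗ X̂ k`, obtained by writing
      -- `x (s k)` through its normalisation.
      coefficient : ℕ → 𝕄
      coefficient j = pe sum-a sum-b (+ 0) (+ 0) · (cm r j · (pe (ℤ.- a (s k)) (ℤ.- b (s k)) (+ 0) (+ 0) ^ᴹ ce r j))

      coefficient≡ : ∀ j → coefficient j ≡ pe (exp-a (+ ce r j)) (exp-b (+ ce r j)) (+ 0) (+ 0) · cpm r j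
      coefficient≡ j = begin
        P · ((cv r · cpm r j) · (Y ^ᴹ ce r j))  ≡⟨ cong (P ·_) (trans (·-assoc (cv r) (cpm r j) Yⁿ) (trans (cong (cv r ·_) (·-comm (cpm r j) Yⁿ)) (sym (·-assoc (cv r) Yⁿ (cpm r j))))) ⟩
        P · ((cv r · (Y ^ᴹ ce r j)) · cpm r j)  ≡⟨ ·-assoc P (cv r · Yⁿ) (cpm r j) ⟨
        (P · (cv r · (Y ^ᴹ ce r j))) · cpm r j  ≡⟨ cong (_· cpm r j) merged ⟩
        pe (exp-a (+ ce r j)) (exp-b (+ ce r j)) (+ 0) (+ 0) · cpm r j ∎
        where
        open ≡.≡-Reasoning
        P = pe sum-a sum-b (+ 0) (+ 0)
        Y = pe (ℤ.- a (s k)) (ℤ.- b (s k)) (+ 0) (+ 0)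
        Yⁿ = Y ^ᴹ ce r j
        n = + ce r j
        merged : P · (cv r · (Y ^ᴹ ce r j)) ≡ pe (exp-a n) (exp-b n) (+ 0) (+ 0)
        merged = trans (cong (λ z → P · (cv r · z)) (trans (pe-^ (ℤ.- a (s k)) (ℤ.- b (s k)) (+ 0) (+ 0) (ce r j))
            (cong₂ (pe (n ℤ.* ℤ.- a (s k)) (n ℤ.* ℤ.- b (s k))) (ℤP.*-zeroʳ n) (ℤP.*-zeroʳ n))))
          (trans (cong (P ·_) (pe-· (v₁ r) (v₂ r) (+ 0) (+ 0) (n ℤ.* ℤ.- a (s k)) (n ℤ.* ℤ.- b (s k)) (+ 0) (+ 0)))
            (pe-· sum-a sum-b (+ 0) (+ 0) (v₁ r ℤ.+ n ℤ.* ℤ.- a (s k)) (v₂ r ℤ.+ n ℤ.* ℤ.- b (s k)) (+ 0) (+ 0)))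

    own₁ : ∀ {i j f} → Own ℓ₁ j i → + 0 ℤ.≤ f → Integral (pe i f (+ 0) (+ 0) · pm₁ j)
    own₁ {i} {j} {f} o h = o , NonNeg-⊞ (NonNeg-expAt ℓ₂ ℓ₂ h) (NonNeg-zeros ℓ₂)

    own₂ : ∀ {i j f} → + 0 ℤ.≤ f → Own ℓ₂ j i → Integral (pe f i (+ 0) (+ 0) · pm₂ j)
    own₂ {i} {j} {f} h o = NonNeg-⊞ (NonNeg-expAt ℓ₁ ℓ₁ h) (NonNeg-zeros ℓ₁) , o

    Conds : Class → ℤ → ℤ → ℤ → ℤ → Set
    Conds r D E' A' B' = D ℤ.+ + ℓ₁ ℤ.* A' ≡ w₁ r × E' ℤ.+ + ℓ₂ ℤ.* B' ≡ w₂ r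

    bounds⁺ : ∀ r {D E' A' B'} → Conds r D E' A' B' → + 0 ℤ.≤ D → + 0 ℤ.≤ E' → ∀ j → j ℕ.≤ cn r →
      Integral (pe (+ 0 ℤ.+ (v₁ r ℤ.+ + ce r j ℤ.* ℤ.- A')) (+ 0 ℤ.+ (v₂ r ℤ.+ + ce r j ℤ.* ℤ.- B')) (+ 0) (+ 0) · cpm r j)
    bounds⁺ C₁ {D} {E'} {A'} {B'} (wa , wb) p q j le = own₁ {j = j} (own-P⁺ {ℓ₁} {j} {D} {A'} p wa le) (other⁺ {ℓ₂} {E'} {B'} 1≤ℓ₂ q wb j)
    bounds⁺ C₂ {D} {E'} {A'} {B'} (wa , wb) p q j le = own₂ {j = j} (other⁺ {ℓ₁} {D} {A'} 1≤ℓ₁ p wa j) (own-P⁺ {ℓ₂} {j} {E'} {B'} q wb le)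
    bounds⁺ C₃ {D} {E'} {A'} {B'} (wa , wb) p q j le = own₁ {j = j} (own-P̄⁺ {ℓ₁} {j} {D} {A'} p wa le) (other⁺ {ℓ₂} {E'} {B'} 1≤ℓ₂ q wb (ℓ₁ ℕ.∸ j))
    bounds⁺ C₀ {D} {E'} {A'} {B'} (wa , wb) p q j le = own₂ {j = j} (other⁺ {ℓ₁} {D} {A'} 1≤ℓ₁ p wa (ℓ₂ ℕ.∸ j)) (own-P̄⁺ {ℓ₂} {j} {E'} {B'} q wb le)

    bounds⁻ : ∀ r {D E' A' B'} → Conds r D E' A' B' → D ℤ.≤ + 0 → E' ℤ.≤ + 0 → ∀ j → j ℕ.≤ cn r →
      Integral (pe ((+ cn r ℤ.* A' ℤ.- w₁ r) ℤ.+ (v₁ r ℤ.+ + ce r j ℤ.* ℤ.- A')) ((+ cn r ℤ.* B' ℤ.- w₂ r) ℤ.+ (v₂ r ℤ.+ + ce r j ℤ.* ℤ.- B')) (+ 0) (+ 0) · cpm r j)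
    bounds⁻ C₁ {D} {E'} {A'} {B'} (wa , wb) p q j le = own₁ {j = j} (own-P⁻ {ℓ₁} {j} {D} {A'} p wa le) (other⁻ {ℓ₂} {E'} {B'} 1≤ℓ₂ q wb le)
    bounds⁻ C₂ {D} {E'} {A'} {B'} (wa , wb) p q j le = own₂ {j = j} (other⁻ {ℓ₁} {D} {A'} 1≤ℓ₁ p wa le) (own-P⁻ {ℓ₂} {j} {E'} {B'} q wb le)
    bounds⁻ C₃ {D} {E'} {A'} {B'} (wa , wb) p q j le = own₁ {j = j} (own-P̄⁻ {ℓ₁} {j} {D} {A'} p wa le) (other⁻ {ℓ₂} {E'} {B'} 1≤ℓ₂ q wb (ℕP.m∸n≤m ℓ₁ j))
    bounds⁻ C₀ {D} {E'} {A'} {B'} (wa , wb) p q j le = own₂ {j = j} (other⁻ {ℓ₁} {D} {A'} 1≤ℓ₁ p wa (ℕP.m∸n≤m ℓ₂ j)) (own-P̄⁻ {ℓ₂} {j} {E'} {B'} q wb le)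

    -- The recurrence for the outer exponents replaces `sum-a` and `sum-b` by expressions in the
    -- middle variable alone, to which the exponent bounds apply.
    coefficient-integral : ∀ k → Mid k → Weights (s k) → ∀ j → j ℕ.≤ cn (r k) → Integral (coefficient k j)
    coefficient-integral k m (wa , wb) j le = ≡.subst Integral (sym (coefficient≡ k j)) (by-sign m)
      where
      cond : Conds (r k) (d (s k)) (e (s k)) (a (s k)) (b (s k))
      cond = trans wa (cong w₁ (cls-suc k)) , trans wb (cong w₂ (cls-suc k))
      Ok : ℤ → ℤ → Set
      Ok u v = Integral (pe (u ℤ.+ (v₁ (r k) ℤ.+ + ce (r k) j ℤ.* ℤ.- a (s k))) (v ℤ.+ (v₂ (r k) ℤ.+ + ce (r k) j ℤ.* ℤ.- b (s k))) (+ 0) (+ 0) · cpm (r k) j)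
      by-sign : Mid k → Ok (a (s (s k)) ℤ.+ a k) (b (s (s k)) ℤ.+ b k)
      by-sign (mid⁺ p q rc) = ≡.subst₂ Ok (sym (Rec⁺.a-eq rc)) (sym (Rec⁺.b-eq rc)) (bounds⁺ (r k) cond p q j le)
      by-sign (mid⁻ p q rc) = ≡.subst₂ Ok (sym (Rec⁻.a-eq rc)) (sym (Rec⁻.b-eq rc)) (bounds⁻ (r k) cond p q j le)

    integral-product : ∀ k → Mid k → Weights (s k) → In Integral (X̂ (s k)) → In Integral (X̂ (s (s k)) ⊗ X̂ k)
    integral-product k m ws ik = In-resp (≋-sym product≋) (Σ≤-closed (In Integral) In-𝟎 In-⊕ (cn (r k)) λ j le →
        In-⊗ {D = Integral} {E = Integral} (λ {m} {n} → Integral-· {m} {n}) (In-mono {Integral} {coefficient k j} (coefficient-integral k m ws j le))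
          (In-^ Integral-one (λ {m} {n} → Integral-· {m} {n}) ik (ce (r k) j)))
      where
      open ≋-R
      M₀ = pe (a k) (b k) (+ 0) (+ 0)
      M₂ = pe (a (s (s k))) (b (s (s k))) (+ 0) (+ 0)
      P = pe (sum-a k) (sum-b k) (+ 0) (+ 0)
      Y = pe (ℤ.- a (s k)) (ℤ.- b (s k)) (+ 0) (+ 0)
      product≋ : X̂ (s (s k)) ⊗ X̂ k ≋ Σ≤ (cn (r k)) (λ j → mono (coefficient k j) ⊗ X̂ (s k) ^ ce (r k) j)
      product≋ = begin
        (mono M₂ ⊗ x (s (s k))) ⊗ (mono M₀ ⊗ x k)  ≈⟨ RI.*-interchange (mono M₂) (x (s (s k))) (mono M₀) (x k) ⟩
        (mono M₂ ⊗ mono M₀) ⊗ (x (s (s k)) ⊗ x k)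
          ≈⟨ ⊗-cong (≋-trans (mono-· M₂ M₀) (≋-reflexive (cong mono (pe-· (a (s (s k))) (b (s (s k))) (+ 0) (+ 0) (a k) (b k) (+ 0) (+ 0))))) (ex k) ⟩
        mono P ⊗ X (r k) (x (s k))                 ≈⟨ ⊗-Σ≤ (mono P) (cn (r k)) (λ j → mono (cm (r k) j) ⊗ x (s k) ^ ce (r k) j) ⟩
        Σ≤ (cn (r k)) (λ j → mono P ⊗ (mono (cm (r k) j) ⊗ x (s k) ^ ce (r k) j)) ≈⟨ Σ≤-cong (cn (r k)) (λ j _ → each j) ⟩
        Σ≤ (cn (r k)) (λ j → mono (coefficient k j) ⊗ X̂ (s k) ^ ce (r k) j) ∎
        where
        each : ∀ j → mono P ⊗ (mono (cm (r k) j) ⊗ x (s k) ^ ce (r k) j) ≋ mono (coefficient k j) ⊗ X̂ (s k) ^ ce (r k) j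
        each j = begin
          mono P ⊗ (mono C ⊗ x (s k) ^ i)                     ≈⟨ ⊗-congˡ (mono P) (⊗-congˡ (mono C) (≋-trans (^-cong i (x-from-X̂ (s k)))
              (≋-trans (⊗-^ (mono Y) (X̂ (s k)) i) (⊗-congʳ (X̂ (s k) ^ i) (mono-^ Y i))))) ⟩
          mono P ⊗ (mono C ⊗ (mono (Y ^ᴹ i) ⊗ X̂ (s k) ^ i))   ≈⟨ ⊗-congˡ (mono P) (≋-trans (≋-sym (⊗-assoc (mono C) (mono (Y ^ᴹ i)) (X̂ (s k) ^ i))) (⊗-congʳ (X̂ (s k) ^ i) (mono-· C (Y ^ᴹ i)))) ⟩
          mono P ⊗ (mono (C · (Y ^ᴹ i)) ⊗ X̂ (s k) ^ i)        ≈⟨ ⊗-assoc (mono P) (mono (C · (Y ^ᴹ i))) (X̂ (s k) ^ i) ⟨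
          (mono P ⊗ mono (C · (Y ^ᴹ i))) ⊗ X̂ (s k) ^ i        ≈⟨ ⊗-congʳ (X̂ (s k) ^ i) (mono-· P (C · (Y ^ᴹ i))) ⟩
          mono (coefficient k j) ⊗ X̂ (s k) ^ i                ∎
          where
          C = cm (r k) j
          i = ce (r k) j

    Both : ℤ → Set _
    Both k = In Integral (X̂ k) × In Integral (X̂ (s k))

    -- The product of the outer variables is integral by the normalised relation; dividing by the
    -- integral, pointed `X̂ k` leaves the next variable.
    Both-up : ∀ k → Both k → Both (s k)
    Both-up k (i₀ , i₁) = i₁ , integral-factor i₀ (integral-product k (Inv-mid (invariant k)) (Inv.wt′ (invariant k)) i₁)

    Both-down : ∀ k → Both (s k) → Both k
    Both-down k (i₁ , i₂) = integral-factor i₂ (In-resp (⊗-comm (X̂ (s (s k))) (X̂ k))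
      (integral-product k (Inv-mid (invariant k)) (Inv.wt′ (invariant k)) i₁)) , i₁

    Both-1 : Both (+ 1)
    Both-1 = In-resp (≋-sym X̂₁) (In-mono (Integral-xm (+ 1) (+ 0))) , In-resp (≋-sym X̂₂) (In-mono (Integral-xm (+ 0) (+ 1)))

  X̂-integral : ∀ k → In Integral (X̂ k)
  X̂-integral k = proj₁ (ℤ-induction Both (Both-down (+ 0) Both-1) Both-up Both-down k)

  module _ {p} {V : 𝕃 → Set p} (sub : Subring V) (V-p : ∀ {m} → exp₁ m ≡ + 0 → exp₂ m ≡ + 0 → V (mono m))
    (V₀ : V (mono (xm (+ 0) -[1+ 0 ]) ⊗ Q₁)) (V₁ : V ξ₁) (V₂ : V ξ₂) (V₃ : V (mono (xm -[1+ 0 ] (+ 0)) ⊗ Q₂)) where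

    open Subring sub
    open Mutation sub

    private
      -- Four consecutive variables, since a mutation expresses the fifth through them.
      Window : ℤ → Set p
      Window k = V (x k) × V (x (s k)) × V (x (s (s k))) × V (x (s (s (s k))))

      V-cpm : ∀ r j → V (mono (cpm r j))
      V-cpm C₁ j = V-p refl refl
      V-cpm C₂ j = V-p refl refl
      V-cpm C₃ j = V-p refl refl
      V-cpm C₀ j = V-p refl refl

      V-cm : ∀ r j → V (mono (cm r j))
      V-cm r j = V-resp (mono-· (cv r) (cpm r j)) (V-⊗ (V-p {cv r} refl refl) (V-cpm r j))

      -- Stated without indices so that it serves both directions. The relations around y₁ and y₃
      -- are reciprocal, and the middle one is used only modulo y₂.
      turn : ∀ r {y₀ y₁ y₂ y₃ y₄ μ} → V y₀ → V y₁ → V y₂ → V y₃ → Pointed μ y₂ → y₀ ⊗ y₂ ≋ X r y₁ →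
        (Σ Class λ r' → y₁ ⊗ y₃ ≋ X r' y₂) → y₂ ⊗ y₄ ≋ X (next (next r)) y₃ → V y₄
      turn r {y₁ = y₁} {y₂} {y₃} v₀ v₁ v₂ v₃ pt h₀ (r' , h₁) h₂ = mutate {c = λ j → mono (cpm r j)} {e = ce r} {e' = ce (next (next r))}
        {u = mono (cv (next (next r)))} {u' = mono (cv r)} {u″ = mono (inv (cv r))}
        (ce-opposite r) (V-cpm r) v₀ v₂ v₃ (V-p refl refl) (V-p refl refl) pt
        (≋-trans (mono-· (inv (cv r)) (cv r)) (≋-reflexive (cong mono (·-inverseˡ (cv r)))))
        (≋-trans h₀ (X-factored r y₁)) (unit (X-modulo sub V-cm r' v₂)) (≋-trans h₂ (X-opposite r y₃))
        where
        unit : Modulo y₂ (X r' y₂) 𝟏 → Modulo y₂ (y₁ ⊗ y₃) 𝟏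
        unit (h , vh , eh) = h , vh , ≋-trans h₁ eh

      next⁴ : ∀ r → r ≡ next (next (next (next r)))
      next⁴ C₁ = refl
      next⁴ C₂ = refl
      next⁴ C₃ = refl
      next⁴ C₀ = refl

      ex′ : ∀ k {r} → next (cls k) ≡ r → x (s (s k)) ⊗ x k ≋ X r (x (s k))
      ex′ k refl = ex k

      swap-ex : ∀ k {r} → next (cls k) ≡ r → x k ⊗ x (s (s k)) ≋ X r (x (s k))
      swap-ex k h = ≋-trans (⊗-comm (x k) (x (s (s k)))) (ex′ k h)

      up : ∀ k → Window k → Window (s k)
      up k (v₀ , v₁ , v₂ , v₃) = v₁ , v₂ , v₃ , turn (next (cls k)) v₀ v₁ v₂ v₃ (x-pointed (s (s k)))
        (swap-ex k refl) (_ , swap-ex (s k) refl) (swap-ex (s (s k)) (cong next (cls-ss k)))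

      down : ∀ k → Window (s k) → Window k
      down k (v₁ , v₂ , v₃ , v₄) = turn (next (cls (s (s k)))) v₄ v₃ v₂ v₁ (x-pointed (s (s k)))
        (ex′ (s (s k)) refl) (_ , ex′ (s k) refl) (ex′ k (trans (next⁴ (next (cls k))) (cong (next ∘ next ∘ next) (sym (cls-ss k))))) , v₁ , v₂ , v₃

    x-in : ∀ k → V (x k)
    x-in k = proj₁ (ℤ-induction Window
      (V-resp (≋-sym x₀-eq) V₀ , V-resp (≋-sym x₁-eq) V₁ , V-resp (≋-sym x₂-eq) V₂ , V-resp (≋-sym x₃-eq) V₃) up down k)

    X̂-in : ∀ k → V (X̂ k)
    X̂-in k = V-⊗ (V-p refl refl) (x-in k)

-- The algebra, the upper bound and the span of the greedy elements coincide.

module Basis {c ℓ} (K : CommutativeRing c ℓ) (0≉1 : ¬ (CommutativeRing._≈_ K (CommutativeRing.0# K) (CommutativeRing.1# K)))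
  (ℓ₁ ℓ₂ : ℕ) (1≤ℓ₁ : 1 ℕ.≤ ℓ₁) (1≤ℓ₂ : 1 ℕ.≤ ℓ₂)
  (x : ℤ → LP K ℓ₁ ℓ₂) (seq : IsPreClusterSeq K ℓ₁ ℓ₂ x) (a b : ℤ → ℤ)
  (lowest : ∀ k → LowestTermNormalized K ℓ₁ ℓ₂ (normalize K ℓ₁ ℓ₂ x a b k)) where

  open GreedyElements K ℓ₁ ℓ₂
  open StandardMonomials K ℓ₁ ℓ₂
  open Exchange K ℓ₁ ℓ₂ using (Subring)
  open ClusterVariables K 0≉1 ℓ₁ ℓ₂ 1≤ℓ₁ 1≤ℓ₂ x seq a b lowest

  Alg : 𝕃 → Set (c ⊔ ℓ)
  Alg = InA K ℓ₁ ℓ₂ (normalize K ℓ₁ ℓ₂ x a b)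

  private
    subring₁ : Subring W₁.V
    subring₁ = record { V-resp = Span-resp ; V-⊕ = Span-⊕ ; V-⊗ = W₁.V-⊗ ; V-neg = Span-neg ; V-𝟏 = W₁.V-plain (In-mono ℤP.≤-refl) }

    subring₂ : Subring W₂.V
    subring₂ = record { V-resp = Span-resp ; V-⊕ = Span-⊕ ; V-⊗ = W₂.V-⊗ ; V-neg = Span-neg ; V-𝟏 = W₂.V-plain (In-mono ℤP.≤-refl) }

    V₁-p : ∀ {m} → exp₁ m ≡ + 0 → exp₂ m ≡ + 0 → W₁.V (mono m)
    V₁-p h _ = W₁.V-plain (In-mono (ℤP.≤-reflexive (sym h)))

    V₂-p : ∀ {m} → exp₁ m ≡ + 0 → exp₂ m ≡ + 0 → W₂.V (mono m)
    V₂-p _ h = W₂.V-plain (In-mono (ℤP.≤-reflexive (sym h)))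

    Q₁-plain : In (λ n → + 0 ℤ.≤ exp₁ n) Q₁
    Q₁-plain = In-resp (≋-sym (Q₁-lead .split)) (In-⊕ (In-mono ℤP.≤-refl)
      (In-list (All.map (λ { (_ , h , _) → h }) (Q₁-lead .higher))))

    Q₂-plain : In (λ n → + 0 ℤ.≤ exp₂ n) Q₂
    Q₂-plain = In-resp (≋-sym (Q₂-lead .split)) (In-⊕ (In-mono ℤP.≤-refl)
      (In-list (All.map (λ { {t} (_ , _ , h , h₁) → ℤP.<⇒≤ (≡.subst (+ 0 ℤ.<_)
        (trans (cong (ℤ._+ exp₂ (proj₂ t)) h₁) (ℤP.+-identityˡ _)) h) }) (Q₂-lead .higher))))

    X̂-V₁ : ∀ k → W₁.V (X̂ k)
    X̂-V₁ = X̂-in subring₁ V₁-p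
      (W₁.V-⊗ (W₁.V-plain (In-mono ℤP.≤-refl)) (W₁.V-plain Q₁-plain))
      (W₁.V-plain (In-mono (ℤ.+≤+ z≤n))) (W₁.V-plain (In-mono ℤP.≤-refl))
      (Span-resp (⊗-congˡ (mono (xm -[1+ 0 ] (+ 0))) (^-one Q₂)) (Span-gen tt))

    X̂-V₂ : ∀ k → W₂.V (X̂ k)
    X̂-V₂ = X̂-in subring₂ V₂-p
      (Span-resp (⊗-congˡ (mono (xm (+ 0) -[1+ 0 ])) (^-one Q₁)) (Span-gen tt))
      (W₂.V-plain (In-mono ℤP.≤-refl)) (W₂.V-plain (In-mono (ℤ.+≤+ z≤n)))
      (W₂.V-⊗ (W₂.V-plain (In-mono ℤP.≤-refl)) (W₂.V-plain Q₂-plain))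

    Scalar : 𝕄 → Set
    Scalar m = Integral m × exp₁ m ≡ + 0 × exp₂ m ≡ + 0

    p₁-scalar : ∀ j → In Scalar (Defs.p₁ K ℓ₁ ℓ₂ j)
    p₁-scalar zero = In-mono (Integral-one , refl , refl)
    p₁-scalar (suc j) with suc j ℕ.≤ᵇ ℓ₁
    ... | true  = In-mono {Scalar} {pm₁ (suc j)} (Integral-pm₁ (suc j) , refl , refl)
    ... | false = In-𝟎

    p₂-scalar : ∀ j → In Scalar (Defs.p₂ K ℓ₁ ℓ₂ j)
    p₂-scalar zero = In-mono (Integral-one , refl , refl)
    p₂-scalar (suc j) with suc j ℕ.≤ᵇ ℓ₂
    ... | true  = In-mono {Scalar} {pm₂ (suc j)} (Integral-pm₂ (suc j) , refl , refl)
    ... | false = In-𝟎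

    const-scalar : ∀ k → In Scalar (Defs.const K ℓ₁ ℓ₂ k)
    const-scalar k = In-list ((Integral-one , refl , refl) ∷ [])

    -- The two pole conditions allow all integer powers of the p_{i,j}; integrality is therefore a
    -- separate component.
    Upper : 𝕃 → Set (c ⊔ ℓ)
    Upper f = W₁.V f × W₂.V f × In Integral f

    scalar-upper : ∀ {f} → In Scalar f → Upper f
    scalar-upper i = W₁.V-plain (In-weaken (λ { (_ , h , _) → ℤP.≤-reflexive (sym h) }) i) ,
      W₂.V-plain (In-weaken (λ { (_ , _ , h) → ℤP.≤-reflexive (sym h) }) i) , In-weaken proj₁ i

    Upper-resp : ∀ {f g} → f ≋ g → Upper f → Upper g
    Upper-resp h (u , v , i) = Span-resp h u , Span-resp h v , In-resp h i

    algebra⊂upper : ∀ {f} → Alg f → Upper f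
    algebra⊂upper (gen k)    = Upper-resp (≋-sym (normalize-X̂ k)) (X̂-V₁ k , X̂-V₂ k , X̂-integral k)
    algebra⊂upper (const∈ k) = scalar-upper (const-scalar k)
    algebra⊂upper (p₁∈ j)    = scalar-upper (p₁-scalar j)
    algebra⊂upper (p₂∈ j)    = scalar-upper (p₂-scalar j)
    algebra⊂upper (add∈ f∈ g∈) with algebra⊂upper f∈ | algebra⊂upper g∈
    ... | u , v , i | u' , v' , i' = Span-⊕ u u' , Span-⊕ v v' , In-⊕ i i'
    algebra⊂upper (mul∈ {f} {g} f∈ g∈) with algebra⊂upper f∈ | algebra⊂upper g∈
    ... | u , v , i | u' , v' , i' = Upper-resp (≋-reflexive (⊗-unfold f g))
      (W₁.V-⊗ u u' , W₂.V-⊗ v v' , In-⊗ {D = Integral} {E = Integral} (λ {m} {n} → Integral-· {m} {n}) i i')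
    algebra⊂upper (resp∈ h f∈) = Upper-resp (mk≋ h) (algebra⊂upper f∈)

    alg-⊗ : ∀ {f g} → Alg f → Alg g → Alg (f ⊗ g)
    alg-⊗ {f} {g} f∈ g∈ = ≡.subst Alg (sym (⊗-unfold f g)) (mul∈ f∈ g∈)

    alg-resp : ∀ {f g} → f ≋ g → Alg f → Alg g
    alg-resp h = resp∈ (h .≋-at)

    -- Elimination with the family ẑ, whose members are polynomials in x₀, x₁, x₂, x₃ over
    -- K[p_{i,j}].
    upper⊂algebra : ∀ {f} → Upper f → Alg f
    upper⊂algebra (u , v , i) = standard-span Alg alg-resp add∈ alg-⊗ const∈ p₁∈ p₂∈
      (alg-resp (≋-trans (normalize-X̂ (+ 0)) X̂₀) (gen (+ 0))) (alg-resp (≋-trans (normalize-X̂ (+ 1)) X̂₁) (gen (+ 1)))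
      (alg-resp (≋-trans (normalize-X̂ (+ 2)) X̂₂) (gen (+ 2))) (alg-resp (≋-trans (normalize-X̂ (+ 3)) X̂₃) (gen (+ 3)))
      (elimination ẑ-left ẑ-right ẑ-V₂ u v i)

    In-scale : ∀ {D f} k → In D f → In D (scale k f)
    In-scale k (mkIn r al h) = mkIn (scale k r) (AllP.map⁺ al) (scale-cong k h)

    In-T : ∀ {D E : 𝕄 → Set} {w f} → (∀ {m} → D m → In E (w m)) → AllM D f → In E (T w f)
    In-T {w = w} h []                        rewrite T-[] w      = In-𝟎
    In-T {w = w} {f = (k , m) ∷ f} h (p ∷ ps) rewrite T-∷ w k m f = In-⊕ (In-scale k (h p)) (In-T h ps)

    w-integral : ∀ {m} → Integral m → In Integral (W₁.w m)
    w-integral {m} i = In-⊗ {D = _≡ m} {E = Integral} (λ { {n = n} refl j → Integral-· {m} {n} i j }) (In-mono refl) (In-weaken proj₁ (W₁.Q^-in _))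

    -- Integrality is read off from the expansion in `Ĝ-left`, whose members `W₁.w n` are integral
    -- for integral n.
    Ĝ-upper : ∀ {m} → Integral m → Upper (Ĝ m)
    Ĝ-upper {m} i = Ĝ-V₁ i , Ĝ-V₂ i , integral (Ĝ-left i)
      where
      integral : (Σ 𝕃 λ h → Span W₁.w (λ n → Integral n × exp₁ m ℤ.< exp₁ n) h × Ĝ m ≋ W₁.w m ⊕ h) → In Integral (Ĝ m)
      integral (h , mkSpan cs al eh , eĜ) = In-resp (≋-sym eĜ) (In-⊕ (w-integral i)
        (In-resp (≋-sym eh) (In-T (λ { {n} (j , _) → w-integral {n} j }) al)))

    greedy-as-Ĝ : ∀ z → gr z ≋ Ĝ (one · xm⁻ z)
    greedy-as-Ĝ z = ≋-trans (≋-sym (⊗-identityˡ (gr z))) (greedy-Ĝ one z refl refl)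

  greedy-member : ∀ z → Alg (gr z)
  greedy-member z = upper⊂algebra (Upper-resp (≋-sym (greedy-as-Ĝ z))
    (Ĝ-upper (Integral-· {one} {xm⁻ z} Integral-one (Integral-xm (ℤ.- proj₁ z) (ℤ.- proj₂ z)))))

  greedy-spanning : ∀ f → Alg f → Σ (List (𝕃 × (ℤ × ℤ))) λ cs → All (λ t → Coeff (proj₁ t)) cs × f ≋ lin cs
  greedy-spanning f f∈ = from-upper (algebra⊂upper f∈)
    where
    from-upper : Upper f → Σ (List (𝕃 × (ℤ × ℤ))) λ cs → All (λ t → Coeff (proj₁ t)) cs × f ≋ lin cs
    -- The same elimination, now with the family Ĝ in place of ẑ, gives coordinates with integral
    -- indices.
    from-upper (u , v , i) = span-to-combination (elimination (λ i _ → Ĝ-left i) (λ _ h → Ĝ-right h) Ĝ-V₂ u v i)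

open import Data.Nat using (_≤_)

theorem7p3 : ∀ {c ℓ : Level} (K : CommutativeRing c ℓ) → IsCharZeroField K →
    (ℓ₁ ℓ₂ : ℕ) → 1 ≤ ℓ₁ → 1 ≤ ℓ₂ →
    -- the cluster pre-variables x_k
    (x : ℤ → LP K ℓ₁ ℓ₂) → IsPreClusterSeq K ℓ₁ ℓ₂ x →
    -- the normalizing exponents a_k, b_k
    (a b : ℤ → ℤ) →
    (∀ k → LowestTermNormalized K ℓ₁ ℓ₂ (normalize K ℓ₁ ℓ₂ x a b k)) →
    IsCoeffBasis K ℓ₁ ℓ₂ (InA K ℓ₁ ℓ₂ (normalize K ℓ₁ ℓ₂ x a b)) (greedy K ℓ₁ ℓ₂)
theorem7p3 K isField ℓ₁ ℓ₂ 1≤ℓ₁ 1≤ℓ₂ x seq a b lowest = record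
  { member      = greedy-member
  ; spanning    = λ f f∈ → let (cs , p , h) = greedy-spanning f f∈ in cs , p , h .≋-at
  ; independent = λ cs p u h → All.map ≋-at (greedy-independent cs p u (mk≋ h))
  }
  where
  open Basis K (IsCharZeroField.0≉1 isField) ℓ₁ ℓ₂ 1≤ℓ₁ 1≤ℓ₂ x seq a b lowest
  open GreedyElements K ℓ₁ ℓ₂ using (greedy-independent; mk≋; ≋-at)
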